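{- Let $n\ge 1$ and let $B\subseteq[n]\times[n]$ be a board. Then for every integer $i$ with $0\le i\le n$, the function $H_i(B,x+1)$ of $x$ is polynomial modulo $x^2$, and its coefficient of $x$ is a non-negative integer. Explicitly: there is a unique integer $C_i(B)$ such that $$H_i(B,q)\equiv C_i(B)\,(q-1)+h_i(B)\pmod{(q-1)^2}\qquad\text{for all prime powers } q,$$ and $C_i(B)\ge 0$.
   Context: Notation: $[n]=\{1,\dots,n\}$. A board is a subset $B\subseteq[m]\times[n]$ (here $m=n$). The hit number $h_i(B)$ is the number of ways to place $m$ non-attacking rooks on $[m]\times[n]$ (i.e. $m$ cells, no two in the same row or column) with exactly $i$ of them in $B$ (for $m\le n$). For a prime power $q>1$, $\mathfrak m_i(B,q)$ is the number of $m\times n$ matrices over $\mathbb F_q$ of rank $i$ whose support (set of positions of nonzero entries) is contained in $B$. The $q$-rook number is $M_i(B,q)=\mathfrak m_i(B,q)/(q-1)^i$ (known to be an integer). Put $[k]_q=1+q+\cdots+q^{k-1}$, $[k]!_q=[k]_q[k-1]_q\cdots[1]_q$, and $(t;q)_k=\prod_{j=0}^{k-1}(1-tq^j)$. For $B\subseteq[m]\times[n]$ with $m\le n$, the $q$-hit numbers $H_i(B,q)$ are defined by the identity of polynomials in $t$ $$\sum_{i=0}^{m}H_i(B,q)t^i=q^{\binom m2}\sum_{i=0}^{m}M_i(B,q)\frac{[n-i]!_q}{[n-m]!_q}(-1)^i(t;q^{ -1})_i .$$ They are integers for each prime power $q$. A function $f:S\to\mathbb Q$ on an unbounded set $S\subseteq\mathbb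 Z$ is polynomial modulo $x^k$ if there is a (necessarily unique) $P\in\mathbb Z[x]$ of degree at most $k-1$ with $P(x)\equiv f(x)\pmod{x^k}$ for all $x\in S$; the coefficients of $f$ are then those of $P$. Here $S=\{q-1: q \text{ a prime power}\}$. -}

module Defs where

open import Algebra.Bundles.Raw using (RawMonoid)
open import Algebra.Structures using (IsCommutativeRing)
import Algebra.Definitions.RawMonoid as RawMonoidDefs
import Algebra.Definitions.RawSemiring as RawSemiringDefs
open import Data.Fin using (Fin; toℕ)
import Data.Fin as Fin
open import Data.Fin.Properties using (all?; inj⇒≟)
open import Data.Fin.Subset using (Subset; inside; outside; ∣_∣; _∩_)
  renaming (_∈_ to _∈ˢ_; _∉_ to _∉ˢ_)
open import Data.Fin.Subset.Properties using () renaming (_∈?_ to _∈ˢ?_)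
open import Data.Integer using (ℤ; +_)
import Data.Integer as ℤ
open import Data.List using (List; []; _∷_; length; map; filter; foldr; upTo; allFin; cartesianProductWith)
open import Data.List.Extrema.Nat using (max)
open import Data.List.Membership.Propositional using (_∈_)
open import Data.List.Membership.Propositional.Properties using (∈-map⁺; ∈-allFin; ∈-cartesianProductWith⁺)
import Data.List.Relation.Unary.All as All
open import Data.List.Relation.Unary.Any using (here)
open import Data.Nat using (ℕ; zero; suc; _∸_; _<_; z≤n; s≤s; NonZero; >-nonZero)
import Data.Nat as ℕ
open import Data.Nat.Combinatorics using (_C_)
open import Data.Nat.Primality using (Prime)
import Data.Nat.Properties as ℕₚ
open import Data.Product using (∃; ∃₂; _×_; _,_)
open import Data.Rational using (ℚ; 0ℚ; 1ℚ; _/_)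
import Data.Rational as ℚ
open import Data.Sum using (_⊎_)
open import Data.Vec using (Vec; []; _∷_; lookup; zipWith)
import Data.Vec as Vec
open import Function using (_↔_; Inverse)
open import Function.Properties.Inverse using (↔-sym; ↔⇒↣)
open import Level using (0ℓ)
open import Relation.Binary.Definitions using (DecidableEquality)
open import Relation.Binary.PropositionalEquality using (_≡_; _≢_; refl; sym; trans; cong; subst)
open import Relation.Nullary using (Dec; ¬?; contradiction)
open import Relation.Nullary.Decidable using (_→-dec_; _×-dec_; _⊎-dec_; map′)
open import Relation.Unary using (Pred; Decidable)

open RawMonoidDefs ℤ.+-0-rawMonoid using () renaming (sum to sumℤ)
open RawSemiringDefs ℚ.+-*-rawSemiring using () renaming (_^_ to _^ℚ_)

vecs : ∀ {a} {A : Set a} → List A → ∀ n → List (Vec A n)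
vecs xs zero    = [] ∷ []
vecs xs (suc n) = cartesianProductWith _∷_ xs (vecs xs n)

∈-vecs : ∀ {a} {A : Set a} {xs : List A} → (∀ x → x ∈ xs) →
         ∀ {n} (v : Vec A n) → v ∈ vecs xs n
∈-vecs complete []      = here refl
∈-vecs complete (x ∷ v) = ∈-cartesianProductWith⁺ _∷_ (complete x) (∈-vecs complete v)

count : ∀ {a p} {A : Set a} {P : Pred A p} → Decidable P → List A → ℕ
count P? xs = length (filter P? xs)

subsets : ∀ n → List (Subset n)
subsets = vecs (inside ∷ outside ∷ [])

-- A board is a subset of [m] × [n], stored as its list of rows.
Board : ℕ → ℕ → Set
Board m n = Vec (Subset n) m

module _ {m n : ℕ} where

  infix 4 _∈ᴮ_ _∈ᴮ?_

  _∈ᴮ_ : Fin m × Fin n → Board m n → Set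
  (i , j) ∈ᴮ B = j ∈ˢ lookup B i

  _∈ᴮ?_ : ∀ c B → Dec (c ∈ᴮ B)
  (i , j) ∈ᴮ? B = j ∈ˢ? lookup B i

  size : Board m n → ℕ
  size B = Vec.sum (Vec.map ∣_∣ B)

  infixr 7 _∩ᴮ_

  _∩ᴮ_ : Board m n → Board m n → Board m n
  _∩ᴮ_ = zipWith _∩_

  NonAttacking : Board m n → Set
  NonAttacking P = ∀ i j i′ j′ → (i , j) ∈ᴮ P → (i′ , j′) ∈ᴮ P →
                   i ≡ i′ ⊎ j ≡ j′ → i ≡ i′ × j ≡ j′

  nonAttacking? : Decidable NonAttacking
  nonAttacking? P =
    all? λ i → all? λ j → all? λ i′ → all? λ j′ →
      ((i , j) ∈ᴮ? P) →-dec ((i′ , j′) ∈ᴮ? P) →-dec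
      ((i Fin.≟ i′) ⊎-dec (j Fin.≟ j′)) →-dec
      ((i Fin.≟ i′) ×-dec (j Fin.≟ j′))

  -- A placement is encoded as the set P of cells occupied by its m rooks.
  IsHit : Board m n → ℕ → Board m n → Set
  IsHit B k P = size P ≡ m × NonAttacking P × size (P ∩ᴮ B) ≡ k

  isHit? : ∀ B k → Decidable (IsHit B k)
  isHit? B k P =
    (size P ℕ.≟ m) ×-dec nonAttacking? P ×-dec (size (P ∩ᴮ B) ℕ.≟ k)

  hitNumber : Board m n → ℕ → ℕ
  hitNumber B k = count (isHit? B k) (vecs (subsets n) m)

IsPrimePower : ℕ → Set
IsPrimePower q = ∃₂ λ p k → Prime p × q ≡ p ℕ.^ suc k

record FiniteField (q : ℕ) : Set₁ where
  infixl 6 _+_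
  infixl 7 _*_
  infix  8 -_
  field
    Carrier           : Set
    _+_ _*_           : Carrier → Carrier → Carrier
    -_                : Carrier → Carrier
    0# 1#             : Carrier
    isCommutativeRing : IsCommutativeRing _≡_ _+_ _*_ -_ 0# 1#
    0≢1               : 0# ≢ 1#
    inverse           : ∀ x → x ≢ 0# → ∃ λ y → x * y ≡ 1#
    enumeration       : Fin q ↔ Carrier

  infix 4 _≟_

  _≟_ : DecidableEquality Carrier
  _≟_ = inj⇒≟ (↔⇒↣ (↔-sym enumeration))

  elements : List Carrier
  elements = map (Inverse.to enumeration) (allFin q)

  ∈-elements : ∀ x → x ∈ elements
  ∈-elements x = subst (_∈ elements) (Inverse.strictlyInverseˡ enumeration x)
    (∈-map⁺ (Inverse.to enumeration) (∈-allFin (Inverse.from enumeration x)))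

  1<q : 1 < q
  1<q = go q enumeration
    where
    go : ∀ k → Fin k ↔ Carrier → 1 < k
    go zero e with () ← Inverse.from e 0#
    go (suc zero) e = contradiction
      (trans (sym (Inverse.strictlyInverseˡ e 0#))
        (trans (cong (Inverse.to e) (all-equal (Inverse.from e 0#) (Inverse.from e 1#)))
          (Inverse.strictlyInverseˡ e 1#)))
      0≢1
      where
      all-equal : ∀ (x y : Fin 1) → x ≡ y
      all-equal Fin.zero Fin.zero = refl
    go (suc (suc k)) e = s≤s (s≤s z≤n)

  instance
    q≢0 : NonZero q
    q≢0 = >-nonZero (ℕₚ.<-trans (s≤s z≤n) 1<q)

    q-1≢0 : NonZero (q ∸ 1)
    q-1≢0 = >-nonZero (ℕₚ.m<n⇒0<n∸m 1<q)

module _ {q : ℕ} (F : FiniteField q) where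
  open FiniteField F

  +-rawMonoid : RawMonoid 0ℓ 0ℓ
  +-rawMonoid = record { _≈_ = _≡_ ; _∙_ = _+_ ; ε = 0# }

  open RawMonoidDefs +-rawMonoid using (sum)

  Matrix : ℕ → ℕ → Set
  Matrix m n = Vec (Vec Carrier n) m

  matrices : ∀ m n → List (Matrix m n)
  matrices m n = vecs (vecs elements n) m

  module _ {m n : ℕ} where

    entry : Matrix m n → Fin m → Fin n → Carrier
    entry A i j = lookup (lookup A i) j

    -- Linear combinations of the rows in S are encoded by coefficient vectors
    -- that vanish outside S.
    IndependentRows : Matrix m n → Subset m → Set
    IndependentRows A S =
      ∀ (c : Vec Carrier m) → (∀ i → i ∉ˢ S → lookup c i ≡ 0#) →
      (∀ j → sum (λ i → lookup c i * entry A i j) ≡ 0#) →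
      ∀ i → lookup c i ≡ 0#

    independentRows? : ∀ A → Decidable (IndependentRows A)
    independentRows? A S =
      map′ (λ holds c → All.lookup holds (∈-vecs ∈-elements c))
           (λ indep → All.universal indep _)
           (All.all? (λ c →
             (all? λ i → ¬? (i ∈ˢ? S) →-dec (lookup c i ≟ 0#)) →-dec
             (all? λ j → sum (λ i → lookup c i * entry A i j) ≟ 0#) →-dec
             (all? λ i → lookup c i ≟ 0#))
             (vecs elements m))

    rank : Matrix m n → ℕ
    rank A = max 0 (map ∣_∣ (filter (independentRows? A) (subsets m)))

    SupportedIn : Board m n → Matrix m n → Set
    SupportedIn B A = ∀ i j → entry A i j ≢ 0# → (i , j) ∈ᴮ B

    supportedIn? : ∀ B → Decidable (SupportedIn B)
    supportedIn? B A =
      all? λ i → all? λ j → ¬? (entry A i j ≟ 0#) →-dec ((i , j) ∈ᴮ? B)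

    matrixCount : Board m n → ℕ → ℕ
    matrixCount B r =
      count (λ A → supportedIn? B A ×-dec (rank A ℕ.≟ r)) (matrices m n)

    qRookNumber : Board m n → ℕ → ℚ
    qRookNumber B r =
      _/_ (+ matrixCount B r) ((q ∸ 1) ℕ.^ r) {{ℕₚ.m^n≢0 (q ∸ 1) r}}

qNumber : ℕ → ℕ → ℕ
qNumber q zero    = 0
qNumber q (suc k) = qNumber q k ℕ.+ q ℕ.^ k

qFactorial : ℕ → ℕ → ℕ
qFactorial q zero    = 1
qFactorial q (suc k) = qNumber q (suc k) ℕ.* qFactorial q k

qFactorial≢0 : ∀ q .{{_ : NonZero q}} k → NonZero (qFactorial q k)
qFactorial≢0 q zero    = _
qFactorial≢0 q (suc k) = ℕₚ.m*n≢0 (qNumber q (suc k)) (qFactorial q k)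
  where
  instance
    [k+1]≢0 : NonZero (qNumber q (suc k))
    [k+1]≢0 = >-nonZero (ℕₚ.<-≤-trans (ℕₚ.m^n>0 q k) (ℕₚ.m≤n+m (q ℕ.^ k) (qNumber q k)))

    [k]!≢0 : NonZero (qFactorial q k)
    [k]!≢0 = qFactorial≢0 q k

-- Polynomials in t, as coefficient lists (constant term first; trailing zeros
-- allowed).
Poly : Set
Poly = List ℚ

infixl 6 _+ₚ_
infixl 7 _*ₚ_
infixr 7 _·ₚ_

_+ₚ_ : Poly → Poly → Poly
[]      +ₚ r       = r
(a ∷ p) +ₚ []      = a ∷ p
(a ∷ p) +ₚ (b ∷ r) = (a ℚ.+ b) ∷ (p +ₚ r)

_·ₚ_ : ℚ → Poly → Poly
a ·ₚ p = map (a ℚ.*_) p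

_*ₚ_ : Poly → Poly → Poly
[]      *ₚ r = []
(a ∷ p) *ₚ r = (a ·ₚ r) +ₚ (0ℚ ∷ (p *ₚ r))

coefficient : Poly → ℕ → ℚ
coefficient []      k       = 0ℚ
coefficient (a ∷ p) zero    = a
coefficient (a ∷ p) (suc k) = coefficient p k

sumₚ : List Poly → Poly
sumₚ = foldr _+ₚ_ []

productₚ : List Poly → Poly
productₚ = foldr _*ₚ_ (1ℚ ∷ [])

-- (t;a)_k as a polynomial in t
pochhammer : ℚ → ℕ → Poly
pochhammer a k = productₚ (map (λ j → 1ℚ ∷ (ℚ.- (a ^ℚ j)) ∷ []) (upTo k))

-- Only meaningful for m ≤ n: otherwise the truncated subtractions below differ
-- from the integer ones.
module _ {q : ℕ} (F : FiniteField q) {m n : ℕ} where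
  open FiniteField F using (q≢0)

  qHitPolynomial : Board m n → Poly
  qHitPolynomial B =
    (+ (q ℕ.^ (m C 2)) / 1) ·ₚ sumₚ (map term (upTo (suc m)))
    where
    term : ℕ → Poly
    term i =
      (qRookNumber F B i
        ℚ.* _/_ (+ qFactorial q (n ∸ i)) (qFactorial q (n ∸ m)) {{qFactorial≢0 q (n ∸ m)}}
        ℚ.* ((ℚ.- 1ℚ) ^ℚ i))
      ·ₚ pochhammer (+ 1 / q) i

  qHitNumber : Board m n → ℕ → ℚ
  qHitNumber B i = coefficient (qHitPolynomial B) i

infix 4 _≡_[mod_]

-- Congruence of rationals modulo the subgroup dℤ.
_≡_[mod_] : ℚ → ℚ → ℤ → Set
a ≡ b [mod d ] = ∃ λ z → a ℚ.- b ≡ (z ℤ.* d) / 1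

evaluate : ∀ {k} → Vec ℤ k → ℤ → ℤ
evaluate P x = sumℤ (λ j → lookup P j ℤ.* x ℤ.^ toℕ j)

-- P, an integer polynomial of degree at most k - 1 given by its k
-- coefficients (constant term first), satisfies P(x) ≡ f(x) modulo x^k at
-- every x = q - 1. The value f(q - 1) is computed from a field with q
-- elements, and the congruence is required for each such field.
IsPolynomialModulo : (k : ℕ) → (∀ {q} → FiniteField q → ℚ) → Vec ℤ k → Set₁
IsPolynomialModulo k f P =
  ∀ q → IsPrimePower q → (F : FiniteField q) →
  (evaluate P (+ (q ∸ 1)) / 1) ≡ f F [mod (+ (q ∸ 1)) ℤ.^ k ]

{-# OPTIONS --safe #-}
module Submission where

-- Put x = q − 1.  Rank can be computed row by row: a row v either lies in the subspace V
-- spanned so far or replaces V by V + ⟨v⟩.  Since rows and columns can be scaled, the sum over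
-- all rows with a given support σ is divisible by high powers of x when σ is large, so that,
-- modulo x^(r + 2), the matrices of rank r supported in B are counted by a recursion in which
-- V is spanned by coordinate vectors and at most one vector e_c + e_d.  Unfolding it,
-- M_r ≡ (number of non-attacking placements of r rooks) + x (signed number of placements with
-- one more cell, or with a full rectangle).
--
-- A placement of r rooks extends to (n − r)! permutations w, which turns Σ H_i t^i modulo x² into
-- a sum over permutations: the value at x = 0 is Σ_w t^hits(w), and twice the coefficient of x
-- is a sum over w and over pairs of rows i < l of t^(hits outside i and l) times a polynomial
-- in t that depends on the four cells in rows i, l and columns w(i), w(l).  Averaging over w and
-- w ∘ (i l) makes this polynomial non-negative; the result is `kernel`.  Identities between
-- polynomials in t are proved by evaluation at the integers t ≥ 2.
--
-- The coefficient of x is unique because there are prime fields with x arbitrarily large.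

open import Defs
open import Algebra.Bundles using (CommutativeRing)
import Algebra.Definitions.RawMonoid as RawMonoidDefs
import Algebra.Definitions.RawSemiring as RawSemiringDefs
import Algebra.Properties.Ring as RingProperties
import Algebra.Solver.Ring.NaturalCoefficients.Default as SemiringSolver
open import Algebra.Structures using (IsCommutativeRing)
open import Data.Bool using (Bool; true; false; if_then_else_; not; _∧_; _∨_)
import Data.Bool.Properties as Boolₚ
open import Data.Empty using (⊥)
open import Data.Fin using (Fin; zero; suc; toℕ; fromℕ<)
import Data.Fin as Fin
open import Data.Fin.Permutation.Components using (transpose; transpose-inverse)
import Data.Fin.Properties as Finₚ
open import Data.Fin.Subset using (Subset; inside; outside; ∣_∣; _∩_; _∪_; ⁅_⁆)
  renaming (⊥ to ∅; _∈_ to _∈ˢ_)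
import Data.Fin.Subset.Properties as Subsetₚ
open import Data.Integer using (ℤ; +_; -_; 0ℤ; 1ℤ; -1ℤ; _+_; _*_; _-_; _^_; _≤_; +≤+)
import Data.Integer as ℤ
open import Data.Integer.Divisibility.Signed using (_∣_; divides)
import Data.Integer.Divisibility.Signed as Div
import Data.Integer.Properties as ℤₚ
open import Data.Integer.Tactic.RingSolver using (solve-∀)
open import Data.List using (List; []; _∷_; _++_; length; map; filter; upTo; allFin; applyUpTo;
  cartesianProductWith)
open import Data.List.Extrema.Nat using (v≤max⁺; max≤v⁺)
open import Data.List.Membership.Propositional using (_∈_; lose)
import Data.List.Membership.Propositional.Properties as ∈ₚ
import Data.List.Properties as Listₚ
import Data.List.Relation.Unary.All as All
import Data.List.Relation.Unary.Any as Any
open import Data.Maybe using (Maybe; just; nothing)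
open import Data.Nat using (ℕ; zero; suc; _∸_; s≤s; z≤n; NonZero; _!) renaming (_≤_ to _≤ℕ_)
import Data.Nat as ℕ
import Data.Nat.Combinatorics as ℕᶜ
import Data.Nat.Coprimality as Coprimality
import Data.Nat.DivMod as ℕᵐ
import Data.Nat.Divisibility as ℕᵈ
import Data.Nat.GCD as GCD
open import Data.Nat.ListAction using () renaming (sum to sumᴺ)
open import Data.Nat.ListAction.Properties using (sum-++)
open import Data.Nat.Primality using (Prime; prime⇒nonZero; prime⇒nonTrivial)
import Data.Nat.Primality as Primality
open import Data.Nat.Primality.Factorisation using (factorise)
import Data.Nat.Properties as ℕₚ
open import Data.Product using (Σ-syntax; ∃; ∃-syntax; ∃!; _×_; _,_; proj₁; proj₂)
open import Data.Rational using (ℚ; 0ℚ; 1ℚ; _/_)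
import Data.Rational as ℚ
import Data.Rational.Properties as ℚₚ
import Data.Rational.Solver as ℚ-Solver
import Data.Rational.Unnormalised as ℚᵘ
import Data.Rational.Unnormalised.Properties as ℚᵘₚ
open import Data.Sum using (_⊎_; inj₁; inj₂)
open import Data.Unit using (⊤; tt)
open import Data.Vec using (Vec; []; _∷_; lookup; zipWith; replicate)
import Data.Vec as Vec
import Data.Vec.Properties as Vecₚ
open import Function using (_∘_; Inverse; id; mk↔ₛ′)
open import Relation.Binary.Definitions using (DecidableEquality)
open import Relation.Binary.PropositionalEquality using (_≡_; _≢_; _≗_; refl; sym; trans; cong;
  cong₂; subst; module ≡-Reasoning)
open import Relation.Binary.PropositionalEquality.Properties using (isEquivalence)
open import Relation.Nullary using (Dec; yes; no; does; ¬_; contradiction)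
import Relation.Nullary.Decidable as Dec

-- Finite sums and congruences

-- In the count of matrices weighted by x ^ (m - r), every row contributes at least one factor x: a
-- row in V through the weight, any other row through scaling. Modulo x ^ (m + 2) this leaves one
-- spare factor, and a row that leads to a diagonal space has already spent it. Hence the two
-- families of spaces suffice, and the second is needed only modulo x ^ (m + 1). For a single
-- permutation w the polynomial of a pair of rows can have negative coefficients. If w hits the
-- board in row i but not in row l, both crossed cells lie in the board and w i > w l, then the pair
-- contributes s (4t - 1), where s = t - 1. The permutation with the two columns exchanged
-- contributes s (2t² + 1), and the sum is 2s (2t + t²). The factor 2 comes from the q-factorial,
-- whose derivative at q = 1 is half of a simpler integer expression. The factor s comes from the
-- derivative of the Pochhammer symbol, which lowers a power of s by one; it has to be cancelled,
-- and this excludes t = 1 from the evaluation points.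

∑ : ∀ {a} {A : Set a} → List A → (A → ℤ) → ℤ
∑ []       f = 0ℤ
∑ (x ∷ xs) f = f x + ∑ xs f

𝟙 : Bool → ℤ
𝟙 true  = 1ℤ
𝟙 false = 0ℤ

module _ {a} {A : Set a} where

  ∑-cong : ∀ (xs : List A) {f g : A → ℤ} → (∀ x → f x ≡ g x) → ∑ xs f ≡ ∑ xs g
  ∑-cong []       f≗g = refl
  ∑-cong (x ∷ xs) f≗g = cong₂ _+_ (f≗g x) (∑-cong xs f≗g)

  ∑-zero : ∀ (xs : List A) {f : A → ℤ} → (∀ x → f x ≡ 0ℤ) → ∑ xs f ≡ 0ℤ
  ∑-zero []       f≗0 = refl
  ∑-zero (x ∷ xs) f≗0 = cong₂ _+_ (f≗0 x) (∑-zero xs f≗0)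

  ∑-+ : ∀ (xs : List A) (f g : A → ℤ) → ∑ xs (λ x → f x + g x) ≡ ∑ xs f + ∑ xs g
  ∑-+ []       f g = refl
  ∑-+ (x ∷ xs) f g = trans (cong (_+_ (f x + g x)) (∑-+ xs f g)) (rearrange (f x) (g x) (∑ xs f) (∑ xs g))
    where
    rearrange : ∀ a b c d → a + b + (c + d) ≡ a + c + (b + d)
    rearrange = solve-∀

  ∑-*ˡ : ∀ (xs : List A) k (f : A → ℤ) → ∑ xs (λ x → k * f x) ≡ k * ∑ xs f
  ∑-*ˡ []       k f = sym (ℤₚ.*-zeroʳ k)
  ∑-*ˡ (x ∷ xs) k f = trans (cong (_+_ (k * f x)) (∑-*ˡ xs k f)) (sym (ℤₚ.*-distribˡ-+ k (f x) (∑ xs f)))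

  ∑-*ʳ : ∀ (xs : List A) k (f : A → ℤ) → ∑ xs (λ x → f x * k) ≡ ∑ xs f * k
  ∑-*ʳ xs k f = trans (∑-cong xs (λ x → ℤₚ.*-comm (f x) k)) (trans (∑-*ˡ xs k f) (ℤₚ.*-comm k (∑ xs f)))

  ∑-const : ∀ (xs : List A) k → ∑ xs (λ _ → k) ≡ + length xs * k
  ∑-const []       k = refl
  ∑-const (x ∷ xs) k = trans (cong (_+_ k) (∑-const xs k)) (sym (ℤₚ.suc-* (+ length xs) k))

  ∑-++ : ∀ (xs ys : List A) (f : A → ℤ) → ∑ (xs ++ ys) f ≡ ∑ xs f + ∑ ys f
  ∑-++ []       ys f = sym (ℤₚ.+-identityˡ _)
  ∑-++ (x ∷ xs) ys f = trans (cong (_+_ (f x)) (∑-++ xs ys f)) (sym (ℤₚ.+-assoc (f x) _ _))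

  ∑-nonneg : ∀ (xs : List A) {f : A → ℤ} → (∀ x → 0ℤ ≤ f x) → 0ℤ ≤ ∑ xs f
  ∑-nonneg []       0≤f = ℤₚ.≤-refl
  ∑-nonneg (x ∷ xs) 0≤f = ℤₚ.+-mono-≤ (0≤f x) (∑-nonneg xs 0≤f)

  ∑-∣ : ∀ (xs : List A) {k} {f : A → ℤ} → (∀ x → k ∣ f x) → k ∣ ∑ xs f
  ∑-∣ []       k∣f = divides 0ℤ refl
  ∑-∣ (x ∷ xs) k∣f = Div.∣m∣n⇒∣m+n (k∣f x) (∑-∣ xs k∣f)

  length-filter : ∀ {p} {P : A → Set p} (P? : ∀ x → Dec (P x)) xs → + length (filter P? xs) ≡ ∑ xs
      (λ x → 𝟙 (does (P? x)))
  length-filter P? []       = refl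
  length-filter P? (x ∷ xs) with does (P? x)
  ... | true  = cong (_+_ 1ℤ) (length-filter P? xs)
  ... | false = trans (length-filter P? xs) (sym (ℤₚ.+-identityˡ _))

  ∑-filter : ∀ {p} {P : A → Set p} (P? : ∀ x → Dec (P x)) xs (f : A → ℤ) →
             ∑ (filter P? xs) f ≡ ∑ xs (λ x → 𝟙 (does (P? x)) * f x)
  ∑-filter P? []       f = refl
  ∑-filter P? (x ∷ xs) f with does (P? x)
  ... | true  = cong₂ _+_ (sym (ℤₚ.*-identityˡ (f x))) (∑-filter P? xs f)
  ... | false = trans (∑-filter P? xs f) (sym (ℤₚ.+-identityˡ _))

module _ {a b} {A : Set a} {B : Set b} where

  ∑-swap : ∀ (xs : List A) (ys : List B) (f : A → B → ℤ) →
           ∑ xs (λ x → ∑ ys (f x)) ≡ ∑ ys (λ y → ∑ xs (λ x → f x y))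
  ∑-swap []       ys f = sym (∑-zero ys (λ _ → refl))
  ∑-swap (x ∷ xs) ys f = trans (cong (_+_ (∑ ys (f x))) (∑-swap xs ys f))
      (sym (∑-+ ys (f x) (λ y → ∑ xs (λ x → f x y))))

  ∑-map : ∀ (h : A → B) xs (f : B → ℤ) → ∑ (map h xs) f ≡ ∑ xs (f ∘ h)
  ∑-map h []       f = refl
  ∑-map h (x ∷ xs) f = cong (_+_ (f (h x))) (∑-map h xs f)

∑-cartesianProductWith : ∀ {a b c} {A : Set a} {B : Set b} {C : Set c} (h : A → B → C) xs ys (f : C → ℤ) →
                         ∑ (cartesianProductWith h xs ys) f ≡ ∑ xs (λ x → ∑ ys (λ y → f (h x y)))
∑-cartesianProductWith h []       ys f = refl
∑-cartesianProductWith h (x ∷ xs) ys f =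
  trans (∑-++ (map (h x) ys) _ f) (cong₂ _+_ (∑-map (h x) ys f) (∑-cartesianProductWith h xs ys f))

∑-allFin : ∀ n (f : Fin (suc n) → ℤ) → ∑ (allFin (suc n)) f ≡ f zero + ∑ (allFin n) (f ∘ suc)
∑-allFin n f = cong (_+_ (f zero)) (trans (cong (λ xs → ∑ xs f) (sym (Listₚ.map-tabulate id suc)))
    (∑-map suc (allFin n) f))

module _ {a} {A : Set a} (xs : List A) where

  ∑-vecs : ∀ n (f : Vec A (suc n) → ℤ) → ∑ (vecs xs (suc n)) f ≡ ∑ xs (λ x → ∑ (vecs xs n) (λ v → f (x ∷ v)))
  ∑-vecs n f = ∑-cartesianProductWith _∷_ xs (vecs xs n) f

-- Every element of A occurs exactly once in xs.
record Enumerates {a} {A : Set a} (xs : List A) : Set a where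
  constructor enumerates
  field
    sift : ∀ (f : A → ℤ) a → (∀ x → x ≢ a → f x ≡ 0ℤ) → ∑ xs f ≡ f a

open Enumerates public

allFin-enumerates : ∀ n → Enumerates (allFin n)
allFin-enumerates zero    = enumerates λ _ ()
allFin-enumerates (suc n) = enumerates λ where
  f zero    off → trans (∑-allFin n f) (trans (cong (_+_ (f zero)) (∑-zero (allFin n) (λ i → off (suc i) λ ())))
                    (ℤₚ.+-identityʳ _))
  f (suc a) off → trans (∑-allFin n f) (trans
    (cong₂ _+_ (off zero λ ()) (sift (allFin-enumerates n) (f ∘ suc) a
        (λ i i≢a → off (suc i) (i≢a ∘ Finₚ.suc-injective))))
    (ℤₚ.+-identityˡ _))

map-enumerates : ∀ {a b} {A : Set a} {B : Set b} {xs : List A} (to : A → B) (from : B → A) →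
                 (∀ y → to (from y) ≡ y) → (∀ x → from (to x) ≡ x) → Enumerates xs → Enumerates (map to xs)
map-enumerates {xs = xs} to from to-from from-to enum = enumerates λ f b off →
  trans (∑-map to xs f)
    (trans (sift enum (f ∘ to) (from b) (λ x x≢ → off (to x) (λ eq → x≢ (trans (sym (from-to x)) (cong from eq)))))
      (cong f (to-from b)))

vecs-enumerates : ∀ {a} {A : Set a} {xs : List A} → Enumerates xs → ∀ n → Enumerates (vecs xs n)
vecs-enumerates enum zero = enumerates λ where f [] off → ℤₚ.+-identityʳ _
vecs-enumerates {xs = xs} enum (suc n) = enumerates λ where
  f (a ∷ u) off →
    trans (∑-vecs xs n f)
      (trans (sift enum _ a (λ x x≢a → ∑-zero (vecs xs n) (λ v → off (x ∷ v) (x≢a ∘ Vecₚ.∷-injectiveˡ))))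
        (sift (vecs-enumerates enum n) (λ v → f (a ∷ v)) u (λ v v≢u → off (a ∷ v) (v≢u ∘ Vecₚ.∷-injectiveʳ))))

bool-enumerates : Enumerates (inside ∷ outside ∷ [])
bool-enumerates = enumerates λ where
  f true  off → trans (cong (λ z → f true + (z + 0ℤ)) (off false λ ())) (ℤₚ.+-identityʳ _)
  f false off → trans (cong (λ z → z + (f false + 0ℤ)) (off true λ ()))
      (trans (ℤₚ.+-identityˡ _) (ℤₚ.+-identityʳ _))

𝟙-true : ∀ {p} {P : Set p} (P? : Dec P) → P → 𝟙 (does P?) ≡ 1ℤ
𝟙-true P? p = cong 𝟙 (Dec.dec-true P? p)

𝟙-false : ∀ {p} {P : Set p} (P? : Dec P) → ¬ P → 𝟙 (does P?) ≡ 0ℤ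
𝟙-false P? ¬p = cong 𝟙 (Dec.dec-false P? ¬p)

𝟙-cong : ∀ {p q} {P : Set p} {Q : Set q} (P? : Dec P) (Q? : Dec Q) → (P → Q) → (Q → P) → 𝟙 (does P?) ≡ 𝟙 (does Q?)
𝟙-cong P? (yes q) f g = 𝟙-true P? (g q)
𝟙-cong P? (no ¬q) f g = 𝟙-false P? (¬q ∘ f)

∑-δ : ∀ {a} {A : Set a} {xs : List A} → Enumerates xs → (_≟_ : DecidableEquality A) → ∀ a (f : A → ℤ) →
      ∑ xs (λ x → 𝟙 (does (x ≟ a)) * f x) ≡ f a
∑-δ enum _≟_ a f = trans (sift enum _ a (λ x x≢a → cong (_* f x) (𝟙-false (x ≟ a) x≢a)))
                         (trans (cong (_* f a) (𝟙-true (a ≟ a) refl)) (ℤₚ.*-identityˡ (f a)))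

-- A delta function at `to x` is inserted, the sums are swapped and the condition is solved for x,
-- so no rearrangement of the list `xs` has to be exhibited.
∑-bijection : ∀ {a} {A : Set a} {xs : List A} → Enumerates xs → DecidableEquality A → (to from : A → A) →
              (∀ x → to (from x) ≡ x) → (∀ x → from (to x) ≡ x) → ∀ (f : A → ℤ) → ∑ xs (f ∘ to) ≡ ∑ xs f
∑-bijection {xs = xs} enum _≟_ to from to-from from-to f = begin
  ∑ xs (f ∘ to)                                           ≡⟨ ∑-cong xs (λ x → ∑-δ enum _≟_ (to x) f) ⟨
  ∑ xs (λ x → ∑ xs (λ y → 𝟙 (does (y ≟ to x)) * f y))     ≡⟨ ∑-swap xs xs _ ⟩
  ∑ xs (λ y → ∑ xs (λ x → 𝟙 (does (y ≟ to x)) * f y))     ≡⟨ ∑-cong xs (λ y → ∑-cong xs (λ x → cong (_* f y)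
                                                               (𝟙-cong (y ≟ to x) (x ≟ from y)
                                                                 (λ eq → trans (sym (from-to x))
                                                                     (cong from (sym eq)))
                                                                 (λ eq → trans (sym (to-from y))
                                                                     (cong to (sym eq)))))) ⟩
  ∑ xs (λ y → ∑ xs (λ x → 𝟙 (does (x ≟ from y)) * f y))   ≡⟨ ∑-cong xs (λ y → ∑-δ enum _≟_ (from y) (λ _ → f y)) ⟩
  ∑ xs f                                                  ∎
  where open ≡-Reasoning

infix 4 _≡_⟦_⟧

-- A record and not a synonym: a and b cannot be inferred from the integer a - b, but they can be
-- from the parameters of a record type.
record _≡_⟦_⟧ (a b k : ℤ) : Set where
  constructor modulo
  field
    difference : k ∣ a - b

open _≡_⟦_⟧ public

module _ {k : ℤ} where

  ≡⇒≡⟦⟧ : ∀ {a b} → a ≡ b → a ≡ b ⟦ k ⟧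
  ≡⇒≡⟦⟧ {a} refl = modulo (divides 0ℤ (ℤₚ.+-inverseʳ a))

  ≡⟦⟧-sym : ∀ {a b} → a ≡ b ⟦ k ⟧ → b ≡ a ⟦ k ⟧
  ≡⟦⟧-sym {a} {b} (modulo p) = modulo (subst (k ∣_) (neg a b) (Div.∣m⇒∣-m p))
    where
    neg : ∀ a b → - (a - b) ≡ b - a
    neg = solve-∀

  ≡⟦⟧-trans : ∀ {a b c} → a ≡ b ⟦ k ⟧ → b ≡ c ⟦ k ⟧ → a ≡ c ⟦ k ⟧
  ≡⟦⟧-trans {a} {b} {c} (modulo p) (modulo q) = modulo (subst (k ∣_) (telescope a b c) (Div.∣m∣n⇒∣m+n p q))
    where
    telescope : ∀ a b c → a - b + (b - c) ≡ a - c
    telescope = solve-∀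

  ≡⟦⟧-+ : ∀ {a b c d} → a ≡ b ⟦ k ⟧ → c ≡ d ⟦ k ⟧ → a + c ≡ b + d ⟦ k ⟧
  ≡⟦⟧-+ {a} {b} {c} {d} (modulo p) (modulo q) = modulo (subst (k ∣_) (rearrange a b c d) (Div.∣m∣n⇒∣m+n p q))
    where
    rearrange : ∀ a b c d → a - b + (c - d) ≡ a + c - (b + d)
    rearrange = solve-∀

  ≡⟦⟧-*ˡ : ∀ m {a b} → a ≡ b ⟦ k ⟧ → m * a ≡ m * b ⟦ k ⟧
  ≡⟦⟧-*ˡ m {a} {b} (modulo p) = modulo (subst (k ∣_) (distrib m a b) (Div.∣n⇒∣m*n m p))
    where
    distrib : ∀ m a b → m * (a - b) ≡ m * a - m * b
    distrib = solve-∀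

  ∣⇒≡0⟦⟧ : ∀ {a} → k ∣ a → a ≡ 0ℤ ⟦ k ⟧
  ∣⇒≡0⟦⟧ {a} k∣a = modulo (subst (k ∣_) (sym (ℤₚ.+-identityʳ a)) k∣a)

  ∑-≡⟦⟧ : ∀ {a} {A : Set a} (xs : List A) {f g : A → ℤ} → (∀ x → f x ≡ g x ⟦ k ⟧) → ∑ xs f ≡ ∑ xs g ⟦ k ⟧
  ∑-≡⟦⟧ []       f≡g = ≡⇒≡⟦⟧ refl
  ∑-≡⟦⟧ (x ∷ xs) f≡g = ≡⟦⟧-+ (f≡g x) (∑-≡⟦⟧ xs f≡g)

-- Unlike in `≡⟦⟧-*ˡ`, the modulus grows as well: a factor x contributed by one row improves the
-- accuracy known for the remaining rows by one order.
≡⟦⟧-scale : ∀ {k a b} m → a ≡ b ⟦ k ⟧ → m * a ≡ m * b ⟦ m * k ⟧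
≡⟦⟧-scale {k} {a} {b} m (modulo p) = modulo (subst (m * k ∣_) (distrib m a b) (Div.*-monoʳ-∣ m p))
  where
  distrib : ∀ m a b → m * (a - b) ≡ m * a - m * b
  distrib = solve-∀

≡⟦⟧-weaken : ∀ {k l a b} → k ∣ l → a ≡ b ⟦ l ⟧ → a ≡ b ⟦ k ⟧
≡⟦⟧-weaken k∣l (modulo p) = modulo (Div.∣-trans k∣l p)

-- Sums over vectors with a given support

∑-cong-∈ : ∀ {a} {A : Set a} (xs : List A) {f g : A → ℤ} → (∀ x → x ∈ xs → f x ≡ g x) → ∑ xs f ≡ ∑ xs g
∑-cong-∈ []       f≗g = refl
∑-cong-∈ (x ∷ xs) f≗g = cong₂ _+_ (f≗g x (Any.here refl)) (∑-cong-∈ xs (λ y y∈ → f≗g y (Any.there y∈)))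

𝟙-not : ∀ b → 𝟙 (not b) + 𝟙 b ≡ 1ℤ
𝟙-not true  = refl
𝟙-not false = refl

∑⊆ : ∀ {n} → Subset n → (Subset n → ℤ) → ℤ
∑⊆ []            h = h []
∑⊆ (inside  ∷ β) h = ∑⊆ β (λ σ → h (inside ∷ σ)) + ∑⊆ β (λ σ → h (outside ∷ σ))
∑⊆ (outside ∷ β) h = ∑⊆ β (λ σ → h (outside ∷ σ))

∑⊆-cong : ∀ {n} (β : Subset n) {f g : Subset n → ℤ} → (∀ σ → f σ ≡ g σ) → ∑⊆ β f ≡ ∑⊆ β g
∑⊆-cong []            f≗g = f≗g []
∑⊆-cong (inside  ∷ β) f≗g = cong₂ _+_ (∑⊆-cong β (λ σ → f≗g _)) (∑⊆-cong β (λ σ → f≗g _))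
∑⊆-cong (outside ∷ β) f≗g = ∑⊆-cong β (λ σ → f≗g _)

∑⊆-∣ : ∀ {n k} (β : Subset n) {f : Subset n → ℤ} → (∀ σ → k ∣ f σ) → k ∣ ∑⊆ β f
∑⊆-∣ []            k∣f = k∣f []
∑⊆-∣ (inside  ∷ β) k∣f = Div.∣m∣n⇒∣m+n (∑⊆-∣ β (λ σ → k∣f _)) (∑⊆-∣ β (λ σ → k∣f _))
∑⊆-∣ (outside ∷ β) k∣f = ∑⊆-∣ β (λ σ → k∣f _)

module FieldSums {q : ℕ} (F : FiniteField q) where

  open FiniteField F public renaming (_+_ to _+ᶠ_; _*_ to _*ᶠ_; -_ to -ᶠ_; _≟_ to _≟ᶠ_)

  commutativeRing : CommutativeRing _ _
  commutativeRing = record { isCommutativeRing = isCommutativeRing }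

  open CommutativeRing commutativeRing public
    using (+-comm; +-identityˡ; +-identityʳ; *-identityˡ; *-identityʳ; *-comm; *-assoc; zeroˡ; zeroʳ; -‿inverseˡ;
        -‿inverseʳ)
  open RingProperties (CommutativeRing.ring commutativeRing) public using () renaming (+-cancelʳ to +ᶠ-cancelʳ)
  open SemiringSolver (CommutativeRing.commutativeSemiring commutativeRing) public using (solve; _:+_; _:*_; _:=_)

  x : ℤ
  x = + (q ∸ 1)

  infix 8 _⁻¹⟨_⟩

  _⁻¹⟨_⟩ : ∀ a → a ≢ 0# → Carrier
  a ⁻¹⟨ a≢0 ⟩ = proj₁ (inverse a a≢0)

  a*a⁻¹≡1 : ∀ {a} (a≢0 : a ≢ 0#) → a *ᶠ a ⁻¹⟨ a≢0 ⟩ ≡ 1#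
  a*a⁻¹≡1 a≢0 = proj₂ (inverse _ a≢0)

  a⁻¹*[a*b]≡b : ∀ {a} (a≢0 : a ≢ 0#) b → a ⁻¹⟨ a≢0 ⟩ *ᶠ (a *ᶠ b) ≡ b
  a⁻¹*[a*b]≡b {a} a≢0 b = trans (solve 3 (λ i a b → (i :* (a :* b)) := ((a :* i) :* b)) refl (a ⁻¹⟨ a≢0 ⟩) a b)
    (trans (cong (_*ᶠ b) (a*a⁻¹≡1 a≢0)) (*-identityˡ b))

  a*[a⁻¹*b]≡b : ∀ {a} (a≢0 : a ≢ 0#) b → a *ᶠ (a ⁻¹⟨ a≢0 ⟩ *ᶠ b) ≡ b
  a*[a⁻¹*b]≡b {a} a≢0 b = trans (sym (*-assoc a _ b)) (trans (cong (_*ᶠ b) (a*a⁻¹≡1 a≢0)) (*-identityˡ b))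

  *-cancelˡ-0 : ∀ {a b} → a ≢ 0# → a *ᶠ b ≡ 0# → b ≡ 0#
  *-cancelˡ-0 {a} {b} a≢0 ab≡0 = trans (sym (a⁻¹*[a*b]≡b a≢0 b)) (trans (cong (a ⁻¹⟨ a≢0 ⟩ *ᶠ_) ab≡0) (zeroʳ _))

  *-≢0 : ∀ {a b} → a ≢ 0# → b ≢ 0# → a *ᶠ b ≢ 0#
  *-≢0 a≢0 b≢0 = b≢0 ∘ *-cancelˡ-0 a≢0

  1≢0 : 1# ≢ 0#
  1≢0 = 0≢1 ∘ sym

  elements-enumerates : Enumerates elements
  elements-enumerates = map-enumerates (Inverse.to enumeration) (Inverse.from enumeration)
    (Inverse.strictlyInverseˡ enumeration) (Inverse.strictlyInverseʳ enumeration) (allFin-enumerates q)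

  units : List Carrier
  units = filter (λ a → Dec.¬? (a ≟ᶠ 0#)) elements

  ∑-units-cong : ∀ {f g : Carrier → ℤ} → (∀ a → a ≢ 0# → f a ≡ g a) → ∑ units f ≡ ∑ units g
  ∑-units-cong f≗g = ∑-cong-∈ units (λ a a∈ → f≗g a (proj₂ (∈ₚ.∈-filter⁻
      (λ a → Dec.¬? (a ≟ᶠ 0#)) {xs = elements} a∈)))

  ∑-units : ∀ f → ∑ units f ≡ ∑ elements (λ a → 𝟙 (not (does (a ≟ᶠ 0#))) * f a)
  ∑-units f = ∑-filter (λ a → Dec.¬? (a ≟ᶠ 0#)) elements f

  ∑-elements : ∀ f → ∑ elements f ≡ ∑ units f + f 0#
  ∑-elements f = begin
    ∑ elements f                                                            ≡⟨ ∑-cong elements split ⟩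
    ∑ elements (λ a → 𝟙 (not (does (a ≟ᶠ 0#))) * f a + 𝟙 (does (a ≟ᶠ 0#)) * f a) ≡⟨ ∑-+ elements _ _ ⟩
    ∑ elements (λ a → 𝟙 (not (does (a ≟ᶠ 0#))) * f a) + ∑ elements (λ a → 𝟙 (does (a ≟ᶠ 0#)) * f a)
      ≡⟨ cong₂ _+_ (sym (∑-units f)) (∑-δ elements-enumerates _≟ᶠ_ 0# f) ⟩
    ∑ units f + f 0#                                                        ∎
    where
    open ≡-Reasoning
    split : ∀ a → f a ≡ 𝟙 (not (does (a ≟ᶠ 0#))) * f a + 𝟙 (does (a ≟ᶠ 0#)) * f a
    split a = trans (sym (ℤₚ.*-identityˡ (f a))) (trans (cong (_* f a) (sym (𝟙-not (does (a ≟ᶠ 0#)))))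
        (ℤₚ.*-distribʳ-+ (f a) (𝟙 (not (does (a ≟ᶠ 0#)))) (𝟙 (does (a ≟ᶠ 0#)))))

  ∑-units-const : ∀ k → ∑ units (λ _ → k) ≡ x * k
  ∑-units-const k = trans (∑-const units k) (cong (_* k) length-units)
    where
    open ≡-Reasoning
    length-units : + length units ≡ x
    length-units = begin
      + length units                    ≡⟨ ℤₚ.*-identityʳ _ ⟨
      + length units * 1ℤ               ≡⟨ ∑-const units 1ℤ ⟨
      ∑ units (λ _ → 1ℤ)                ≡⟨ shift _ ⟩
      ∑ units (λ _ → 1ℤ) + 1ℤ - 1ℤ      ≡⟨ cong (_- 1ℤ) (∑-elements (λ _ → 1ℤ)) ⟨
      ∑ elements (λ _ → 1ℤ) - 1ℤ        ≡⟨ cong (_- 1ℤ) (∑-const elements 1ℤ) ⟩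
      + length elements * 1ℤ - 1ℤ       ≡⟨ cong (λ l → + l * 1ℤ - 1ℤ)
          (trans (Listₚ.length-map _ (allFin q)) (Listₚ.length-tabulate {n = q} id)) ⟩
      + q * 1ℤ - 1ℤ                     ≡⟨ cong (_- 1ℤ) (ℤₚ.*-identityʳ (+ q)) ⟩
      + q - 1ℤ                          ≡⟨ ℤₚ.m-n≡m⊖n q 1 ⟩
      q ℤ.⊖ 1                           ≡⟨ ℤₚ.⊖-≥ (ℕₚ.<⇒≤ 1<q) ⟩
      x                                 ∎
      where
      shift : ∀ a → a ≡ a + 1ℤ - 1ℤ
      shift = solve-∀

  ∑-units-scale : ∀ {a} → a ≢ 0# → ∀ f → ∑ units (λ b → f (a *ᶠ b)) ≡ ∑ units f
  ∑-units-scale {a} a≢0 f = begin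
    ∑ units (λ b → f (a *ᶠ b))                                              ≡⟨ ∑-units _ ⟩
    ∑ elements (λ b → 𝟙 (not (does (b ≟ᶠ 0#))) * f (a *ᶠ b))               ≡⟨ ∑-cong elements
        (λ b → cong (_* f (a *ᶠ b)) (same-zero b)) ⟩
    ∑ elements (λ b → 𝟙 (not (does (a *ᶠ b ≟ᶠ 0#))) * f (a *ᶠ b))          ≡⟨ ∑-bijection elements-enumerates _≟ᶠ_
        (a *ᶠ_) (a ⁻¹⟨ a≢0 ⟩ *ᶠ_)
                                                                                (a*[a⁻¹*b]≡b a≢0) (a⁻¹*[a*b]≡b a≢0)
                                                                                    _ ⟩
    ∑ elements (λ b → 𝟙 (not (does (b ≟ᶠ 0#))) * f b)                      ≡⟨ ∑-units f ⟨
    ∑ units f                                                               ∎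
    where
    open ≡-Reasoning
    same-zero : ∀ b → 𝟙 (not (does (b ≟ᶠ 0#))) ≡ 𝟙 (not (does (a *ᶠ b ≟ᶠ 0#)))
    same-zero b = 𝟙-cong (Dec.¬? (b ≟ᶠ 0#)) (Dec.¬? (a *ᶠ b ≟ᶠ 0#)) (*-≢0 a≢0)
        (λ ab≢0 b≡0 → ab≢0 (trans (cong (a *ᶠ_) b≡0) (zeroʳ a)))

  HasSupport : ∀ {n} → Subset n → Vec Carrier n → Set
  HasSupport σ v = ∀ j → (lookup σ j ≡ inside → lookup v j ≢ 0#) × (lookup σ j ≡ outside → lookup v j ≡ 0#)

  inside-support : ∀ {n a} {σ : Subset n} {v} → a ≢ 0# → HasSupport σ v → HasSupport (inside ∷ σ) (a ∷ v)
  inside-support a≢0 s zero    = (λ _ → a≢0) , λ ()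
  inside-support a≢0 s (suc j) = s j

  outside-support : ∀ {n} {σ : Subset n} {v} → HasSupport σ v → HasSupport (outside ∷ σ) (0# ∷ v)
  outside-support s zero    = (λ ()) , λ _ → refl
  outside-support s (suc j) = s j

  -- The support is exactly σ, not merely contained in it; this is what makes scaling of coordinates
  -- a bijection of the index set with orbits of known size.
  ∑supp : ∀ {n} → Subset n → (Vec Carrier n → ℤ) → ℤ
  ∑supp []            f = f []
  ∑supp (inside  ∷ σ) f = ∑ units (λ a → ∑supp σ (λ v → f (a ∷ v)))
  ∑supp (outside ∷ σ) f = ∑supp σ (λ v → f (0# ∷ v))

  ∑supp-cong : ∀ {n} (σ : Subset n) {f g} → (∀ v → HasSupport σ v → f v ≡ g v) → ∑supp σ f ≡ ∑supp σ g
  ∑supp-cong []            f≗g = f≗g [] (λ ())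
  ∑supp-cong (inside  ∷ σ) f≗g = ∑-units-cong (λ a a≢0 → ∑supp-cong σ (λ v s → f≗g (a ∷ v) (inside-support a≢0 s)))
  ∑supp-cong (outside ∷ σ) f≗g = ∑supp-cong σ (λ v s → f≗g (0# ∷ v) (outside-support s))

  ∑supp-∣ : ∀ {n k} (σ : Subset n) {f} → (∀ v → k ∣ f v) → k ∣ ∑supp σ f
  ∑supp-∣ []            k∣f = k∣f []
  ∑supp-∣ (inside  ∷ σ) k∣f = ∑-∣ units (λ a → ∑supp-∣ σ (λ v → k∣f (a ∷ v)))
  ∑supp-∣ (outside ∷ σ) k∣f = ∑supp-∣ σ (λ v → k∣f (0# ∷ v))

  ∑supp-const : ∀ {n} (σ : Subset n) k → ∑supp σ (λ _ → k) ≡ x ^ ∣ σ ∣ * k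
  ∑supp-const []            k = sym (ℤₚ.*-identityˡ k)
  ∑supp-const (inside  ∷ σ) k = trans (∑-units-const _) (trans (cong (x *_) (∑supp-const σ k))
      (sym (ℤₚ.*-assoc x _ k)))
  ∑supp-const (outside ∷ σ) k = ∑supp-const σ k

  ∑supp-constant : ∀ {n} (σ : Subset n) {f k} → (∀ v → HasSupport σ v → f v ≡ k) → ∑supp σ f ≡ x ^ ∣ σ ∣ * k
  ∑supp-constant σ f≗k = trans (∑supp-cong σ f≗k) (∑supp-const σ _)

  infixr 7 _⊙_

  _⊙_ : ∀ {n} → Vec Carrier n → Vec Carrier n → Vec Carrier n
  _⊙_ = zipWith _*ᶠ_

  Invertible : ∀ {n} → Vec Carrier n → Set
  Invertible d = ∀ j → lookup d j ≢ 0#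

  scale : ∀ {n} → Carrier → Vec Carrier n → Vec Carrier n
  scale a v = replicate _ a ⊙ v

  scaleAt : ∀ {n} → Fin n → Carrier → Vec Carrier n → Vec Carrier n
  scaleAt zero    a (b ∷ v) = a *ᶠ b ∷ v
  scaleAt (suc j) a (b ∷ v) = b ∷ scaleAt j a v

  -- An invertible diagonal matrix permutes the vectors with support σ.
  ∑supp-⊙ : ∀ {n} (σ : Subset n) d → Invertible d → ∀ f → ∑supp σ (λ v → f (d ⊙ v)) ≡ ∑supp σ f
  ∑supp-⊙ []            []      inv f = refl
  ∑supp-⊙ (inside  ∷ σ) (c ∷ d) inv f =
    trans (∑-cong units (λ a → ∑supp-⊙ σ d (inv ∘ suc) (λ v → f (c *ᶠ a ∷ v))))
          (∑-units-scale (inv zero) (λ a → ∑supp σ (λ v → f (a ∷ v))))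
  ∑supp-⊙ (outside ∷ σ) (c ∷ d) inv f =
    trans (∑supp-cong σ (λ v _ → cong (λ z → f (z ∷ d ⊙ v)) (zeroʳ c))) (∑supp-⊙ σ d (inv ∘ suc) (λ v → f (0# ∷ v)))

  replicate-invertible : ∀ {n a} → a ≢ 0# → Invertible (replicate n a)
  replicate-invertible a≢0 j = a≢0 ∘ trans (sym (Vecₚ.lookup-replicate j _))

  𝟏 : ∀ {n} → Subset n → Vec Carrier n
  𝟏 = Vec.map (λ b → if b then 1# else 0#)

  ⊙-identityˡ : ∀ {n} (v : Vec Carrier n) → scale 1# v ≡ v
  ⊙-identityˡ []      = refl
  ⊙-identityˡ (a ∷ v) = cong₂ _∷_ (*-identityˡ a) (⊙-identityˡ v)

  -- Diagonal matrices act transitively on the vectors with support σ, so f has the value of the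
  -- representative `𝟏 σ` on all x ^ ∣ σ ∣ of them.
  ∑supp-invariant : ∀ {n} (σ : Subset n) {f} → (∀ d v → Invertible d → f (d ⊙ v) ≡ f v) → ∑supp σ f ≡ x ^ ∣ σ ∣ * f
      (𝟏 σ)
  ∑supp-invariant []            inv = sym (ℤₚ.*-identityˡ _)
  ∑supp-invariant (inside  ∷ σ) {f} inv = begin
    ∑ units (λ a → ∑supp σ (λ v → f (a ∷ v)))    ≡⟨ ∑-units-cong
        (λ a a≢0 → ∑supp-cong σ (λ v _ → normalise a a≢0 v)) ⟩
    ∑ units (λ _ → ∑supp σ (λ v → f (1# ∷ v)))   ≡⟨ ∑-units-const _ ⟩
    x * ∑supp σ (λ v → f (1# ∷ v))               ≡⟨ cong (x *_) (∑supp-invariant σ (λ d v d-inv →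
                                                      trans (cong (λ z → f (z ∷ d ⊙ v)) (sym (*-identityˡ 1#)))
                                                          (inv (1# ∷ d) (1# ∷ v) (cons 1≢0 d-inv)))) ⟩
    x * (x ^ ∣ σ ∣ * f (1# ∷ 𝟏 σ))               ≡⟨ ℤₚ.*-assoc x _ _ ⟨
    x ^ suc ∣ σ ∣ * f (1# ∷ 𝟏 σ)                 ∎
    where
    open ≡-Reasoning
    cons : ∀ {n a} {d : Vec Carrier n} → a ≢ 0# → Invertible d → Invertible (a ∷ d)
    cons a≢0 d-inv zero    = a≢0
    cons a≢0 d-inv (suc j) = d-inv j
    normalise : ∀ a → a ≢ 0# → ∀ v → f (a ∷ v) ≡ f (1# ∷ v)
    normalise a a≢0 v = trans (cong₂ (λ b u → f (b ∷ u)) (sym (*-identityʳ a)) (sym (⊙-identityˡ v)))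
                              (inv (a ∷ replicate _ 1#) (1# ∷ v) (cons a≢0 (replicate-invertible 1≢0)))
  ∑supp-invariant (outside ∷ σ) {f} inv = ∑supp-invariant σ (λ d v d-inv →
    trans (cong (λ z → f (z ∷ d ⊙ v)) (sym (zeroʳ 1#))) (inv (1# ∷ d) (0# ∷ v)
        (λ { zero → 1≢0 ; (suc j) → d-inv j })))

  ScaleInvariant : ∀ {n} → (Vec Carrier n → ℤ) → Set
  ScaleInvariant f = ∀ a v → a ≢ 0# → f (scale a v) ≡ f v

  CoordinateInvariant : ∀ {n} → Fin n → (Vec Carrier n → ℤ) → Set
  CoordinateInvariant j f = ∀ a v → a ≢ 0# → f (scaleAt j a v) ≡ f v

  scale-outside : ∀ {n} {f : Vec Carrier (suc n) → ℤ} → ScaleInvariant f → ScaleInvariant (λ v → f (0# ∷ v))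
  scale-outside {f = f} inv a v a≢0 = trans (cong (λ z → f (z ∷ scale a v)) (sym (zeroʳ a))) (inv a (0# ∷ v) a≢0)

  -- An overall scaling normalises the leading nonzero entry to 1, so its x possible values
  -- contribute equally.
  ∑supp-scale-inside : ∀ {n} (σ : Subset n) {f} → ScaleInvariant f → ∑supp (inside ∷ σ) f ≡ x * ∑supp σ
      (λ v → f (1# ∷ v))
  ∑supp-scale-inside σ {f} inv = trans
    (∑-units-cong (λ a a≢0 → trans (sym (∑supp-⊙ σ (replicate _ a) (replicate-invertible a≢0) (λ v → f (a ∷ v))))
      (∑supp-cong σ (λ v _ → trans (cong (λ b → f (b ∷ scale a v)) (sym (*-identityʳ a))) (inv a (1# ∷ v) a≢0)))))
    (∑-units-const _)

  ∑supp-scale-∣ : ∀ {n k} (σ : Subset n) {f} → ScaleInvariant f → ∀ i → lookup σ i ≡ inside →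
                  (∀ v → k ∣ f v) → x * k ∣ ∑supp σ f
  ∑supp-scale-∣ {k = k} (inside ∷ σ) inv i i∈σ k∣f =
    subst (x * k ∣_) (sym (∑supp-scale-inside σ inv)) (Div.*-monoʳ-∣ x (∑supp-∣ σ (λ v → k∣f (1# ∷ v))))
  ∑supp-scale-∣ (outside ∷ σ) inv (suc i) i∈σ k∣f =
    ∑supp-scale-∣ σ (scale-outside inv) i i∈σ (λ v → k∣f (0# ∷ v))

  ∑supp-coordinate-∣ : ∀ {n k} (σ : Subset n) {f} j → CoordinateInvariant j f → lookup σ j ≡ inside →
                       (∀ v → k ∣ f v) → x * k ∣ ∑supp σ f
  ∑supp-coordinate-∣ {k = k} (inside ∷ σ) {f} zero inv j∈σ k∣f =
    subst (x * k ∣_) (sym (trans (∑-units-cong (λ a a≢0 → ∑supp-cong σ (λ v _ →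
                                    trans (cong (λ b → f (b ∷ v)) (sym (*-identityʳ a))) (inv a (1# ∷ v) a≢0))))
                                 (∑-units-const _)))
          (Div.*-monoʳ-∣ x (∑supp-∣ σ (λ v → k∣f (1# ∷ v))))
  ∑supp-coordinate-∣ (inside ∷ σ) (suc j) inv j∈σ k∣f =
    ∑-∣ units (λ b → ∑supp-coordinate-∣ σ j (λ a v → inv a (b ∷ v)) j∈σ (λ v → k∣f (b ∷ v)))
  ∑supp-coordinate-∣ (outside ∷ σ) (suc j) inv j∈σ k∣f =
    ∑supp-coordinate-∣ σ j (λ a v → inv a (0# ∷ v)) j∈σ (λ v → k∣f (0# ∷ v))

  -- The overall scaling and the scaling of coordinate j are independent as soon as the support has
  -- a further element i. Two entries can then be normalised, each at the price of a factor x.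
  ∑supp-scale-coordinate-∣ : ∀ {n k} (σ : Subset n) {f} i j → ScaleInvariant f → CoordinateInvariant j f →
                             lookup σ i ≡ inside → lookup σ j ≡ inside → i ≢ j →
                             (∀ v → k ∣ f v) → x * (x * k) ∣ ∑supp σ f
  ∑supp-scale-coordinate-∣ (inside ∷ σ) zero zero sc co i∈σ j∈σ i≢j k∣f = contradiction refl i≢j
  ∑supp-scale-coordinate-∣ {k = k} (inside ∷ σ) {f} (suc i) zero sc co i∈σ j∈σ i≢j k∣f =
    subst (x * (x * k) ∣_) (sym (trans (∑-units-cong (λ a a≢0 → ∑supp-cong σ (λ v _ →
                                    trans (cong (λ b → f (b ∷ v)) (sym (*-identityʳ a))) (co a (1# ∷ v) a≢0))))
                                 (∑-units-const _)))
          (Div.*-monoʳ-∣ x (∑supp-scale-∣ σ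
            -- With coordinate j fixed at 1, scaling the other entries still preserves f: coordinate
            -- j can be rescaled for free, which completes the operation to an overall scaling.
            (λ a v a≢0 → trans (sym (co a (1# ∷ scale a v) a≢0)) (sc a (1# ∷ v) a≢0)) i i∈σ (λ v → k∣f (1# ∷ v))))
  ∑supp-scale-coordinate-∣ {k = k} (inside ∷ σ) i (suc j) sc co i∈σ j∈σ i≢j k∣f =
    subst (x * (x * k) ∣_) (sym (∑supp-scale-inside σ sc))
          (Div.*-monoʳ-∣ x (∑supp-coordinate-∣ σ j (λ a v → co a (1# ∷ v)) j∈σ (λ v → k∣f (1# ∷ v))))
  ∑supp-scale-coordinate-∣ (outside ∷ σ) (suc i) (suc j) sc co i∈σ j∈σ i≢j k∣f =
    ∑supp-scale-coordinate-∣ σ i j (scale-outside sc) (λ a v → co a (0# ∷ v)) i∈σ j∈σ (i≢j ∘ cong suc)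
        (λ v → k∣f (0# ∷ v))

-- Non-attacking placements

∑ᶠ : ∀ {n} → (Fin n → ℤ) → ℤ
∑ᶠ f = ∑ (allFin _) f

∑ᶠ-suc : ∀ {n} (f : Fin (suc n) → ℤ) → ∑ᶠ f ≡ f zero + ∑ᶠ (f ∘ suc)
∑ᶠ-suc f = ∑-allFin _ f

∑ᶠ-cong : ∀ {n} {f g : Fin n → ℤ} → (∀ i → f i ≡ g i) → ∑ᶠ f ≡ ∑ᶠ g
∑ᶠ-cong = ∑-cong (allFin _)

∑ᶠ-zero : ∀ {n} {f : Fin n → ℤ} → (∀ i → f i ≡ 0ℤ) → ∑ᶠ f ≡ 0ℤ
∑ᶠ-zero = ∑-zero (allFin _)

∑ᶠ-+ : ∀ {n} (f g : Fin n → ℤ) → ∑ᶠ (λ i → f i + g i) ≡ ∑ᶠ f + ∑ᶠ g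
∑ᶠ-+ = ∑-+ (allFin _)

∑ᶠ-≡⟦⟧ : ∀ {n k} {f g : Fin n → ℤ} → (∀ i → f i ≡ g i ⟦ k ⟧) → ∑ᶠ f ≡ ∑ᶠ g ⟦ k ⟧
∑ᶠ-≡⟦⟧ {f = f} = ∑-≡⟦⟧ (allFin _) {f}

_<ᵇ_ : ∀ {n} → Fin n → Fin n → Bool
i <ᵇ j = toℕ i ℕ.<ᵇ toℕ j

_==_ : ∀ {n} → Fin n → Fin n → Bool
i == j = does (i Fin.≟ j)

==-refl : ∀ {n} (i : Fin n) → (i == i) ≡ true
==-refl i = Dec.dec-true (i Fin.≟ i) refl

==-≢ : ∀ {n} {i j : Fin n} → i ≢ j → (i == j) ≡ false
==-≢ {i = i} {j} = Dec.dec-false (i Fin.≟ j)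

==-sym : ∀ {n} (i j : Fin n) → (i == j) ≡ (j == i)
==-sym i j with i Fin.≟ j
... | yes refl = sym (==-refl i)
... | no i≢j   = sym (==-≢ (i≢j ∘ sym))

<ᵇ-irrefl : ∀ {n} (i : Fin n) → (i <ᵇ i) ≡ false
<ᵇ-irrefl zero    = refl
<ᵇ-irrefl (suc i) = <ᵇ-irrefl i

𝟙-<ᵇ-total : ∀ {n} (i j : Fin n) → 𝟙 (i <ᵇ j) + 𝟙 (j <ᵇ i) ≡ 𝟙 (not (i == j))
𝟙-<ᵇ-total zero    zero    = refl
𝟙-<ᵇ-total zero    (suc j) = refl
𝟙-<ᵇ-total (suc i) zero    = refl
𝟙-<ᵇ-total (suc i) (suc j) = 𝟙-<ᵇ-total i j

-- Placements produce ordered choices (rook, further cell) in a row, whereas supports {c, d} are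
-- listed once, with c < d. This identity passes between the two.
∑ᶠ-pairs : ∀ {n} (f : Fin n → Fin n → ℤ) →
           ∑ᶠ (λ i → ∑ᶠ (λ j → 𝟙 (i <ᵇ j) * (f i j + f j i))) ≡ ∑ᶠ (λ i → ∑ᶠ (λ j → 𝟙 (not (i == j)) * f i j))
∑ᶠ-pairs {n} f = begin
  ∑ᶠ (λ i → ∑ᶠ (λ j → 𝟙 (i <ᵇ j) * (f i j + f j i)))
    ≡⟨ ∑ᶠ-cong (λ i → trans (∑ᶠ-cong (λ j → ℤₚ.*-distribˡ-+ (𝟙 (i <ᵇ j)) (f i j) (f j i)))
        (∑ᶠ-+ (above i) (λ j → below j i))) ⟩
  ∑ᶠ (λ i → ∑ᶠ (above i) + ∑ᶠ (λ j → below j i))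
    ≡⟨ ∑ᶠ-+ (λ i → ∑ᶠ (above i)) (λ i → ∑ᶠ (λ j → below j i)) ⟩
  ∑ᶠ (λ i → ∑ᶠ (above i)) + ∑ᶠ (λ i → ∑ᶠ (λ j → below j i))
    ≡⟨ cong (_+_ (∑ᶠ (λ i → ∑ᶠ (above i)))) (∑-swap (allFin n) (allFin n) (λ i j → below j i)) ⟩
  ∑ᶠ (λ i → ∑ᶠ (above i)) + ∑ᶠ (λ i → ∑ᶠ (below i))
    ≡⟨ ∑ᶠ-+ (λ i → ∑ᶠ (above i)) (λ i → ∑ᶠ (below i)) ⟨
  ∑ᶠ (λ i → ∑ᶠ (above i) + ∑ᶠ (below i))
    ≡⟨ ∑ᶠ-cong (λ i → trans (sym (∑ᶠ-+ (above i) (below i))) (∑ᶠ-cong (λ j →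
         trans (sym (ℤₚ.*-distribʳ-+ (f i j) (𝟙 (i <ᵇ j)) (𝟙 (j <ᵇ i)))) (cong (_* f i j) (𝟙-<ᵇ-total i j))))) ⟩
  ∑ᶠ (λ i → ∑ᶠ (λ j → 𝟙 (not (i == j)) * f i j)) ∎
  where
  open ≡-Reasoning
  above below : Fin n → Fin n → ℤ
  above i j = 𝟙 (i <ᵇ j) * f i j
  below i j = 𝟙 (j <ᵇ i) * f i j

singletonSum : ∀ {n} → Subset n → (Fin n → ℤ) → ℤ
singletonSum β f = ∑ᶠ (λ c → 𝟙 (lookup β c) * f c)

singletonSum-suc : ∀ {n} b (β : Subset n) f → singletonSum (b ∷ β) f ≡ 𝟙 b * f zero + singletonSum β (f ∘ suc)
singletonSum-suc b β f = ∑ᶠ-suc (λ c → 𝟙 (lookup (b ∷ β) c) * f c)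

pairSum : ∀ {n} → Subset n → (Fin n → Fin n → ℤ) → ℤ
pairSum β f = ∑ᶠ (λ c → ∑ᶠ (λ d → 𝟙 (c <ᵇ d) * (𝟙 (lookup β c) * (𝟙 (lookup β d) * f c d))))

pairSum-suc : ∀ {n} b (β : Subset n) f →
              pairSum (b ∷ β) f ≡ 𝟙 b * ∑ᶠ (λ d → 𝟙 (lookup β d) * f zero (suc d)) + pairSum β
                  (λ c d → f (suc c) (suc d))
pairSum-suc {n} b β f = trans (∑ᶠ-suc row) (cong₂ _+_
  (trans (∑ᶠ-suc (entries zero)) (trans (ℤₚ.+-identityˡ (∑ᶠ (entries zero ∘ suc))) (trans
    (∑ᶠ-cong (λ d → ℤₚ.*-identityˡ (𝟙 b * (𝟙 (lookup β d) * f zero (suc d)))))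
        (∑-*ˡ (allFin n) (𝟙 b) (λ d → 𝟙 (lookup β d) * f zero (suc d))))))
  (∑ᶠ-cong (λ c → trans (∑ᶠ-suc (entries (suc c))) (ℤₚ.+-identityˡ (∑ᶠ (entries (suc c) ∘ suc))))))
  where
  entries : Fin (suc n) → Fin (suc n) → ℤ
  entries c d = 𝟙 (c <ᵇ d) * (𝟙 (lookup (b ∷ β) c) * (𝟙 (lookup (b ∷ β) d) * f c d))
  row : Fin (suc n) → ℤ
  row c = ∑ᶠ (entries c)

module _ {k : ℤ} where

  +-≡0⟦⟧ : ∀ {a b c} → a ≡ c ⟦ k ⟧ → k ∣ b → b + a ≡ c ⟦ k ⟧
  +-≡0⟦⟧ p k∣b = ≡⟦⟧-trans (≡⟦⟧-+ (∣⇒≡0⟦⟧ k∣b) p) (≡⇒≡⟦⟧ (ℤₚ.+-identityˡ _))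

  -- If large supports are negligible, a sum over all supports reduces to the few small ones. The
  -- bounds 1, 2, 3 in this lemma and the next two are linked: a support that contains the head of β
  -- needs one element less from the tail.
  ∑⊆-≡∅ : ∀ {n} (β : Subset n) (H : Subset n → ℤ) → (∀ σ → 1 ≤ℕ ∣ σ ∣ → k ∣ H σ) → ∑⊆ β H ≡ H ∅ ⟦ k ⟧
  ∑⊆-≡∅ []            H k∣H = ≡⇒≡⟦⟧ refl
  ∑⊆-≡∅ (inside ∷ β)  H k∣H = +-≡0⟦⟧ (∑⊆-≡∅ β (λ σ → H (outside ∷ σ)) (λ σ → k∣H (outside ∷ σ)))
                                     (∑⊆-∣ β (λ σ → k∣H (inside ∷ σ) (s≤s z≤n)))
  ∑⊆-≡∅ (outside ∷ β) H k∣H = ∑⊆-≡∅ β (λ σ → H (outside ∷ σ)) (λ σ → k∣H (outside ∷ σ))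

  ∑⊆-≡singletons : ∀ {n} (β : Subset n) (H : Subset n → ℤ) → (∀ σ → 2 ≤ℕ ∣ σ ∣ → k ∣ H σ) →
                   ∑⊆ β H ≡ H ∅ + singletonSum β (H ∘ ⁅_⁆) ⟦ k ⟧
  ∑⊆-≡singletons []            H k∣H = ≡⇒≡⟦⟧ (sym (ℤₚ.+-identityʳ (H [])))
  ∑⊆-≡singletons (inside ∷ β)  H k∣H = ≡⟦⟧-trans
    (≡⟦⟧-+ (∑⊆-≡∅ β (λ σ → H (inside ∷ σ)) (λ σ 1≤σ → k∣H (inside ∷ σ) (s≤s 1≤σ)))
           (∑⊆-≡singletons β (λ σ → H (outside ∷ σ)) (λ σ → k∣H (outside ∷ σ))))
    (≡⇒≡⟦⟧ (trans (rearrange (H (inside ∷ ∅)) (H ∅) (singletonSum β (λ c → H (outside ∷ ⁅ c ⁆))))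
                  (cong (_+_ (H ∅)) (sym (singletonSum-suc true β (H ∘ ⁅_⁆))))))
    where
    rearrange : ∀ a b c → a + (b + c) ≡ b + (1ℤ * a + c)
    rearrange = solve-∀
  ∑⊆-≡singletons (outside ∷ β) H k∣H = ≡⟦⟧-trans
    (∑⊆-≡singletons β (λ σ → H (outside ∷ σ)) (λ σ → k∣H (outside ∷ σ)))
    (≡⇒≡⟦⟧ (cong (_+_ (H ∅)) (sym (trans (singletonSum-suc false β (H ∘ ⁅_⁆))
        (ℤₚ.+-identityˡ (singletonSum β (λ c → H (outside ∷ ⁅ c ⁆))))))))

  ∑⊆-≡pairs : ∀ {n} (β : Subset n) (H : Subset n → ℤ) → (∀ σ → 3 ≤ℕ ∣ σ ∣ → k ∣ H σ) →
              ∑⊆ β H ≡ H ∅ + singletonSum β (H ∘ ⁅_⁆) + pairSum β (λ c d → H (⁅ c ⁆ ∪ ⁅ d ⁆)) ⟦ k ⟧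
  ∑⊆-≡pairs []            H k∣H = ≡⇒≡⟦⟧ (sym (trans (ℤₚ.+-identityʳ (H [] + 0ℤ)) (ℤₚ.+-identityʳ (H []))))
  ∑⊆-≡pairs (inside ∷ β)  H k∣H = ≡⟦⟧-trans
    (≡⟦⟧-+ (∑⊆-≡singletons β (λ σ → H (inside ∷ σ)) (λ σ 2≤σ → k∣H (inside ∷ σ) (s≤s 2≤σ)))
           (∑⊆-≡pairs β (λ σ → H (outside ∷ σ)) (λ σ → k∣H (outside ∷ σ))))
    (≡⇒≡⟦⟧ (trans (rearrange (H (inside ∷ ∅)) (singletonSum β (λ c → H (inside ∷ ⁅ c ⁆))) (H ∅)
                             (singletonSum β (λ c → H (outside ∷ ⁅ c ⁆)))
                                 (pairSum β (λ c d → H (outside ∷ (⁅ c ⁆ ∪ ⁅ d ⁆)))))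
      (sym (cong₂ (λ u v → H ∅ + u + v) (singletonSum-suc true β (H ∘ ⁅_⁆))
       (trans (pairSum-suc true β (λ c d → H (⁅ c ⁆ ∪ ⁅ d ⁆)))
         (cong (λ u → 1ℤ * u + pairSum β (λ c d → H (outside ∷ (⁅ c ⁆ ∪ ⁅ d ⁆))))
         (∑ᶠ-cong (λ d → cong (λ σ → 𝟙 (lookup β d) * H (inside ∷ σ)) (Subsetₚ.∪-identityˡ ⁅ d ⁆)))))))))
    where
    rearrange : ∀ a s b c d → a + s + (b + c + d) ≡ b + (1ℤ * a + c) + (1ℤ * s + d)
    rearrange = solve-∀
  ∑⊆-≡pairs (outside ∷ β) H k∣H = ≡⟦⟧-trans
    (∑⊆-≡pairs β (λ σ → H (outside ∷ σ)) (λ σ → k∣H (outside ∷ σ)))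
    (≡⇒≡⟦⟧ (sym (cong₂ (λ u v → H ∅ + u + v)
       (trans (singletonSum-suc false β (H ∘ ⁅_⁆)) (ℤₚ.+-identityˡ (singletonSum β (λ c → H (outside ∷ ⁅ c ⁆)))))
       (trans (pairSum-suc false β (λ c d → H (⁅ c ⁆ ∪ ⁅ d ⁆)))
           (ℤₚ.+-identityˡ (pairSum β (λ c d → H (outside ∷ (⁅ c ⁆ ∪ ⁅ d ⁆)))))))))

∅-or-∈ : ∀ {n} (σ : Subset n) → σ ≡ ∅ ⊎ ∃ λ i → lookup σ i ≡ inside
∅-or-∈ []            = inj₁ refl
∅-or-∈ (inside ∷ σ)  = inj₂ (zero , refl)
∅-or-∈ (outside ∷ σ) with ∅-or-∈ σ
... | inj₁ σ≡∅       = inj₁ (cong (outside ∷_) σ≡∅)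
... | inj₂ (i , i∈σ) = inj₂ (suc i , i∈σ)

-- Predicates and not bit vectors, so that adding a column is a pointwise `∨`. The price is that
-- sets of columns are equal only pointwise, hence the congruence lemmas for `≗`.
Columns : ℕ → Set
Columns n = Fin n → Bool

noColumns : ∀ {n} → Columns n
noColumns _ = false

infixl 6 _◂_

_◂_ : ∀ {n} → Columns n → Fin n → Columns n
(C ◂ c) j = C j ∨ (j == c)

◂-cong : ∀ {n} {C D : Columns n} c → C ≗ D → C ◂ c ≗ D ◂ c
◂-cong c C≗D j = cong (_∨ (j == c)) (C≗D j)

◂-comm : ∀ {n} (C : Columns n) c d → C ◂ c ◂ d ≗ C ◂ d ◂ c
◂-comm C c d j = trans (Boolₚ.∨-assoc (C j) _ _) (trans (cong (C j ∨_) (Boolₚ.∨-comm (j == c) (j == d)))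
    (sym (Boolₚ.∨-assoc (C j) _ _)))

◂-≢ : ∀ {n} (C : Columns n) {c j} → j ≢ c → (C ◂ c) j ≡ C j
◂-≢ C j≢c = trans (cong (C _ ∨_) (==-≢ j≢c)) (Boolₚ.∨-identityʳ (C _))

◂-false : ∀ {n} (C : Columns n) {c j} → (C ◂ c) j ≡ false → C j ≡ false × j ≢ c
◂-false C {c} {j} eq = Boolₚ.∨-conicalˡ (C j) (j == c) eq ,
  λ j≡c → contradiction (trans (sym (Dec.dec-true (j Fin.≟ c) j≡c)) (Boolₚ.∨-conicalʳ (C j) (j == c) eq)) λ ()

◂-false⁺ : ∀ {n} (C : Columns n) {c j} → C j ≡ false → j ≢ c → (C ◂ c) j ≡ false
◂-false⁺ C Cj j≢c = trans (◂-≢ C j≢c) Cj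

𝟙-not-◂ : ∀ {n} (C : Columns n) c d → 𝟙 (not ((C ◂ c) d)) ≡ 𝟙 (not (C d)) * 𝟙 (not (d == c))
𝟙-not-◂ C c d with C d | d == c
... | true  | _     = refl
... | false | true  = refl
... | false | false = refl

Placement : ℕ → ℕ → Set
Placement m n = Vec (Maybe (Fin n)) m

placements : ∀ m n → List (Placement m n)
placements m n = vecs (nothing ∷ map just (allFin n)) m

∑-placements : ∀ m n (f : Placement (suc m) n → ℤ) → ∑ (placements (suc m) n) f ≡
               ∑ (placements m n) (λ p → f (nothing ∷ p)) + ∑ᶠ (λ c → ∑ (placements m n) (λ p → f (just c ∷ p)))
∑-placements m n f = trans (∑-vecs _ m f) (cong (_+_ (∑ (placements m n) (λ p → f (nothing ∷ p))))
    (∑-map just (allFin n) _))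

rooks : ∀ {m n} → Placement m n → ℕ
rooks []            = 0
rooks (nothing ∷ p) = rooks p
rooks (just c ∷ p)  = suc (rooks p)

-- An integer indicator, so that the conditions move through sums as factors; C collects the columns
-- that are already taken.
valid : ∀ {m n} → Board m n → Columns n → Placement m n → ℤ
valid []      C []            = 1ℤ
valid (β ∷ B) C (nothing ∷ p) = valid B C p
valid (β ∷ B) C (just c ∷ p)  = 𝟙 (lookup β c) * (𝟙 (not (C c)) * valid B (C ◂ c) p)

meet : ∀ {n} → Subset n → Columns n → ℤ
meet β C = ∑ᶠ (λ c → 𝟙 (lookup β c) * 𝟙 (C c))

-- A first-order term of a matrix count is supported on a non-attacking placement and
-- one more cell d in a row whose rook is in column c, or on the four corners of a
-- rectangle, which count −1 because the invertible 2 × 2 matrices without zero entries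
-- number x² (x² − x).  `partner` is the total for d when the rows below carry p; if no
-- rook of p is in column d, then c and d play the same role and only c < d is counted.
partner : ∀ {m n} → Fin n → Fin n → Board m n → Placement m n → ℤ
partner c d []      []            = 𝟙 (c <ᵇ d)
partner c d (β ∷ B) (nothing ∷ p) = partner c d B p
partner c d (β ∷ B) (just e ∷ p)  = if e == d then 1ℤ - 𝟙 (c <ᵇ d) * 𝟙 (lookup β c) else partner c d B p

-- Here C consists of the columns of the preceding rooks; a further cell in one of these
-- columns is a first-order term as well, whether or not its row carries a rook.
extra : ∀ {m n} → Board m n → Columns n → Placement m n → ℤ
extra []      C []            = 0ℤ
extra (β ∷ B) C (nothing ∷ p) = meet β C + extra B C p
extra (β ∷ B) C (just c ∷ p)  =
  meet β C + extra B (C ◂ c) p + ∑ᶠ (λ d → 𝟙 (lookup β d) * (𝟙 (not ((C ◂ c) d)) * partner c d B p))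

module _ {m n} (B : Board m n) where

  rookSum : Columns n → (ℕ → ℤ) → ℤ
  rookSum C ω = ∑ (placements m n) (λ p → valid B C p * ω (rooks p))

  extraSum : Columns n → (ℕ → ℤ) → ℤ
  extraSum C ω = ∑ (placements m n) (λ p → valid B C p * (extra B C p * ω (rooks p)))

  -- The row with its rook in column c and a further cell in column d has been split off; B consists
  -- of the rows below it.
  partnerSum : Columns n → Fin n → Fin n → (ℕ → ℤ) → ℤ
  partnerSum C c d ω = ∑ (placements m n) (λ p → valid B (C ◂ c) p * (partner c d B p * ω (rooks p)))

valid-cong : ∀ {m n} (B : Board m n) {C D} → C ≗ D → ∀ p → valid B C p ≡ valid B D p
valid-cong []      C≗D []            = refl
valid-cong (β ∷ B) C≗D (nothing ∷ p) = valid-cong B C≗D p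
valid-cong (β ∷ B) C≗D (just c ∷ p)  =
  cong (𝟙 (lookup β c) *_) (cong₂ _*_ (cong (𝟙 ∘ not) (C≗D c)) (valid-cong B (◂-cong c C≗D) p))

rookSum-cong : ∀ {m n} (B : Board m n) {C D} ω → C ≗ D → rookSum B C ω ≡ rookSum B D ω
rookSum-cong B ω C≗D = ∑-cong (placements _ _) (λ p → cong (_* ω (rooks p)) (valid-cong B C≗D p))

∑-*ˡ² : ∀ {a} {A : Set a} (xs : List A) k l (f : A → ℤ) → ∑ xs (λ x → k * (l * f x)) ≡ k * (l * ∑ xs f)
∑-*ˡ² xs k l f = trans (∑-*ˡ xs k (λ x → l * f x)) (cong (k *_) (∑-*ˡ xs l f))

*-assoc³ : ∀ a b c d → a * (b * c) * d ≡ a * (b * (c * d))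
*-assoc³ = solve-∀

rookSum-∷ : ∀ {m n} (β : Subset n) (B : Board m n) C ω → rookSum (β ∷ B) C ω ≡
            rookSum B C ω + ∑ᶠ (λ c → 𝟙 (lookup β c) * (𝟙 (not (C c)) * rookSum B (C ◂ c) (ω ∘ suc)))
rookSum-∷ {m} {n} β B C ω = trans (∑-placements m n _) (cong (_+_ (rookSum B C ω)) (∑ᶠ-cong (λ c →
  trans (∑-cong (placements m n) (λ p → *-assoc³ (𝟙 (lookup β c)) (𝟙 (not (C c))) (valid B (C ◂ c) p)
      (ω (suc (rooks p)))))
        (∑-*ˡ² (placements m n) (𝟙 (lookup β c)) (𝟙 (not (C c))) (λ p → valid B (C ◂ c) p * ω (suc (rooks p)))))))

partnerSum-∷ : ∀ {m n} (β : Subset n) (B : Board m n) C c d ω → partnerSum (β ∷ B) C c d ω ≡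
  partnerSum B C c d ω + ∑ᶠ (λ e → 𝟙 (lookup β e) * (𝟙 (not ((C ◂ c) e)) *
    (if e == d then (1ℤ - 𝟙 (c <ᵇ d) * 𝟙 (lookup β c)) * rookSum B (C ◂ c ◂ e) (ω ∘ suc)
               else partnerSum B (C ◂ e) c d (ω ∘ suc))))
partnerSum-∷ {m} {n} β B C c d ω = trans (∑-placements m n _) (cong (_+_ (partnerSum B C c d ω)) (∑ᶠ-cong (λ e →
  trans (∑-cong (placements m n) (λ p → *-assoc³ (𝟙 (lookup β e)) (𝟙 (not ((C ◂ c) e))) (valid B (C ◂ c ◂ e) p)
      (weight e p)))
    (trans (∑-*ˡ² (placements m n) (𝟙 (lookup β e)) (𝟙 (not ((C ◂ c) e)))
        (λ p → valid B (C ◂ c ◂ e) p * weight e p))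
           (cong (λ z → 𝟙 (lookup β e) * (𝟙 (not ((C ◂ c) e)) * z)) (by-cases e))))))
  where
  swap : ∀ a b c → a * (b * c) ≡ b * (a * c)
  swap = solve-∀
  weight : Fin n → Placement m n → ℤ
  weight e p = partner c d (β ∷ B) (just e ∷ p) * ω (suc (rooks p))
  by-cases : ∀ e → ∑ (placements m n) (λ p → valid B (C ◂ c ◂ e) p * weight e p) ≡
    (if e == d then (1ℤ - 𝟙 (c <ᵇ d) * 𝟙 (lookup β c)) * rookSum B (C ◂ c ◂ e) (ω ∘ suc) else partnerSum B
        (C ◂ e) c d (ω ∘ suc))
  by-cases e with e == d
  ... | true  = trans (∑-cong (placements m n) (λ p → swap (valid B (C ◂ c ◂ e) p) free (ω (suc (rooks p)))))
                      (∑-*ˡ (placements m n) free (λ p → valid B (C ◂ c ◂ e) p * ω (suc (rooks p))))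
    where
    free = 1ℤ - 𝟙 (c <ᵇ d) * 𝟙 (lookup β c)
  ... | false = ∑-cong (placements m n) (λ p → cong (_* (partner c d B p * ω (suc (rooks p))))
      (valid-cong B (◂-comm C c e) p))

-- The leading contribution of a row with support {c, d}. Modulo the coordinate space of C such a
-- row vanishes, or is a multiple of one new basis vector, or, if both columns are new, is
-- proportional to e_c + e_d after a rescaling of columns.
pairValue : ∀ {m n} → Board m n → Columns n → (ℕ → ℤ) → Fin n → Fin n → ℤ
pairValue B C ω c d = if C c then (if C d then 0ℤ else rookSum B (C ◂ d) ω)
                             else (if C d then rookSum B (C ◂ c) ω else partnerSum B C c d ω + partnerSum B C d c ω)

-- The summands are arranged to match an expansion by supports: the empty row, one cell in an old
-- column, one cell in a new column, and two cells. In the last case both choices of the rook among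
-- the two cells are combined.
extraSum-∷ : ∀ {m n} (β : Subset n) (B : Board m n) C ω → extraSum (β ∷ B) C ω ≡
  extraSum B C ω + meet β C * rookSum B C ω
  + singletonSum β (λ c → 𝟙 (not (C c)) * extraSum B (C ◂ c) (ω ∘ suc))
  + pairSum β (pairValue B C (ω ∘ suc))
extraSum-∷ {m} {n} β B C ω = begin
  extraSum (β ∷ B) C ω
    ≡⟨ ∑-placements m n _ ⟩
  ∑ ps (λ p → valid B C p * ((meet β C + extra B C p) * ω (rooks p)))
  + ∑ᶠ (λ c → ∑ ps (λ p → valid (β ∷ B) C (just c ∷ p) * (extra (β ∷ B) C (just c ∷ p) * ω′ (rooks p))))
    ≡⟨ cong₂ _+_ empty-row (∑ᶠ-cong rook-row) ⟩
  E₀ + O * R₀ + ∑ᶠ (λ c → 𝟙 (lookup β c) * (𝟙 (not (C c)) * extraSum B (C ◂ c) ω′) + ∑ᶠ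
      (λ d → 𝟙 (not (c == d)) * S c d))
    ≡⟨ cong (_+_ (E₀ + O * R₀)) (∑ᶠ-+ rook-term (λ c → ∑ᶠ (λ d → 𝟙 (not (c == d)) * S c d))) ⟩
  E₀ + O * R₀ + (∑ᶠ rook-term + ∑ᶠ (λ c → ∑ᶠ (λ d → 𝟙 (not (c == d)) * S c d)))
    ≡⟨ ℤₚ.+-assoc (E₀ + O * R₀) (∑ᶠ rook-term) (∑ᶠ (λ c → ∑ᶠ (λ d → 𝟙 (not (c == d)) * S c d))) ⟨
  E₀ + O * R₀ + ∑ᶠ rook-term + ∑ᶠ (λ c → ∑ᶠ (λ d → 𝟙 (not (c == d)) * S c d))
    ≡⟨ cong (_+_ (E₀ + O * R₀ + ∑ᶠ rook-term)) (trans (sym (∑ᶠ-pairs S))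
        (∑ᶠ-cong (λ c → ∑ᶠ-cong (λ d → cong (𝟙 (c <ᵇ d) *_) (symmetrised c d))))) ⟩
  E₀ + O * R₀ + ∑ᶠ rook-term + pairSum β (pairValue B C ω′) ∎
  where
  open ≡-Reasoning
  ps = placements m n
  ω′ = ω ∘ suc
  O  = meet β C
  E₀ = extraSum B C ω
  R₀ = rookSum B C ω
  S : Fin n → Fin n → ℤ
  S c d = 𝟙 (lookup β c) * (𝟙 (not (C c)) * (𝟙 (lookup β d) *
      (𝟙 (C d) * rookSum B (C ◂ c) ω′ + 𝟙 (not (C d)) * partnerSum B C c d ω′)))
  rook-term : Fin n → ℤ
  rook-term c = 𝟙 (lookup β c) * (𝟙 (not (C c)) * extraSum B (C ◂ c) ω′)
  empty-row : ∑ ps (λ p → valid B C p * ((O + extra B C p) * ω (rooks p))) ≡ E₀ + O * R₀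
  empty-row = trans (∑-cong ps (λ p → expand (valid B C p) O (extra B C p) (ω (rooks p))))
    (trans (∑-+ ps (λ p → valid B C p * (extra B C p * ω (rooks p))) (λ p → O * (valid B C p * ω (rooks p))))
           (cong (_+_ E₀) (∑-*ˡ ps O (λ p → valid B C p * ω (rooks p)))))
    where
    expand : ∀ v o e w → v * ((o + e) * w) ≡ v * (e * w) + o * (v * w)
    expand = solve-∀
  rook-row : ∀ c → ∑ ps (λ p → valid (β ∷ B) C (just c ∷ p) * (extra (β ∷ B) C (just c ∷ p) * ω′ (rooks p))) ≡
             𝟙 (lookup β c) * (𝟙 (not (C c)) * extraSum B (C ◂ c) ω′) + ∑ᶠ (λ d → 𝟙 (not (c == d)) * S c d)
  rook-row c with C c in Cc
  ... | true  = trans (∑-zero ps (λ p → kill (𝟙 (lookup β c)) (valid B (C ◂ c) p)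
      (extra (β ∷ B) C (just c ∷ p) * ω′ (rooks p))))
                      (sym (cong₂ _+_ (ℤₚ.*-zeroʳ (𝟙 (lookup β c)))
                          (∑ᶠ-zero (λ d → kill′ (𝟙 (not (c == d))) (𝟙 (lookup β c))
                        (𝟙 (lookup β d) * (𝟙 (C d) * rookSum B (C ◂ c) ω′ + 𝟙
                            (not (C d)) * partnerSum B C c d ω′))))))
    where
    kill : ∀ a v e → a * (0ℤ * v) * e ≡ 0ℤ
    kill = solve-∀
    kill′ : ∀ b a e → b * (a * (0ℤ * e)) ≡ 0ℤ
    kill′ = solve-∀
  ... | false = begin
    ∑ ps (λ p → b * (1ℤ * V p) * ((O + E p + ∑ᶠ (λ d → T d p)) * w p))
      ≡⟨ ∑-cong ps (λ p → expand b (V p) O (E p) (∑ᶠ (λ d → T d p)) (w p)) ⟩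
    ∑ ps (λ p → b * (V p * (E p * w p)) + (b * O * (V p * w p) + b * (∑ᶠ (λ d → T d p) * (V p * w p))))
      ≡⟨ trans (∑-+ ps (λ p → b * (V p * (E p * w p))) (λ p → b * O * (V p * w p) + b *
          (∑ᶠ (λ d → T d p) * (V p * w p))))
           (cong₂ _+_ (∑-*ˡ ps b (λ p → V p * (E p * w p)))
             (trans (∑-+ ps (λ p → b * O * (V p * w p)) (λ p → b * (∑ᶠ (λ d → T d p) * (V p * w p))))
               (cong₂ _+_ (∑-*ˡ ps (b * O) (λ p → V p * w p)) (∑-*ˡ ps b (λ p → ∑ᶠ (λ d → T d p) * (V p * w p))))))
                   ⟩
    b * extraSum B (C ◂ c) ω′ + (b * O * R₁ + b * ∑ ps (λ p → ∑ᶠ (λ d → T d p) * (V p * w p)))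
      ≡⟨ cong₂ (λ u v → b * u + v) (sym (ℤₚ.*-identityˡ (extraSum B (C ◂ c) ω′)))
          (cong₂ (λ u v → u + b * v) meet-part partner-part) ⟩
    b * (1ℤ * extraSum B (C ◂ c) ω′) + (∑ᶠ M + b * ∑ᶠ N)
      ≡⟨ cong (_+_ (b * (1ℤ * extraSum B (C ◂ c) ω′))) (trans (cong (_+_ (∑ᶠ M)) (sym (∑-*ˡ (allFin n) b N)))
           (trans (sym (∑ᶠ-+ M (λ d → b * N d))) (∑ᶠ-cong combine))) ⟩
    b * (1ℤ * extraSum B (C ◂ c) ω′) + ∑ᶠ (λ d → 𝟙 (not (c == d)) *
        (b * (1ℤ * (𝟙 (lookup β d) * (𝟙 (C d) * R₁ + 𝟙 (not (C d)) * partnerSum B C c d ω′))))) ∎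
    where
    b = 𝟙 (lookup β c)
    V E w : Placement m n → ℤ
    V = valid B (C ◂ c)
    E = extra B (C ◂ c)
    w = ω′ ∘ rooks
    R₁ = rookSum B (C ◂ c) ω′
    T : Fin n → Placement m n → ℤ
    T d p = 𝟙 (lookup β d) * (𝟙 (not ((C ◂ c) d)) * partner c d B p)
    M N : Fin n → ℤ
    M d = 𝟙 (lookup β d) * 𝟙 (C d) * (b * R₁)
    N d = 𝟙 (lookup β d) * (𝟙 (not ((C ◂ c) d)) * partnerSum B C c d ω′)
    expand : ∀ b v o e s w → b * (1ℤ * v) * ((o + e + s) * w) ≡ b * (v * (e * w)) +
        (b * o * (v * w) + b * (s * (v * w)))
    expand = solve-∀
    meet-part : b * O * R₁ ≡ ∑ᶠ M
    meet-part = trans (swap b O R₁) (sym (∑-*ʳ (allFin n) (b * R₁) (λ d → 𝟙 (lookup β d) * 𝟙 (C d))))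
      where
      swap : ∀ b o r → b * o * r ≡ o * (b * r)
      swap = solve-∀
    partner-part : ∑ ps (λ p → ∑ᶠ (λ d → T d p) * (V p * w p)) ≡ ∑ᶠ N
    partner-part = trans (∑-cong ps (λ p → sym (∑-*ʳ (allFin n) (V p * w p) (λ d → T d p))))
      (trans (∑-swap ps (allFin n) (λ p d → T d p * (V p * w p)))
        (∑ᶠ-cong (λ d → trans (∑-cong ps (λ p → rotate (𝟙 (lookup β d)) (𝟙 (not ((C ◂ c) d))) (partner c d B p)
            (V p) (w p)))
                              (∑-*ˡ² ps (𝟙 (lookup β d)) (𝟙 (not ((C ◂ c) d)))
                                  (λ p → V p * (partner c d B p * w p))))))
      where
      rotate : ∀ b c t v w → b * (c * t) * (v * w) ≡ b * (c * (v * (t * w)))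
      rotate = solve-∀
    combine : ∀ d → M d + b * N d ≡
              𝟙 (not (c == d)) * (b * (1ℤ * (𝟙 (lookup β d) *
                  (𝟙 (C d) * R₁ + 𝟙 (not (C d)) * partnerSum B C c d ω′))))
    combine d rewrite 𝟙-not-◂ C c d | ==-sym d c with c Fin.≟ d
    ... | yes refl rewrite Cc = lemma b R₁ (partnerSum B C c c ω′)
        (b * (1ℤ * (b * (0ℤ * R₁ + 1ℤ * partnerSum B C c c ω′))))
      where
      lemma : ∀ b r p u → b * 0ℤ * (b * r) + b * (b * (1ℤ * 0ℤ * p)) ≡ 0ℤ * u
      lemma = solve-∀
    ... | no _ = lemma b (𝟙 (lookup β d)) (𝟙 (C d)) (𝟙 (not (C d))) R₁ (partnerSum B C c d ω′)
      where
      lemma : ∀ b a c c′ r p → a * c * (b * r) + b * (a * (c′ * 1ℤ * p)) ≡ 1ℤ * (b * (1ℤ * (a * (c * r + c′ * p))))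
      lemma = solve-∀
  symmetrised : ∀ c d → S c d + S d c ≡ 𝟙 (lookup β c) * (𝟙 (lookup β d) * pairValue B C ω′ c d)
  symmetrised c d with C c | C d
  ... | true  | true  = lemma (𝟙 (lookup β c)) (𝟙 (lookup β d))
    (𝟙 (lookup β d) * (1ℤ * rookSum B (C ◂ c) ω′ + 0ℤ * partnerSum B C c d ω′))
    (𝟙 (lookup β c) * (1ℤ * rookSum B (C ◂ d) ω′ + 0ℤ * partnerSum B C d c ω′))
    where
    lemma : ∀ a b u v → a * (0ℤ * u) + b * (0ℤ * v) ≡ a * (b * 0ℤ)
    lemma = solve-∀
  ... | true  | false = lemma (𝟙 (lookup β c)) (𝟙 (lookup β d))
    (𝟙 (lookup β d) * (0ℤ * rookSum B (C ◂ c) ω′ + 1ℤ * partnerSum B C c d ω′)) (rookSum B (C ◂ d) ω′)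
        (partnerSum B C d c ω′)
    where
    lemma : ∀ a b u r y → a * (0ℤ * u) + b * (1ℤ * (a * (1ℤ * r + 0ℤ * y))) ≡ a * (b * r)
    lemma = solve-∀
  ... | false | true  = lemma (𝟙 (lookup β c)) (𝟙 (lookup β d))
    (𝟙 (lookup β c) * (0ℤ * rookSum B (C ◂ d) ω′ + 1ℤ * partnerSum B C d c ω′)) (rookSum B (C ◂ c) ω′)
        (partnerSum B C c d ω′)
    where
    lemma : ∀ a b u r y → a * (1ℤ * (b * (1ℤ * r + 0ℤ * y))) + b * (0ℤ * u) ≡ a * (b * r)
    lemma = solve-∀
  ... | false | false = lemma (𝟙 (lookup β c)) (𝟙 (lookup β d)) (rookSum B (C ◂ c) ω′) (rookSum B (C ◂ d) ω′)
      (partnerSum B C c d ω′) (partnerSum B C d c ω′)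
    where
    lemma : ∀ a b r r′ u v → a * (1ℤ * (b * (0ℤ * r + 1ℤ * u))) + b * (1ℤ * (a * (0ℤ * r′ + 1ℤ * v))) ≡ a *
        (b * (u + v))
    lemma = solve-∀

-- Subspaces and the sum over matrices

module RankSum {q : ℕ} (F : FiniteField q) where

  open FieldSums F public

  infixl 6 _+[_]_ _⊞_

  _+[_]_ : ∀ {n} → Vec Carrier n → Carrier → Vec Carrier n → Vec Carrier n
  u +[ a ] v = zipWith (λ b c → b +ᶠ a *ᶠ c) u v

  lookup-+[] : ∀ {n} (u : Vec Carrier n) a v j → lookup (u +[ a ] v) j ≡ lookup u j +ᶠ a *ᶠ lookup v j
  lookup-+[] u a v j = Vecₚ.lookup-zipWith _ j u v

  -- The subspace axioms are kept apart in `IsSubspace`, so that the recursion for `rankSum` can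
  -- form spans without carrying proofs.
  record Region (n : ℕ) : Set₁ where
    field
      Mem  : Vec Carrier n → Set
      mem? : ∀ v → Dec (Mem v)

  open Region public

  record IsSubspace {n : ℕ} (V : Region n) : Set where
    field
      mem-0    : ∀ v → (∀ j → lookup v j ≡ 0#) → Mem V v
      mem-+[]  : ∀ {u v} a → Mem V u → Mem V v → Mem V (u +[ a ] v)

  open IsSubspace public

  -- The span of V and v, provided that V is a subspace.
  _⊞_ : ∀ {n} → Region n → Vec Carrier n → Region n
  Mem  (V ⊞ v) w = ∃ λ a → Mem V (w +[ a ] v)
  mem? (V ⊞ v) w = Dec.map′ Any.satisfied (λ { (a , p) → lose (∈-elements a) p })
      (Any.any? (λ a → mem? V (w +[ a ] v)) elements)

  infix 4 _≈_

  _≈_ : ∀ {n} → Region n → Region n → Set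
  V ≈ W = ∀ v → (Mem V v → Mem W v) × (Mem W v → Mem V v)

  ⊞-cong : ∀ {n} {V W : Region n} v → V ≈ W → V ⊞ v ≈ W ⊞ v
  ⊞-cong v V≈W w = (λ { (a , p) → a , proj₁ (V≈W (w +[ a ] v)) p }) ,
      (λ { (a , p) → a , proj₂ (V≈W (w +[ a ] v)) p })

  ⊞-isSubspace : ∀ {n} {V : Region n} v → IsSubspace V → IsSubspace (V ⊞ v)
  mem-0 (⊞-isSubspace v sub) w w≡0 = 0# , mem-0 sub (w +[ 0# ] v) (λ j →
    trans (lookup-+[] w 0# v j) (trans (cong₂ _+ᶠ_ (w≡0 j) (zeroˡ (lookup v j))) (+-identityˡ 0#)))
  mem-+[] (⊞-isSubspace {V = V} v sub) {u} {w} b (a , p) (a′ , p′) =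
    a +ᶠ b *ᶠ a′ , subst (Mem V) (rearrange u w v) (mem-+[] sub b p p′)
    where
    rearrange : ∀ {n} (u w v : Vec Carrier n) → (u +[ a ] v) +[ b ] (w +[ a′ ] v) ≡ (u +[ b ] w) +[ a +ᶠ b *ᶠ a′ ] v
    rearrange []      []      []      = refl
    rearrange (c ∷ u) (d ∷ w) (e ∷ v) = cong₂ _∷_
      (solve 6 (λ c d e a b a′ → (c :+ a :* e) :+ b :* (d :+ a′ :* e) := (c :+ b :* d) :+
          (a :+ b :* a′) :* e) refl c d e a b a′)
      (rearrange u w v)

  mutual

    -- The sum of x ^ (m - r) * ω r over the matrices with rows in the rows of B,
    -- where r is the dimension of their row space modulo V.
    rankSum : ∀ {m n} → Region n → Board m n → (ℕ → ℤ) → ℤ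
    rankSum V []      ω = ω 0
    rankSum V (β ∷ B) ω = ∑⊆ β (λ σ → ∑supp σ (rankStep V B ω))

    rankStep : ∀ {m n} → Region n → Board m n → (ℕ → ℤ) → Vec Carrier n → ℤ
    rankStep V B ω v = if does (mem? V v) then x * rankSum V B ω else rankSum (V ⊞ v) B (ω ∘ suc)

  rankStep-∈ : ∀ {m n} {V : Region n} (B : Board m n) ω {v} → Mem V v → rankStep V B ω v ≡ x * rankSum V B ω
  rankStep-∈ {V = V} B ω {v} v∈V rewrite Dec.dec-true (mem? V v) v∈V = refl

  rankStep-∉ : ∀ {m n} {V : Region n} (B : Board m n) ω {v} → ¬ Mem V v → rankStep V B ω v ≡ rankSum (V ⊞ v) B
      (ω ∘ suc)
  rankStep-∉ {V = V} B ω {v} v∉V rewrite Dec.dec-false (mem? V v) v∉V = refl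

  mutual

    -- A span and the standard space that it equals are different predicates with the same members,
    -- so one can replace the other only through `≈`.
    rankSum-cong : ∀ {m n} {V W : Region n} (B : Board m n) ω → V ≈ W → rankSum V B ω ≡ rankSum W B ω
    rankSum-cong []      ω V≈W = refl
    rankSum-cong (β ∷ B) ω V≈W = ∑⊆-cong β (λ σ → ∑supp-cong σ (λ v _ → rankStep-cong B ω V≈W v))

    rankStep-cong : ∀ {m n} {V W : Region n} (B : Board m n) ω → V ≈ W → ∀ v → rankStep V B ω v ≡ rankStep W B ω v
    rankStep-cong {V = V} {W} B ω V≈W v with mem? V v
    ... | yes p = trans (cong (x *_) (rankSum-cong B ω V≈W)) (sym (rankStep-∈ {V = W} B ω (proj₁ (V≈W v) p)))
    ... | no ¬p = trans (rankSum-cong B (ω ∘ suc) (⊞-cong {V = V} {W} v V≈W))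
        (sym (rankStep-∉ {V = W} B ω (¬p ∘ proj₂ (V≈W v))))

  pull : ∀ {n} → Region n → Vec Carrier n → Region n
  Mem  (pull V d) v = Mem V (d ⊙ v)
  mem? (pull V d) v = mem? V (d ⊙ v)

  ⊙-+[] : ∀ {n} (d w v : Vec Carrier n) a → d ⊙ (w +[ a ] v) ≡ (d ⊙ w) +[ a ] (d ⊙ v)
  ⊙-+[] []      []      []      a = refl
  ⊙-+[] (b ∷ d) (c ∷ w) (e ∷ v) a = cong₂ _∷_
    (solve 4 (λ a b c e → b :* (c :+ a :* e) := b :* c :+ a :* (b :* e)) refl a b c e) (⊙-+[] d w v a)

  pull-⊞ : ∀ {n} (V : Region n) d v → pull V d ⊞ v ≈ pull (V ⊞ (d ⊙ v)) d
  pull-⊞ V d v w = (λ { (a , p) → a , subst (Mem V) (⊙-+[] d w v a) p }) ,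
      (λ { (a , p) → a , subst (Mem V) (sym (⊙-+[] d w v a)) p })

  mutual

    -- Rescaling the columns of a matrix permutes the matrices supported in B and preserves
    -- dimensions modulo V, provided that V is replaced by its preimage.
    rankSum-pull : ∀ {m n} (V : Region n) (B : Board m n) ω d → Invertible d → rankSum (pull V d) B ω
        ≡ rankSum V B ω
    rankSum-pull V []      ω d inv = refl
    rankSum-pull V (β ∷ B) ω d inv = ∑⊆-cong β (λ σ →
      trans (∑supp-cong σ (λ v _ → rankStep-pull V B ω d inv v)) (∑supp-⊙ σ d inv (rankStep V B ω)))

    rankStep-pull : ∀ {m n} (V : Region n) (B : Board m n) ω d → Invertible d → ∀ v →
                    rankStep (pull V d) B ω v ≡ rankStep V B ω (d ⊙ v)
    rankStep-pull V B ω d inv v with mem? V (d ⊙ v)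
    ... | yes _ = cong (x *_) (rankSum-pull V B ω d inv)
    ... | no  _ = trans (rankSum-cong B (ω ∘ suc) (pull-⊞ V d v)) (rankSum-pull (V ⊞ (d ⊙ v)) B (ω ∘ suc) d inv)

  -- Only the diagonal matrices that stabilise V act on the next row. For a coordinate space these
  -- are all invertible ones, for a diagonal space they are fewer, and this decides how many factors
  -- x a support yields.
  rankStep-invariant : ∀ {m n} (V : Region n) (B : Board m n) ω d → Invertible d → pull V d ≈ V →
                       ∀ v → rankStep V B ω (d ⊙ v) ≡ rankStep V B ω v
  rankStep-invariant V B ω d inv eq v = trans (sym (rankStep-pull V B ω d inv v)) (rankStep-cong B ω eq v)

  ⊙-inverse : ∀ {n a} (a≢0 : a ≢ 0#) (v : Vec Carrier n) → scale (a ⁻¹⟨ a≢0 ⟩) (scale a v) ≡ v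
  ⊙-inverse a≢0 []      = refl
  ⊙-inverse a≢0 (b ∷ v) = cong₂ _∷_ (a⁻¹*[a*b]≡b a≢0 b) (⊙-inverse a≢0 v)

  mem-scale : ∀ {n} {V : Region n} → IsSubspace V → ∀ a v → Mem V v → Mem V (scale a v)
  -- The vector av is written as v + (a - 1)v, because closure is available in the form `_+[_]_`.
  mem-scale {V = V} sub a v v∈V = subst (Mem V) (scale-+[] v) (mem-+[] sub (a +ᶠ -ᶠ 1#) v∈V v∈V)
    where
    scale-+[] : ∀ {n} (v : Vec Carrier n) → v +[ a +ᶠ -ᶠ 1# ] v ≡ scale a v
    scale-+[] []      = refl
    scale-+[] (b ∷ v) = cong₂ _∷_
      (trans (solve 4 (λ a b m o → b :+ (a :+ m) :* b := (a :* b :+ b) :+ m :* b) refl a b (-ᶠ 1#) 1#)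
        (trans (cong (λ z → (a *ᶠ b +ᶠ z) +ᶠ -ᶠ 1# *ᶠ b) (sym (*-identityˡ b)))
          (trans (solve 4 (λ a b m o → (a :* b :+ o :* b) :+ m :* b := a :* b :+ (o :+ m) :* b) refl a b (-ᶠ 1#) 1#)
            (trans (cong (λ z → a *ᶠ b +ᶠ z *ᶠ b) (-‿inverseʳ 1#))
                (trans (cong (a *ᶠ b +ᶠ_) (zeroˡ b)) (+-identityʳ (a *ᶠ b)))))))
      (scale-+[] v)

  pull-scale : ∀ {n} {V : Region n} → IsSubspace V → ∀ {a} → a ≢ 0# → pull V (replicate n a) ≈ V
  pull-scale {V = V} sub {a} a≢0 v =
    (λ p → subst (Mem V) (⊙-inverse a≢0 v) (mem-scale {V = V} sub (a ⁻¹⟨ a≢0 ⟩) (scale a v) p)) , mem-scale {V = V}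
        sub a v

  rankStep-scaleInvariant : ∀ {m n} {V : Region n} (B : Board m n) ω → IsSubspace V → ScaleInvariant
      (rankStep V B ω)
  rankStep-scaleInvariant {V = V} B ω sub a v a≢0 =
    rankStep-invariant V B ω (replicate _ a) (replicate-invertible a≢0) (pull-scale {V = V} sub a≢0) v

  support-∅ : ∀ {n} {v : Vec Carrier n} → HasSupport ∅ v → ∀ j → lookup v j ≡ 0#
  support-∅ s j = proj₂ (s j) (Vecₚ.lookup-replicate j outside)

  rankStep-∅ : ∀ {m n} {V : Region n} (B : Board m n) ω → IsSubspace V → ∑supp ∅ (rankStep V B ω)
      ≡ x * rankSum V B ω
  rankStep-∅ {n = n} {V} B ω sub = trans (∑supp-constant ∅ (λ v s → rankStep-∈ {V = V} B ω
      (mem-0 sub v (support-∅ {v = v} s))))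
    (trans (cong (λ k → x ^ k * (x * rankSum V B ω)) (Subsetₚ.∣⊥∣≡0 n)) (ℤₚ.*-identityˡ (x * rankSum V B ω)))

  mutual

    -- Each row supplies one factor x: the zero row lies in V and carries it by definition, and a
    -- nonzero row can be multiplied by the x units without a change of `rankStep`.
    rankSum-∣ : ∀ {m n} {V : Region n} (B : Board m n) ω → IsSubspace V → x ^ m ∣ rankSum V B ω
    rankSum-∣ []      ω sub = divides (ω 0) (sym (ℤₚ.*-identityʳ (ω 0)))
    rankSum-∣ {suc m} {V = V} (β ∷ B) ω sub = ∑⊆-∣ β row
      where
      row : ∀ σ → x ^ suc m ∣ ∑supp σ (rankStep V B ω)
      row σ with ∅-or-∈ σ
      ... | inj₁ refl      = subst (x ^ suc m ∣_) (sym (rankStep-∅ {V = V} B ω sub))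
          (Div.*-monoʳ-∣ x (rankSum-∣ {V = V} B ω sub))
      ... | inj₂ (i , i∈σ) = ∑supp-scale-∣ σ (rankStep-scaleInvariant {V = V} B ω sub) i i∈σ
          (rankStep-∣ {V = V} B ω sub)

    rankStep-∣ : ∀ {m n} {V : Region n} (B : Board m n) ω → IsSubspace V → ∀ v → x ^ m ∣ rankStep V B ω v
    rankStep-∣ {V = V} B ω sub v with mem? V v
    ... | yes _ = Div.∣n⇒∣m*n x (rankSum-∣ {V = V} B ω sub)
    ... | no  _ = rankSum-∣ {V = V ⊞ v} B (ω ∘ suc) (⊞-isSubspace {V = V} v sub)

  -- Coordinate and diagonal spaces, their spans with a row and their stabilisers

  coordinateSpace : ∀ {n} → Columns n → Region n
  Mem  (coordinateSpace C) v = ∀ j → C j ≡ false → lookup v j ≡ 0#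
  mem? (coordinateSpace C) v = Finₚ.all? (λ j → (C j Boolₚ.≟ false) Dec.→-dec (lookup v j ≟ᶠ 0#))

  -- The span of the coordinate space of C and of the sum of the basis vectors c and d.
  diagonalSpace : ∀ {n} → Columns n → Fin n → Fin n → Region n
  Mem  (diagonalSpace C c d) v = lookup v c ≡ lookup v d × (∀ j → C j ≡ false → j ≢ c → j ≢ d → lookup v j ≡ 0#)
  mem? (diagonalSpace C c d) v = (lookup v c ≟ᶠ lookup v d) Dec.×-dec
    Finₚ.all? (λ j → (C j Boolₚ.≟ false) Dec.→-dec (Dec.¬? (j Fin.≟ c) Dec.→-dec
        (Dec.¬? (j Fin.≟ d) Dec.→-dec (lookup v j ≟ᶠ 0#))))

  lookup-+[]-0 : ∀ {n} (u : Vec Carrier n) a v j → lookup u j ≡ 0# → lookup v j ≡ 0# → lookup (u +[ a ] v) j ≡ 0#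
  lookup-+[]-0 u a v j u≡0 v≡0 = trans (lookup-+[] u a v j)
    (trans (cong₂ (λ b c → b +ᶠ a *ᶠ c) u≡0 v≡0) (trans (cong (0# +ᶠ_) (zeroʳ a)) (+-identityˡ 0#)))

  lookup-+[]-cancel : ∀ {n} (u : Vec Carrier n) a v j → lookup v j ≡ 0# → lookup (u +[ a ] v) j ≡ 0#
      → lookup u j ≡ 0#
  lookup-+[]-cancel u a v j v≡0 eq = trans (sym (+-identityʳ _)) (trans (cong (lookup u j +ᶠ_) (sym (zeroʳ a)))
    (trans (cong (λ c → lookup u j +ᶠ a *ᶠ c) (sym v≡0)) (trans (sym (lookup-+[] u a v j)) eq)))

  coordinate-isSubspace : ∀ {n} (C : Columns n) → IsSubspace (coordinateSpace C)
  mem-0 (coordinate-isSubspace C) v v≡0 j _ = v≡0 j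
  mem-+[] (coordinate-isSubspace C) {u} {v} a p p′ j Cj = lookup-+[]-0 u a v j (p j Cj) (p′ j Cj)

  diagonal-isSubspace : ∀ {n} (C : Columns n) c d → IsSubspace (diagonalSpace C c d)
  mem-0 (diagonal-isSubspace C c d) v v≡0 = trans (v≡0 c) (sym (v≡0 d)) , λ j _ _ _ → v≡0 j
  mem-+[] (diagonal-isSubspace C c d) {u} {v} a (eq , p) (eq′ , p′) =
    trans (lookup-+[] u a v c) (trans (cong₂ (λ b e → b +ᶠ a *ᶠ e) eq eq′) (sym (lookup-+[] u a v d))) ,
    λ j Cj j≢c j≢d → lookup-+[]-0 u a v j (p j Cj j≢c j≢d) (p′ j Cj j≢c j≢d)

  eliminate : ∀ {b} → b ≢ 0# → ∀ w → ∃ λ a → w +ᶠ a *ᶠ b ≡ 0#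
  eliminate {b} b≢0 w = -ᶠ w *ᶠ b ⁻¹⟨ b≢0 ⟩ , trans (solve 4
      (λ w m i b → w :+ (m :* i) :* b := w :+ m :* (b :* i)) refl w (-ᶠ w) (b ⁻¹⟨ b≢0 ⟩) b)
    (trans (cong (λ z → w +ᶠ -ᶠ w *ᶠ z) (a*a⁻¹≡1 b≢0)) (trans (cong (w +ᶠ_) (*-identityʳ (-ᶠ w))) (-‿inverseʳ w)))

  coordinate-⊞ : ∀ {n} (C : Columns n) {c v} → C c ≡ false → lookup v c ≢ 0# →
                 (∀ j → C j ≡ false → j ≢ c → lookup v j ≡ 0#) → coordinateSpace C ⊞ v ≈ coordinateSpace (C ◂ c)
  coordinate-⊞ C {c} {v} Cc vc≢0 v≡0 w = to , from
    where
    to : Mem (coordinateSpace C ⊞ v) w → Mem (coordinateSpace (C ◂ c)) w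
    to (a , p) j eq with Cj , j≢c ← ◂-false C eq = lookup-+[]-cancel w a v j (v≡0 j Cj j≢c) (p j Cj)
    from : Mem (coordinateSpace (C ◂ c)) w → Mem (coordinateSpace C ⊞ v) w
    from p = a , at
      where
      a = proj₁ (eliminate vc≢0 (lookup w c))
      eq = proj₂ (eliminate vc≢0 (lookup w c))
      at : ∀ j → C j ≡ false → lookup (w +[ a ] v) j ≡ 0#
      at j Cj with j Fin.≟ c
      ... | yes refl = trans (lookup-+[] w a v c) eq
      ... | no j≢c   = lookup-+[]-0 w a v j (p j (◂-false⁺ C Cj j≢c)) (v≡0 j Cj j≢c)

  -- Modulo the coordinate space, v is a nonzero multiple of e_c + e_d, so the coefficient that
  -- clears entry c of w clears entry d as well.
  coordinate-⊞-diagonal : ∀ {n} (C : Columns n) {c d v} → C c ≡ false → C d ≡ false →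
                          lookup v c ≢ 0# → lookup v c ≡ lookup v d →
                          (∀ j → C j ≡ false → j ≢ c → j ≢ d → lookup v j ≡ 0#)
                              → coordinateSpace C ⊞ v ≈ diagonalSpace C c d
  coordinate-⊞-diagonal C {c} {d} {v} Cc Cd vc≢0 vc≡vd v≡0 w = to , from
    where
    to : Mem (coordinateSpace C ⊞ v) w → Mem (diagonalSpace C c d) w
    to (a , p) = cancel , λ j Cj j≢c j≢d → lookup-+[]-cancel w a v j (v≡0 j Cj j≢c j≢d) (p j Cj)
      where
      cancel : lookup w c ≡ lookup w d
      cancel = +ᶠ-cancelʳ (a *ᶠ lookup v d) (lookup w c) (lookup w d)
        (trans (cong (λ z → lookup w c +ᶠ a *ᶠ z) (sym vc≡vd))
          (trans (sym (lookup-+[] w a v c)) (trans (p c Cc) (trans (sym (p d Cd)) (lookup-+[] w a v d)))))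
    from : Mem (diagonalSpace C c d) w → Mem (coordinateSpace C ⊞ v) w
    from (wc≡wd , p) = a , at
      where
      a = proj₁ (eliminate vc≢0 (lookup w c))
      eq = proj₂ (eliminate vc≢0 (lookup w c))
      at : ∀ j → C j ≡ false → lookup (w +[ a ] v) j ≡ 0#
      at j Cj with j Fin.≟ c | j Fin.≟ d
      ... | yes refl | _        = trans (lookup-+[] w a v c) eq
      ... | no _     | yes refl = trans (lookup-+[] w a v d)
          (trans (cong₂ (λ b e → b +ᶠ a *ᶠ e) (sym wc≡wd) (sym vc≡vd)) eq)
      ... | no j≢c   | no j≢d   = lookup-+[]-0 w a v j (p j Cj j≢c j≢d) (v≡0 j Cj j≢c j≢d)

  diagonal-⊞-other : ∀ {n} (C : Columns n) {c d e v} → C e ≡ false → e ≢ c → e ≢ d → lookup v e ≢ 0# →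
                     (∀ j → j ≢ e → lookup v j ≡ 0#) → diagonalSpace C c d ⊞ v ≈ diagonalSpace (C ◂ e) c d
  diagonal-⊞-other C {c} {d} {e} {v} Ce e≢c e≢d ve≢0 v≡0 w = to , from
    where
    shift : ∀ a j → j ≢ e → lookup (w +[ a ] v) j ≡ lookup w j
    shift a j j≢e = trans (lookup-+[] w a v j) (trans (cong (λ z → lookup w j +ᶠ a *ᶠ z) (v≡0 j j≢e))
      (trans (cong (lookup w j +ᶠ_) (zeroʳ a)) (+-identityʳ (lookup w j))))
    to : Mem (diagonalSpace C c d ⊞ v) w → Mem (diagonalSpace (C ◂ e) c d) w
    to (a , eq , p) = trans (sym (shift a c (e≢c ∘ sym))) (trans eq (shift a d (e≢d ∘ sym))) , at
      where
      at : ∀ j → (C ◂ e) j ≡ false → j ≢ c → j ≢ d → lookup w j ≡ 0#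
      at j eq′ j≢c j≢d with Cj , j≢e ← ◂-false C eq′ = trans (sym (shift a j j≢e)) (p j Cj j≢c j≢d)
    from : Mem (diagonalSpace (C ◂ e) c d) w → Mem (diagonalSpace C c d ⊞ v) w
    from (wc≡wd , p) = a , trans (shift a c (e≢c ∘ sym)) (trans wc≡wd (sym (shift a d (e≢d ∘ sym)))) , at
      where
      a = proj₁ (eliminate ve≢0 (lookup w e))
      eq = proj₂ (eliminate ve≢0 (lookup w e))
      at : ∀ j → C j ≡ false → j ≢ c → j ≢ d → lookup (w +[ a ] v) j ≡ 0#
      at j Cj j≢c j≢d with j Fin.≟ e
      ... | yes refl = trans (lookup-+[] w a v e) eq
      ... | no j≢e   = trans (shift a j j≢e) (p j (◂-false⁺ C Cj j≢e) j≢c j≢d)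

  -- In the plane of c and d, the vector v is not proportional to e_c + e_d, so the two span the
  -- plane.
  diagonal-⊞-pair : ∀ {n} (C : Columns n) {c d v} → lookup v c ≢ lookup v d →
                    (∀ j → C j ≡ false → j ≢ c → j ≢ d → lookup v j ≡ 0#) →
                    diagonalSpace C c d ⊞ v ≈ coordinateSpace (C ◂ c ◂ d)
  diagonal-⊞-pair C {c} {d} {v} vc≢vd v≡0 w = to , from
    where
    to : Mem (diagonalSpace C c d ⊞ v) w → Mem (coordinateSpace (C ◂ c ◂ d)) w
    to (a , _ , p) j eq with eq′ , j≢d ← ◂-false (C ◂ c) eq with Cj , j≢c ← ◂-false C eq′ =
      lookup-+[]-cancel w a v j (v≡0 j Cj j≢c j≢d) (p j Cj j≢c j≢d)
    vc-vd≢0 : lookup v c +ᶠ -ᶠ lookup v d ≢ 0#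
    vc-vd≢0 eq = vc≢vd (+ᶠ-cancelʳ (-ᶠ lookup v d) (lookup v c) (lookup v d)
        (trans eq (sym (-‿inverseʳ (lookup v d)))))
    from : Mem (coordinateSpace (C ◂ c ◂ d)) w → Mem (diagonalSpace C c d ⊞ v) w
    from p = a , trans (lookup-+[] w a v c) (trans (solution (lookup w c) (lookup w d) (lookup v c)
        (lookup v d) a eq) (sym (lookup-+[] w a v d))) ,
      λ j Cj j≢c j≢d → lookup-+[]-0 w a v j (p j (◂-false⁺ (C ◂ c) (◂-false⁺ C Cj j≢c) j≢d)) (v≡0 j Cj j≢c j≢d)
      where
      -- The coefficient a makes the entries c and d of w + av equal, by clearing their difference.
      a = proj₁ (eliminate vc-vd≢0 (lookup w c +ᶠ -ᶠ lookup w d))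
      eq = proj₂ (eliminate vc-vd≢0 (lookup w c +ᶠ -ᶠ lookup w d))
      solution : ∀ w w′ v v′ a → (w +ᶠ -ᶠ w′) +ᶠ a *ᶠ (v +ᶠ -ᶠ v′) ≡ 0# → w +ᶠ a *ᶠ v ≡ w′ +ᶠ a *ᶠ v′
      solution w w′ v v′ a eq = begin
        w +ᶠ a *ᶠ v
          ≡⟨ trans (cong₂ (λ y z → (w +ᶠ y) +ᶠ a *ᶠ (v +ᶠ z)) (-‿inverseˡ w′) (-‿inverseˡ v′))
               (cong₂ (λ y z → y +ᶠ a *ᶠ z) (+-identityʳ w) (+-identityʳ v)) ⟨
        (w +ᶠ (-ᶠ w′ +ᶠ w′)) +ᶠ a *ᶠ (v +ᶠ (-ᶠ v′ +ᶠ v′))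
          ≡⟨ solve 7 (λ w w′ v v′ a n n′ → (w :+ (n :+ w′)) :+ a :* (v :+ (n′ :+ v′)) :=
              ((w :+ n) :+ a :* (v :+ n′)) :+ (w′ :+ a :* v′))
               refl w w′ v v′ a (-ᶠ w′) (-ᶠ v′) ⟩
        ((w +ᶠ -ᶠ w′) +ᶠ a *ᶠ (v +ᶠ -ᶠ v′)) +ᶠ (w′ +ᶠ a *ᶠ v′)
          ≡⟨ trans (cong (_+ᶠ (w′ +ᶠ a *ᶠ v′)) eq) (+-identityˡ (w′ +ᶠ a *ᶠ v′)) ⟩
        w′ +ᶠ a *ᶠ v′ ∎
        where open ≡-Reasoning

  pull-coordinate : ∀ {n} (C : Columns n) d → Invertible d → pull (coordinateSpace C) d ≈ coordinateSpace C
  pull-coordinate C d inv v =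
    (λ p j Cj → *-cancelˡ-0 (inv j) (trans (sym (Vecₚ.lookup-zipWith _*ᶠ_ j d v)) (p j Cj))) ,
    (λ p j Cj → trans (Vecₚ.lookup-zipWith _*ᶠ_ j d v) (trans (cong (lookup d j *ᶠ_) (p j Cj))
        (zeroʳ (lookup d j))))

  dilation : ∀ {n} → Fin n → Carrier → Vec Carrier n
  dilation e a = replicate _ 1# Vec.[ e ]≔ a

  dilation-⊙ : ∀ {n} (e : Fin n) a v → dilation e a ⊙ v ≡ scaleAt e a v
  dilation-⊙ zero    a (b ∷ v) = cong (_ ∷_) (⊙-identityˡ v)
  dilation-⊙ (suc e) a (b ∷ v) = cong₂ _∷_ (*-identityˡ b) (dilation-⊙ e a v)

  lookup-dilation : ∀ {n} {e : Fin n} a {j} → j ≢ e → lookup (dilation e a) j ≡ 1#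
  lookup-dilation {e = e} a {j} j≢e = trans (Vecₚ.lookup∘update′ j≢e (replicate _ 1#) a)
      (Vecₚ.lookup-replicate j 1#)

  dilation-invertible : ∀ {n} {e : Fin n} {a} → a ≢ 0# → Invertible (dilation e a)
  dilation-invertible {e = e} {a} a≢0 j with j Fin.≟ e
  ... | yes refl = a≢0 ∘ trans (sym (Vecₚ.lookup∘update e (replicate _ 1#) a))
  ... | no j≢e   = 1≢0 ∘ trans (sym (lookup-dilation a j≢e))

  -- Scaling column c or d alone would destroy the equality of the two entries; the other columns
  -- can be scaled one by one.
  pull-diagonal : ∀ {n} (C : Columns n) c d {e a} → e ≢ c → e ≢ d → a ≢ 0# → pull (diagonalSpace C c d)
      (dilation e a) ≈ diagonalSpace C c d
  pull-diagonal C c d {e} {a} e≢c e≢d a≢0 v =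
    (λ { (eq , p) → trans (sym (fixed c (e≢c ∘ sym))) (trans eq (fixed d (e≢d ∘ sym))) ,
         λ j Cj j≢c j≢d → *-cancelˡ-0 (dilation-invertible {e = e} a≢0 j)
             (trans (sym (Vecₚ.lookup-zipWith _*ᶠ_ j (dilation e a) v)) (p j Cj j≢c j≢d)) }) ,
    (λ { (eq , p) → trans (fixed c (e≢c ∘ sym)) (trans eq (sym (fixed d (e≢d ∘ sym)))) ,
         λ j Cj j≢c j≢d → trans (Vecₚ.lookup-zipWith _*ᶠ_ j (dilation e a) v)
           (trans (cong (lookup (dilation e a) j *ᶠ_) (p j Cj j≢c j≢d)) (zeroʳ (lookup (dilation e a) j))) })
    where
    fixed : ∀ j → j ≢ e → lookup (dilation e a ⊙ v) j ≡ lookup v j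
    fixed j j≢e = trans (Vecₚ.lookup-zipWith _*ᶠ_ j (dilation e a) v)
      (trans (cong (_*ᶠ lookup v j) (lookup-dilation a j≢e)) (*-identityˡ (lookup v j)))

  rankStep-coordinateInvariant : ∀ {m n} (B : Board m n) ω C {c d e} → e ≢ c → e ≢ d →
                                 CoordinateInvariant e (rankStep (diagonalSpace C c d) B ω)
  rankStep-coordinateInvariant B ω C {c} {d} {e} e≢c e≢d a v a≢0 =
    trans (cong (rankStep (diagonalSpace C c d) B ω) (sym (dilation-⊙ e a v)))
      (rankStep-invariant (diagonalSpace C c d) B ω (dilation e a) (dilation-invertible a≢0)
          (pull-diagonal C c d e≢c e≢d a≢0) v)

-- The recursion modulo higher powers of q − 1

<ᵇ-asym : ∀ {n} (i j : Fin n) → (i <ᵇ j) ≡ true → (j <ᵇ i) ≡ false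
<ᵇ-asym zero    (suc j) lt = refl
<ᵇ-asym (suc i) (suc j) lt = <ᵇ-asym i j lt

not-<ᵇ : ∀ {m} (i j : Fin m) → i ≢ j → (j <ᵇ i) ≡ not (i <ᵇ j)
not-<ᵇ zero    zero    i≢j = contradiction refl i≢j
not-<ᵇ zero    (suc j) i≢j = refl
not-<ᵇ (suc i) zero    i≢j = refl
not-<ᵇ (suc i) (suc j) i≢j = not-<ᵇ i j (i≢j ∘ cong suc)

<ᵇ⇒≢ : ∀ {n} (i j : Fin n) → (i <ᵇ j) ≡ true → i ≢ j
<ᵇ⇒≢ i _ lt refl = contradiction (trans (sym lt) (<ᵇ-irrefl i)) λ ()

lookup-⁅⁆ : ∀ {n} (c j : Fin n) → lookup ⁅ c ⁆ j ≡ (j == c)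
lookup-⁅⁆ zero    zero    = refl
lookup-⁅⁆ zero    (suc j) = Vecₚ.lookup-replicate j outside
lookup-⁅⁆ (suc c) zero    = refl
lookup-⁅⁆ (suc c) (suc j) = lookup-⁅⁆ c j

∣pair∣ : ∀ {n} (c d : Fin n) → (c <ᵇ d) ≡ true → ∣ ⁅ c ⁆ ∪ ⁅ d ⁆ ∣ ≡ 2
∣pair∣ zero    (suc d) lt = cong suc (trans (cong ∣_∣ (Subsetₚ.∪-identityˡ ⁅ d ⁆)) (Subsetₚ.∣⁅x⁆∣≡1 d))
∣pair∣ (suc c) (suc d) lt = ∣pair∣ c d lt

lookup-pair : ∀ {n} (c d j : Fin n) → lookup (⁅ c ⁆ ∪ ⁅ d ⁆) j ≡ (j == c) ∨ (j == d)
lookup-pair c d j = trans (Vecₚ.lookup-zipWith _∨_ j ⁅ c ⁆ ⁅ d ⁆) (cong₂ _∨_ (lookup-⁅⁆ c j) (lookup-⁅⁆ d j))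

∈-pairˡ : ∀ {n} (c d : Fin n) → lookup (⁅ c ⁆ ∪ ⁅ d ⁆) c ≡ inside
∈-pairˡ c d = trans (lookup-pair c d c) (cong (_∨ (c == d)) (==-refl c))

∈-pairʳ : ∀ {n} (c d : Fin n) → lookup (⁅ c ⁆ ∪ ⁅ d ⁆) d ≡ inside
∈-pairʳ c d = trans (lookup-pair c d d) (trans (cong ((d == c) ∨_) (==-refl d)) (Boolₚ.∨-zeroʳ (d == c)))

∉-pair : ∀ {n} {c d j : Fin n} → j ≢ c → j ≢ d → lookup (⁅ c ⁆ ∪ ⁅ d ⁆) j ≡ outside
∉-pair {c = c} {d} {j} j≢c j≢d = trans (lookup-pair c d j) (cong₂ _∨_ (==-≢ j≢c) (==-≢ j≢d))

exists-outside : ∀ {n} (σ τ : Subset n) → ∣ τ ∣ ℕ.< ∣ σ ∣ → ∃ λ j → lookup σ j ≡ inside × lookup τ j ≢ inside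
exists-outside σ τ lt with Finₚ.any? (λ j → (lookup σ j Boolₚ.≟ inside) Dec.×-dec Dec.¬?
    (lookup τ j Boolₚ.≟ inside))
... | yes found = found
... | no ¬found = contradiction (Subsetₚ.p⊆q⇒∣p∣≤∣q∣ {p = σ} {τ}
    (λ {j} j∈σ → Vecₚ.lookup⇒[]= j τ (Dec.decidable-stable (lookup τ j Boolₚ.≟ inside)
                    (λ j∉τ → ¬found (j , Vecₚ.[]=⇒lookup j∈σ , j∉τ))))) (ℕₚ.<⇒≱ {∣ τ ∣} {∣ σ ∣} lt)

singletonSum-≡⟦⟧ : ∀ {n k} (β : Subset n) {f g : Fin n → ℤ} → (∀ c → f c ≡ g c ⟦ k ⟧) → singletonSum β f
    ≡ singletonSum β g ⟦ k ⟧
singletonSum-≡⟦⟧ β f≡g = ∑ᶠ-≡⟦⟧ (λ c → ≡⟦⟧-*ˡ (𝟙 (lookup β c)) (f≡g c))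

pairSum-≡⟦⟧ : ∀ {n k} (β : Subset n) {f g : Fin n → Fin n → ℤ} → (∀ c d → (c <ᵇ d) ≡ true → f c d ≡ g c d ⟦ k ⟧) →
              pairSum β f ≡ pairSum β g ⟦ k ⟧
pairSum-≡⟦⟧ {k = k} β {f} {g} f≡g = ∑ᶠ-≡⟦⟧ (λ c → ∑ᶠ-≡⟦⟧ (λ d → summand c d))
  where
  summand : ∀ c d → 𝟙 (c <ᵇ d) * (𝟙 (lookup β c) * (𝟙 (lookup β d) * f c d)) ≡ 𝟙 (c <ᵇ d) *
      (𝟙 (lookup β c) * (𝟙 (lookup β d) * g c d)) ⟦ k ⟧
  summand c d with c <ᵇ d in lt
  ... | true  = ≡⟦⟧-*ˡ 1ℤ (≡⟦⟧-*ˡ (𝟙 (lookup β c)) (≡⟦⟧-*ˡ (𝟙 (lookup β d)) (f≡g c d lt)))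
  ... | false = ≡⇒≡⟦⟧ refl

pairSum-*ˡ : ∀ {n} (β : Subset n) k f → pairSum β (λ c d → k * f c d) ≡ k * pairSum β f
pairSum-*ˡ {n} β k f = trans
  (∑ᶠ-cong (λ c → trans (∑ᶠ-cong (λ d → pull-out (𝟙 (c <ᵇ d)) (𝟙 (lookup β c)) (𝟙 (lookup β d)) k (f c d)))
      (∑-*ˡ (allFin n) k (entries c))))
  (∑-*ˡ (allFin n) k (λ c → ∑ᶠ (entries c)))
  where
  entries : Fin n → Fin n → ℤ
  entries c d = 𝟙 (c <ᵇ d) * (𝟙 (lookup β c) * (𝟙 (lookup β d) * f c d))
  pull-out : ∀ l a b k z → l * (a * (b * (k * z))) ≡ k * (l * (a * (b * z)))
  pull-out = solve-∀

∑ᶠ-δ : ∀ {n} (c : Fin n) f → ∑ᶠ (λ e → 𝟙 (e == c) * f e) ≡ f c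
∑ᶠ-δ c f = ∑-δ (allFin-enumerates _) Fin._≟_ c f

pairSum-δ : ∀ {n} (β : Subset n) {c d} k → (c <ᵇ d) ≡ true →
            pairSum β (λ e f → 𝟙 (e == c) * (𝟙 (f == d) * k)) ≡ 𝟙 (lookup β c) * (𝟙 (lookup β d) * k)
pairSum-δ {n} β {c} {d} k lt = begin
  pairSum β (λ e f → 𝟙 (e == c) * (𝟙 (f == d) * k))
    ≡⟨ ∑ᶠ-cong (λ e → trans (∑ᶠ-cong (λ f → pull-out (𝟙 (e <ᵇ f)) (𝟙 (lookup β e)) (𝟙 (lookup β f)) (𝟙 (e == c))
        (𝟙 (f == d)) k))
         (trans (∑-*ˡ (allFin n) (𝟙 (e == c)) (λ f → 𝟙 (f == d) * value e f))
             (cong (𝟙 (e == c) *_) (∑ᶠ-δ d (value e))))) ⟩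
  ∑ᶠ (λ e → 𝟙 (e == c) * value e d)
    ≡⟨ ∑ᶠ-δ c (λ e → value e d) ⟩
  𝟙 (c <ᵇ d) * (𝟙 (lookup β c) * (𝟙 (lookup β d) * k))
    ≡⟨ trans (cong (λ b → 𝟙 b * (𝟙 (lookup β c) * (𝟙 (lookup β d) * k))) lt)
        (ℤₚ.*-identityˡ (𝟙 (lookup β c) * (𝟙 (lookup β d) * k))) ⟩
  𝟙 (lookup β c) * (𝟙 (lookup β d) * k) ∎
  where
  open ≡-Reasoning
  value : Fin n → Fin n → ℤ
  value e f = 𝟙 (e <ᵇ f) * (𝟙 (lookup β e) * (𝟙 (lookup β f) * k))
  pull-out : ∀ l a b u v k → l * (a * (b * (u * (v * k)))) ≡ u * (v * (l * (a * (b * k))))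
  pull-out = solve-∀

-- The columns c and d enter `diagonalSpace` symmetrically, so both choices for the column of the
-- rook are added.
diagonalSum : ∀ {m n} → Board m n → Columns n → Fin n → Fin n → (ℕ → ℤ) → ℤ
diagonalSum B C c d ω = partnerSum B C c d ω + partnerSum B C d c ω

diagonalSingle : ∀ {m n} → Board m n → Columns n → Fin n → Fin n → (ℕ → ℤ) → Fin n → ℤ
diagonalSingle B C c d ω e = if C e then 0ℤ else if e == c then rookSum B (C ◂ c ◂ d) ω
                             else if e == d then rookSum B (C ◂ c ◂ d) ω else diagonalSum B (C ◂ e) c d ω

-- The correction arises when the new row has cells in both c and d and so closes a rectangle. As c
-- < d, only the term with first rook in c and new rook in d carries it, so the rectangle is counted
-- once.
diagonalSum-∷ : ∀ {m n} (β : Subset n) (B : Board m n) C {c d} ω → C c ≡ false → C d ≡ false → (c <ᵇ d) ≡ true →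
  diagonalSum (β ∷ B) C c d ω ≡ diagonalSum B C c d ω + singletonSum β (diagonalSingle B C c d (ω ∘ suc))
                                - 𝟙 (lookup β c) * (𝟙 (lookup β d) * rookSum B (C ◂ c ◂ d) (ω ∘ suc))
diagonalSum-∷ {m} {n} β B C {c} {d} ω Cc Cd c<d = begin
  diagonalSum (β ∷ B) C c d ω
    ≡⟨ cong₂ _+_ (partnerSum-∷ β B C c d ω) (partnerSum-∷ β B C d c ω) ⟩
  partnerSum B C c d ω + ∑ᶠ (T c d) + (partnerSum B C d c ω + ∑ᶠ (T d c))
    ≡⟨ regroup (partnerSum B C c d ω) (∑ᶠ (T c d)) (partnerSum B C d c ω) (∑ᶠ (T d c)) ⟩
  diagonalSum B C c d ω + (∑ᶠ (T c d) + ∑ᶠ (T d c))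
    ≡⟨ cong (_+_ (diagonalSum B C c d ω)) (trans (sym (∑ᶠ-+ (T c d) (T d c))) (trans (∑ᶠ-cong pointwise)
         (trans (∑ᶠ-+ single correction) (cong (_+_ (∑ᶠ single))
             (∑ᶠ-δ d (λ e → - (𝟙 (lookup β c) * (𝟙 (lookup β e) * R)))))))) ⟩
  diagonalSum B C c d ω + (∑ᶠ single - 𝟙 (lookup β c) * (𝟙 (lookup β d) * R))
    ≡⟨ ℤₚ.+-assoc (diagonalSum B C c d ω) (∑ᶠ single) _ ⟨
  diagonalSum B C c d ω + ∑ᶠ single - 𝟙 (lookup β c) * (𝟙 (lookup β d) * R) ∎
  where
  open ≡-Reasoning
  ω′ = ω ∘ suc
  R = rookSum B (C ◂ c ◂ d) ω′
  T : Fin n → Fin n → Fin n → ℤ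
  T c d e = 𝟙 (lookup β e) * (𝟙 (not ((C ◂ c) e)) *
    (if e == d then (1ℤ - 𝟙 (c <ᵇ d) * 𝟙 (lookup β c)) * rookSum B (C ◂ c ◂ e) ω′ else partnerSum B (C ◂ e) c d ω′))
  single correction : Fin n → ℤ
  single e = 𝟙 (lookup β e) * diagonalSingle B C c d ω′ e
  correction e = 𝟙 (e == d) * - (𝟙 (lookup β c) * (𝟙 (lookup β e) * R))
  regroup : ∀ a b c d → a + b + (c + d) ≡ a + c + (b + d)
  regroup = solve-∀
  pointwise : ∀ e → T c d e + T d c e ≡ single e + correction e
  pointwise e rewrite 𝟙-not-◂ C c e | 𝟙-not-◂ C d e | c<d | <ᵇ-asym c d c<d with e Fin.≟ c | e Fin.≟ d
  ... | yes refl | yes refl = contradiction refl (<ᵇ⇒≢ c d c<d)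
  ... | yes refl | no _ rewrite Cc | rookSum-cong B ω′ (◂-comm C d c) =
    lemma (𝟙 (lookup β c)) (𝟙 (lookup β d)) (partnerSum B (C ◂ c) c d ω′) R
    where
    lemma : ∀ b b′ p r → b * (0ℤ * p) + b * (1ℤ * ((1ℤ - 0ℤ * b′) * r)) ≡ b * r + 0ℤ * - (b * (b * r))
    lemma = solve-∀
  ... | no _ | yes refl rewrite Cd = lemma (𝟙 (lookup β c)) (𝟙 (lookup β d)) (partnerSum B (C ◂ d) d c ω′) R
    where
    lemma : ∀ b b′ p r → b′ * (1ℤ * ((1ℤ - 1ℤ * b) * r)) + b′ * (0ℤ * p) ≡ b′ * r + 1ℤ * - (b * (b′ * r))
    lemma = solve-∀
  ... | no _ | no _ with C e
  ...   | true  = lemma (𝟙 (lookup β e)) (partnerSum B (C ◂ e) c d ω′) (partnerSum B (C ◂ e) d c ω′)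
      (𝟙 (lookup β c) * (𝟙 (lookup β e) * R))
    where
    lemma : ∀ b p p′ r → b * (0ℤ * p) + b * (0ℤ * p′) ≡ b * 0ℤ + 0ℤ * - r
    lemma = solve-∀
  ...   | false = lemma (𝟙 (lookup β e)) (partnerSum B (C ◂ e) c d ω′) (partnerSum B (C ◂ e) d c ω′)
      (𝟙 (lookup β c) * (𝟙 (lookup β e) * R))
    where
    lemma : ∀ b p p′ r → b * (1ℤ * p) + b * (1ℤ * p′) ≡ b * (p + p′) + 0ℤ * - r
    lemma = solve-∀

module RankCongruence {q : ℕ} (F : FiniteField q) where

  open RankSum F public

  support-∈ : ∀ {n} (σ : Subset n) v {j} → HasSupport σ v → lookup σ j ≡ inside → lookup v j ≢ 0#
  support-∈ σ v {j} s = proj₁ (s j)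

  support-∉ : ∀ {n} (σ : Subset n) v {j} → HasSupport σ v → lookup σ j ≡ outside → lookup v j ≡ 0#
  support-∉ σ v {j} s = proj₂ (s j)

  𝟏-support : ∀ {n} (σ : Subset n) → HasSupport σ (𝟏 σ)
  𝟏-support []            ()
  𝟏-support (inside ∷ σ)  = inside-support 1≢0 (𝟏-support σ)
  𝟏-support (outside ∷ σ) = outside-support (𝟏-support σ)

  ∑-units-δ : ∀ {a} → a ≢ 0# → ∀ k l → ∑ units (λ b → if does (b ≟ᶠ a) then k else l) ≡ k + (x - 1ℤ) * l
  ∑-units-δ {a} a≢0 k l = begin
    ∑ units (λ b → if does (b ≟ᶠ a) then k else l)                          ≡⟨ ∑-cong units split ⟩
    ∑ units (λ b → 𝟙 (does (b ≟ᶠ a)) * (k - l) + l)                         ≡⟨ ∑-+ units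
        (λ b → 𝟙 (does (b ≟ᶠ a)) * (k - l)) (λ _ → l) ⟩
    ∑ units (λ b → 𝟙 (does (b ≟ᶠ a)) * (k - l)) + ∑ units (λ _ → l)         ≡⟨ cong₂ _+_ at-a (∑-units-const l) ⟩
    k - l + x * l                                                           ≡⟨ regroup k l x ⟩
    k + (x - 1ℤ) * l                                                        ∎
    where
    open ≡-Reasoning
    regroup : ∀ k l x → k - l + x * l ≡ k + (x - 1ℤ) * l
    regroup = solve-∀
    split : ∀ b → (if does (b ≟ᶠ a) then k else l) ≡ 𝟙 (does (b ≟ᶠ a)) * (k - l) + l
    split b with does (b ≟ᶠ a)
    ... | true  = lemma k l
      where
      lemma : ∀ k l → k ≡ 1ℤ * (k - l) + l
      lemma = solve-∀
    ... | false = lemma k l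
      where
      lemma : ∀ k l → l ≡ 0ℤ * (k - l) + l
      lemma = solve-∀
    swap : ∀ u v w → u * (v * w) ≡ v * (u * w)
    swap = solve-∀
    at-a : ∑ units (λ b → 𝟙 (does (b ≟ᶠ a)) * (k - l)) ≡ k - l
    at-a = trans (∑-units (λ b → 𝟙 (does (b ≟ᶠ a)) * (k - l)))
      (trans (∑-cong elements (λ b → swap (𝟙 (not (does (b ≟ᶠ 0#)))) (𝟙 (does (b ≟ᶠ a))) (k - l)))
        (trans (∑-δ elements-enumerates _≟ᶠ_ a (λ b → 𝟙 (not (does (b ≟ᶠ 0#))) * (k - l)))
          (trans (cong (_* (k - l)) (𝟙-true (Dec.¬? (a ≟ᶠ 0#)) a≢0)) (ℤₚ.*-identityˡ (k - l)))))

  ∑supp-⁅⁆ : ∀ {n} (d : Fin n) {f h} → (∀ v → HasSupport ⁅ d ⁆ v → f v ≡ h (lookup v d)) → ∑supp ⁅ d ⁆ f ≡ ∑ units h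
  ∑supp-⁅⁆ {suc n} zero    {f} {h} f≡h = ∑-units-cong (λ a a≢0 → trans
    (∑supp-constant ∅ {k = h a} (λ v s → f≡h (a ∷ v) (inside-support a≢0 s)))
    (trans (cong (λ k → x ^ k * h a) (Subsetₚ.∣⊥∣≡0 n)) (ℤₚ.*-identityˡ (h a))))
  ∑supp-⁅⁆ (suc d) f≡h = ∑supp-⁅⁆ d (λ v s → f≡h (0# ∷ v) (outside-support s))

  -- For each of the x units in column c, exactly one unit in column d equals it and x - 1 differ
  -- from it.
  ∑supp-pair : ∀ {n} (c d : Fin n) {f k l} → (c <ᵇ d) ≡ true →
               (∀ v → HasSupport (⁅ c ⁆ ∪ ⁅ d ⁆) v → lookup v c ≡ lookup v d → f v ≡ k) →
               (∀ v → HasSupport (⁅ c ⁆ ∪ ⁅ d ⁆) v → lookup v c ≢ lookup v d → f v ≡ l) →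
               ∑supp (⁅ c ⁆ ∪ ⁅ d ⁆) f ≡ x * (k + (x - 1ℤ) * l)
  ∑supp-pair zero    (suc d) {f} {k} {l} lt f≡k f≡l rewrite Subsetₚ.∪-identityˡ ⁅ d ⁆ =
    trans (∑-units-cong (λ a a≢0 → trans (∑supp-⁅⁆ d (λ v s → by-cases a v (inside-support a≢0 s)))
        (∑-units-δ a≢0 k l))) (∑-units-const (k + (x - 1ℤ) * l))
    where
    by-cases : ∀ a v → HasSupport (inside ∷ ⁅ d ⁆) (a ∷ v) → f (a ∷ v) ≡ (if does (lookup v d ≟ᶠ a) then k else l)
    by-cases a v s = decide (lookup v d ≟ᶠ a)
      where
      decide : (a? : Dec (lookup v d ≡ a)) → f (a ∷ v) ≡ (if does a? then k else l)
      decide (yes eq) = f≡k (a ∷ v) s (sym eq)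
      decide (no neq) = f≡l (a ∷ v) s (neq ∘ sym)
  ∑supp-pair (suc c) (suc d) lt f≡k f≡l =
    ∑supp-pair c d lt (λ v s → f≡k (0# ∷ v) (outside-support s)) (λ v s → f≡l (0# ∷ v) (outside-support s))

  ∑supp-⁅⁆-constant : ∀ {n} (d : Fin n) {f k} → (∀ v → HasSupport ⁅ d ⁆ v → f v ≡ k) → ∑supp ⁅ d ⁆ f ≡ x * k
  ∑supp-⁅⁆-constant d f≡k = trans (∑supp-⁅⁆ d f≡k) (∑-units-const _)

  module _ {m n} (B : Board m n) (ω : ℕ → ℤ) (C : Columns n) where

    private
      V = coordinateSpace C
      step = rankStep V B ω

    ∑supp-coordinate : ∀ σ → ∑supp σ step ≡ x ^ ∣ σ ∣ * step (𝟏 σ)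
    ∑supp-coordinate σ = ∑supp-invariant σ (λ d v inv → rankStep-invariant V B ω d inv (pull-coordinate C d inv) v)

    -- All coordinates can be scaled independently, so the row yields at least x³, and the m rows
    -- below it yield x ^ m.
    coordinate-large : ∀ σ → 3 ≤ℕ ∣ σ ∣ → x ^ (3 ℕ.+ m) ∣ ∑supp σ step
    coordinate-large σ 3≤σ = subst (x ^ (3 ℕ.+ m) ∣_) (sym (∑supp-coordinate σ))
      (subst (_∣ x ^ ∣ σ ∣ * step (𝟏 σ)) (sym (ℤₚ.^-distribˡ-+-* x 3 m))
        (Div.∣-trans (Div.*-monoʳ-∣ (x ^ 3) (rankStep-∣ {V = V} B ω (coordinate-isSubspace C) (𝟏 σ)))
          (Div.*-monoˡ-∣ (step (𝟏 σ)) (subst (x ^ 3 ∣_) (sym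
              (trans (cong (x ^_) (sym (ℕₚ.m+[n∸m]≡n 3≤σ))) (ℤₚ.^-distribˡ-+-* x 3 (∣ σ ∣ ∸ 3))))
            (Div.∣m⇒∣m*n (x ^ (∣ σ ∣ ∸ 3)) (Div.∣-refl {x ^ 3}))))))

    coordinate-single-∈ : ∀ {c} → C c ≡ true → ∑supp ⁅ c ⁆ step ≡ x * (x * rankSum V B ω)
    coordinate-single-∈ {c} Cc = ∑supp-⁅⁆-constant c (λ v s → rankStep-∈ {V = V} B ω (λ j Cj →
      support-∉ ⁅ c ⁆ v s (trans (lookup-⁅⁆ c j) (==-≢ {i = j} {c}
          (λ { refl → contradiction (trans (sym Cc) Cj) λ () })))))

    coordinate-single-∉ : ∀ {c} → C c ≡ false → ∑supp ⁅ c ⁆ step ≡ x * rankSum (coordinateSpace (C ◂ c)) B (ω ∘ suc)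
    coordinate-single-∉ {c} Cc = ∑supp-⁅⁆-constant c (λ v s →
      let vc≢0 = support-∈ ⁅ c ⁆ v s (trans (lookup-⁅⁆ c c) (==-refl c))
      in trans (rankStep-∉ {V = V} B ω (λ p → vc≢0 (p c Cc)))
        (rankSum-cong B (ω ∘ suc) (coordinate-⊞ C Cc vc≢0 (λ j _ j≢c → support-∉ ⁅ c ⁆ v s
            (trans (lookup-⁅⁆ c j) (==-≢ j≢c))))))

    module _ {c d : Fin n} (c<d : (c <ᵇ d) ≡ true) where

      private
        σ = ⁅ c ⁆ ∪ ⁅ d ⁆
        1c≢0 : lookup (𝟏 σ) c ≢ 0#
        1c≢0 = support-∈ σ (𝟏 σ) (𝟏-support σ) (∈-pairˡ c d)
        1d≢0 : lookup (𝟏 σ) d ≢ 0#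
        1d≢0 = support-∈ σ (𝟏 σ) (𝟏-support σ) (∈-pairʳ c d)
        1j≡0 : ∀ j → j ≢ c → j ≢ d → lookup (𝟏 σ) j ≡ 0#
        1j≡0 j j≢c j≢d = support-∉ σ (𝟏 σ) (𝟏-support σ) (∉-pair j≢c j≢d)
        to-𝟏 : ∀ {k} → step (𝟏 σ) ≡ k → ∑supp σ step ≡ x * (x * k)
        to-𝟏 {k} eq = trans (∑supp-coordinate σ) (trans (cong₂ (λ l s → x ^ l * s) (∣pair∣ c d c<d) eq)
            (square x k))
          where
          square : ∀ x k → x * (x * 1ℤ) * k ≡ x * (x * k)
          square = solve-∀
        false≢true : ∀ {j} → C j ≡ true → ¬ C j ≡ false
        false≢true Cj Cj′ = contradiction (trans (sym Cj) Cj′) λ ()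

      coordinate-pair-∈∈ : C c ≡ true → C d ≡ true → ∑supp σ step ≡ x * (x * (x * rankSum V B ω))
      coordinate-pair-∈∈ Cc Cd = to-𝟏 (rankStep-∈ {V = V} B ω
          (λ j Cj → 1j≡0 j (λ { refl → false≢true Cc Cj }) (λ { refl → false≢true Cd Cj })))

      coordinate-pair-∈∉ : C c ≡ true → C d ≡ false → ∑supp σ step ≡ x *
          (x * rankSum (coordinateSpace (C ◂ d)) B (ω ∘ suc))
      coordinate-pair-∈∉ Cc Cd = to-𝟏 (trans (rankStep-∉ {V = V} B ω (λ p → 1d≢0 (p d Cd)))
        (rankSum-cong B (ω ∘ suc) (coordinate-⊞ C Cd 1d≢0 (λ j Cj → 1j≡0 j (λ { refl → false≢true Cc Cj })))))

      coordinate-pair-∉∈ : C c ≡ false → C d ≡ true → ∑supp σ step ≡ x *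
          (x * rankSum (coordinateSpace (C ◂ c)) B (ω ∘ suc))
      coordinate-pair-∉∈ Cc Cd = to-𝟏 (trans (rankStep-∉ {V = V} B ω (λ p → 1c≢0 (p c Cc)))
        (rankSum-cong B (ω ∘ suc) (coordinate-⊞ C Cc 1c≢0 (λ j Cj j≢c →
            1j≡0 j j≢c (λ { refl → false≢true Cd Cj })))))

      coordinate-pair-∉∉ : C c ≡ false → C d ≡ false → ∑supp σ step ≡ x *
          (x * rankSum (diagonalSpace C c d) B (ω ∘ suc))
      coordinate-pair-∉∉ Cc Cd = to-𝟏 (trans (rankStep-∉ {V = V} B ω (λ p → 1c≢0 (p c Cc)))
        (rankSum-cong B (ω ∘ suc) (coordinate-⊞-diagonal C Cc Cd 1c≢0
          (trans (one-at (∈-pairˡ c d)) (sym (one-at (∈-pairʳ c d)))) (λ j _ → 1j≡0 j))))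
        where
        one-at : ∀ {j} → lookup σ j ≡ inside → lookup (𝟏 σ) j ≡ 1#
        one-at {j} j∈σ = trans (Vecₚ.lookup-map j (λ b → if b then 1# else 0#) σ)
            (cong (λ b → if b then 1# else 0#) j∈σ)

  module _ {m n} (B : Board m n) (ω : ℕ → ℤ) (C : Columns n) {c d : Fin n} (Cc : C c ≡ false) (Cd : C d ≡ false) (c<d : (c <ᵇ d) ≡ true) where

    private
      V = diagonalSpace C c d
      V-sub = diagonal-isSubspace C c d
      step = rankStep V B ω
      C′ = C ◂ c ◂ d

    -- Two factors x come from the row, by overall scaling and by scaling column j; the remaining x
    -- ^ m comes from the rows below.
    diagonal-two : ∀ σ {i j} → lookup σ i ≡ inside → lookup σ j ≡ inside
        → i ≢ j → j ≢ c → j ≢ d → x ^ (2 ℕ.+ m) ∣ ∑supp σ step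
    diagonal-two σ {i} {j} i∈σ j∈σ i≢j j≢c j≢d = ∑supp-scale-coordinate-∣ σ i j
        (rankStep-scaleInvariant {V = V} B ω V-sub)
      (rankStep-coordinateInvariant B ω C j≢c j≢d) i∈σ j∈σ i≢j (rankStep-∣ {V = V} B ω V-sub)

    -- Three cells cannot all lie in {c, d}: there is a j outside, and some second element i besides
    -- j.
    diagonal-large : ∀ σ → 3 ≤ℕ ∣ σ ∣ → x ^ (2 ℕ.+ m) ∣ ∑supp σ step
    diagonal-large σ 3≤σ = diagonal-two σ (proj₁ (proj₂ i)) (proj₁ (proj₂ j)) i≢j j≢c j≢d
      where
      j = exists-outside σ (⁅ c ⁆ ∪ ⁅ d ⁆) (subst (ℕ._< ∣ σ ∣) (sym (∣pair∣ c d c<d)) 3≤σ)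
      i = exists-outside σ ⁅ proj₁ j ⁆ (subst (ℕ._< ∣ σ ∣) (sym (Subsetₚ.∣⁅x⁆∣≡1 (proj₁ j)))
          (ℕₚ.<-trans (s≤s (s≤s z≤n)) 3≤σ))
      j≢c : proj₁ j ≢ c
      j≢c eq = proj₂ (proj₂ j) (trans (cong (lookup (⁅ c ⁆ ∪ ⁅ d ⁆)) eq) (∈-pairˡ c d))
      j≢d : proj₁ j ≢ d
      j≢d eq = proj₂ (proj₂ j) (trans (cong (lookup (⁅ c ⁆ ∪ ⁅ d ⁆)) eq) (∈-pairʳ c d))
      i≢j : proj₁ i ≢ proj₁ j
      i≢j eq = proj₂ (proj₂ i) (trans (cong (lookup ⁅ proj₁ j ⁆) eq)
          (trans (lookup-⁅⁆ (proj₁ j) (proj₁ j)) (==-refl (proj₁ j))))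

    diagonal-pair-other : ∀ e f → (e <ᵇ f) ≡ true → ¬ (e ≡ c × f ≡ d) → x ^ (2 ℕ.+ m) ∣ ∑supp (⁅ e ⁆ ∪ ⁅ f ⁆) step
    diagonal-pair-other e f e<f ¬cd with e Fin.≟ c | e Fin.≟ d
    ... | yes refl | _        = diagonal-two (⁅ e ⁆ ∪ ⁅ f ⁆) (∈-pairˡ e f) (∈-pairʳ e f) (<ᵇ⇒≢ e f e<f)
        (<ᵇ⇒≢ e f e<f ∘ sym) (λ f≡d → ¬cd (refl , f≡d))
    -- Here f > e = d > c, so f lies outside {c, d}.
    ... | no _     | yes refl = diagonal-two (⁅ e ⁆ ∪ ⁅ f ⁆) (∈-pairˡ e f) (∈-pairʳ e f) (<ᵇ⇒≢ e f e<f)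
                                  (λ { refl → contradiction (trans (sym e<f) (<ᵇ-asym c d c<d)) λ () })
                                      (<ᵇ⇒≢ e f e<f ∘ sym)
    ... | no e≢c   | no e≢d   = diagonal-two (⁅ e ⁆ ∪ ⁅ f ⁆) (∈-pairʳ e f) (∈-pairˡ e f)
        (<ᵇ⇒≢ e f e<f ∘ sym) e≢c e≢d

    diagonal-single-∈ : ∀ {e} → C e ≡ true → ∑supp ⁅ e ⁆ step ≡ x * (x * rankSum V B ω)
    diagonal-single-∈ {e} Ce = ∑supp-⁅⁆-constant e (λ v s → rankStep-∈ {V = V} B ω
      (trans (v≡0 v s Cc) (sym (v≡0 v s Cd)) , λ j Cj _ _ → v≡0 v s Cj))
      where
      v≡0 : ∀ v → HasSupport ⁅ e ⁆ v → ∀ {j} → C j ≡ false → lookup v j ≡ 0#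
      v≡0 v s {j} Cj = support-∉ ⁅ e ⁆ v s (trans (lookup-⁅⁆ e j)
          (==-≢ {i = j} {e} (λ { refl → contradiction (trans (sym Ce) Cj) λ () })))

    diagonal-single-pair : ∀ {e} → e ≡ c ⊎ e ≡ d → ∑supp ⁅ e ⁆ step ≡ x * rankSum (coordinateSpace C′) B (ω ∘ suc)
    diagonal-single-pair {e} e∈cd = ∑supp-⁅⁆-constant e (λ v s → trans (rankStep-∉ {V = V} B ω
        (vc≢vd e∈cd v s ∘ proj₁))
      (rankSum-cong B (ω ∘ suc) (diagonal-⊞-pair C (vc≢vd e∈cd v s)
          (λ j _ j≢c j≢d → v≡0 v s (λ j≡e → other e∈cd j≡e j≢c j≢d)))))
      where
      v≡0 : ∀ v → HasSupport ⁅ e ⁆ v → ∀ {j} → j ≢ e → lookup v j ≡ 0#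
      v≡0 v s {j} j≢e = support-∉ ⁅ e ⁆ v s (trans (lookup-⁅⁆ e j) (==-≢ j≢e))
      ve≢0 : ∀ v → HasSupport ⁅ e ⁆ v → lookup v e ≢ 0#
      ve≢0 v s = support-∈ ⁅ e ⁆ v s (trans (lookup-⁅⁆ e e) (==-refl e))
      vc≢vd : e ≡ c ⊎ e ≡ d → ∀ v → HasSupport ⁅ e ⁆ v → lookup v c ≢ lookup v d
      vc≢vd (inj₁ refl) v s eq = ve≢0 v s (trans eq (v≡0 v s (<ᵇ⇒≢ c d c<d ∘ sym)))
      vc≢vd (inj₂ refl) v s eq = ve≢0 v s (trans (sym eq) (v≡0 v s (<ᵇ⇒≢ c d c<d)))
      other : e ≡ c ⊎ e ≡ d → ∀ {j} → j ≡ e → j ≢ c → j ≢ d → ⊥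
      other (inj₁ refl) j≡e j≢c j≢d = j≢c j≡e
      other (inj₂ refl) j≡e j≢c j≢d = j≢d j≡e

    diagonal-single-other : ∀ {e} → C e ≡ false → e ≢ c → e ≢ d → ∑supp ⁅ e ⁆ step ≡ x * rankSum
        (diagonalSpace (C ◂ e) c d) B (ω ∘ suc)
    diagonal-single-other {e} Ce e≢c e≢d = ∑supp-⁅⁆-constant e (λ v s → trans
      (rankStep-∉ {V = V} B ω (λ p → ve≢0 v s (proj₂ p e Ce e≢c e≢d)))
      (rankSum-cong B (ω ∘ suc) (diagonal-⊞-other C Ce e≢c e≢d (ve≢0 v s)
          (λ j j≢e → support-∉ ⁅ e ⁆ v s (trans (lookup-⁅⁆ e j) (==-≢ j≢e))))))
      where
      ve≢0 : ∀ v → HasSupport ⁅ e ⁆ v → lookup v e ≢ 0#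
      ve≢0 v s = support-∈ ⁅ e ⁆ v s (trans (lookup-⁅⁆ e e) (==-refl e))

    -- The source of the negative sign: the rows on {c, d} that are not in V number x (x - 1), which
    -- is -x to leading order.
    diagonal-pair : ∑supp (⁅ c ⁆ ∪ ⁅ d ⁆) step ≡ x * (x * rankSum V B ω + (x - 1ℤ) * rankSum (coordinateSpace C′) B
        (ω ∘ suc))
    diagonal-pair = ∑supp-pair c d c<d
      (λ v s eq → rankStep-∈ {V = V} B ω (eq , λ j _ j≢c j≢d → support-∉ (⁅ c ⁆ ∪ ⁅ d ⁆) v s (∉-pair j≢c j≢d)))
      (λ v s neq → trans (rankStep-∉ {V = V} B ω (neq ∘ proj₁))
        (rankSum-cong B (ω ∘ suc) (diagonal-⊞-pair C neq (λ j _ j≢c j≢d → support-∉ (⁅ c ⁆ ∪ ⁅ d ⁆) v s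
            (∉-pair j≢c j≢d)))))

module RankExpansion {q : ℕ} (F : FiniteField q) where

  open RankCongruence F public

  private
    ∑-linear₃ : ∀ {n} a b c (f g h : Fin n → ℤ) → ∑ᶠ (λ i → a * f i + b * g i + c * h i) ≡ a * ∑ᶠ f + b * ∑ᶠ g
        + c * ∑ᶠ h
    ∑-linear₃ {n} a b c f g h = trans (∑ᶠ-+ (λ i → a * f i + b * g i) (λ i → c * h i))
      (cong₂ _+_ (trans (∑ᶠ-+ (λ i → a * f i) (λ i → b * g i))
          (cong₂ _+_ (∑-*ˡ (allFin n) a f) (∑-*ˡ (allFin n) b g))) (∑-*ˡ (allFin n) c h))

  mutual

    -- Leading order suffices, because the row that created the diagonal space has contributed x².
    -- The recursion is mutual, since a later row can complete the plane of c and d and thus return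
    -- to a coordinate space.
    diagonal-rankSum : ∀ {m n} (B : Board m n) ω C {c d} → C c ≡ false → C d ≡ false → (c <ᵇ d) ≡ true →
                       rankSum (diagonalSpace C c d) B ω ≡ x ^ m * diagonalSum B C c d ω ⟦ x ^ suc m ⟧
    -- With no rows left, exactly one of the two orders of c and d is counted, which matches the
    -- single empty matrix.
    diagonal-rankSum [] ω C {c} {d} Cc Cd c<d rewrite c<d | <ᵇ-asym c d c<d = ≡⇒≡⟦⟧ (base (ω 0))
      where
      base : ∀ w → w ≡ 1ℤ * (1ℤ * (1ℤ * w) + 0ℤ + (1ℤ * (0ℤ * w) + 0ℤ))
      base = solve-∀
    diagonal-rankSum {suc m} {n} (β ∷ B) ω C {c} {d} Cc Cd c<d =
      ≡⟦⟧-trans (∑⊆-≡pairs β H (diagonal-large B ω C Cc Cd c<d))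
        (≡⟦⟧-trans (≡⟦⟧-+ (≡⟦⟧-+ empty (singletonSum-≡⟦⟧ β single)) (pairSum-≡⟦⟧ β pair)) (≡⇒≡⟦⟧ total))
      where
      ω′ = ω ∘ suc
      X = x ^ m
      V = diagonalSpace C c d
      H : Subset n → ℤ
      H σ = ∑supp σ (rankStep V B ω)
      D = diagonalSum B C c d ω
      R = rookSum B (C ◂ c ◂ d) ω′
      K = - (x * X * R)
      empty : H ∅ ≡ x * (X * D) ⟦ x ^ (2 ℕ.+ m) ⟧
      empty = ≡⟦⟧-trans (≡⇒≡⟦⟧ (rankStep-∅ {V = V} B ω (diagonal-isSubspace C c d)))
          (≡⟦⟧-scale x (diagonal-rankSum B ω C Cc Cd c<d))
      rook : ∀ {e} → e ≡ c ⊎ e ≡ d → H ⁅ e ⁆ ≡ x * (X * R) ⟦ x ^ (2 ℕ.+ m) ⟧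
      rook e∈cd = ≡⟦⟧-trans (≡⇒≡⟦⟧ (diagonal-single-pair B ω C Cc Cd c<d e∈cd))
          (≡⟦⟧-scale x (coordinate-rookSum B ω′ (C ◂ c ◂ d)))
      single : ∀ e → H ⁅ e ⁆ ≡ x * (X * diagonalSingle B C c d ω′ e) ⟦ x ^ (2 ℕ.+ m) ⟧
      single e with C e in Ce
      ... | true  = ≡⟦⟧-trans (≡⇒≡⟦⟧ (diagonal-single-∈ B ω C Cc Cd c<d Ce))
                      (≡⟦⟧-trans (∣⇒≡0⟦⟧ (Div.*-monoʳ-∣ x (Div.*-monoʳ-∣ x
                          (rankSum-∣ {V = V} B ω (diagonal-isSubspace C c d)))))
                        (≡⇒≡⟦⟧ (vanish x X)))
        where
        vanish : ∀ x X → 0ℤ ≡ x * (X * 0ℤ)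
        vanish = solve-∀
      ... | false with e Fin.≟ c | e Fin.≟ d
      ...   | yes e≡c | _       = rook (inj₁ e≡c)
      ...   | no _    | yes e≡d = rook (inj₂ e≡d)
      ...   | no e≢c  | no e≢d  = ≡⟦⟧-trans (≡⇒≡⟦⟧ (diagonal-single-other B ω C Cc Cd c<d Ce e≢c e≢d))
        (≡⟦⟧-scale x (diagonal-rankSum B ω′ (C ◂ e) (◂-false⁺ C Cc (e≢c ∘ sym)) (◂-false⁺ C Cd (e≢d ∘ sym)) c<d))
      pair : ∀ e f → (e <ᵇ f) ≡ true → H (⁅ e ⁆ ∪ ⁅ f ⁆) ≡ 𝟙 (e == c) * (𝟙 (f == d) * K) ⟦ x ^ (2 ℕ.+ m) ⟧
      pair e f e<f with e Fin.≟ c | f Fin.≟ d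
      ... | no e≢c   | _        = ∣⇒≡0⟦⟧ (diagonal-pair-other B ω C Cc Cd c<d e f e<f (e≢c ∘ proj₁))
      ... | yes _    | no f≢d   = ∣⇒≡0⟦⟧ (diagonal-pair-other B ω C Cc Cd c<d e f e<f (f≢d ∘ proj₂))
      ... | yes refl | yes refl = ≡⟦⟧-trans
        (≡⇒≡⟦⟧ (trans (diagonal-pair B ω C Cc Cd c<d) (expand x (rankSum V B ω)
            (rankSum (coordinateSpace (C ◂ c ◂ d)) B ω′))))
        (≡⟦⟧-trans (≡⟦⟧-+ (∣⇒≡0⟦⟧ (Div.*-monoʳ-∣ x (Div.*-monoʳ-∣ x
            (Div.∣m∣n⇒∣m+n (rankSum-∣ {V = V} B ω (diagonal-isSubspace C c d))
                                      (rankSum-∣ {V = coordinateSpace (C ◂ c ◂ d)} B ω′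
                                          (coordinate-isSubspace (C ◂ c ◂ d)))))))
                          (≡⟦⟧-*ˡ -1ℤ (≡⟦⟧-scale x (coordinate-rookSum B ω′ (C ◂ c ◂ d)))))
                   (≡⇒≡⟦⟧ (negate x X R)))
        where
        expand : ∀ x a b → x * (x * a + (x - 1ℤ) * b) ≡ x * (x * (a + b)) + -1ℤ * (x * b)
        expand = solve-∀
        negate : ∀ x X r → 0ℤ + -1ℤ * (x * (X * r)) ≡ 1ℤ * (1ℤ * - (x * X * r))
        negate = solve-∀
      total : x * (X * D) + singletonSum β (λ e → x * (X * diagonalSingle B C c d ω′ e)) + pairSum β
          (λ e f → 𝟙 (e == c) * (𝟙 (f == d) * K))
              ≡ x ^ suc m * diagonalSum (β ∷ B) C c d ω
      total = trans (cong₂ (λ u v → x * (X * D) + u + v)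
          (trans (∑ᶠ-cong (λ e → factor (𝟙 (lookup β e)) x X (diagonalSingle B C c d ω′ e)))
                 (∑-*ˡ (allFin n) (x * X) (λ e → 𝟙 (lookup β e) * diagonalSingle B C c d ω′ e)))
          (pairSum-δ β K c<d))
        (trans (collect x X D (singletonSum β (diagonalSingle B C c d ω′)) (𝟙 (lookup β c)) (𝟙 (lookup β d)) R)
               (cong (x ^ suc m *_) (sym (diagonalSum-∷ β B C ω Cc Cd c<d))))
        where
        factor : ∀ b x X s → b * (x * (X * s)) ≡ x * X * (b * s)
        factor = solve-∀
        collect : ∀ x X d s b b′ r → x * (X * d) + x * X * s + b * (b′ * - (x * X * r)) ≡ x * X *
            (d + s - b * (b′ * r))
        collect = solve-∀

    -- Rows with one cell in an old column or with two cells cost x² and use up the spare order, so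
    -- the rows after them matter only to leading order. An empty row or a single new cell costs
    -- just x and passes both orders on.
    coordinate-rankSum : ∀ {m n} (B : Board m n) ω C →
                         rankSum (coordinateSpace C) B ω ≡ x ^ m * (rookSum B C ω + x * extraSum B C ω) ⟦ x ^
                             (2 ℕ.+ m) ⟧
    coordinate-rankSum [] ω C = ≡⇒≡⟦⟧ (base (ω 0) x)
      where
      base : ∀ w x → w ≡ 1ℤ * (1ℤ * w + 0ℤ + x * (1ℤ * (0ℤ * w) + 0ℤ))
      base = solve-∀
    coordinate-rankSum {suc m} {n} (β ∷ B) ω C =
      ≡⟦⟧-trans (∑⊆-≡pairs β H (coordinate-large B ω C))
        (≡⟦⟧-trans (≡⟦⟧-+ (≡⟦⟧-+ empty (singletonSum-≡⟦⟧ β single)) (pairSum-≡⟦⟧ β pair)) (≡⇒≡⟦⟧ total))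
      where
      ω′ = ω ∘ suc
      X = x ^ m
      V = coordinateSpace C
      H : Subset n → ℤ
      H σ = ∑supp σ (rankStep V B ω)
      R = rookSum B C ω
      E = extraSum B C ω
      R′ E′ value : Fin n → ℤ
      R′ c = rookSum B (C ◂ c) ω′
      E′ c = extraSum B (C ◂ c) ω′
      value c = if C c then x * (x * (X * R)) else x * (X * (R′ c + x * E′ c))
      empty : H ∅ ≡ x * (X * (R + x * E)) ⟦ x ^ (3 ℕ.+ m) ⟧
      empty = ≡⟦⟧-trans (≡⇒≡⟦⟧ (rankStep-∅ {V = V} B ω (coordinate-isSubspace C)))
          (≡⟦⟧-scale x (coordinate-rankSum B ω C))
      single : ∀ c → H ⁅ c ⁆ ≡ value c ⟦ x ^ (3 ℕ.+ m) ⟧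
      single c with C c in Cc
      ... | true  = ≡⟦⟧-trans (≡⇒≡⟦⟧ (coordinate-single-∈ B ω C Cc))
          (≡⟦⟧-scale x (≡⟦⟧-scale x (coordinate-rookSum B ω C)))
      ... | false = ≡⟦⟧-trans (≡⇒≡⟦⟧ (coordinate-single-∉ B ω C Cc)) (≡⟦⟧-scale x (coordinate-rankSum B ω′ (C ◂ c)))
      assoc : ∀ x X r → x * (x * (X * r)) ≡ x * (x * X) * r
      assoc = solve-∀
      pair : ∀ c d → (c <ᵇ d) ≡ true → H (⁅ c ⁆ ∪ ⁅ d ⁆) ≡ x * (x * X) * pairValue B C ω′ c d ⟦ x ^ (3 ℕ.+ m) ⟧
      pair c d c<d with C c in Cc | C d in Cd
      ... | true  | true  = ≡⟦⟧-trans (≡⇒≡⟦⟧ (coordinate-pair-∈∈ B ω C c<d Cc Cd))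
        (≡⟦⟧-trans (∣⇒≡0⟦⟧ (Div.*-monoʳ-∣ x (Div.*-monoʳ-∣ x
            (Div.*-monoʳ-∣ x (rankSum-∣ {V = V} B ω (coordinate-isSubspace C))))))
                   (≡⇒≡⟦⟧ (sym (ℤₚ.*-zeroʳ (x * (x * X))))))
      ... | true  | false = ≡⟦⟧-trans (≡⇒≡⟦⟧ (coordinate-pair-∈∉ B ω C c<d Cc Cd))
        (≡⟦⟧-trans (≡⟦⟧-scale x (≡⟦⟧-scale x (coordinate-rookSum B ω′ (C ◂ d)))) (≡⇒≡⟦⟧ (assoc x X (R′ d))))
      ... | false | true  = ≡⟦⟧-trans (≡⇒≡⟦⟧ (coordinate-pair-∉∈ B ω C c<d Cc Cd))
        (≡⟦⟧-trans (≡⟦⟧-scale x (≡⟦⟧-scale x (coordinate-rookSum B ω′ (C ◂ c)))) (≡⇒≡⟦⟧ (assoc x X (R′ c))))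
      ... | false | false = ≡⟦⟧-trans (≡⇒≡⟦⟧ (coordinate-pair-∉∉ B ω C c<d Cc Cd))
        (≡⟦⟧-trans (≡⟦⟧-scale x (≡⟦⟧-scale x (diagonal-rankSum B ω′ C Cc Cd c<d)))
            (≡⇒≡⟦⟧ (assoc x X (diagonalSum B C c d ω′))))
      total : x * (X * (R + x * E)) + singletonSum β value + pairSum β (λ c d → x * (x * X) * pairValue B C ω′ c d)
              ≡ x ^ suc m * (rookSum (β ∷ B) C ω + x * extraSum (β ∷ B) C ω)
      total = trans (cong₂ (λ u v → x * (X * (R + x * E)) + u + v) singles
          (pairSum-*ˡ β (x * (x * X)) (pairValue B C ω′)))
        (trans (collect x X R E (∑ᶠ (λ c → 𝟙 (lookup β c) * (𝟙 (not (C c)) * R′ c)))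
            (∑ᶠ (λ c → 𝟙 (lookup β c) * (𝟙 (not (C c)) * E′ c)))
                        (meet β C) (pairSum β (pairValue B C ω′)))
               (cong₂ (λ u v → x ^ suc m * (u + x * v)) (sym (rookSum-∷ β B C ω)) (sym (extraSum-∷ β B C ω))))
        where
        collect : ∀ x X r e s t o p → x * (X * (r + x * e)) + (x * X * s + x * (x * X) * t + x * (x * X) * r * o)
            + x * (x * X) * p
                  ≡ x * X * (r + s + x * (e + o * r + t + p))
        collect = solve-∀
        split : ∀ c → 𝟙 (lookup β c) * value c ≡ x * X * (𝟙 (lookup β c) * (𝟙 (not (C c)) * R′ c))
                + x * (x * X) * (𝟙 (lookup β c) * (𝟙 (not (C c)) * E′ c)) + x * (x * X) * R *
                    (𝟙 (lookup β c) * 𝟙 (C c))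
        split c with C c
        ... | true  = lemma (𝟙 (lookup β c)) x X R (R′ c) (E′ c)
          where
          lemma : ∀ b x X r r′ e′ → b * (x * (x * (X * r))) ≡ x * X * (b * (0ℤ * r′)) + x * (x * X) *
              (b * (0ℤ * e′)) + x * (x * X) * r * (b * 1ℤ)
          lemma = solve-∀
        ... | false = lemma (𝟙 (lookup β c)) x X R (R′ c) (E′ c)
          where
          lemma : ∀ b x X r r′ e′ → b * (x * (X * (r′ + x * e′))) ≡ x * X * (b * (1ℤ * r′)) + x * (x * X) *
              (b * (1ℤ * e′)) + x * (x * X) * r * (b * 0ℤ)
          lemma = solve-∀
        singles : singletonSum β value ≡ x * X * ∑ᶠ (λ c → 𝟙 (lookup β c) * (𝟙 (not (C c)) * R′ c))
                  + x * (x * X) * ∑ᶠ (λ c → 𝟙 (lookup β c) * (𝟙 (not (C c)) * E′ c)) + x * (x * X) * R * meet β C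
        singles = trans (∑ᶠ-cong split) (∑-linear₃ (x * X) (x * (x * X)) (x * (x * X) * R)
          (λ c → 𝟙 (lookup β c) * (𝟙 (not (C c)) * R′ c)) (λ c → 𝟙 (lookup β c) * (𝟙 (not (C c)) * E′ c))
              (λ c → 𝟙 (lookup β c) * 𝟙 (C c)))

    coordinate-rookSum : ∀ {m n} (B : Board m n) ω C → rankSum (coordinateSpace C) B ω
        ≡ x ^ m * rookSum B C ω ⟦ x ^ suc m ⟧
    coordinate-rookSum {m} B ω C = ≡⟦⟧-trans
      (≡⟦⟧-weaken (Div.∣n⇒∣m*n x (Div.∣-refl {x ^ suc m})) (coordinate-rankSum B ω C))
      (≡⟦⟧-trans (≡⇒≡⟦⟧ (expand x (x ^ m) (rookSum B C ω) (extraSum B C ω)))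
        (+-≡0⟦⟧ (≡⇒≡⟦⟧ refl) (Div.∣m⇒∣m*n (extraSum B C ω) (Div.∣-refl {x ^ suc m}))))
      where
      expand : ∀ x X r e → X * (r + x * e) ≡ x * X * e + X * r
      expand = solve-∀

-- Independent rows

vec-ext : ∀ {a} {A : Set a} {n} {u v : Vec A n} → (∀ j → lookup u j ≡ lookup v j) → u ≡ v
vec-ext {u = u} {v} eq = trans (sym (Vecₚ.tabulate∘lookup u))
    (trans (Vecₚ.tabulate-cong eq) (Vecₚ.tabulate∘lookup v))

∑⊆-swap : ∀ {n a} {A : Set a} (β : Subset n) (xs : List A) (f : Subset n → A → ℤ) →
          ∑⊆ β (λ σ → ∑ xs (f σ)) ≡ ∑ xs (λ y → ∑⊆ β (λ σ → f σ y))
∑⊆-swap []            xs f = refl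
∑⊆-swap (inside ∷ β)  xs f = trans (cong₂ _+_ (∑⊆-swap β xs (λ σ → f (inside ∷ σ)))
    (∑⊆-swap β xs (λ σ → f (outside ∷ σ))))
  (sym (∑-+ xs (λ y → ∑⊆ β (λ σ → f (inside ∷ σ) y)) (λ y → ∑⊆ β (λ σ → f (outside ∷ σ) y))))
∑⊆-swap (outside ∷ β) xs f = ∑⊆-swap β xs (λ σ → f (outside ∷ σ))

𝟙-∧ : ∀ a b → 𝟙 (a ∧ b) ≡ 𝟙 a * 𝟙 b
𝟙-∧ true  b = sym (ℤₚ.*-identityˡ (𝟙 b))
𝟙-∧ false b = refl

∣outside∣ : ∀ {n} (S : Subset n) k → lookup S k ≡ inside → ∣ S ∣ ≡ suc ∣ S Vec.[ k ]≔ outside ∣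
∣outside∣ (inside ∷ S)  zero    k∈S = refl
∣outside∣ (inside ∷ S)  (suc k) k∈S = cong suc (∣outside∣ S k k∈S)
∣outside∣ (outside ∷ S) (suc k) k∈S = ∣outside∣ S k k∈S

rankIs : ℕ → ℕ → ℤ
rankIs r k = 𝟙 (does (k ℕ.≟ r))

module GreedyRank {q : ℕ} (F : FiniteField q) where

  open RankExpansion F public
  open RawMonoidDefs (+-rawMonoid F) using () renaming (sum to sumᶠ)

  combination : ∀ {m n} → Vec Carrier m → Matrix F m n → Vec Carrier n
  combination []      []      = replicate _ 0#
  combination (a ∷ c) (v ∷ A) = combination c A +[ a ] v

  lookup-combination : ∀ {m n} (c : Vec Carrier m) (A : Matrix F m n) j →
                       lookup (combination c A) j ≡ sumᶠ (λ i → lookup c i *ᶠ entry F A i j)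
  lookup-combination []      []      j = Vecₚ.lookup-replicate j 0#
  lookup-combination (a ∷ c) (v ∷ A) j = trans (lookup-+[] (combination c A) a v j)
    (trans (cong (_+ᶠ a *ᶠ lookup v j) (lookup-combination c A j)) (+-comm _ (a *ᶠ lookup v j)))

  combination-+[] : ∀ {m n} (c d : Vec Carrier m) t (A : Matrix F m n) → combination c A +[ t ] combination d A
      ≡ combination (c +[ t ] d) A
  combination-+[] []      []      t []      = vec-ext (λ j → trans
    (lookup-+[]-0 (replicate _ 0#) t (replicate _ 0#) j (Vecₚ.lookup-replicate j 0#) (Vecₚ.lookup-replicate j 0#))
        (sym (Vecₚ.lookup-replicate j 0#)))
  combination-+[] (a ∷ c) (b ∷ d) t (v ∷ A) = trans (interchange (combination c A) (combination d A) v)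
    (cong (_+[ a +ᶠ t *ᶠ b ] v) (combination-+[] c d t A))
    where
    interchange : ∀ {n} (u w v : Vec Carrier n) → (u +[ a ] v) +[ t ] (w +[ b ] v) ≡ (u +[ t ] w) +[ a +ᶠ t *ᶠ b ] v
    interchange []      []      []      = refl
    interchange (e ∷ u) (f ∷ w) (g ∷ v) = cong₂ _∷_
      (solve 6 (λ e f g a t b → (e :+ a :* g) :+ t :* (f :+ b :* g) := (e :+ t :* f) :+
          (a :+ t :* b) :* g) refl e f g a t b) (interchange u w v)

  combination-0 : ∀ {m n} (c : Vec Carrier m) (A : Matrix F m n) → (∀ i → lookup c i ≡ 0#)
      → ∀ j → lookup (combination c A) j ≡ 0#
  combination-0 []      []      c≡0 j = Vecₚ.lookup-replicate j 0#
  combination-0 (a ∷ c) (v ∷ A) c≡0 j = trans (lookup-+[] (combination c A) a v j)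
    (trans (cong₂ (λ b e → b +ᶠ e *ᶠ lookup v j) (combination-0 c A (c≡0 ∘ suc) j) (c≡0 zero))
      (trans (+-identityˡ (0# *ᶠ lookup v j)) (zeroˡ (lookup v j))))

  SupportedOn : ∀ {m} → Subset m → Vec Carrier m → Set
  SupportedOn S c = ∀ i → lookup S i ≡ outside → lookup c i ≡ 0#

  Independent : ∀ {m n} → Region n → Matrix F m n → Subset m → Set
  Independent V A S = ∀ c → SupportedOn S c → Mem V (combination c A) → ∀ i → lookup c i ≡ 0#

  -- The field is finite, so a search through all coefficient vectors either finds an explicit
  -- relation or proves independence.
  independent-or-relation : ∀ {m n} (V : Region n) (A : Matrix F m n) S →
    Independent V A S ⊎ (∃ λ c → SupportedOn S c × Mem V (combination c A) × ∃ λ k → lookup c k ≢ 0#)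
  independent-or-relation {m} V A S with Any.any? relation? (vecs elements m)
    where
    relation? : ∀ c → Dec (SupportedOn S c × Mem V (combination c A) × ∃ λ k → lookup c k ≢ 0#)
    relation? c = Finₚ.all? (λ i → (lookup S i Boolₚ.≟ outside) Dec.→-dec (lookup c i ≟ᶠ 0#)) Dec.×-dec
                  (mem? V (combination c A) Dec.×-dec Finₚ.any? (λ k → Dec.¬? (lookup c k ≟ᶠ 0#)))
  ... | yes found = inj₂ (Any.satisfied found)
  ... | no ¬found = inj₁ (λ c supp mem i → Dec.decidable-stable (lookup c i ≟ᶠ 0#)
                      (λ ci≢0 → ¬found (lose (∈-vecs ∈-elements c) (supp , mem , i , ci≢0))))

  greedyRank : ∀ {m n} → Region n → Matrix F m n → ℕ
  greedyRank V []      = 0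
  greedyRank V (v ∷ A) = if does (mem? V v) then greedyRank V A else suc (greedyRank (V ⊞ v) A)

  greedyRank-∈ : ∀ {m n} {V : Region n} (A : Matrix F m n) {v} → Mem V v → greedyRank V (v ∷ A) ≡ greedyRank V A
  greedyRank-∈ {V = V} A {v} v∈V rewrite Dec.dec-true (mem? V v) v∈V = refl

  greedyRank-∉ : ∀ {m n} {V : Region n} (A : Matrix F m n) {v} → ¬ Mem V v → greedyRank V (v ∷ A) ≡ suc
      (greedyRank (V ⊞ v) A)
  greedyRank-∉ {V = V} A {v} v∉V rewrite Dec.dec-false (mem? V v) v∉V = refl

  greedyRank≤m : ∀ {m n} (V : Region n) (A : Matrix F m n) → greedyRank V A ≤ℕ m
  greedyRank≤m V []      = z≤n
  greedyRank≤m V (v ∷ A) = by-cases (mem? V v)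
    where
    by-cases : (v? : Dec (Mem V v)) → (if does v? then greedyRank V A else suc (greedyRank (V ⊞ v) A)) ≤ℕ suc _
    by-cases (yes _) = ℕₚ.m≤n⇒m≤1+n (greedyRank≤m V A)
    by-cases (no  _) = s≤s (greedyRank≤m (V ⊞ v) A)

  independent-tail : ∀ {m n} (V : Region n) v (A : Matrix F m n) {b} S → Independent V (v ∷ A) (b ∷ S)
      → Independent V A S
  independent-tail V v A S ind c supp mem i =
    ind (0# ∷ c) (λ { zero _ → refl ; (suc i) → supp i }) (subst (Mem V) (vec-ext λ j → sym (shift j)) mem) (suc i)
    where
    shift : ∀ j → lookup (combination c A +[ 0# ] v) j ≡ lookup (combination c A) j
    shift j = trans (lookup-+[] (combination c A) 0# v j) (trans
        (cong (lookup (combination c A) j +ᶠ_) (zeroˡ (lookup v j))) (+-identityʳ _))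

  -- The rows at which the span grows are independent modulo V.
  greedyRank-attained : ∀ {m n} (V : Region n) (A : Matrix F m n) → IsSubspace V → ∃ λ S → Independent V A S × ∣ S ∣
      ≡ greedyRank V A
  greedyRank-attained V []      sub = [] , (λ { [] _ _ () }) , refl
  greedyRank-attained {suc m} {n} V (v ∷ A) sub = by-cases (mem? V v)
    where
    by-cases : Dec (Mem V v) → ∃ λ S → Independent V (v ∷ A) S × ∣ S ∣ ≡ greedyRank V (v ∷ A)
    by-cases (yes v∈V) with S , ind , card ← greedyRank-attained V A sub =
      outside ∷ S , independent , trans card (sym (greedyRank-∈ {V = V} A v∈V))
      where
      independent : Independent V (v ∷ A) (outside ∷ S)
      independent (a ∷ c) supp mem zero    = supp zero refl
      independent (a ∷ c) supp mem (suc i) = ind c (supp ∘ suc) (subst (Mem V) (vec-ext shift) mem) i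
        where
        shift : ∀ j → lookup (combination c A +[ a ] v) j ≡ lookup (combination c A) j
        shift j = trans (lookup-+[] (combination c A) a v j)
            (trans (cong (λ z → lookup (combination c A) j +ᶠ z *ᶠ lookup v j) (supp zero refl))
          (trans (cong (lookup (combination c A) j +ᶠ_) (zeroˡ (lookup v j))) (+-identityʳ _)))
    by-cases (no v∉V) with S , ind , card ← greedyRank-attained (V ⊞ v) A (⊞-isSubspace {V = V} v sub) =
      inside ∷ S , independent , trans (cong suc card) (sym (greedyRank-∉ {V = V} A v∉V))
      where
      independent : Independent V (v ∷ A) (inside ∷ S)
      independent (a ∷ c) supp mem = conclude (a ≟ᶠ 0#)
        where
        c≡0 : ∀ i → lookup c i ≡ 0#
        c≡0 = ind c (supp ∘ suc) (a , mem)
        scaled : combination c A +[ a ] v ≡ scale a v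
        scaled = vec-ext (λ j → trans (lookup-+[] (combination c A) a v j)
          (trans (cong (_+ᶠ a *ᶠ lookup v j) (combination-0 c A c≡0 j)) (trans (+-identityˡ (a *ᶠ lookup v j))
            (sym (trans (Vecₚ.lookup-zipWith _*ᶠ_ j (replicate _ a) v)
                (cong (_*ᶠ lookup v j) (Vecₚ.lookup-replicate j a)))))))
        conclude : Dec (a ≡ 0#) → ∀ i → lookup (a ∷ c) i ≡ 0#
        conclude (yes a≡0) zero    = a≡0
        -- If a were nonzero, av in V would put v itself into V.
        conclude (no a≢0)  zero    = contradiction (proj₁ (pull-scale {V = V} sub a≢0 v)
            (subst (Mem V) scaled mem)) v∉V
        conclude _         (suc i) = c≡0 i

  -- A relation modulo V ⊞ v between rows that are independent modulo V involves v,
  -- so it can be used to eliminate v from every other such relation.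
  exchange : ∀ {m n} (V : Region n) v (A : Matrix F m n) S → IsSubspace V → Independent V (v ∷ A) (outside ∷ S) →
             ∀ c → SupportedOn S c → Mem (V ⊞ v) (combination c A) → ∀ k → lookup c k ≢ 0# →
             Independent (V ⊞ v) A (S Vec.[ k ]≔ outside)
  exchange V v A S sub ind c supp (a , mem) k ck≢0 c′ supp′ (a′ , mem′) i =
    trans (sym (+-identityʳ (lookup c′ i))) (trans (cong (lookup c′ i +ᶠ_)
        (sym (trans (cong (_*ᶠ lookup c i) t≡0) (zeroˡ (lookup c i)))))
      (trans (sym (lookup-+[] c′ t c i)) (c″≡0 i)))
    where
    extend : ∀ d → SupportedOn S d → SupportedOn (outside ∷ S) (0# ∷ d)
    extend d supp zero    _ = refl
    extend d supp (suc i) = supp i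
    a≢0 : a ≢ 0#
    a≢0 a≡0 = ck≢0 (ind (0# ∷ c) (extend c supp) (subst (λ b → Mem V (combination c A +[ b ] v)) a≡0 mem) (suc k))
    t = proj₁ (eliminate a≢0 a′)
    c″ = c′ +[ t ] c
    supp″ : SupportedOn S c″
    supp″ j Sj = lookup-+[]-0 c′ t c j (supp′ j (still-outside j Sj)) (supp j Sj)
      where
      still-outside : ∀ j → lookup S j ≡ outside → lookup (S Vec.[ k ]≔ outside) j ≡ outside
      still-outside j Sj with j Fin.≟ k
      ... | yes refl = Vecₚ.lookup∘update k S outside
      ... | no j≢k   = trans (Vecₚ.lookup∘update′ j≢k S outside) Sj
    relation : (combination c′ A +[ a′ ] v) +[ t ] (combination c A +[ a ] v) ≡ combination (0# ∷ c″) (v ∷ A)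
    relation = trans (combination-+[] (a′ ∷ c′) (a ∷ c) t (v ∷ A))
      (cong (λ b → combination c″ A +[ b ] v) (proj₂ (eliminate a≢0 a′)))
    c″≡0 : ∀ i → lookup c″ i ≡ 0#
    c″≡0 i = ind (0# ∷ c″) (extend c″ supp″) (subst (Mem V) relation (mem-+[] sub t mem′ mem)) (suc i)
    -- Entry k of c′ is zero, so entry k of the vanishing vector c″ is t times the nonzero entry k
    -- of c.
    t≡0 : t ≡ 0#
    t≡0 = *-cancelˡ-0 ck≢0 (trans (*-comm (lookup c k) t) (trans (sym (+-identityˡ (t *ᶠ lookup c k)))
      (trans (cong (_+ᶠ t *ᶠ lookup c k) (sym (supp′ k (Vecₚ.lookup∘update k S outside))))
          (trans (sym (lookup-+[] c′ t c k)) (c″≡0 k)))))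

  -- Induction over the rows, for all V at once. The critical case is a new row v outside V that S
  -- omits: either S stays independent modulo V + ⟨v⟩, or it becomes so after losing the one element
  -- found by `exchange`, and the `suc` in the greedy rank pays for that element.
  greedyRank-maximal : ∀ {m n} (V : Region n) (A : Matrix F m n) → IsSubspace V → ∀ S → Independent V A S
      → ∣ S ∣ ≤ℕ greedyRank V A
  greedyRank-maximal V []      sub []      ind = z≤n
  greedyRank-maximal {suc m} V (v ∷ A) sub (b ∷ S) ind = by-cases (mem? V v) b ind
    where
    sub′ = ⊞-isSubspace {V = V} v sub
    by-cases : Dec (Mem V v) → ∀ b → Independent V (v ∷ A) (b ∷ S) → ∣ b ∷ S ∣ ≤ℕ greedyRank V (v ∷ A)
    by-cases (yes v∈V) inside ind = contradiction
      (ind (1# ∷ replicate m 0#) (λ { (suc i) _ → Vecₚ.lookup-replicate i 0# })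
          (subst (Mem V) (vec-ext unit) v∈V) zero) 1≢0
      where
      unit : ∀ j → lookup v j ≡ lookup (combination (replicate m 0#) A +[ 1# ] v) j
      unit j = sym (trans (lookup-+[] (combination (replicate m 0#) A) 1# v j)
        (trans (cong₂ _+ᶠ_ (combination-0 (replicate m 0#) A (λ i → Vecₚ.lookup-replicate i 0#) j)
            (*-identityˡ (lookup v j))) (+-identityˡ (lookup v j))))
    by-cases (yes v∈V) outside ind = subst (∣ S ∣ ≤ℕ_) (sym (greedyRank-∈ {V = V} A v∈V))
      (greedyRank-maximal V A sub S (independent-tail V v A S ind))
    by-cases (no v∉V) inside ind = subst (suc ∣ S ∣ ≤ℕ_) (sym (greedyRank-∉ {V = V} A v∉V))
      (s≤s (greedyRank-maximal (V ⊞ v) A sub′ S (λ c supp mem i →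
        ind (proj₁ mem ∷ c) (λ { (suc i) → supp i }) (proj₂ mem) (suc i))))
    by-cases (no v∉V) outside ind = subst (∣ S ∣ ≤ℕ_) (sym (greedyRank-∉ {V = V} A v∉V))
        (bound (independent-or-relation (V ⊞ v) A S))
      where
      bound : Independent (V ⊞ v) A S ⊎ (∃ λ c → SupportedOn S c × Mem (V ⊞ v)
          (combination c A) × ∃ λ k → lookup c k ≢ 0#) →
              ∣ S ∣ ≤ℕ suc (greedyRank (V ⊞ v) A)
      bound (inj₁ ind′) = ℕₚ.m≤n⇒m≤1+n (greedyRank-maximal (V ⊞ v) A sub′ S ind′)
      bound (inj₂ (c , supp , mem , k , ck≢0)) = subst (_≤ℕ suc (greedyRank (V ⊞ v) A)) (sym (∣outside∣ S k k∈S))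
        (s≤s (greedyRank-maximal (V ⊞ v) A sub′ (S Vec.[ k ]≔ outside)
            (exchange V v A S sub ind c supp mem k ck≢0)))
        where
        k∈S : lookup S k ≡ inside
        k∈S with lookup S k in Sk
        ... | true  = refl
        ... | false = contradiction (supp k Sk) ck≢0

  zeroSpace : ∀ {n} → Region n
  zeroSpace = coordinateSpace noColumns

  independentRows⇒ : ∀ {m n} (A : Matrix F m n) S → IndependentRows F A S → Independent zeroSpace A S
  independentRows⇒ A S ind c supp mem = ind c
    (λ i i∉S → supp i (Boolₚ.¬-not (λ i∈S → i∉S (Vecₚ.lookup⇒[]= i S i∈S))))
    (λ j → trans (sym (lookup-combination c A j)) (mem j refl))

  independentRows⇐ : ∀ {m n} (A : Matrix F m n) S → Independent zeroSpace A S → IndependentRows F A S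
  independentRows⇐ A S ind c supp sum≡0 = ind c
    (λ i Si → supp i (λ i∈S → contradiction (trans (sym (Vecₚ.[]=⇒lookup i∈S)) Si) λ ()))
    (λ j _ → trans (lookup-combination c A j) (sum≡0 j))

  rank≡greedyRank : ∀ {m n} (A : Matrix F m n) → rank F A ≡ greedyRank zeroSpace A
  rank≡greedyRank {m} {n} A = ℕₚ.≤-antisym
    (max≤v⁺ z≤n (All.tabulate below))
    (v≤max⁺ 0 sizes (inj₂ (lose (∈ₚ.∈-map⁺ ∣_∣ (∈ₚ.∈-filter⁺ (independentRows? F A) (∈-vecs in-bool S)
        (independentRows⇐ A S ind)))
      (ℕₚ.≤-reflexive (sym card)))))
    where
    sizes = map ∣_∣ (filter (independentRows? F A) (subsets m))
    sub = coordinate-isSubspace (noColumns {n})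
    attained = greedyRank-attained zeroSpace A sub
    S = proj₁ attained
    ind = proj₁ (proj₂ attained)
    card = proj₂ (proj₂ attained)
    in-bool : ∀ b → b ∈ inside ∷ outside ∷ []
    in-bool true  = Any.here refl
    in-bool false = Any.there (Any.here refl)
    below : ∀ {k} → k ∈ sizes → k ≤ℕ greedyRank zeroSpace A
    below k∈ with T , T∈ , refl ← ∈ₚ.∈-map⁻ ∣_∣ k∈ =
      greedyRank-maximal zeroSpace A sub T (independentRows⇒ A T
          (proj₂ (∈ₚ.∈-filter⁻ (independentRows? F A) {xs = subsets m} T∈)))

  -- Matrix counts as rank sums

  rowWithin : ∀ {n} → Subset n → Vec Carrier n → ℤ
  rowWithin []            []      = 1ℤ
  rowWithin (inside ∷ β)  (a ∷ v) = rowWithin β v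
  rowWithin (outside ∷ β) (a ∷ v) = 𝟙 (does (a ≟ᶠ 0#)) * rowWithin β v

  within : ∀ {m n} → Board m n → Matrix F m n → ℤ
  within []      []      = 1ℤ
  within (β ∷ B) (v ∷ A) = rowWithin β v * within B A

  ∑⊆-∑supp : ∀ {n} (β : Subset n) f → ∑⊆ β (λ σ → ∑supp σ f) ≡ ∑ (vecs elements n) (λ v → rowWithin β v * f v)
  ∑⊆-∑supp []            f = sym (trans (ℤₚ.+-identityʳ (1ℤ * f [])) (ℤₚ.*-identityˡ (f [])))
  ∑⊆-∑supp {suc n} (inside ∷ β)  f = begin
    ∑⊆ β (λ σ → ∑ units (λ a → ∑supp σ (λ v → f (a ∷ v)))) + ∑⊆ β (λ σ → ∑supp σ (λ v → f (0# ∷ v)))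
      ≡⟨ cong (_+ ∑⊆ β (λ σ → ∑supp σ (λ v → f (0# ∷ v)))) (∑⊆-swap β units (λ σ a → ∑supp σ (λ v → f (a ∷ v)))) ⟩
    ∑ units row + row 0#
      ≡⟨ ∑-elements row ⟨
    ∑ elements row
      ≡⟨ ∑-cong elements (λ a → ∑⊆-∑supp β (λ v → f (a ∷ v))) ⟩
    ∑ elements (λ a → ∑ (vecs elements n) (λ v → rowWithin β v * f (a ∷ v)))
      ≡⟨ ∑-vecs elements n (λ v → rowWithin (inside ∷ β) v * f v) ⟨
    ∑ (vecs elements (suc n)) (λ v → rowWithin (inside ∷ β) v * f v) ∎
    where
    open ≡-Reasoning
    row : Carrier → ℤ
    row a = ∑⊆ β (λ σ → ∑supp σ (λ v → f (a ∷ v)))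
  ∑⊆-∑supp {suc n} (outside ∷ β) f = begin
    ∑⊆ β (λ σ → ∑supp σ (λ v → f (0# ∷ v)))
      ≡⟨ ∑⊆-∑supp β (λ v → f (0# ∷ v)) ⟩
    row 0#
      ≡⟨ ∑-δ elements-enumerates _≟ᶠ_ 0# row ⟨
    ∑ elements (λ a → 𝟙 (does (a ≟ᶠ 0#)) * row a)
      ≡⟨ ∑-cong elements (λ a → trans (sym (∑-*ˡ (vecs elements n) (𝟙 (does (a ≟ᶠ 0#)))
          (λ v → rowWithin β v * f (a ∷ v))))
           (∑-cong (vecs elements n) (λ v → sym (ℤₚ.*-assoc (𝟙 (does (a ≟ᶠ 0#))) (rowWithin β v) (f (a ∷ v)))))) ⟩
    ∑ elements (λ a → ∑ (vecs elements n) (λ v → rowWithin (outside ∷ β) (a ∷ v) * f (a ∷ v)))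
      ≡⟨ ∑-vecs elements n (λ v → rowWithin (outside ∷ β) v * f v) ⟨
    ∑ (vecs elements (suc n)) (λ v → rowWithin (outside ∷ β) v * f v) ∎
    where
    open ≡-Reasoning
    row : Carrier → ℤ
    row a = ∑ (vecs elements n) (λ v → rowWithin β v * f (a ∷ v))

  rankWeight : ∀ {m n} → Region n → (ℕ → ℤ) → Matrix F m n → ℤ
  rankWeight {m} V ω A = x ^ (m ∸ greedyRank V A) * ω (greedyRank V A)

  rankSum-matrices : ∀ {m n} (V : Region n) (B : Board m n) ω → rankSum V B ω ≡ ∑ (matrices F m n)
      (λ A → within B A * rankWeight V ω A)
  rankSum-matrices V []      ω = sym (trans (ℤₚ.+-identityʳ (1ℤ * (1ℤ * ω 0)))
      (trans (ℤₚ.*-identityˡ (1ℤ * ω 0)) (ℤₚ.*-identityˡ (ω 0))))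
  rankSum-matrices {suc m} {n} V (β ∷ B) ω = begin
    ∑⊆ β (λ σ → ∑supp σ (rankStep V B ω))
      ≡⟨ ∑⊆-∑supp β (rankStep V B ω) ⟩
    ∑ (vecs elements n) (λ v → rowWithin β v * rankStep V B ω v)
      ≡⟨ ∑-cong (vecs elements n) (λ v → trans (cong (rowWithin β v *_) (step v (mem? V v)))
           (trans (sym (∑-*ˡ (matrices F m n) (rowWithin β v) (λ A → within B A * rankWeight V ω (v ∷ A))))
             (∑-cong (matrices F m n) (λ A → sym (ℤₚ.*-assoc (rowWithin β v) (within B A)
                 (rankWeight V ω (v ∷ A))))))) ⟩
    ∑ (vecs elements n) (λ v → ∑ (matrices F m n) (λ A → within (β ∷ B) (v ∷ A) * rankWeight V ω (v ∷ A)))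
      ≡⟨ ∑-vecs (vecs elements n) m (λ A → within (β ∷ B) A * rankWeight V ω A) ⟨
    ∑ (matrices F (suc m) n) (λ A → within (β ∷ B) A * rankWeight V ω A) ∎
    where
    open ≡-Reasoning
    step : ∀ v → Dec (Mem V v) → rankStep V B ω v ≡ ∑ (matrices F m n) (λ A → within B A * rankWeight V ω (v ∷ A))
    step v (yes v∈V) = trans (rankStep-∈ {V = V} B ω v∈V) (trans (cong (x *_) (rankSum-matrices V B ω))
      (trans (sym (∑-*ˡ (matrices F m n) x (λ A → within B A * rankWeight V ω A)))
          (∑-cong (matrices F m n) weight)))
      where
      rearrange : ∀ x w X o → x * (w * (X * o)) ≡ w * (x * X * o)
      rearrange = solve-∀
      weight : ∀ A → x * (within B A * rankWeight V ω A) ≡ within B A * rankWeight V ω (v ∷ A)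
      weight A = trans (rearrange x (within B A) (x ^ (m ∸ greedyRank V A)) (ω (greedyRank V A)))
        (cong (within B A *_) (trans (cong (λ k → x ^ k * ω (greedyRank V A))
            (sym (ℕₚ.+-∸-assoc 1 (greedyRank≤m V A))))
          (cong (λ g → x ^ (suc m ∸ g) * ω g) (sym (greedyRank-∈ {V = V} A v∈V)))))
    step v (no v∉V) = trans (rankStep-∉ {V = V} B ω v∉V) (trans (rankSum-matrices (V ⊞ v) B (ω ∘ suc))
      (∑-cong (matrices F m n) (λ A → cong (λ g → within B A * (x ^ (suc m ∸ g) * ω g))
          (sym (greedyRank-∉ {V = V} A v∉V)))))

  RowSupportedIn : ∀ {n} → Subset n → Vec Carrier n → Set
  RowSupportedIn β v = ∀ j → lookup v j ≢ 0# → lookup β j ≡ inside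

  rowWithin-𝟙 : ∀ {n} (β : Subset n) v → (RowSupportedIn β v × rowWithin β v ≡ 1ℤ) ⊎
      (¬ RowSupportedIn β v × rowWithin β v ≡ 0ℤ)
  rowWithin-𝟙 []            []      = inj₁ ((λ ()) , refl)
  rowWithin-𝟙 (inside ∷ β)  (a ∷ v) with rowWithin-𝟙 β v
  ... | inj₁ (p , eq)  = inj₁ ((λ { zero _ → refl ; (suc j) → p j }) , eq)
  ... | inj₂ (¬p , eq) = inj₂ ((λ p → ¬p (p ∘ suc)) , eq)
  rowWithin-𝟙 (outside ∷ β) (a ∷ v) = by-cases (a ≟ᶠ 0#) (rowWithin-𝟙 β v)
    where
    by-cases : Dec (a ≡ 0#) → (RowSupportedIn β v × rowWithin β v ≡ 1ℤ) ⊎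
        (¬ RowSupportedIn β v × rowWithin β v ≡ 0ℤ) →
               (RowSupportedIn (outside ∷ β) (a ∷ v) × rowWithin (outside ∷ β) (a ∷ v) ≡ 1ℤ) ⊎
               (¬ RowSupportedIn (outside ∷ β) (a ∷ v) × rowWithin (outside ∷ β) (a ∷ v) ≡ 0ℤ)
    by-cases (no a≢0)  _              = inj₂ ((λ p → contradiction (p zero a≢0) λ ()) , cong (_* rowWithin β v)
        (𝟙-false (a ≟ᶠ 0#) a≢0))
    by-cases (yes a≡0) (inj₁ (p , eq)) = inj₁ ((λ { zero a≢0 → contradiction a≡0 a≢0 ; (suc j) → p j }) ,
                                               cong₂ _*_ (𝟙-true (a ≟ᶠ 0#) a≡0) eq)
    by-cases (yes a≡0) (inj₂ (¬p , eq)) = inj₂ ((λ p → ¬p (p ∘ suc)) , cong₂ _*_ (𝟙-true (a ≟ᶠ 0#) a≡0) eq)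

  within-𝟙 : ∀ {m n} (B : Board m n) A → (SupportedIn F B A × within B A ≡ 1ℤ) ⊎
      (¬ SupportedIn F B A × within B A ≡ 0ℤ)
  within-𝟙 []      []      = inj₁ ((λ ()) , refl)
  within-𝟙 (β ∷ B) (v ∷ A) with rowWithin-𝟙 β v | within-𝟙 B A
  ... | inj₁ (p , eq)  | inj₁ (s , eq′)  = inj₁ ((λ { zero j ne → Vecₚ.lookup⇒[]= j β (p j ne) ; (suc i) → s i }) ,
      cong₂ _*_ eq eq′)
  ... | inj₁ (p , eq)  | inj₂ (¬s , eq′) = inj₂ ((λ s → ¬s (s ∘ suc)) , cong₂ _*_ eq eq′)
  ... | inj₂ (¬p , eq) | _               = inj₂ ((λ s → ¬p (λ j ne → Vecₚ.[]=⇒lookup (s zero j ne))) , cong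
      (_* within B A) eq)

  supported-within : ∀ {m n} (B : Board m n) A → 𝟙 (does (supportedIn? F B A)) ≡ within B A
  supported-within B A with within-𝟙 B A
  ... | inj₁ (s , eq)  = trans (𝟙-true (supportedIn? F B A) s) (sym eq)
  ... | inj₂ (¬s , eq) = trans (𝟙-false (supportedIn? F B A) ¬s) (sym eq)

  -- Once `rankIs r` fixes the rank, the weight of a matrix in the rank sum is the constant x ^ (m ∸
  -- r).
  matrixCount-rankSum : ∀ {m n} (B : Board m n) r → x ^ (m ∸ r) * + matrixCount F B r ≡ rankSum zeroSpace B
      (rankIs r)
  matrixCount-rankSum {m} {n} B r = begin
    x ^ (m ∸ r) * + matrixCount F B r
      ≡⟨ cong (x ^ (m ∸ r) *_) (length-filter (λ A → supportedIn? F B A Dec.×-dec (rank F A ℕ.≟ r))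
          (matrices F m n)) ⟩
    x ^ (m ∸ r) * ∑ (matrices F m n) (λ A → 𝟙 (does (supportedIn? F B A) ∧ does (rank F A ℕ.≟ r)))
      ≡⟨ ∑-*ˡ (matrices F m n) (x ^ (m ∸ r)) (λ A → 𝟙 (does (supportedIn? F B A) ∧ does (rank F A ℕ.≟ r))) ⟨
    ∑ (matrices F m n) (λ A → x ^ (m ∸ r) * 𝟙 (does (supportedIn? F B A) ∧ does (rank F A ℕ.≟ r)))
      ≡⟨ ∑-cong (matrices F m n) weight ⟩
    ∑ (matrices F m n) (λ A → within B A * rankWeight zeroSpace (rankIs r) A)
      ≡⟨ rankSum-matrices zeroSpace B (rankIs r) ⟨
    rankSum zeroSpace B (rankIs r) ∎
    where
    open ≡-Reasoning
    rearrange : ∀ X w o → X * (w * o) ≡ w * (X * o)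
    rearrange = solve-∀
    at-rank : ∀ g → x ^ (m ∸ r) * rankIs r g ≡ x ^ (m ∸ g) * rankIs r g
    at-rank g with g ℕ.≟ r
    ... | yes refl = refl
    ... | no g≢r   = trans (vanish (x ^ (m ∸ r))) (sym (vanish (x ^ (m ∸ g))))
      where
      vanish : ∀ X → X * rankIs r g ≡ 0ℤ
      vanish X = trans (cong (X *_) (𝟙-false (g ℕ.≟ r) g≢r)) (ℤₚ.*-zeroʳ X)
    weight : ∀ A → x ^ (m ∸ r) * 𝟙 (does (supportedIn? F B A) ∧ does (rank F A ℕ.≟ r))
        ≡ within B A * rankWeight zeroSpace (rankIs r) A
    weight A = begin
      x ^ (m ∸ r) * 𝟙 (does (supportedIn? F B A) ∧ does (rank F A ℕ.≟ r))
        ≡⟨ cong (x ^ (m ∸ r) *_) (trans (𝟙-∧ (does (supportedIn? F B A)) (does (rank F A ℕ.≟ r)))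
             (cong₂ (λ u g → u * rankIs r g) (supported-within B A) (rank≡greedyRank A))) ⟩
      x ^ (m ∸ r) * (within B A * rankIs r (greedyRank zeroSpace A))
        ≡⟨ trans (rearrange (x ^ (m ∸ r)) (within B A) (rankIs r (greedyRank zeroSpace A)))
            (cong (within B A *_) (at-rank (greedyRank zeroSpace A))) ⟩
      within B A * rankWeight zeroSpace (rankIs r) A ∎

  -- Cancelling x ^ (m ∸ r) turns the congruence modulo x ^ (m + 2) into one modulo x ^ (r + 2). The
  -- remainder z is exposed so that division by x ^ r visibly yields an integer.
  matrixCount-expansion : ∀ {m n} (B : Board m n) r → r ≤ℕ m → ∃ λ z →
    + matrixCount F B r ≡ x ^ r * (rookSum B noColumns (rankIs r) + x * extraSum B noColumns (rankIs r) + x *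
        (x * z))
  matrixCount-expansion {m} {n} B r r≤m with difference (coordinate-rankSum B (rankIs r) noColumns)
  ... | divides z eq = z , ℤₚ.*-cancelˡ-≡ (x ^ (m ∸ r)) _ _ {{x^≢0 (m ∸ r)}} (begin
    x ^ (m ∸ r) * + matrixCount F B r
      ≡⟨ matrixCount-rankSum B r ⟩
    rankSum zeroSpace B (rankIs r)
      ≡⟨ restore (rankSum zeroSpace B (rankIs r)) (x ^ m * (R + x * E)) ⟩
    rankSum zeroSpace B (rankIs r) - x ^ m * (R + x * E) + x ^ m * (R + x * E)
      ≡⟨ cong (_+ x ^ m * (R + x * E)) eq ⟩
    z * (x * (x * x ^ m)) + x ^ m * (R + x * E)
      ≡⟨ cong (λ X → z * (x * (x * X)) + X * (R + x * E)) (trans (cong (x ^_) (sym (ℕₚ.m∸n+n≡m r≤m)))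
          (ℤₚ.^-distribˡ-+-* x (m ∸ r) r)) ⟩
    z * (x * (x * (x ^ (m ∸ r) * x ^ r))) + x ^ (m ∸ r) * x ^ r * (R + x * E)
      ≡⟨ collect x (x ^ (m ∸ r)) (x ^ r) z R E ⟩
    x ^ (m ∸ r) * (x ^ r * (R + x * E + x * (x * z))) ∎)
    where
    open ≡-Reasoning
    R = rookSum B noColumns (rankIs r)
    E = extraSum B noColumns (rankIs r)
    x^≢0 : ∀ k → ℤ.NonZero (x ^ k)
    x^≢0 zero    = _
    x^≢0 (suc k) = ℤₚ.i*j≢0 x (x ^ k) {{q-1≢0}} {{x^≢0 k}}
    restore : ∀ a b → a ≡ a - b + b
    restore = solve-∀
    collect : ∀ x X Y z r e → z * (x * (x * (X * Y))) + X * Y * (r + x * e) ≡ X * (Y * (r + x * e + x * (x * z)))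
    collect = solve-∀

-- Placements and permutations

Assignment : ℕ → ℕ → Set
Assignment m n = Vec (Fin n) m

assignments : ∀ m n → List (Assignment m n)
assignments m n = vecs (allFin n) m

-- `Fresh` and `injective` state one condition twice: as a proposition to argue from, and as a 0/1
-- factor to sum with.
Fresh : ∀ {m n} → Columns n → Assignment m n → Set
Fresh C []      = ⊤
Fresh C (c ∷ w) = C c ≡ false × Fresh (C ◂ c) w

injective : ∀ {m n} → Columns n → Assignment m n → ℤ
injective C []      = 1ℤ
injective C (c ∷ w) = 𝟙 (not (C c)) * injective (C ◂ c) w

fresh-or-0 : ∀ {m n} C (w : Assignment m n) → (Fresh C w × injective C w ≡ 1ℤ) ⊎ injective C w ≡ 0ℤ
fresh-or-0 C []      = inj₁ (tt , refl)
fresh-or-0 C (c ∷ w) with C c in Cc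
... | true  = inj₂ refl
... | false with fresh-or-0 (C ◂ c) w
...   | inj₁ (f , eq) = inj₁ ((refl , f) , trans (ℤₚ.*-identityˡ (injective (C ◂ c) w)) eq)
...   | inj₂ eq       = inj₂ (trans (ℤₚ.*-identityˡ (injective (C ◂ c) w)) eq)

-- Under the weight `injective`, a summand has to be computed only for assignments with distinct
-- columns outside C.
injective-cong : ∀ {m n} C (w : Assignment m n) {k l} → (Fresh C w → k ≡ l) → injective C w * k ≡ injective C w * l
injective-cong C w {k} {l} eq with fresh-or-0 C w
... | inj₁ (f , _) = cong (injective C w *_) (eq f)
... | inj₂ z       = trans (cong (_* k) z) (sym (cong (_* l) z))

fresh-avoids : ∀ {m n} C (w : Assignment m n) → Fresh C w → ∀ i → C (lookup w i) ≡ false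
fresh-avoids C (c ∷ w) (Cc , f) zero    = Cc
fresh-avoids C (c ∷ w) (Cc , f) (suc i) = proj₁ (◂-false C (fresh-avoids (C ◂ c) w f i))

empties : ∀ {m n} → Placement m n → ℕ
empties []            = 0
empties (nothing ∷ p) = suc (empties p)
empties (just c ∷ p)  = empties p

rooks+empties : ∀ {m n} (p : Placement m n) → rooks p ℕ.+ empties p ≡ m
rooks+empties []            = refl
rooks+empties (nothing ∷ p) = trans (ℕₚ.+-suc (rooks p) (empties p)) (cong suc (rooks+empties p))
rooks+empties (just c ∷ p)  = cong suc (rooks+empties p)

avoiding : ∀ {m n} → Columns n → Placement m n → ℤ
avoiding C []            = 1ℤ
avoiding C (nothing ∷ p) = avoiding C p
avoiding C (just c ∷ p)  = 𝟙 (not (C c)) * avoiding (C ◂ c) p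

avoiding-cong : ∀ {m n} {C D : Columns n} → C ≗ D → ∀ (p : Placement m n) → avoiding C p ≡ avoiding D p
avoiding-cong C≗D []            = refl
avoiding-cong C≗D (nothing ∷ p) = avoiding-cong C≗D p
avoiding-cong C≗D (just c ∷ p)  = cong₂ _*_ (cong (𝟙 ∘ not) (C≗D c)) (avoiding-cong (◂-cong c C≗D) p)

onBoard : ∀ {m n} → Board m n → Placement m n → ℤ
onBoard []      []            = 1ℤ
onBoard (β ∷ B) (nothing ∷ p) = onBoard B p
onBoard (β ∷ B) (just c ∷ p)  = 𝟙 (lookup β c) * onBoard B p

valid-avoiding : ∀ {m n} (B : Board m n) C p → valid B C p ≡ avoiding C p * onBoard B p
valid-avoiding []      C []            = refl
valid-avoiding (β ∷ B) C (nothing ∷ p) = valid-avoiding B C p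
valid-avoiding (β ∷ B) C (just c ∷ p)  = trans (cong (λ v → 𝟙 (lookup β c) * (𝟙 (not (C c)) * v))
    (valid-avoiding B (C ◂ c) p))
  (rearrange (𝟙 (lookup β c)) (𝟙 (not (C c))) (avoiding (C ◂ c) p) (onBoard B p))
  where
  rearrange : ∀ b c a o → b * (c * (a * o)) ≡ c * a * (b * o)
  rearrange = solve-∀

extends : ∀ {m n} → Placement m n → Assignment m n → ℤ
extends []            []      = 1ℤ
extends (nothing ∷ p) (c ∷ w) = extends p w
extends (just d ∷ p)  (c ∷ w) = 𝟙 (c == d) * extends p w

free : ∀ {n} → Columns n → ℤ
free C = ∑ᶠ (λ c → 𝟙 (not (C c)))

falling : ℤ → ℕ → ℤ
falling z zero    = 1ℤ
falling z (suc k) = z * falling (z - 1ℤ) k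

𝟙-not-split : ∀ {n} (C : Columns n) {c} → C c ≡ false → ∀ d → 𝟙 (not (C d)) ≡ 𝟙 (d == c) * 1ℤ + 𝟙 (not ((C ◂ c) d))
𝟙-not-split C {c} Cc d rewrite 𝟙-not-◂ C c d with d Fin.≟ c
... | yes refl rewrite Cc = refl
... | no _ = lemma (𝟙 (not (C d)))
  where
  lemma : ∀ a → a ≡ 0ℤ * 1ℤ + a * 1ℤ
  lemma = solve-∀

∑-fresh-split : ∀ {n} (C : Columns n) {c} → C c ≡ false → ∀ (f : Fin n → ℤ) →
                ∑ᶠ (λ d → 𝟙 (not (C d)) * f d) ≡ f c + ∑ᶠ (λ d → 𝟙 (not ((C ◂ c) d)) * f d)
∑-fresh-split C {c} Cc f = trans (∑ᶠ-cong (λ d → trans (cong (_* f d) (𝟙-not-split C Cc d))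
    (distrib (𝟙 (d == c)) (𝟙 (not ((C ◂ c) d))) (f d))))
  (trans (∑ᶠ-+ (λ d → 𝟙 (d == c) * f d) (λ d → 𝟙 (not ((C ◂ c) d)) * f d))
      (cong (_+ ∑ᶠ (λ d → 𝟙 (not ((C ◂ c) d)) * f d)) (∑ᶠ-δ c f)))
  where
  distrib : ∀ e u f → (e * 1ℤ + u) * f ≡ e * f + u * f
  distrib = solve-∀

free-◂ : ∀ {n} (C : Columns n) {c} → C c ≡ false → free C ≡ 1ℤ + free (C ◂ c)
free-◂ C {c} Cc = trans (∑ᶠ-cong (λ d → sym (ℤₚ.*-identityʳ (𝟙 (not (C d))))))
  (trans (∑-fresh-split C Cc (λ _ → 1ℤ)) (cong (_+_ 1ℤ) (∑ᶠ-cong (λ d → ℤₚ.*-identityʳ (𝟙 (not ((C ◂ c) d)))))))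

-- If p avoids C, its rooks occupy `rooks p` of the columns outside C, and c ranges over the others.
avoiding-sum : ∀ {m n} (C : Columns n) (p : Placement m n) →
               ∑ᶠ (λ c → 𝟙 (not (C c)) * avoiding (C ◂ c) p) ≡ avoiding C p * (free C - + rooks p)
avoiding-sum C []            = trans (∑ᶠ-cong (λ c → ℤₚ.*-identityʳ (𝟙 (not (C c))))) (lemma (free C))
  where
  lemma : ∀ f → f ≡ 1ℤ * (f - 0ℤ)
  lemma = solve-∀
avoiding-sum C (nothing ∷ p) = avoiding-sum C p
avoiding-sum {n = n} C (just d ∷ p) = trans (∑ᶠ-cong exchange-columns)
  (trans (∑-*ˡ (allFin n) (𝟙 (not (C d))) (λ c → 𝟙 (not ((C ◂ d) c)) * avoiding (C ◂ d ◂ c) p))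
    (trans (cong (𝟙 (not (C d)) *_) (avoiding-sum (C ◂ d) p)) lower))
  where
  exchange-columns : ∀ c → 𝟙 (not (C c)) * (𝟙 (not ((C ◂ c) d)) * avoiding (C ◂ c ◂ d) p) ≡
                     𝟙 (not (C d)) * (𝟙 (not ((C ◂ d) c)) * avoiding (C ◂ d ◂ c) p)
  exchange-columns c rewrite 𝟙-not-◂ C c d | 𝟙-not-◂ C d c | ==-sym d c | avoiding-cong (◂-comm C c d) p =
    lemma (𝟙 (not (C c))) (𝟙 (not (C d))) (𝟙 (not (c == d))) (avoiding (C ◂ d ◂ c) p)
    where
    lemma : ∀ a b e v → a * (b * e * v) ≡ b * (a * e * v)
    lemma = solve-∀
  lower : 𝟙 (not (C d)) * (avoiding (C ◂ d) p * (free (C ◂ d) - + rooks p)) ≡ 𝟙 (not (C d)) * avoiding (C ◂ d) p *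
      (free C - + suc (rooks p))
  lower with C d in Cd
  ... | true  = refl
  ... | false rewrite free-◂ C Cd = lemma (avoiding (C ◂ d) p) (free (C ◂ d)) (+ rooks p)
    where
    lemma : ∀ a f r → 1ℤ * (a * (f - r)) ≡ 1ℤ * a * (1ℤ + f - (1ℤ + r))
    lemma = solve-∀

-- The empty rows of p are filled one after the other, each with one choice fewer than the one
-- before.
extension-count : ∀ {m n} (C : Columns n) (p : Placement m n) →
  ∑ (assignments m n) (λ w → injective C w * extends p w) ≡ avoiding C p * falling (free C - + rooks p) (empties p)
extension-count C [] = refl
extension-count {suc m} {n} C (nothing ∷ p) = begin
  ∑ (assignments (suc m) n) (λ w → injective C w * extends (nothing ∷ p) w)
    ≡⟨ ∑-vecs (allFin n) m (λ w → injective C w * extends (nothing ∷ p) w) ⟩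
  ∑ᶠ (λ c → ∑ (assignments m n) (λ w → 𝟙 (not (C c)) * injective (C ◂ c) w * extends p w))
    ≡⟨ ∑ᶠ-cong (λ c → trans (∑-cong (assignments m n) (λ w → ℤₚ.*-assoc (𝟙 (not (C c))) (injective (C ◂ c) w)
        (extends p w)))
         (trans (∑-*ˡ (assignments m n) (𝟙 (not (C c))) (λ w → injective (C ◂ c) w * extends p w))
           (trans (cong (𝟙 (not (C c)) *_) (extension-count (C ◂ c) p)) (lower c)))) ⟩
  ∑ᶠ (λ c → 𝟙 (not (C c)) * avoiding (C ◂ c) p * falling (free C - + rooks p - 1ℤ) (empties p))
    ≡⟨ ∑-*ʳ (allFin n) (falling (free C - + rooks p - 1ℤ) (empties p)) (λ c → 𝟙 (not (C c)) * avoiding (C ◂ c) p) ⟩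
  ∑ᶠ (λ c → 𝟙 (not (C c)) * avoiding (C ◂ c) p) * falling (free C - + rooks p - 1ℤ) (empties p)
    ≡⟨ trans (cong (_* falling (free C - + rooks p - 1ℤ) (empties p)) (avoiding-sum C p))
         (ℤₚ.*-assoc (avoiding C p) (free C - + rooks p) (falling (free C - + rooks p - 1ℤ) (empties p))) ⟩
  avoiding C p * falling (free C - + rooks p) (suc (empties p)) ∎
  where
  open ≡-Reasoning
  lower : ∀ c → 𝟙 (not (C c)) * (avoiding (C ◂ c) p * falling (free (C ◂ c) - + rooks p) (empties p)) ≡
          𝟙 (not (C c)) * avoiding (C ◂ c) p * falling (free C - + rooks p - 1ℤ) (empties p)
  lower c with C c in Cc
  ... | true  = refl
  ... | false = trans (sym (ℤₚ.*-assoc 1ℤ (avoiding (C ◂ c) p) _))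
    (cong (λ z → 1ℤ * avoiding (C ◂ c) p * falling z (empties p))
        (trans (shift (free (C ◂ c)) (+ rooks p)) (cong (λ z → z - + rooks p - 1ℤ) (sym (free-◂ C Cc)))))
    where
    shift : ∀ f r → f - r ≡ 1ℤ + f - r - 1ℤ
    shift = solve-∀
extension-count {suc m} {n} C (just d ∷ p) = begin
  ∑ (assignments (suc m) n) (λ w → injective C w * extends (just d ∷ p) w)
    ≡⟨ ∑-vecs (allFin n) m (λ w → injective C w * extends (just d ∷ p) w) ⟩
  ∑ᶠ (λ c → ∑ (assignments m n) (λ w → 𝟙 (not (C c)) * injective (C ◂ c) w * (𝟙 (c == d) * extends p w)))
    ≡⟨ ∑ᶠ-cong (λ c → trans (∑-cong (assignments m n) (λ w → rearrange (𝟙 (not (C c))) (injective (C ◂ c) w)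
        (𝟙 (c == d)) (extends p w)))
         (∑-*ˡ² (assignments m n) (𝟙 (c == d)) (𝟙 (not (C c))) (λ w → injective (C ◂ c) w * extends p w))) ⟩
  ∑ᶠ (λ c → 𝟙 (c == d) * (𝟙 (not (C c)) * ∑ (assignments m n) (λ w → injective (C ◂ c) w * extends p w)))
    ≡⟨ ∑ᶠ-δ d (λ c → 𝟙 (not (C c)) * ∑ (assignments m n) (λ w → injective (C ◂ c) w * extends p w)) ⟩
  𝟙 (not (C d)) * ∑ (assignments m n) (λ w → injective (C ◂ d) w * extends p w)
    ≡⟨ cong (𝟙 (not (C d)) *_) (extension-count (C ◂ d) p) ⟩
  𝟙 (not (C d)) * (avoiding (C ◂ d) p * falling (free (C ◂ d) - + rooks p) (empties p))
    ≡⟨ lower ⟩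
  𝟙 (not (C d)) * avoiding (C ◂ d) p * falling (free C - + suc (rooks p)) (empties p) ∎
  where
  open ≡-Reasoning
  rearrange : ∀ a i e x → a * i * (e * x) ≡ e * (a * (i * x))
  rearrange = solve-∀
  lower : 𝟙 (not (C d)) * (avoiding (C ◂ d) p * falling (free (C ◂ d) - + rooks p) (empties p)) ≡
          𝟙 (not (C d)) * avoiding (C ◂ d) p * falling (free C - + suc (rooks p)) (empties p)
  lower with C d in Cd
  ... | true  = refl
  ... | false = trans (sym (ℤₚ.*-assoc 1ℤ (avoiding (C ◂ d) p) _))
    (cong (λ z → 1ℤ * avoiding (C ◂ d) p * falling z (empties p))
        (trans (shift (free (C ◂ d)) (+ rooks p)) (cong (_- + suc (rooks p)) (sym (free-◂ C Cd)))))
    where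
    shift : ∀ f r → f - r ≡ 1ℤ + f - (1ℤ + r)
    shift = solve-∀

restrict : ∀ {m n} → Assignment m n → Subset m → Placement m n
restrict []      []            = []
restrict (c ∷ w) (inside ∷ S)  = just c ∷ restrict w S
restrict (c ∷ w) (outside ∷ S) = nothing ∷ restrict w S

∑-subsets : ∀ n (f : Subset (suc n) → ℤ) → ∑ (subsets (suc n)) f ≡ ∑ (subsets n) (λ S → f (inside ∷ S)) + ∑
    (subsets n) (λ S → f (outside ∷ S))
∑-subsets n f = trans (∑-vecs (inside ∷ outside ∷ []) n f)
  (cong (_+_ (∑ (subsets n) (λ S → f (inside ∷ S)))) (ℤₚ.+-identityʳ (∑ (subsets n) (λ S → f (outside ∷ S)))))

-- The placements that w extends are its restrictions to sets of rows.
∑-extends : ∀ {m n} (w : Assignment m n) (G : Placement m n → ℤ) → ∑ (placements m n) (λ p → extends p w * G p) ≡ ∑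
    (subsets m) (λ S → G (restrict w S))
∑-extends []      G = cong (_+ 0ℤ) (ℤₚ.*-identityˡ (G []))
∑-extends {suc m} {n} (c ∷ w) G = begin
  ∑ (placements (suc m) n) (λ p → extends p (c ∷ w) * G p)
    ≡⟨ ∑-placements m n (λ p → extends p (c ∷ w) * G p) ⟩
  ∑ (placements m n) (λ p → extends p w * G (nothing ∷ p)) + ∑ᶠ
      (λ d → ∑ (placements m n) (λ p → 𝟙 (c == d) * extends p w * G (just d ∷ p)))
    ≡⟨ cong₂ _+_ (∑-extends w (λ p → G (nothing ∷ p))) (trans (∑ᶠ-cong (λ d → trans
         (∑-cong (placements m n) (λ p → trans (cong (λ b → 𝟙 b * extends p w * G (just d ∷ p)) (==-sym c d))
             (ℤₚ.*-assoc (𝟙 (d == c)) (extends p w) (G (just d ∷ p)))))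
         (∑-*ˡ (placements m n) (𝟙 (d == c)) (λ p → extends p w * G (just d ∷ p)))))
           (trans (∑ᶠ-δ c (λ d → ∑ (placements m n) (λ p → extends p w * G (just d ∷ p))))
               (∑-extends w (λ p → G (just c ∷ p))))) ⟩
  ∑ (subsets m) (λ S → G (nothing ∷ restrict w S)) + ∑ (subsets m) (λ S → G (just c ∷ restrict w S))
    ≡⟨ ℤₚ.+-comm (∑ (subsets m) (λ S → G (nothing ∷ restrict w S)))
        (∑ (subsets m) (λ S → G (just c ∷ restrict w S))) ⟩
  ∑ (subsets m) (λ S → G (just c ∷ restrict w S)) + ∑ (subsets m) (λ S → G (nothing ∷ restrict w S))
    ≡⟨ ∑-subsets m (λ S → G (restrict (c ∷ w) S)) ⟨
  ∑ (subsets (suc m)) (λ S → G (restrict (c ∷ w) S)) ∎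
  where open ≡-Reasoning

free-noColumns : ∀ n → free (noColumns {n}) ≡ + n
free-noColumns n = trans (∑-const (allFin n) 1ℤ) (trans (ℤₚ.*-identityʳ (+ length (allFin n)))
    (cong +_ (Listₚ.length-tabulate {n = n} id)))

falling-factorial : ∀ k → falling (+ k) k ≡ + (k !)
falling-factorial zero    = refl
falling-factorial (suc k) = trans (cong (+ suc k *_) (falling-factorial k)) (sym (ℤₚ.pos-* (suc k) (k !)))

-- A non-attacking placement p extends to (empties p) ! full placements.
placements-to-assignments : ∀ {n} (B : Board n n) (H : Placement n n → ℤ) →
  ∑ (placements n n) (λ p → valid B noColumns p * (+ (empties p !) * H p)) ≡
  ∑ (assignments n n) (λ w → injective noColumns w * ∑ (subsets n)
      (λ S → onBoard B (restrict w S) * H (restrict w S)))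
placements-to-assignments {n} B H = begin
  ∑ (placements n n) (λ p → valid B noColumns p * (+ (empties p !) * H p))
    ≡⟨ ∑-cong (placements n n) expand ⟩
  ∑ (placements n n) (λ p → ∑ (assignments n n) (λ w → injective noColumns w * (extends p w * (onBoard B p * H p))))
    ≡⟨ ∑-swap (placements n n) (assignments n n) (λ p w → injective noColumns w *
        (extends p w * (onBoard B p * H p))) ⟩
  ∑ (assignments n n) (λ w → ∑ (placements n n) (λ p → injective noColumns w * (extends p w * (onBoard B p * H p))))
    ≡⟨ ∑-cong (assignments n n) (λ w → trans (∑-*ˡ (placements n n) (injective noColumns w)
        (λ p → extends p w * (onBoard B p * H p)))
         (cong (injective noColumns w *_) (∑-extends w (λ p → onBoard B p * H p)))) ⟩
  ∑ (assignments n n) (λ w → injective noColumns w * ∑ (subsets n)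
      (λ S → onBoard B (restrict w S) * H (restrict w S))) ∎
  where
  open ≡-Reasoning
  difference-nat : ∀ a b → + (a ℕ.+ b) - + a ≡ + b
  difference-nat a b = trans (cong (_- + a) (ℤₚ.pos-+ a b)) (cancel (+ a) (+ b))
    where
    cancel : ∀ a b → a + b - a ≡ b
    cancel = solve-∀
  factorial : ∀ p → falling (free (noColumns {n}) - + rooks p) (empties p) ≡ + (empties p !)
  factorial p = trans (cong (λ z → falling z (empties p)) (trans
      (cong (_- + rooks p) (trans (free-noColumns n) (cong +_ (sym (rooks+empties p)))))
    (difference-nat (rooks p) (empties p)))) (falling-factorial (empties p))
  rearrange : ∀ a o f h → a * o * (f * h) ≡ a * f * (o * h)
  rearrange = solve-∀
  expand : ∀ p → valid B noColumns p * (+ (empties p !) * H p) ≡ ∑ (assignments n n)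
      (λ w → injective noColumns w * (extends p w * (onBoard B p * H p)))
  expand p = trans (cong (_* (+ (empties p !) * H p)) (valid-avoiding B noColumns p))
    (trans (rearrange (avoiding noColumns p) (onBoard B p) (+ (empties p !)) (H p))
      (trans (cong (λ z → avoiding noColumns p * z * (onBoard B p * H p)) (sym (factorial p)))
        (trans (cong (_* (onBoard B p * H p)) (sym (extension-count noColumns p)))
          (trans (sym (∑-*ʳ (assignments n n) (onBoard B p * H p) (λ w → injective noColumns w * extends p w)))
            (∑-cong (assignments n n) (λ w → ℤₚ.*-assoc (injective noColumns w) (extends p w)
                (onBoard B p * H p)))))))

𝟙-nonneg : ∀ b → 0ℤ ≤ 𝟙 b
𝟙-nonneg true  = +≤+ z≤n
𝟙-nonneg false = +≤+ z≤n

∑ᶠ-𝟙≡0 : ∀ {n} (f : Fin n → Bool) → ∑ᶠ (𝟙 ∘ f) ≡ 0ℤ → ∀ i → f i ≡ false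
∑ᶠ-𝟙≡0 {suc n} f eq i with f zero in f0 | trans (sym (∑ᶠ-suc (𝟙 ∘ f))) eq
... | true  | eq′ = contradiction (subst (1ℤ ≤_) eq′ (ℤₚ.+-monoʳ-≤ 1ℤ
    (∑-nonneg (allFin n) {𝟙 ∘ f ∘ suc} (λ j → 𝟙-nonneg (f (suc j)))))) λ { (+≤+ ()) }
∑ᶠ-𝟙≡0 {suc n} f eq zero    | false | eq′ = f0
∑ᶠ-𝟙≡0 {suc n} f eq (suc i) | false | eq′ = ∑ᶠ-𝟙≡0 (f ∘ suc) (trans (sym (ℤₚ.+-identityˡ (∑ᶠ (𝟙 ∘ f ∘ suc)))) eq′) i

-- By counting, the m distinct entries of w exhaust the m columns outside D.
complement-sum : ∀ {m n} D (w : Assignment m n) → Fresh D w → free D ≡ + m → ∀ (f : Fin n → ℤ) →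
                 ∑ᶠ (λ c → 𝟙 (not (D c)) * f c) ≡ ∑ᶠ (λ i → f (lookup w i))
complement-sum D []      _        free≡0 f = ∑ᶠ-zero (λ c → cong (λ b → 𝟙 b * f c) (∑ᶠ-𝟙≡0 (not ∘ D) free≡0 c))
complement-sum {suc m} D (c ∷ w) (Dc , fw) free≡m f = trans (∑-fresh-split D Dc f)
  (trans (cong (_+_ (f c)) (complement-sum (D ◂ c) w fw (RingProperties.+-cancelˡ ℤₚ.+-*-ring 1ℤ (free (D ◂ c))
      (+ m) (trans (sym (free-◂ D Dc)) free≡m)) f))
         (sym (∑ᶠ-suc (λ i → f (lookup (c ∷ w) i)))))

-- Since the columns of w are distinct, only row l can stop the recursion of `partner` at column
-- `lookup w l`, and it does so iff S keeps its rook.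
partner-at : ∀ {m n} (c : Fin n) C (B : Board m n) (w : Assignment m n) S → Fresh C w → ∀ l →
             partner c (lookup w l) B (restrict w S) ≡
             (if lookup S l then 1ℤ - 𝟙 (c <ᵇ lookup w l) * 𝟙 (lookup (lookup B l) c) else 𝟙 (c <ᵇ lookup w l))
partner-none : ∀ {m n} (c d : Fin n) (B : Board m n) (w : Assignment m n) S → (∀ l → lookup w l ≢ d) →
               partner c d B (restrict w S) ≡ 𝟙 (c <ᵇ d)

partner-none c d []      []      []            w≢d = refl
partner-none c d (β ∷ B) (e ∷ w) (inside ∷ S)  w≢d rewrite ==-≢ (w≢d zero) = partner-none c d B w S (w≢d ∘ suc)
partner-none c d (β ∷ B) (e ∷ w) (outside ∷ S) w≢d = partner-none c d B w S (w≢d ∘ suc)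

partner-at c C (β ∷ B) (e ∷ w) (inside ∷ S)  (_ , f) zero rewrite ==-refl e = refl
partner-at c C (β ∷ B) (e ∷ w) (outside ∷ S) (_ , f) zero =
  partner-none c e B w S (λ l → proj₂ (◂-false C (fresh-avoids (C ◂ e) w f l)))
partner-at c C (β ∷ B) (e ∷ w) (inside ∷ S)  (_ , f) (suc l)
  rewrite ==-≢ (proj₂ (◂-false C (fresh-avoids (C ◂ e) w f l)) ∘ sym) = partner-at c (C ◂ e) B w S f l
partner-at c C (β ∷ B) (e ∷ w) (outside ∷ S) (_ , f) (suc l) = partner-at c (C ◂ e) B w S f l

-- The contribution to `extra` of two rows whose rooks, in columns increasing iff κ, lie
-- in S iff a and a′; x and y tell whether the board contains the other two corners.
pairExtra : (a a′ x y κ : Bool) → ℤ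
pairExtra true  true  x y κ = 𝟙 y + 𝟙 x * (1ℤ - 𝟙 κ * 𝟙 y)
pairExtra true  false x y κ = 𝟙 y + 𝟙 x * 𝟙 κ
pairExtra false true  x y κ = 𝟙 (not κ) * 𝟙 y
pairExtra false false x y κ = 0ℤ

pairs : ∀ {m} → (Fin m → Fin m → ℤ) → ℤ
pairs f = ∑ᶠ (λ i → ∑ᶠ (λ l → 𝟙 (i <ᵇ l) * f i l))

pairs-suc : ∀ {m} (f : Fin (suc m) → Fin (suc m) → ℤ) → pairs f ≡ ∑ᶠ (λ l → f zero (suc l)) + pairs
    (λ i l → f (suc i) (suc l))
pairs-suc f = trans (∑ᶠ-suc (λ i → ∑ᶠ (terms i))) (cong₂ _+_
  (trans (∑ᶠ-suc (terms zero)) (trans (ℤₚ.+-identityˡ (∑ᶠ (terms zero ∘ suc)))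
      (∑ᶠ-cong (λ l → ℤₚ.*-identityˡ (f zero (suc l))))))
  (∑ᶠ-cong (λ i → trans (∑ᶠ-suc (terms (suc i))) (ℤₚ.+-identityˡ (∑ᶠ (terms (suc i) ∘ suc))))))
  where
  terms : _ → _ → ℤ
  terms i l = 𝟙 (i <ᵇ l) * f i l

module _ {m n} (B : Board m n) (w : Assignment m n) where

  corner : Fin m → Fin m → Bool
  corner i l = lookup (lookup B i) (lookup w l)

  extraPairs : Subset m → ℤ
  extraPairs S = pairs (λ i l → pairExtra (lookup S i) (lookup S l) (corner i l) (corner l i)
      (lookup w i <ᵇ lookup w l))

  -- Further cells in the columns of preceding rows without a rook, that is, in D but not in C. The
  -- term serves the induction and vanishes at its start, where D is empty.
  usedExtra : Subset m → Columns n → Columns n → ℤ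
  usedExtra S D C = ∑ᶠ (λ i → 𝟙 (lookup S i) * ∑ᶠ (λ d → 𝟙 (D d) *
      (𝟙 (not (C d)) * (𝟙 (lookup (lookup B i) d) * 𝟙 (lookup w i <ᵇ d)))))

oldExtra : ∀ {m n} → Board m n → Columns n → ℤ
oldExtra B C = ∑ᶠ (λ i → meet (lookup B i) C)

meet-◂ : ∀ {n} (β : Subset n) C {c} → C c ≡ false → meet β (C ◂ c) ≡ meet β C + 𝟙 (lookup β c)
meet-◂ β C {c} Cc = trans (∑ᶠ-cong split) (trans (∑ᶠ-+ (λ d → 𝟙 (lookup β d) * 𝟙 (C d))
    (λ d → 𝟙 (d == c) * 𝟙 (lookup β d)))
  (cong (_+_ (meet β C)) (∑ᶠ-δ c (λ d → 𝟙 (lookup β d)))))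
  where
  split : ∀ d → 𝟙 (lookup β d) * 𝟙 ((C ◂ c) d) ≡ 𝟙 (lookup β d) * 𝟙 (C d) + 𝟙 (d == c) * 𝟙 (lookup β d)
  split d with d Fin.≟ c
  ... | yes refl rewrite Cc = lemma (𝟙 (lookup β d))
    where
    lemma : ∀ b → b * 1ℤ ≡ b * 0ℤ + 1ℤ * b
    lemma = solve-∀
  ... | no _ rewrite Boolₚ.∨-identityʳ (C d) = sym (ℤₚ.+-identityʳ (𝟙 (lookup β d) * 𝟙 (C d)))

oldExtra-◂ : ∀ {m n} (B : Board m n) C {c} → C c ≡ false →
             oldExtra B (C ◂ c) ≡ oldExtra B C + ∑ᶠ (λ i → 𝟙 (lookup (lookup B i) c))
oldExtra-◂ B C {c} Cc = trans (∑ᶠ-cong (λ i → meet-◂ (lookup B i) C Cc))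
    (∑ᶠ-+ (λ i → meet (lookup B i) C) (λ i → 𝟙 (lookup (lookup B i) c)))

-- D consists of the columns of w in the preceding rows, C of those that carry a rook.
extra-restrict : ∀ {m n} (B : Board m n) C D (w : Assignment m n) S → Fresh D w → free D ≡ + m →
    (∀ c → D c ≡ false → C c ≡ false) →
                 extra B C (restrict w S) ≡ oldExtra B C + usedExtra B w S D C + extraPairs B w S
extra-restrict [] C D [] [] _ _ _ = refl
extra-restrict {suc m} {n} (β ∷ B) C D (c ∷ w) (b ∷ S) (Dc , fw) free≡ C⊆D = by-cases b
  where
  Cc = C⊆D c Dc
  free′ : free (D ◂ c) ≡ + m
  free′ = RingProperties.+-cancelˡ ℤₚ.+-*-ring 1ℤ (free (D ◂ c)) (+ m) (trans (sym (free-◂ D Dc)) free≡)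
  used : Columns n → Subset m → Columns n → Fin m → ℤ
  used D S C i = 𝟙 (lookup S i) * ∑ᶠ (λ d → 𝟙 (D d) * (𝟙 (not (C d)) *
      (𝟙 (lookup (lookup B i) d) * 𝟙 (lookup w i <ᵇ d))))
  firstUsed : ℤ
  firstUsed = ∑ᶠ (λ d → 𝟙 (D d) * (𝟙 (not (C d)) * (𝟙 (lookup β d) * 𝟙 (c <ᵇ d))))
  firstPair : Bool → Fin m → ℤ
  firstPair b l = pairExtra b (lookup S l) (lookup β (lookup w l)) (lookup (lookup B l) c) (c <ᵇ lookup w l)
  firstPairs : Bool → ℤ
  firstPairs b = ∑ᶠ (firstPair b)
  extraPairs-∷ : ∀ b → extraPairs (β ∷ B) (c ∷ w) (b ∷ S) ≡ firstPairs b + extraPairs B w S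
  extraPairs-∷ b = pairs-suc (λ i l → pairExtra (lookup (b ∷ S) i) (lookup (b ∷ S) l) (corner (β ∷ B) (c ∷ w) i l)
      (corner (β ∷ B) (c ∷ w) l i)
                                              (lookup (c ∷ w) i <ᵇ lookup (c ∷ w) l))
  assemble : ∀ b {e} → e ≡ meet β C + oldExtra B C + (𝟙 b * firstUsed + usedExtra B w S D C) +
      (firstPairs b + extraPairs B w S) →
             e ≡ oldExtra (β ∷ B) C + usedExtra (β ∷ B) (c ∷ w) (b ∷ S) D C + extraPairs (β ∷ B) (c ∷ w) (b ∷ S)
  assemble b eq = trans eq (sym (cong₂ _+_ (cong₂ _+_ (∑ᶠ-suc (λ i → meet (lookup (β ∷ B) i) C))
    (∑ᶠ-suc (λ i → 𝟙 (lookup (b ∷ S) i) * ∑ᶠ (λ d → 𝟙 (D d) *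
        (𝟙 (not (C d)) * (𝟙 (lookup (lookup (β ∷ B) i) d) * 𝟙 (lookup (c ∷ w) i <ᵇ d)))))))
    (extraPairs-∷ b)))
  by-cases : ∀ b → extra (β ∷ B) C (restrict (c ∷ w) (b ∷ S)) ≡
                   oldExtra (β ∷ B) C + usedExtra (β ∷ B) (c ∷ w) (b ∷ S) D C + extraPairs (β ∷ B) (c ∷ w) (b ∷ S)
  by-cases true = assemble true (begin
    meet β C + extra B (C ◂ c) (restrict w S) + ∑ᶠ (λ d → 𝟙 (lookup β d) *
        (𝟙 (not ((C ◂ c) d)) * partner c d B (restrict w S)))
      ≡⟨ cong₂ (λ u v → meet β C + u + v) tail-extra partners ⟩
    meet β C + (oldExtra B C + ∑ᶠ column + usedExtra B w S D C + extraPairs B w S) + (∑ᶠ rest + firstUsed)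
      ≡⟨ regroup (meet β C) (oldExtra B C) (∑ᶠ column) (usedExtra B w S D C) (extraPairs B w S)
          (∑ᶠ rest) firstUsed ⟩
    meet β C + oldExtra B C + (1ℤ * firstUsed + usedExtra B w S D C) + (∑ᶠ column + ∑ᶠ rest + extraPairs B w S)
      ≡⟨ cong (λ u → meet β C + oldExtra B C + (1ℤ * firstUsed + usedExtra B w S D C) + (u + extraPairs B w S))
           (trans (sym (∑ᶠ-+ column rest)) (∑ᶠ-cong pair)) ⟩
    meet β C + oldExtra B C + (1ℤ * firstUsed + usedExtra B w S D C) + (firstPairs true + extraPairs B w S) ∎)
    where
    open ≡-Reasoning
    column rest : Fin m → ℤ
    column l = 𝟙 (lookup (lookup B l) c)
    rest l = 𝟙 (lookup β (lookup w l)) * partner c (lookup w l) B (restrict w S)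
    regroup : ∀ a b k u p r f → a + (b + k + u + p) + (r + f) ≡ a + b + (1ℤ * f + u) + (k + r + p)
    regroup = solve-∀
    pair : ∀ l → column l + rest l ≡ firstPair true l
    pair l rewrite partner-at c (D ◂ c) B w S fw l with lookup S l
    ... | true  = refl
    ... | false = refl
    same-used : ∀ d → 𝟙 ((D ◂ c) d) * (𝟙 (not ((C ◂ c) d))) ≡ 𝟙 (D d) * 𝟙 (not (C d))
    same-used d rewrite 𝟙-not-◂ C c d with d Fin.≟ c
    ... | yes refl rewrite Cc | Dc = refl
    ... | no _ rewrite Boolₚ.∨-identityʳ (D d) = cong (𝟙 (D d) *_) (ℤₚ.*-identityʳ (𝟙 (not (C d))))
    tail-extra : extra B (C ◂ c) (restrict w S) ≡ oldExtra B C + ∑ᶠ column + usedExtra B w S D C + extraPairs B w S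
    tail-extra = trans (extra-restrict B (C ◂ c) (D ◂ c) w S fw free′
        (λ d Dd → ◂-false⁺ C (C⊆D d (proj₁ (◂-false D Dd))) (proj₂ (◂-false D Dd))))
      (cong₂ (λ u v → u + v + extraPairs B w S) (oldExtra-◂ B C Cc)
        (∑ᶠ-cong (λ i → cong (𝟙 (lookup S i) *_) (∑ᶠ-cong (λ d → transport d
            (𝟙 (lookup (lookup B i) d) * 𝟙 (lookup w i <ᵇ d)))))))
      where
      transport : ∀ d z → 𝟙 ((D ◂ c) d) * (𝟙 (not ((C ◂ c) d)) * z) ≡ 𝟙 (D d) * (𝟙 (not (C d)) * z)
      transport d z = trans (sym (ℤₚ.*-assoc (𝟙 ((D ◂ c) d)) (𝟙 (not ((C ◂ c) d))) z))
        (trans (cong (_* z) (same-used d)) (ℤₚ.*-assoc (𝟙 (D d)) (𝟙 (not (C d))) z))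
    -- A further cell of the first row lies either in the column of a preceding empty row, where no
    -- later rook meets it, or in the column of a later row.
    split : ∀ d → 𝟙 (lookup β d) * (𝟙 (not ((C ◂ c) d)) * partner c d B (restrict w S)) ≡
            𝟙 (not ((D ◂ c) d)) * (𝟙 (lookup β d) * partner c d B (restrict w S)) + 𝟙 (D d) *
                (𝟙 (not (C d)) * (𝟙 (lookup β d) * 𝟙 (c <ᵇ d)))
    split d with D d in Dd
    ... | true = trans (cong₂ (λ u p → 𝟙 (lookup β d) * (u * p))
        (trans (𝟙-not-◂ C c d) (trans (cong (λ e → 𝟙 (not (C d)) * 𝟙 (not e)) (==-≢ d≢c))
        (ℤₚ.*-identityʳ (𝟙 (not (C d))))))
                                    (partner-none c d B w S w≢d))
                       (lemma (𝟙 (lookup β d)) (𝟙 (not (C d))) (𝟙 (c <ᵇ d))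
                           (𝟙 (lookup β d) * partner c d B (restrict w S)))
      where
      d≢c : d ≢ c
      d≢c refl = contradiction (trans (sym Dd) Dc) λ ()
      w≢d : ∀ l → lookup w l ≢ d
      w≢d l refl = contradiction (trans (sym Dd) (proj₁ (◂-false D (fresh-avoids (D ◂ c) w fw l)))) λ ()
      lemma : ∀ b u k z → b * (u * k) ≡ 0ℤ * z + 1ℤ * (u * (b * k))
      lemma = solve-∀
    ... | false = trans (cong (λ u → 𝟙 (lookup β d) * (u * P))
        (trans (𝟙-not-◂ C c d) (cong (λ z → 𝟙 (not z) * 𝟙 (not (d == c))) (C⊆D d Dd))))
                        (lemma (𝟙 (lookup β d)) (𝟙 (not (d == c))) P
                            (𝟙 (not (C d)) * (𝟙 (lookup β d) * 𝟙 (c <ᵇ d))))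
      where
      P = partner c d B (restrict w S)
      lemma : ∀ b e p z → b * (1ℤ * e * p) ≡ e * (b * p) + 0ℤ * z
      lemma = solve-∀
    partners : ∑ᶠ (λ d → 𝟙 (lookup β d) * (𝟙 (not ((C ◂ c) d)) * partner c d B (restrict w S))) ≡ ∑ᶠ rest
        + firstUsed
    partners = trans (∑ᶠ-cong split) (trans (∑ᶠ-+ (λ d → 𝟙 (not ((D ◂ c) d)) *
        (𝟙 (lookup β d) * partner c d B (restrict w S)))
                                                  (λ d → 𝟙 (D d) * (𝟙 (not (C d)) * (𝟙 (lookup β d) * 𝟙 (c <ᵇ d)))))
      (cong (_+ firstUsed) (complement-sum (D ◂ c) w fw free′
          (λ d → 𝟙 (lookup β d) * partner c d B (restrict w S)))))
  -- Without a rook, the column c joins D but not C. What this adds to `usedExtra` is exactly the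
  -- contribution of the pairs formed with the first row.
  by-cases false = assemble false (begin
    meet β C + extra B C (restrict w S)
      ≡⟨ cong (_+_ (meet β C)) (extra-restrict B C (D ◂ c) w S fw free′ (λ d Dd → C⊆D d (proj₁ (◂-false D Dd)))) ⟩
    meet β C + (oldExtra B C + usedExtra B w S (D ◂ c) C + extraPairs B w S)
      ≡⟨ cong (λ u → meet β C + (oldExtra B C + u + extraPairs B w S))
          (trans (∑ᶠ-cong split) (∑ᶠ-+ (used D S C) (firstPair false))) ⟩
    meet β C + (oldExtra B C + (usedExtra B w S D C + firstPairs false) + extraPairs B w S)
      ≡⟨ regroup (meet β C) (oldExtra B C) (usedExtra B w S D C) (firstPairs false) (extraPairs B w S) firstUsed ⟩
    meet β C + oldExtra B C + (0ℤ * firstUsed + usedExtra B w S D C) + (firstPairs false + extraPairs B w S) ∎)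
    where
    open ≡-Reasoning
    regroup : ∀ a b u p e f → a + (b + (u + p) + e) ≡ a + b + (0ℤ * f + u) + (p + e)
    regroup = solve-∀
    new : ∀ i d → 𝟙 ((D ◂ c) d) * (𝟙 (not (C d)) * (𝟙 (lookup (lookup B i) d) * 𝟙 (lookup w i <ᵇ d))) ≡
          𝟙 (D d) * (𝟙 (not (C d)) * (𝟙 (lookup (lookup B i) d) * 𝟙 (lookup w i <ᵇ d))) + 𝟙 (d == c) *
              (𝟙 (lookup (lookup B i) d) * 𝟙 (lookup w i <ᵇ d))
    new i d with d Fin.≟ c
    ... | yes refl rewrite Dc | Cc = lemma (𝟙 (lookup (lookup B i) d) * 𝟙 (lookup w i <ᵇ d))
      where
      lemma : ∀ z → 1ℤ * (1ℤ * z) ≡ 0ℤ * (1ℤ * z) + 1ℤ * z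
      lemma = solve-∀
    ... | no _ rewrite Boolₚ.∨-identityʳ (D d) = sym (ℤₚ.+-identityʳ
        (𝟙 (D d) * (𝟙 (not (C d)) * (𝟙 (lookup (lookup B i) d) * 𝟙 (lookup w i <ᵇ d)))))
    reverse : ∀ i → 𝟙 (lookup w i <ᵇ c) ≡ 𝟙 (not (c <ᵇ lookup w i))
    reverse i = cong 𝟙 (not-<ᵇ c (lookup w i) (proj₂ (◂-false D (fresh-avoids (D ◂ c) w fw i)) ∘ sym))
    split : ∀ i → used (D ◂ c) S C i ≡ used D S C i + firstPair false i
    split i = trans (cong (𝟙 (lookup S i) *_) (trans (∑ᶠ-cong (new i))
        (trans (∑ᶠ-+ (λ d → 𝟙 (D d) * (𝟙 (not (C d)) * (𝟙 (lookup (lookup B i) d) * 𝟙 (lookup w i <ᵇ d))))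
                     (λ d → 𝟙 (d == c) * (𝟙 (lookup (lookup B i) d) * 𝟙 (lookup w i <ᵇ d))))
          (cong (_+_ U) (∑ᶠ-δ c (λ d → 𝟙 (lookup (lookup B i) d) * 𝟙 (lookup w i <ᵇ d)))))))
      (trans (ℤₚ.*-distribˡ-+ (𝟙 (lookup S i)) U (𝟙 (lookup (lookup B i) c) * 𝟙 (lookup w i <ᵇ c)))
          (cong (_+_ (𝟙 (lookup S i) * U)) first))
      where
      U = ∑ᶠ (λ d → 𝟙 (D d) * (𝟙 (not (C d)) * (𝟙 (lookup (lookup B i) d) * 𝟙 (lookup w i <ᵇ d))))
      first : 𝟙 (lookup S i) * (𝟙 (lookup (lookup B i) c) * 𝟙 (lookup w i <ᵇ c)) ≡ firstPair false i
      first with lookup S i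
      ... | true  = trans (ℤₚ.*-identityˡ (𝟙 (lookup (lookup B i) c) * 𝟙 (lookup w i <ᵇ c)))
                      (trans (ℤₚ.*-comm (𝟙 (lookup (lookup B i) c)) (𝟙 (lookup w i <ᵇ c)))
                          (cong (_* 𝟙 (lookup (lookup B i) c)) (reverse i)))
      ... | false = refl

extra≡extraPairs : ∀ {n} (B : Board n n) w S → Fresh noColumns w → extra B noColumns (restrict w S)
    ≡ extraPairs B w S
extra≡extraPairs {n} B w S f = trans (extra-restrict B noColumns noColumns w S f (free-noColumns n) (λ _ _ → refl))
  (trans (cong₂ (λ u v → u + v + extraPairs B w S) (∑ᶠ-zero
      (λ i → ∑ᶠ-zero (λ d → ℤₚ.*-zeroʳ (𝟙 (lookup (lookup B i) d)))))
    (∑ᶠ-zero (λ i → trans (cong (𝟙 (lookup S i) *_) (∑ᶠ-zero {n} (λ d → refl))) (ℤₚ.*-zeroʳ (𝟙 (lookup S i))))))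
    (ℤₚ.+-identityˡ (extraPairs B w S)))

-- Pairs of rows and the exchange of two columns

∏ᶠ : ∀ {n} → (Fin n → ℤ) → ℤ
∏ᶠ {zero}  f = 1ℤ
∏ᶠ {suc n} f = f zero * ∏ᶠ (f ∘ suc)

∏ᶠ-cong : ∀ {n} {f g : Fin n → ℤ} → (∀ k → f k ≡ g k) → ∏ᶠ f ≡ ∏ᶠ g
∏ᶠ-cong {zero}  f≗g = refl
∏ᶠ-cong {suc n} f≗g = cong₂ _*_ (f≗g zero) (∏ᶠ-cong (f≗g ∘ suc))

number : ∀ {n} → (Fin n → Bool) → ℕ
number {zero}  f = 0
number {suc n} f = if f zero then suc (number (f ∘ suc)) else number (f ∘ suc)

∏ᶠ-power : ∀ {n} t (f : Fin n → Bool) → ∏ᶠ (λ k → if f k then t else 1ℤ) ≡ t ^ number f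
∏ᶠ-power {zero}  t f = refl
∏ᶠ-power {suc n} t f with f zero
... | true  = cong (t *_) (∏ᶠ-power t (f ∘ suc))
... | false = trans (ℤₚ.*-identityˡ (∏ᶠ (λ k → if f (suc k) then t else 1ℤ))) (∏ᶠ-power t (f ∘ suc))

number-sum : ∀ {n} (f : Fin n → Bool) → ∑ᶠ (𝟙 ∘ f) ≡ + number f
number-sum {zero}  f = refl
number-sum {suc n} f = trans (∑ᶠ-suc (𝟙 ∘ f)) (trans (cong (_+_ (𝟙 (f zero))) (number-sum (f ∘ suc))) by-cases)
  where
  by-cases : 𝟙 (f zero) + + number (f ∘ suc) ≡ + number f
  by-cases with f zero
  ... | true  = refl
  ... | false = ℤₚ.+-identityˡ (+ number (f ∘ suc))

-- The binomial coefficient k (k - 1) / 2, defined without division; it counts pairs.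
triangular : ℕ → ℤ
triangular zero    = 0ℤ
triangular (suc k) = triangular k + + k

pairs-number : ∀ {m} (f : Fin m → Bool) → pairs (λ i l → 𝟙 (f i) * 𝟙 (f l)) ≡ triangular (number f)
pairs-number {zero}  f = refl
pairs-number {suc m} f = trans (pairs-suc (λ i l → 𝟙 (f i) * 𝟙 (f l)))
  (trans (cong₂ _+_ (trans (∑-*ˡ (allFin m) (𝟙 (f zero)) (𝟙 ∘ f ∘ suc))
      (cong (𝟙 (f zero) *_) (number-sum (f ∘ suc)))) (pairs-number (f ∘ suc))) by-cases)
  where
  by-cases : 𝟙 (f zero) * + number (f ∘ suc) + triangular (number (f ∘ suc)) ≡ triangular (number f)
  by-cases with f zero
  ... | true  = trans (cong (_+ triangular (number (f ∘ suc))) (ℤₚ.*-identityˡ (+ number (f ∘ suc))))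
      (ℤₚ.+-comm (+ number (f ∘ suc)) (triangular (number (f ∘ suc))))
  ... | false = ℤₚ.+-identityˡ (triangular (number (f ∘ suc)))

pairs-cong : ∀ {m} {f g : Fin m → Fin m → ℤ} → (∀ i l → (i <ᵇ l) ≡ true → f i l ≡ g i l) → pairs f ≡ pairs g
pairs-cong {f = f} {g} eq = ∑ᶠ-cong (λ i → ∑ᶠ-cong (λ l → summand i l))
  where
  summand : ∀ i l → 𝟙 (i <ᵇ l) * f i l ≡ 𝟙 (i <ᵇ l) * g i l
  summand i l with i <ᵇ l in lt
  ... | true  = cong (1ℤ *_) (eq i l lt)
  ... | false = refl

pairs-+ : ∀ {m} (f g : Fin m → Fin m → ℤ) → pairs (λ i l → f i l + g i l) ≡ pairs f + pairs g
pairs-+ f g = trans (∑ᶠ-cong (λ i → trans (∑ᶠ-cong (λ l → ℤₚ.*-distribˡ-+ (𝟙 (i <ᵇ l)) (f i l) (g i l)))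
  (∑ᶠ-+ (λ l → 𝟙 (i <ᵇ l) * f i l) (λ l → 𝟙 (i <ᵇ l) * g i l))))
      (∑ᶠ-+ (λ i → ∑ᶠ (λ l → 𝟙 (i <ᵇ l) * f i l)) (λ i → ∑ᶠ (λ l → 𝟙 (i <ᵇ l) * g i l)))

pairs-*ˡ : ∀ {m} k (f : Fin m → Fin m → ℤ) → pairs (λ i l → k * f i l) ≡ k * pairs f
pairs-*ˡ {m} k f = trans (∑ᶠ-cong (λ i → trans (∑ᶠ-cong (λ l → swap (𝟙 (i <ᵇ l)) k (f i l)))
    (∑-*ˡ (allFin m) k (λ l → 𝟙 (i <ᵇ l) * f i l))))
  (∑-*ˡ (allFin m) k (λ i → ∑ᶠ (λ l → 𝟙 (i <ᵇ l) * f i l)))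
  where
  swap : ∀ a k z → a * (k * z) ≡ k * (a * z)
  swap = solve-∀

pairs-∑ : ∀ {m a} {A : Set a} (xs : List A) (f : A → Fin m → Fin m → ℤ) → ∑ xs (λ y → pairs (f y)) ≡ pairs
    (λ i l → ∑ xs (λ y → f y i l))
pairs-∑ {m} xs f = trans (∑-swap xs (allFin m) (λ y i → ∑ᶠ (λ l → 𝟙 (i <ᵇ l) * f y i l)))
  (∑ᶠ-cong (λ i → trans (∑-swap xs (allFin m) (λ y l → 𝟙 (i <ᵇ l) * f y i l))
      (∑ᶠ-cong (λ l → ∑-*ˡ xs (𝟙 (i <ᵇ l)) (λ y → f y i l)))))

except₁ : ∀ {n} → Fin n → (Fin n → ℤ) → ℤ
except₁ i f = ∏ᶠ (λ k → if k == i then 1ℤ else f k)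

except₂ : ∀ {n} → Fin n → Fin n → (Fin n → ℤ) → ℤ
except₂ i l f = ∏ᶠ (λ k → if (k == i) ∨ (k == l) then 1ℤ else f k)

private
  both : (Bool → ℤ) → ℤ
  both f = f true + f false

∑-subsets-∏ : ∀ n (φ : Fin n → Bool → ℤ) → ∑ (subsets n) (λ S → ∏ᶠ (λ k → φ k (lookup S k))) ≡ ∏ᶠ
    (λ k → φ k true + φ k false)
∑-subsets-∏ zero    φ = refl
∑-subsets-∏ (suc n) φ = trans (∑-subsets n (λ S → ∏ᶠ (λ k → φ k (lookup S k))))
  (trans (cong₂ _+_ (row true) (row false)) (sym (ℤₚ.*-distribʳ-+ (∏ᶠ (λ k → both (φ (suc k)))) (φ zero true)
      (φ zero false))))
  where
  row : ∀ b → ∑ (subsets n) (λ S → φ zero b * ∏ᶠ (λ k → φ (suc k) (lookup S k))) ≡ φ zero b * ∏ᶠ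
      (λ k → both (φ (suc k)))
  row b = trans (∑-*ˡ (subsets n) (φ zero b) (λ S → ∏ᶠ (λ k → φ (suc k) (lookup S k))))
      (cong (φ zero b *_) (∑-subsets-∏ n (φ ∘ suc)))

∑-subsets-∏₁ : ∀ {n} (φ : Fin n → Bool → ℤ) i (h : Bool → ℤ) →
  ∑ (subsets n) (λ S → ∏ᶠ (λ k → φ k (lookup S k)) * h (lookup S i)) ≡ except₁ i (λ k → φ k true + φ k false) * both
      (λ a → φ i a * h a)
∑-subsets-∏₁ {suc n} φ zero    h = trans (∑-subsets n (λ S → ∏ᶠ (λ k → φ k (lookup S k)) * h (lookup S zero)))
  (trans (cong₂ _+_ (row true) (row false)) (factor (φ zero true) (h true) (φ zero false) (h false)
      (∏ᶠ (λ k → both (φ (suc k))))))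
  where
  rearrange : ∀ p q h → p * q * h ≡ p * h * q
  rearrange = solve-∀
  factor : ∀ p h q k r → p * h * r + q * k * r ≡ 1ℤ * r * (p * h + q * k)
  factor = solve-∀
  row : ∀ b → ∑ (subsets n) (λ S → φ zero b * ∏ᶠ (λ k → φ (suc k) (lookup S k)) * h b) ≡ φ zero b * h b * ∏ᶠ
      (λ k → both (φ (suc k)))
  row b = trans (∑-cong (subsets n) (λ S → rearrange (φ zero b) (∏ᶠ (λ k → φ (suc k) (lookup S k))) (h b)))
    (trans (∑-*ˡ (subsets n) (φ zero b * h b) (λ S → ∏ᶠ (λ k → φ (suc k) (lookup S k))))
        (cong (φ zero b * h b *_) (∑-subsets-∏ n (φ ∘ suc))))
∑-subsets-∏₁ {suc n} φ (suc i) h = trans (∑-subsets n (λ S → ∏ᶠ (λ k → φ k (lookup S k)) * h (lookup S (suc i))))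
  (trans (cong₂ _+_ (row true) (row false)) (factor (φ zero true) (φ zero false)
      (except₁ i (λ k → both (φ (suc k)))) (both (λ a → φ (suc i) a * h a))))
  where
  factor : ∀ p q e h → p * (e * h) + q * (e * h) ≡ (p + q) * e * h
  factor = solve-∀
  row : ∀ b → ∑ (subsets n) (λ S → φ zero b * ∏ᶠ (λ k → φ (suc k) (lookup S k)) * h (lookup S i)) ≡
        φ zero b * (except₁ i (λ k → both (φ (suc k))) * both (λ a → φ (suc i) a * h a))
  row b = trans (∑-cong (subsets n) (λ S → ℤₚ.*-assoc (φ zero b) (∏ᶠ (λ k → φ (suc k) (lookup S k)))
      (h (lookup S i))))
    (trans (∑-*ˡ (subsets n) (φ zero b) (λ S → ∏ᶠ (λ k → φ (suc k) (lookup S k)) * h (lookup S i)))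
        (cong (φ zero b *_) (∑-subsets-∏₁ (φ ∘ suc) i h)))

-- A sum over subsets of a product over rows is a product of binomials. A factor h that sees only
-- the rows i and l leaves the binomials of all other rows intact.
∑-subsets-∏₂ : ∀ {n} (φ : Fin n → Bool → ℤ) i l (h : Bool → Bool → ℤ) → (i <ᵇ l) ≡ true →
  ∑ (subsets n) (λ S → ∏ᶠ (λ k → φ k (lookup S k)) * h (lookup S i) (lookup S l)) ≡
  except₂ i l (λ k → φ k true + φ k false) * both (λ a → φ i a * both (λ a′ → φ l a′ * h a a′))
∑-subsets-∏₂ {suc n} φ zero (suc l) h lt = trans (∑-subsets n
    (λ S → ∏ᶠ (λ k → φ k (lookup S k)) * h (lookup S zero) (lookup S (suc l))))
  (trans (cong₂ _+_ (row true) (row false)) (factor (φ zero true) (φ zero false)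
      (except₁ l (λ k → both (φ (suc k))))
    (both (λ a′ → φ (suc l) a′ * h true a′)) (both (λ a′ → φ (suc l) a′ * h false a′))))
  where
  factor : ∀ p q e h k → p * (e * h) + q * (e * k) ≡ 1ℤ * e * (p * h + q * k)
  factor = solve-∀
  row : ∀ b → ∑ (subsets n) (λ S → φ zero b * ∏ᶠ (λ k → φ (suc k) (lookup S k)) * h b (lookup S l)) ≡
        φ zero b * (except₁ l (λ k → both (φ (suc k))) * both (λ a′ → φ (suc l) a′ * h b a′))
  row b = trans (∑-cong (subsets n) (λ S → ℤₚ.*-assoc (φ zero b) (∏ᶠ (λ k → φ (suc k) (lookup S k)))
      (h b (lookup S l))))
    (trans (∑-*ˡ (subsets n) (φ zero b) (λ S → ∏ᶠ (λ k → φ (suc k) (lookup S k)) * h b (lookup S l)))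
        (cong (φ zero b *_) (∑-subsets-∏₁ (φ ∘ suc) l (h b))))
∑-subsets-∏₂ {suc n} φ (suc i) (suc l) h lt = trans (∑-subsets n
    (λ S → ∏ᶠ (λ k → φ k (lookup S k)) * h (lookup S (suc i)) (lookup S (suc l))))
  (trans (cong₂ _+_ (row true) (row false)) (factor (φ zero true) (φ zero false)
      (except₂ i l (λ k → both (φ (suc k))))
    (both (λ a → φ (suc i) a * both (λ a′ → φ (suc l) a′ * h a a′)))))
  where
  factor : ∀ p q e h → p * (e * h) + q * (e * h) ≡ (p + q) * e * h
  factor = solve-∀
  row : ∀ b → ∑ (subsets n) (λ S → φ zero b * ∏ᶠ (λ k → φ (suc k) (lookup S k)) * h (lookup S i) (lookup S l)) ≡
        φ zero b * (except₂ i l (λ k → both (φ (suc k))) * both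
            (λ a → φ (suc i) a * both (λ a′ → φ (suc l) a′ * h a a′)))
  row b = trans (∑-cong (subsets n) (λ S → ℤₚ.*-assoc (φ zero b) (∏ᶠ (λ k → φ (suc k) (lookup S k)))
      (h (lookup S i) (lookup S l))))
    (trans (∑-*ˡ (subsets n) (φ zero b) (λ S → ∏ᶠ (λ k → φ (suc k) (lookup S k)) * h (lookup S i) (lookup S l)))
      (cong (φ zero b *_) (∑-subsets-∏₂ (φ ∘ suc) i l h lt)))

-- Unlike `Fresh`, which follows the order of the rows, this form is evidently stable under an
-- exchange of rows.
Distinct : ∀ {m n} → Assignment m n → Set
Distinct w = ∀ i j → lookup w i ≡ lookup w j → i ≡ j

fresh⇒distinct : ∀ {m n} C (w : Assignment m n) → Fresh C w → Distinct w
fresh⇒distinct C (c ∷ w) (Cc , f) zero    zero    eq = refl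
fresh⇒distinct C (c ∷ w) (Cc , f) zero    (suc j) eq = contradiction (sym eq)
    (proj₂ (◂-false C (fresh-avoids (C ◂ c) w f j)))
fresh⇒distinct C (c ∷ w) (Cc , f) (suc i) zero    eq = contradiction eq
    (proj₂ (◂-false C (fresh-avoids (C ◂ c) w f i)))
fresh⇒distinct C (c ∷ w) (Cc , f) (suc i) (suc j) eq = cong suc (fresh⇒distinct (C ◂ c) w f i j eq)

distinct⇒fresh : ∀ {m n} C (w : Assignment m n) → (∀ i → C (lookup w i) ≡ false) → Distinct w → Fresh C w
distinct⇒fresh C []      avoids distinct = tt
distinct⇒fresh C (c ∷ w) avoids distinct = avoids zero , distinct⇒fresh (C ◂ c) w
  (λ i → ◂-false⁺ C (avoids (suc i)) (λ eq → contradiction (distinct (suc i) zero eq) λ ()))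
      (λ i j eq → Finₚ.suc-injective (distinct (suc i) (suc j) eq))

fresh⇒1 : ∀ {m n} C (w : Assignment m n) → Fresh C w → injective C w ≡ 1ℤ
fresh⇒1 C []      f        = refl
fresh⇒1 C (c ∷ w) (Cc , f) rewrite Cc = trans (ℤₚ.*-identityˡ (injective (C ◂ c) w)) (fresh⇒1 (C ◂ c) w f)

injective-⇔ : ∀ {m n} (v w : Assignment m n) → (Distinct v → Distinct w) → (Distinct w → Distinct v)
    → injective noColumns v ≡ injective noColumns w
injective-⇔ v w to from with fresh-or-0 noColumns v | fresh-or-0 noColumns w
... | inj₁ (f , eq) | _ = trans eq (sym (fresh⇒1 noColumns w
    (distinct⇒fresh noColumns w (λ _ → refl) (to (fresh⇒distinct noColumns v f)))))
... | inj₂ eq       | inj₁ (g , eq′) = trans (fresh⇒1 noColumns v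
    (distinct⇒fresh noColumns v (λ _ → refl) (from (fresh⇒distinct noColumns w g)))) (sym eq′)
... | inj₂ eq       | inj₂ eq′ = trans eq (sym eq′)

swapRows : ∀ {m n} → Fin m → Fin m → Assignment m n → Assignment m n
swapRows i l w = Vec.tabulate (λ k → lookup w (transpose i l k))

lookup-swapRows : ∀ {m n} (i l : Fin m) (w : Assignment m n) k → lookup (swapRows i l w) k ≡ lookup w
    (transpose i l k)
lookup-swapRows i l w k = Vecₚ.lookup∘tabulate (λ k → lookup w (transpose i l k)) k

swapRows-inverse : ∀ {m n} (i l : Fin m) (w : Assignment m n) → swapRows i l (swapRows l i w) ≡ w
swapRows-inverse i l w = vec-ext (λ k → trans (lookup-swapRows i l (swapRows l i w) k)
  (trans (lookup-swapRows l i w (transpose i l k)) (cong (lookup w) (transpose-inverse l i))))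

distinct-swapRows : ∀ {m n} (i l : Fin m) (w : Assignment m n) → Distinct w → Distinct (swapRows i l w)
distinct-swapRows i l w distinct j k eq = trans (sym (transpose-inverse l i)) (trans (cong (transpose l i)
  (distinct (transpose i l j) (transpose i l k) (trans (sym (lookup-swapRows i l w j))
      (trans eq (lookup-swapRows i l w k))))) (transpose-inverse l i))

injective-swapRows : ∀ {m n} (i l : Fin m) (w : Assignment m n) → injective noColumns (swapRows i l w)
    ≡ injective noColumns w
injective-swapRows i l w = injective-⇔ (swapRows i l w) w
  (λ distinct → subst Distinct (swapRows-inverse l i w) (distinct-swapRows l i (swapRows i l w) distinct))
      (distinct-swapRows i l w)

∑-swapRows : ∀ {m n} (i l : Fin m) (f : Assignment m n → ℤ) → ∑ (assignments m n) (f ∘ swapRows i l) ≡ ∑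
    (assignments m n) f
∑-swapRows {m} {n} i l f = ∑-bijection (vecs-enumerates (allFin-enumerates n) m) (Vecₚ.≡-dec Fin._≟_)
  (swapRows i l) (swapRows l i) (swapRows-inverse i l) (swapRows-inverse l i) f

transpose-left : ∀ {n} (i l : Fin n) → transpose i l i ≡ l
transpose-left i l rewrite Dec.dec-true (i Fin.≟ i) refl = refl

transpose-right : ∀ {n} (i l : Fin n) → transpose i l l ≡ i
transpose-right i l with l Fin.≟ i
... | yes l≡i = l≡i
... | no _ rewrite Dec.dec-true (l Fin.≟ l) refl = refl

transpose-other : ∀ {n} {i l k : Fin n} → k ≢ i → k ≢ l → transpose i l k ≡ k
transpose-other {i = i} {l} {k} k≢i k≢l rewrite Dec.dec-false (k Fin.≟ i) k≢i | Dec.dec-false (k Fin.≟ l) k≢l = refl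

rooks-restrict : ∀ {m n} (w : Assignment m n) S → rooks (restrict w S) ≡ number (lookup S)
rooks-restrict []      []            = refl
rooks-restrict (c ∷ w) (inside ∷ S)  = cong suc (rooks-restrict w S)
rooks-restrict (c ∷ w) (outside ∷ S) = rooks-restrict w S

empties-restrict : ∀ {m n} (w : Assignment m n) S → empties (restrict w S) ≡ number (not ∘ lookup S)
empties-restrict []      []            = refl
empties-restrict (c ∷ w) (inside ∷ S)  = empties-restrict w S
empties-restrict (c ∷ w) (outside ∷ S) = cong suc (empties-restrict w S)

number-all : ∀ n → number {n} (λ _ → true) ≡ n
number-all zero    = refl
number-all (suc n) = cong suc (number-all n)

cell : ∀ {m n} → Board m n → Assignment m n → Fin m → Bool
cell B w k = corner B w k k

-- As a product over rows, the summand allows the sum over S to be carried out row by row.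
onBoard-power : ∀ {m n} s (B : Board m n) (w : Assignment m n) S →
                onBoard B (restrict w S) * s ^ rooks (restrict w S) ≡ ∏ᶠ
                    (λ k → if lookup S k then 𝟙 (cell B w k) * s else 1ℤ)
onBoard-power s []      []      []            = refl
onBoard-power s (β ∷ B) (c ∷ w) (inside ∷ S)  = trans (rearrange (𝟙 (lookup β c)) (onBoard B (restrict w S)) s
    (s ^ rooks (restrict w S)))
  (cong (𝟙 (lookup β c) * s *_) (onBoard-power s B w S))
  where
  rearrange : ∀ b o s p → b * o * (s * p) ≡ b * s * (o * p)
  rearrange = solve-∀
onBoard-power s (β ∷ B) (c ∷ w) (outside ∷ S) = trans (onBoard-power s B w S)
    (sym (ℤₚ.*-identityˡ (∏ᶠ (λ k → if lookup S k then 𝟙 (cell B w k) * s else 1ℤ))))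

-- The polynomial of a pair of rows

eval : List ℤ → ℤ → ℤ
eval []      t = 0ℤ
eval (a ∷ p) t = a + t * eval p t

hits : Bool → Bool → ℕ
hits true  true  = 2
hits true  false = 1
hits false true  = 1
hits false false = 0

-- In t, this is 3 t ^ u if u = v, and (2 + t) t ^ min(u, v) otherwise, for u, v at most 2. Here u
-- and v are the numbers of hits in the two rows before and after the exchange of their columns. The
-- absence of negative coefficients is what finally gives C ≥ 0.
kernel : ℕ → ℕ → List ℤ
kernel 0             0             = + 3 ∷ []
kernel 0             (suc _)       = + 2 ∷ 1ℤ ∷ []
kernel (suc _)       0             = + 2 ∷ 1ℤ ∷ []
kernel 1             1             = 0ℤ ∷ + 3 ∷ []
kernel 1             (suc (suc _)) = 0ℤ ∷ + 2 ∷ 1ℤ ∷ []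
kernel (suc (suc _)) 1             = 0ℤ ∷ + 2 ∷ 1ℤ ∷ []
kernel (suc (suc _)) (suc (suc _)) = 0ℤ ∷ 0ℤ ∷ + 3 ∷ []

-- The arguments stand for u = b + b′, p = bb′, v = x + y, r = xy, so that 1 + su + s²p = (1 + sb)(1
-- + sb′), which is t ^ u for indicators b, b′ and t = 1 + s. In these terms `pairTotal-symmetric`
-- is a polynomial identity in the four indicators.
symmetric : (s u p v r : ℤ) → ℤ
symmetric s u p v r = + 2 * (1ℤ + s * u + s * s * p) + + 2 * (1ℤ + s * v + s * s * r) + + 2 + + 2 * s * u * v +
    + 2 * s * s * (p * v + r * u - p * r) - + 2 * s * (1ℤ + s) * (p + r)

private
  -- The two digits in the names are u and v; each right-hand side is twice the corresponding
  -- `kernel` evaluated at 1 + s, written out.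
  sym00 : ∀ s → + 2 * (1ℤ + s * 0ℤ + s * s * 0ℤ) + + 2 * (1ℤ + s * 0ℤ + s * s * 0ℤ) + + 2 + + 2 * s * 0ℤ * 0ℤ +
      + 2 * s * s * (0ℤ * 0ℤ + 0ℤ * 0ℤ - 0ℤ * 0ℤ) - + 2 * s * (1ℤ + s) * (0ℤ + 0ℤ) ≡ + 2 * (+ 3 + (1ℤ + s) * 0ℤ)
  sym00 = solve-∀
  sym01 : ∀ s → + 2 * (1ℤ + s * 0ℤ + s * s * 0ℤ) + + 2 * (1ℤ + s * 1ℤ + s * s * 0ℤ) + + 2 + + 2 * s * 0ℤ * 1ℤ +
      + 2 * s * s * (0ℤ * 1ℤ + 0ℤ * 0ℤ - 0ℤ * 0ℤ) - + 2 * s * (1ℤ + s) * (0ℤ + 0ℤ) ≡ + 2 *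
      (+ 2 + (1ℤ + s) * (1ℤ + (1ℤ + s) * 0ℤ))
  sym01 = solve-∀
  sym02 : ∀ s → + 2 * (1ℤ + s * 0ℤ + s * s * 0ℤ) + + 2 * (1ℤ + s * (+ 2) + s * s * 1ℤ) + + 2 + + 2 * s * 0ℤ * (+ 2)
      + + 2 * s * s * (0ℤ * (+ 2) + 1ℤ * 0ℤ - 0ℤ * 1ℤ) - + 2 * s * (1ℤ + s) * (0ℤ + 1ℤ) ≡ + 2 *
      (+ 2 + (1ℤ + s) * (1ℤ + (1ℤ + s) * 0ℤ))
  sym02 = solve-∀
  sym10 : ∀ s → + 2 * (1ℤ + s * 1ℤ + s * s * 0ℤ) + + 2 * (1ℤ + s * 0ℤ + s * s * 0ℤ) + + 2 + + 2 * s * 1ℤ * 0ℤ +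
      + 2 * s * s * (0ℤ * 0ℤ + 0ℤ * 1ℤ - 0ℤ * 0ℤ) - + 2 * s * (1ℤ + s) * (0ℤ + 0ℤ) ≡ + 2 *
      (+ 2 + (1ℤ + s) * (1ℤ + (1ℤ + s) * 0ℤ))
  sym10 = solve-∀
  sym11 : ∀ s → + 2 * (1ℤ + s * 1ℤ + s * s * 0ℤ) + + 2 * (1ℤ + s * 1ℤ + s * s * 0ℤ) + + 2 + + 2 * s * 1ℤ * 1ℤ +
      + 2 * s * s * (0ℤ * 1ℤ + 0ℤ * 1ℤ - 0ℤ * 0ℤ) - + 2 * s * (1ℤ + s) * (0ℤ + 0ℤ) ≡ + 2 *
      (0ℤ + (1ℤ + s) * (+ 3 + (1ℤ + s) * 0ℤ))
  sym11 = solve-∀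
  sym12 : ∀ s → + 2 * (1ℤ + s * 1ℤ + s * s * 0ℤ) + + 2 * (1ℤ + s * (+ 2) + s * s * 1ℤ) + + 2 + + 2 * s * 1ℤ * (+ 2)
      + + 2 * s * s * (0ℤ * (+ 2) + 1ℤ * 1ℤ - 0ℤ * 1ℤ) - + 2 * s * (1ℤ + s) * (0ℤ + 1ℤ) ≡ + 2 *
      (0ℤ + (1ℤ + s) * (+ 2 + (1ℤ + s) * (1ℤ + (1ℤ + s) * 0ℤ)))
  sym12 = solve-∀
  sym20 : ∀ s → + 2 * (1ℤ + s * (+ 2) + s * s * 1ℤ) + + 2 * (1ℤ + s * 0ℤ + s * s * 0ℤ) + + 2 + + 2 * s * (+ 2) * 0ℤ
      + + 2 * s * s * (1ℤ * 0ℤ + 0ℤ * (+ 2) - 1ℤ * 0ℤ) - + 2 * s * (1ℤ + s) * (1ℤ + 0ℤ) ≡ + 2 *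
      (+ 2 + (1ℤ + s) * (1ℤ + (1ℤ + s) * 0ℤ))
  sym20 = solve-∀
  sym21 : ∀ s → + 2 * (1ℤ + s * (+ 2) + s * s * 1ℤ) + + 2 * (1ℤ + s * 1ℤ + s * s * 0ℤ) + + 2 + + 2 * s * (+ 2) * 1ℤ
      + + 2 * s * s * (1ℤ * 1ℤ + 0ℤ * (+ 2) - 1ℤ * 0ℤ) - + 2 * s * (1ℤ + s) * (1ℤ + 0ℤ) ≡ + 2 *
      (0ℤ + (1ℤ + s) * (+ 2 + (1ℤ + s) * (1ℤ + (1ℤ + s) * 0ℤ)))
  sym21 = solve-∀
  sym22 : ∀ s → + 2 * (1ℤ + s * (+ 2) + s * s * 1ℤ) + + 2 * (1ℤ + s * (+ 2) + s * s * 1ℤ) + + 2 + + 2 * s * (+ 2) *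
      (+ 2) + + 2 * s * s * (1ℤ * (+ 2) + 1ℤ * (+ 2) - 1ℤ * 1ℤ) - + 2 * s * (1ℤ + s) * (1ℤ + 1ℤ) ≡ + 2 *
      (0ℤ + (1ℤ + s) * (0ℤ + (1ℤ + s) * (+ 3 + (1ℤ + s) * 0ℤ)))
  sym22 = solve-∀

symmetric-kernel : ∀ s b b′ x y → symmetric s (𝟙 b + 𝟙 b′) (𝟙 b * 𝟙 b′) (𝟙 x + 𝟙 y) (𝟙 x * 𝟙 y) ≡ + 2 * eval
    (kernel (hits b b′) (hits x y)) (1ℤ + s)
symmetric-kernel s false false false false = sym00 s
symmetric-kernel s false false true  false = sym01 s
symmetric-kernel s false false false true  = sym01 s
symmetric-kernel s false false true  true  = sym02 s
symmetric-kernel s true  false false false = sym10 s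
symmetric-kernel s false true  false false = sym10 s
symmetric-kernel s true  false true  false = sym11 s
symmetric-kernel s true  false false true  = sym11 s
symmetric-kernel s false true  true  false = sym11 s
symmetric-kernel s false true  false true  = sym11 s
symmetric-kernel s true  false true  true  = sym12 s
symmetric-kernel s false true  true  true  = sym12 s
symmetric-kernel s true  true  false false = sym20 s
symmetric-kernel s true  true  true  false = sym21 s
symmetric-kernel s true  true  false true  = sym21 s
symmetric-kernel s true  true  true  true  = sym22 s

-- The share of one pair of rows in `bracket`, without the power of s. The triangular numbers of n,
-- r and e there count all pairs of rows, the pairs inside S and the pairs outside S.
pairWeight : (s : ℤ) (x y κ : Bool) → Bool → Bool → ℤ
pairWeight s x y κ a a′ = s * (+ 2 * pairExtra a a′ x y κ + + 2 - + 2 * (𝟙 a * 𝟙 a′) + 𝟙 (not a) * 𝟙 (not a′)) -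
    + 2 * (𝟙 a * 𝟙 a′)

rowWeight : ℤ → Bool → Bool → ℤ
rowWeight s b a = if a then 𝟙 b * s else 1ℤ

pairTotal : (s : ℤ) (b b′ x y κ : Bool) → ℤ
pairTotal s b b′ x y κ =
  rowWeight s b true * (rowWeight s b′ true * pairWeight s x y κ true true
      + rowWeight s b′ false * pairWeight s x y κ true false) +
  rowWeight s b false * (rowWeight s b′ true * pairWeight s x y κ false true
      + rowWeight s b′ false * pairWeight s x y κ false false)

-- Exchanging the columns of two rows exchanges (b , b′) with (x , y) and negates κ.
pairTotal-symmetric : ∀ s b b′ x y κ → pairTotal s b b′ x y κ + pairTotal s x y b b′ (not κ) ≡
                      s * symmetric s (𝟙 b + 𝟙 b′) (𝟙 b * 𝟙 b′) (𝟙 x + 𝟙 y) (𝟙 x * 𝟙 y)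
pairTotal-symmetric s b b′ x y true = lemma s (𝟙 b) (𝟙 b′) (𝟙 x) (𝟙 y)
  where
  lemma : ∀ s b b′ x y → (b * s * (b′ * s * (s * (+ 2 * (y + x * (1ℤ - 1ℤ * y)) + + 2 - + 2 * (1ℤ * 1ℤ) + 0ℤ * 0ℤ) -
      + 2 * (1ℤ * 1ℤ)) + 1ℤ * (s * (+ 2 * (y + x * 1ℤ) + + 2 - + 2 * (1ℤ * 0ℤ) + 0ℤ * 1ℤ) - + 2 * (1ℤ * 0ℤ))) + 1ℤ *
      (b′ * s * (s * (+ 2 * (0ℤ * y) + + 2 - + 2 * (0ℤ * 1ℤ) + 1ℤ * 0ℤ) - + 2 * (0ℤ * 1ℤ)) + 1ℤ *
      (s * (+ 2 * 0ℤ + + 2 - + 2 * (0ℤ * 0ℤ) + 1ℤ * 1ℤ) - + 2 * (0ℤ * 0ℤ)))) +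
      (x * s * (y * s * (s * (+ 2 * (b′ + b * (1ℤ - 0ℤ * b′)) + + 2 - + 2 * (1ℤ * 1ℤ) + 0ℤ * 0ℤ) - + 2 * (1ℤ * 1ℤ))
      + 1ℤ * (s * (+ 2 * (b′ + b * 0ℤ) + + 2 - + 2 * (1ℤ * 0ℤ) + 0ℤ * 1ℤ) - + 2 * (1ℤ * 0ℤ))) + 1ℤ *
      (y * s * (s * (+ 2 * (1ℤ * b′) + + 2 - + 2 * (0ℤ * 1ℤ) + 1ℤ * 0ℤ) - + 2 * (0ℤ * 1ℤ)) + 1ℤ *
      (s * (+ 2 * 0ℤ + + 2 - + 2 * (0ℤ * 0ℤ) + 1ℤ * 1ℤ) - + 2 * (0ℤ * 0ℤ))))
          ≡ s * (+ 2 * (1ℤ + s * (b + b′) + s * s * (b * b′)) + + 2 * (1ℤ + s * (x + y) + s * s * (x * y)) + + 2 +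
              + 2 * s * (b + b′) * (x + y) + + 2 * s * s * ((b * b′) * (x + y) + (x * y) * (b + b′) - (b * b′) *
              (x * y)) - + 2 * s * (1ℤ + s) * ((b * b′) + (x * y)))
  lemma = solve-∀
pairTotal-symmetric s b b′ x y false = lemma s (𝟙 b) (𝟙 b′) (𝟙 x) (𝟙 y)
  where
  lemma : ∀ s b b′ x y → (b * s * (b′ * s * (s * (+ 2 * (y + x * (1ℤ - 0ℤ * y)) + + 2 - + 2 * (1ℤ * 1ℤ) + 0ℤ * 0ℤ) -
      + 2 * (1ℤ * 1ℤ)) + 1ℤ * (s * (+ 2 * (y + x * 0ℤ) + + 2 - + 2 * (1ℤ * 0ℤ) + 0ℤ * 1ℤ) - + 2 * (1ℤ * 0ℤ))) + 1ℤ *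
      (b′ * s * (s * (+ 2 * (1ℤ * y) + + 2 - + 2 * (0ℤ * 1ℤ) + 1ℤ * 0ℤ) - + 2 * (0ℤ * 1ℤ)) + 1ℤ *
      (s * (+ 2 * 0ℤ + + 2 - + 2 * (0ℤ * 0ℤ) + 1ℤ * 1ℤ) - + 2 * (0ℤ * 0ℤ)))) +
      (x * s * (y * s * (s * (+ 2 * (b′ + b * (1ℤ - 1ℤ * b′)) + + 2 - + 2 * (1ℤ * 1ℤ) + 0ℤ * 0ℤ) - + 2 * (1ℤ * 1ℤ))
      + 1ℤ * (s * (+ 2 * (b′ + b * 1ℤ) + + 2 - + 2 * (1ℤ * 0ℤ) + 0ℤ * 1ℤ) - + 2 * (1ℤ * 0ℤ))) + 1ℤ *
      (y * s * (s * (+ 2 * (0ℤ * b′) + + 2 - + 2 * (0ℤ * 1ℤ) + 1ℤ * 0ℤ) - + 2 * (0ℤ * 1ℤ)) + 1ℤ *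
      (s * (+ 2 * 0ℤ + + 2 - + 2 * (0ℤ * 0ℤ) + 1ℤ * 1ℤ) - + 2 * (0ℤ * 0ℤ))))
          ≡ s * (+ 2 * (1ℤ + s * (b + b′) + s * s * (b * b′)) + + 2 * (1ℤ + s * (x + y) + s * s * (x * y)) + + 2 +
              + 2 * s * (b + b′) * (x + y) + + 2 * s * s * ((b * b′) * (x + y) + (x * y) * (b + b′) - (b * b′) *
              (x * y)) - + 2 * s * (1ℤ + s) * ((b * b′) + (x * y)))
  lemma = solve-∀

-- The first-order term of the r-th summand for one placement, divided by (n - r)! and multiplied by
-- 2s. Writing T for `triangular`, the factor of s ^ r in that term is `extras` from the q-rook
-- number, T n - T r from the power of q and T e / 2 from the q-factorial. The derivative of the
-- factors q ^ j - t adds -T r times s ^ (r - 1).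
bracket : (s : ℤ) (n r e : ℕ) → ℤ → ℤ
bracket s n r e extras = s ^ r * (s * (+ 2 * extras + + 2 * triangular n - + 2 * triangular r + triangular e) -
    + 2 * triangular r)

module _ {n : ℕ} (B : Board n n) (s : ℤ) where

  private
    t = 1ℤ + s

  weightOf : Assignment n n → Fin n → Fin n → Bool → Bool → ℤ
  weightOf w i l = pairWeight s (corner B w i l) (corner B w l i) (lookup w i <ᵇ lookup w l)

  totalOf : Assignment n n → Fin n → Fin n → ℤ
  totalOf w i l = pairTotal s (cell B w i) (cell B w l) (corner B w i l) (corner B w l i) (lookup w i <ᵇ lookup w l)

  hitsOutside : Assignment n n → Fin n → Fin n → ℕ
  hitsOutside w i l = number (λ k → cell B w k ∧ not ((k == i) ∨ (k == l)))

  kernelOf : Assignment n n → Fin n → Fin n → List ℤ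
  kernelOf w i l = kernel (hits (cell B w i) (cell B w l)) (hits (corner B w i l) (corner B w l i))

  bracket-pairs : ∀ w S → Fresh noColumns w →
    bracket s n (rooks (restrict w S)) (empties (restrict w S)) (extra B noColumns (restrict w S)) ≡
    s ^ rooks (restrict w S) * pairs (λ i l → weightOf w i l (lookup S i) (lookup S l))
  bracket-pairs w S f = cong (s ^ rooks (restrict w S) *_) (begin
    s * (+ 2 * extra B noColumns (restrict w S) + + 2 * triangular n - + 2 * triangular (rooks (restrict w S))
        + triangular (empties (restrict w S)))
    - + 2 * triangular (rooks (restrict w S))
      ≡⟨ substitute (extra≡extraPairs B w S f) (trans (cong triangular (sym (number-all n)))
          (sym (pairs-number {n} (λ _ → true))))
           (trans (cong triangular (rooks-restrict w S)) (sym (pairs-number (lookup S))))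
           (trans (cong triangular (empties-restrict w S)) (sym (pairs-number (not ∘ lookup S)))) ⟩
    s * (+ 2 * pairs T + + 2 * pairs O - + 2 * pairs A + pairs A′) - + 2 * pairs A
      ≡⟨ collect s (pairs T) (pairs O) (pairs A) (pairs A′) ⟩
    s * + 2 * pairs T + s * + 2 * pairs O + (- (s * + 2) - + 2) * pairs A + s * pairs A′
      ≡⟨ linear (s * + 2) (s * + 2) (- (s * + 2) - + 2) s T O A A′ ⟨
    pairs (λ i l → s * + 2 * T i l + s * + 2 * (1ℤ * 1ℤ) + (- (s * + 2) - + 2) * A i l + s * A′ i l)
      ≡⟨ pairs-cong (λ i l _ → expand s (T i l) (A i l) (A′ i l)) ⟩
    pairs (λ i l → weightOf w i l (lookup S i) (lookup S l)) ∎)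
    where
    open ≡-Reasoning
    T O A A′ : Fin n → Fin n → ℤ
    O i l = 1ℤ * 1ℤ
    T i l = pairExtra (lookup S i) (lookup S l) (corner B w i l) (corner B w l i) (lookup w i <ᵇ lookup w l)
    A i l = 𝟙 (lookup S i) * 𝟙 (lookup S l)
    A′ i l = 𝟙 (not (lookup S i)) * 𝟙 (not (lookup S l))
    substitute : ∀ {a a′ b b′ c c′ d d′} → a ≡ a′ → b ≡ b′ → c ≡ c′ → d ≡ d′ →
                 s * (+ 2 * a + + 2 * b - + 2 * c + d) - + 2 * c ≡ s * (+ 2 * a′ + + 2 * b′ - + 2 * c′ + d′) -
                     + 2 * c′
    substitute refl refl refl refl = refl
    collect : ∀ s a b c d → s * (+ 2 * a + + 2 * b - + 2 * c + d) - + 2 * c ≡ s * + 2 * a + s * + 2 * b +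
        (- (s * + 2) - + 2) * c + s * d
    collect = solve-∀
    expand : ∀ s a c d → s * + 2 * a + s * + 2 * (1ℤ * 1ℤ) + (- (s * + 2) - + 2) * c + s * d ≡ s *
        (+ 2 * a + + 2 - + 2 * c + d) - + 2 * c
    expand = solve-∀
    linear : ∀ a b c d (f g h k : Fin n → Fin n → ℤ) → pairs (λ i l → a * f i l + b * g i l + c * h i l + d * k i l)
        ≡ a * pairs f + b * pairs g + c * pairs h + d * pairs k
    linear a b c d f g h k = trans (pairs-+ (λ i l → a * f i l + b * g i l + c * h i l) (λ i l → d * k i l))
        (cong₂ _+_
      (trans (pairs-+ (λ i l → a * f i l + b * g i l) (λ i l → c * h i l)) (cong₂ _+_
        (trans (pairs-+ (λ i l → a * f i l) (λ i l → b * g i l)) (cong₂ _+_ (pairs-*ˡ a f) (pairs-*ˡ b g)))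
            (pairs-*ˡ c h))) (pairs-*ˡ d k))

  -- A hit of w in another row contributes 1 + s, one summand for each answer to whether S contains
  -- the row; a row without a hit contributes 1.
  outside-power : ∀ w i l → except₂ i l (λ k → rowWeight s (cell B w k) true + rowWeight s (cell B w k) false)
      ≡ t ^ hitsOutside w i l
  outside-power w i l = trans (∏ᶠ-cong (λ k → factor (cell B w k) ((k == i) ∨ (k == l))))
      (∏ᶠ-power t (λ k → cell B w k ∧ not ((k == i) ∨ (k == l))))
    where
    factor : ∀ b e → (if e then 1ℤ else 𝟙 b * s + 1ℤ) ≡ (if b ∧ not e then t else 1ℤ)
    factor true  true  = refl
    factor true  false = trans (cong (_+ 1ℤ) (ℤₚ.*-identityˡ s)) (ℤₚ.+-comm s 1ℤ)
    factor false true  = refl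
    factor false false = refl

  assignment-bracket : ∀ w → Fresh noColumns w →
    ∑ (subsets n) (λ S → onBoard B (restrict w S) *
      bracket s n (rooks (restrict w S)) (empties (restrict w S)) (extra B noColumns (restrict w S))) ≡
    pairs (λ i l → t ^ hitsOutside w i l * totalOf w i l)
  assignment-bracket w f = begin
    ∑ (subsets n) (λ S → onBoard B (restrict w S) * bracket s n (rooks (restrict w S)) (empties (restrict w S))
        (extra B noColumns (restrict w S)))
      ≡⟨ ∑-cong (subsets n) (λ S → trans (cong (onBoard B (restrict w S) *_) (bracket-pairs w S f))
           (trans (sym (ℤₚ.*-assoc (onBoard B (restrict w S)) (s ^ rooks (restrict w S)) (pairs (weights S))))
             (trans (cong (_* pairs (weights S)) (onBoard-power s B w S))
                 (sym (pairs-*ˡ (product S) (weights S)))))) ⟩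
    ∑ (subsets n) (λ S → pairs (λ i l → product S * weights S i l))
      ≡⟨ pairs-∑ (subsets n) (λ S i l → product S * weights S i l) ⟩
    pairs (λ i l → ∑ (subsets n) (λ S → product S * weights S i l))
      ≡⟨ pairs-cong (λ i l i<l → trans (∑-subsets-∏₂ (λ k → rowWeight s (cell B w k)) i l (weightOf w i l) i<l)
           (cong (_* totalOf w i l) (outside-power w i l))) ⟩
    pairs (λ i l → t ^ hitsOutside w i l * totalOf w i l) ∎
    where
    open ≡-Reasoning
    product : Subset n → ℤ
    product S = ∏ᶠ (λ k → rowWeight s (cell B w k) (lookup S k))
    weights : Subset n → Fin n → Fin n → ℤ
    weights S i l = weightOf w i l (lookup S i) (lookup S l)

  hitsOutside-swapRows : ∀ w i l → hitsOutside (swapRows i l w) i l ≡ hitsOutside w i l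
  hitsOutside-swapRows w i l = number-cong same
    where
    number-cong : ∀ {m} {f g : Fin m → Bool} → f ≗ g → number f ≡ number g
    number-cong {zero}  f≗g = refl
    number-cong {suc m} f≗g = cong₂ (λ b k → if b then suc k else k) (f≗g zero) (number-cong (f≗g ∘ suc))
    same : ∀ k → cell B (swapRows i l w) k ∧ not ((k == i) ∨ (k == l)) ≡ cell B w k ∧ not ((k == i) ∨ (k == l))
    same k with k Fin.≟ i | k Fin.≟ l
    ... | yes _  | _      = trans (Boolₚ.∧-zeroʳ (cell B (swapRows i l w) k)) (sym (Boolₚ.∧-zeroʳ (cell B w k)))
    ... | no _   | yes _  = trans (Boolₚ.∧-zeroʳ (cell B (swapRows i l w) k)) (sym (Boolₚ.∧-zeroʳ (cell B w k)))
    ... | no k≢i | no k≢l = cong (λ c → lookup (lookup B k) c ∧ true)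
        (trans (lookup-swapRows i l w k) (cong (lookup w) (transpose-other k≢i k≢l)))

  totalOf-swapRows : ∀ w i l → (lookup w l <ᵇ lookup w i) ≡ not (lookup w i <ᵇ lookup w l) →
    totalOf (swapRows i l w) i l ≡ pairTotal s (corner B w i l) (corner B w l i) (cell B w i) (cell B w l)
        (not (lookup w i <ᵇ lookup w l))
  totalOf-swapRows w i l flip rewrite trans (lookup-swapRows i l w i) (cong (lookup w) (transpose-left i l))
                                    | trans (lookup-swapRows i l w l)
                                        (cong (lookup w) (transpose-right i l)) | flip = refl

  -- Exchanging the columns of rows i and l permutes the injective assignments and fixes the hits
  -- elsewhere. Twice the left side is therefore a sum of symmetrised totals, each equal to 2s times
  -- the kernel.
  pair-kernel : ∀ i l → (i <ᵇ l) ≡ true →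
    ∑ (assignments n n) (λ w → injective noColumns w * (t ^ hitsOutside w i l * totalOf w i l)) ≡
    s * ∑ (assignments n n) (λ w → injective noColumns w * (t ^ hitsOutside w i l * eval (kernelOf w i l) t))
  pair-kernel i l i<l = ℤₚ.*-cancelˡ-≡ (+ 2) _ _ (begin
    + 2 * ∑ ws term
      ≡⟨ double (∑ ws term) ⟩
    ∑ ws term + ∑ ws term
      ≡⟨ cong (_+_ (∑ ws term)) (∑-swapRows i l term) ⟨
    ∑ ws term + ∑ ws (term ∘ swapRows i l)
      ≡⟨ ∑-+ ws term (term ∘ swapRows i l) ⟨
    ∑ ws (λ w → term w + term (swapRows i l w))
      ≡⟨ ∑-cong ws symmetrise ⟩
    ∑ ws (λ w → + 2 * s * (injective noColumns w * (t ^ hitsOutside w i l * eval (kernelOf w i l) t)))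
      ≡⟨ trans (∑-*ˡ ws (+ 2 * s) kernelTerm) (ℤₚ.*-assoc (+ 2) s (∑ ws kernelTerm)) ⟩
    + 2 * (s * ∑ ws kernelTerm) ∎)
    where
    open ≡-Reasoning
    ws = assignments n n
    term kernelTerm : Assignment n n → ℤ
    term w = injective noColumns w * (t ^ hitsOutside w i l * totalOf w i l)
    kernelTerm w = injective noColumns w * (t ^ hitsOutside w i l * eval (kernelOf w i l) t)
    double : ∀ a → + 2 * a ≡ a + a
    double = solve-∀
    distrib : ∀ j e a b → j * (e * a) + j * (e * b) ≡ j * (e * (a + b))
    distrib = solve-∀
    extract : ∀ j e s k → j * (e * (s * (+ 2 * k))) ≡ + 2 * s * (j * (e * k))
    extract = solve-∀
    symmetrise : ∀ w → term w + term (swapRows i l w) ≡ + 2 * s * kernelTerm w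
    symmetrise w = begin
      term w + term (swapRows i l w)
        ≡⟨ cong (_+_ (term w)) (cong₂ _*_ (injective-swapRows i l w)
            (cong (λ k → t ^ k * totalOf (swapRows i l w) i l) (hitsOutside-swapRows w i l))) ⟩
      term w + injective noColumns w * (t ^ hitsOutside w i l * totalOf (swapRows i l w) i l)
        ≡⟨ distrib (injective noColumns w) (t ^ hitsOutside w i l) (totalOf w i l) (totalOf (swapRows i l w) i l) ⟩
      injective noColumns w * (t ^ hitsOutside w i l * (totalOf w i l + totalOf (swapRows i l w) i l))
        ≡⟨ injective-cong noColumns w (λ f → cong (t ^ hitsOutside w i l *_) (sum-of-totals f)) ⟩
      injective noColumns w * (t ^ hitsOutside w i l * (s * (+ 2 * eval (kernelOf w i l) t)))
        ≡⟨ extract (injective noColumns w) (t ^ hitsOutside w i l) s (eval (kernelOf w i l) t) ⟩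
      + 2 * s * kernelTerm w ∎
      where
      sum-of-totals : Fresh noColumns w → totalOf w i l + totalOf (swapRows i l w) i l ≡ s *
          (+ 2 * eval (kernelOf w i l) t)
      sum-of-totals f = trans (cong (_+_ (totalOf w i l)) (totalOf-swapRows w i l
          (not-<ᵇ (lookup w i) (lookup w l) (λ eq → <ᵇ⇒≢ i l i<l (fresh⇒distinct noColumns w f i l eq)))))
        (trans (pairTotal-symmetric s (cell B w i) (cell B w l) (corner B w i l) (corner B w l i)
            (lookup w i <ᵇ lookup w l))
          (cong (s *_) (symmetric-kernel s (cell B w i) (cell B w l) (corner B w i l) (corner B w l i))))

  bracket-kernel : ∑ (placements n n) (λ p → valid B noColumns p *
      (+ (empties p !) * bracket s n (rooks p) (empties p) (extra B noColumns p))) ≡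
    s * pairs (λ i l → ∑ (assignments n n) (λ w → injective noColumns w *
        (t ^ hitsOutside w i l * eval (kernelOf w i l) t)))
  bracket-kernel = begin
    ∑ (placements n n) (λ p → valid B noColumns p * (+ (empties p !) * bracket s n (rooks p) (empties p)
        (extra B noColumns p)))
      ≡⟨ placements-to-assignments B (λ p → bracket s n (rooks p) (empties p) (extra B noColumns p)) ⟩
    ∑ ws (λ w → injective noColumns w * ∑ (subsets n) (λ S → onBoard B (restrict w S) *
      bracket s n (rooks (restrict w S)) (empties (restrict w S)) (extra B noColumns (restrict w S))))
      ≡⟨ ∑-cong ws (λ w → trans (injective-cong noColumns w (assignment-bracket w))
           (sym (pairs-*ˡ (injective noColumns w) (λ i l → t ^ hitsOutside w i l * totalOf w i l)))) ⟩
    ∑ ws (λ w → pairs (λ i l → injective noColumns w * (t ^ hitsOutside w i l * totalOf w i l)))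
      ≡⟨ pairs-∑ ws (λ w i l → injective noColumns w * (t ^ hitsOutside w i l * totalOf w i l)) ⟩
    pairs (λ i l → ∑ ws (λ w → injective noColumns w * (t ^ hitsOutside w i l * totalOf w i l)))
      ≡⟨ trans (pairs-cong pair-kernel) (pairs-*ˡ s (λ i l → ∑ ws (λ w → injective noColumns w *
          (t ^ hitsOutside w i l * eval (kernelOf w i l) t)))) ⟩
    s * pairs (λ i l → ∑ ws (λ w → injective noColumns w * (t ^ hitsOutside w i l * eval (kernelOf w i l) t))) ∎
    where
    open ≡-Reasoning
    ws = assignments n n

  -- The classical relation between rook and hit numbers: the sum of R_r (n - r)! (t - 1) ^ r is the
  -- sum of t ^ hits(w) over all permutations w.
  rook-hits : ∑ (placements n n) (λ p → valid B noColumns p * (+ (empties p !) * s ^ rooks p)) ≡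
              ∑ (assignments n n) (λ w → injective noColumns w * t ^ number (cell B w))
  rook-hits = trans (placements-to-assignments B (λ p → s ^ rooks p))
      (∑-cong (assignments n n) (λ w → cong (injective noColumns w *_)
    (trans (∑-cong (subsets n) (onBoard-power s B w)) (trans (∑-subsets-∏ n (λ k → rowWeight s (cell B w k)))
      (trans (∏ᶠ-cong (λ k → factor (cell B w k))) (∏ᶠ-power t (cell B w)))))))
    where
    factor : ∀ b → 𝟙 b * s + 1ℤ ≡ (if b then t else 1ℤ)
    factor true  = trans (cong (_+ 1ℤ) (ℤₚ.*-identityˡ s)) (ℤₚ.+-comm s 1ℤ)
    factor false = refl

-- Polynomials in t

infixl 6 _+ᶻ_
infixr 7 _·ᶻ_

_+ᶻ_ : List ℤ → List ℤ → List ℤ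
[]      +ᶻ r       = r
(a ∷ p) +ᶻ []      = a ∷ p
(a ∷ p) +ᶻ (b ∷ r) = (a + b) ∷ (p +ᶻ r)

_·ᶻ_ : ℤ → List ℤ → List ℤ
a ·ᶻ p = map (a *_) p

coef : List ℤ → ℕ → ℤ
coef []      k       = 0ℤ
coef (a ∷ p) zero    = a
coef (a ∷ p) (suc k) = coef p k

eval-+ᶻ : ∀ p r t → eval (p +ᶻ r) t ≡ eval p t + eval r t
eval-+ᶻ []      r       t = sym (ℤₚ.+-identityˡ (eval r t))
eval-+ᶻ (a ∷ p) []      t = sym (ℤₚ.+-identityʳ (a + t * eval p t))
eval-+ᶻ (a ∷ p) (b ∷ r) t = trans (cong (λ z → a + b + t * z) (eval-+ᶻ p r t))
    (rearrange a b t (eval p t) (eval r t))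
  where
  rearrange : ∀ a b t p r → a + b + t * (p + r) ≡ a + t * p + (b + t * r)
  rearrange = solve-∀

eval-·ᶻ : ∀ k p t → eval (k ·ᶻ p) t ≡ k * eval p t
eval-·ᶻ k []      t = sym (ℤₚ.*-zeroʳ k)
eval-·ᶻ k (a ∷ p) t = trans (cong (λ z → k * a + t * z) (eval-·ᶻ k p t)) (rearrange k a t (eval p t))
  where
  rearrange : ∀ k a t p → k * a + t * (k * p) ≡ k * (a + t * p)
  rearrange = solve-∀

coef-+ᶻ : ∀ p r k → coef (p +ᶻ r) k ≡ coef p k + coef r k
coef-+ᶻ []      r       k       = sym (ℤₚ.+-identityˡ (coef r k))
coef-+ᶻ (a ∷ p) []      k       = sym (ℤₚ.+-identityʳ (coef (a ∷ p) k))
coef-+ᶻ (a ∷ p) (b ∷ r) zero    = refl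
coef-+ᶻ (a ∷ p) (b ∷ r) (suc k) = coef-+ᶻ p r k

coef-·ᶻ : ∀ c p k → coef (c ·ᶻ p) k ≡ c * coef p k
coef-·ᶻ c []      k       = sym (ℤₚ.*-zeroʳ c)
coef-·ᶻ c (a ∷ p) zero    = refl
coef-·ᶻ c (a ∷ p) (suc k) = coef-·ᶻ c p k

module _ {a} {A : Set a} where

  sumᶻ : List A → (A → List ℤ) → List ℤ
  sumᶻ []       f = []
  sumᶻ (y ∷ ys) f = f y +ᶻ sumᶻ ys f

  eval-sumᶻ : ∀ (ys : List A) f t → eval (sumᶻ ys f) t ≡ ∑ ys (λ y → eval (f y) t)
  eval-sumᶻ []       f t = refl
  eval-sumᶻ (y ∷ ys) f t = trans (eval-+ᶻ (f y) (sumᶻ ys f) t) (cong (_+_ (eval (f y) t)) (eval-sumᶻ ys f t))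

  coef-sumᶻ : ∀ (ys : List A) f k → coef (sumᶻ ys f) k ≡ ∑ ys (λ y → coef (f y) k)
  coef-sumᶻ []       f k = refl
  coef-sumᶻ (y ∷ ys) f k = trans (coef-+ᶻ (f y) (sumᶻ ys f) k) (cong (_+_ (coef (f y) k)) (coef-sumᶻ ys f k))

multiple-of-all⇒0 : ∀ a → (∀ k → + suc (suc k) ∣ a) → a ≡ 0ℤ
multiple-of-all⇒0 a divs with ℤ.∣ a ∣ in eq
... | zero  = ℤₚ.∣i∣≡0⇒i≡0 eq
... | suc k = contradiction (ℕᵈ.∣⇒≤ {{subst NonZero (sym eq) _}} (Div.∣⇒∣ᵤ (divs (suc k))))
                (ℕₚ.<⇒≱ (subst (ℕ._< suc (suc (suc k))) (sym eq) (ℕₚ.n≤1+n (suc (suc k)))))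

-- The constant coefficient is divisible by every t ≥ 2, hence zero; then a factor t cancels and the
-- rest vanishes at the same points.
vanishing⇒coef≡0 : ∀ p → (∀ k → eval p (+ suc (suc k)) ≡ 0ℤ) → ∀ k → coef p k ≡ 0ℤ
vanishing⇒coef≡0 []      vanish k = refl
vanishing⇒coef≡0 (a ∷ p) vanish k = by-cases k
  where
  a≡0 : a ≡ 0ℤ
  a≡0 = multiple-of-all⇒0 a (λ k → divides (- eval p (+ suc (suc k)))
      (solve-for-a a (+ suc (suc k)) (eval p (+ suc (suc k))) (vanish k)))
    where
    restore : ∀ a t e → a ≡ a + t * e + - e * t
    restore = solve-∀
    solve-for-a : ∀ a t e → a + t * e ≡ 0ℤ → a ≡ - e * t
    solve-for-a a t e eq = trans (restore a t e) (trans (cong (_+ - e * t) eq) (ℤₚ.+-identityˡ (- e * t)))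
  rest : ∀ k → eval p (+ suc (suc k)) ≡ 0ℤ
  rest k = ℤₚ.*-cancelˡ-≡ (+ suc (suc k)) (eval p (+ suc (suc k))) 0ℤ
    (trans (sym (ℤₚ.+-identityˡ (+ suc (suc k) * eval p (+ suc (suc k)))))
      (trans (cong (_+ + suc (suc k) * eval p (+ suc (suc k))) (sym a≡0))
          (trans (vanish k) (sym (ℤₚ.*-zeroʳ (+ suc (suc k)))))))
  by-cases : ∀ k → coef (a ∷ p) k ≡ 0ℤ
  by-cases zero    = a≡0
  by-cases (suc k) = vanishing⇒coef≡0 p rest k

eval-determines : ∀ p r → (∀ k → eval p (+ suc (suc k)) ≡ eval r (+ suc (suc k))) → ∀ k → coef p k ≡ coef r k
eval-determines p r eq k = ℤₚ.i-j≡0⇒i≡j (coef p k) (coef r k)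
  (trans (cong (_+_ (coef p k)) (trans (sym (ℤₚ.-1*i≡-i (coef r k))) (sym (coef-·ᶻ -1ℤ r k))))
    (trans (sym (coef-+ᶻ p (-1ℤ ·ᶻ r) k)) (vanishing⇒coef≡0 (p +ᶻ -1ℤ ·ᶻ r) difference-vanishes k)))
  where
  difference-vanishes : ∀ k → eval (p +ᶻ -1ℤ ·ᶻ r) (+ suc (suc k)) ≡ 0ℤ
  difference-vanishes k = trans (eval-+ᶻ p (-1ℤ ·ᶻ r) t) (trans
      (cong₂ _+_ (eq k) (trans (eval-·ᶻ -1ℤ r t) (ℤₚ.-1*i≡-i (eval r t)))) (ℤₚ.+-inverseʳ (eval r t)))
    where
    t = + suc (suc k)

shift : ℕ → List ℤ → List ℤ
shift zero    p = p
shift (suc k) p = 0ℤ ∷ shift k p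

eval-shift : ∀ k p t → eval (shift k p) t ≡ t ^ k * eval p t
eval-shift zero    p t = sym (ℤₚ.*-identityˡ (eval p t))
eval-shift (suc k) p t = trans (ℤₚ.+-identityˡ (t * eval (shift k p) t))
    (trans (cong (t *_) (eval-shift k p t)) (sym (ℤₚ.*-assoc t (t ^ k) (eval p t))))

coef-shift-1 : ∀ k j → coef (shift k (1ℤ ∷ [])) j ≡ 𝟙 (does (k ℕ.≟ j))
coef-shift-1 zero    zero    = refl
coef-shift-1 zero    (suc j) = refl
coef-shift-1 (suc k) zero    = refl
coef-shift-1 (suc k) (suc j) = coef-shift-1 k j

Nonneg : List ℤ → Set
Nonneg p = ∀ k → 0ℤ ≤ coef p k

nonneg-shift : ∀ j p → Nonneg p → Nonneg (shift j p)
nonneg-shift zero    p 0≤p k       = 0≤p k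
nonneg-shift (suc j) p 0≤p zero    = ℤₚ.≤-refl
nonneg-shift (suc j) p 0≤p (suc k) = nonneg-shift j p 0≤p k

nonneg-sumᶻ : ∀ {a} {A : Set a} (ys : List A) f → (∀ y → Nonneg (f y)) → Nonneg (sumᶻ ys f)
nonneg-sumᶻ ys f 0≤f k = subst (0ℤ ≤_) (sym (coef-sumᶻ ys f k)) (∑-nonneg ys (λ y → 0≤f y k))

*-nonneg : ∀ {a b} → 0ℤ ≤ a → 0ℤ ≤ b → 0ℤ ≤ a * b
*-nonneg {+ a} {+ b} _ _ = subst (0ℤ ≤_) (ℤₚ.pos-* a b) (+≤+ z≤n)

nonneg-·ᶻ : ∀ c p → 0ℤ ≤ c → Nonneg p → Nonneg (c ·ᶻ p)
nonneg-·ᶻ c p 0≤c 0≤p k = subst (0ℤ ≤_) (sym (coef-·ᶻ c p k)) (*-nonneg 0≤c (0≤p k))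

nonneg-kernel : ∀ u v → Nonneg (kernel u v)
nonneg-kernel u v k = go (kernel-natural u v) k
  where
  Natural : List ℤ → Set
  Natural []      = ⊤
  Natural (a ∷ p) = 0ℤ ≤ a × Natural p
  go : ∀ {p} → Natural p → Nonneg p
  go {[]}    _       k       = ℤₚ.≤-refl
  go {a ∷ p} (q , _) zero    = q
  go {a ∷ p} (_ , r) (suc k) = go r k
  kernel-natural : ∀ u v → Natural (kernel u v)
  kernel-natural 0             0             = +≤+ z≤n , tt
  kernel-natural 0             (suc _)       = +≤+ z≤n , +≤+ z≤n , tt
  kernel-natural (suc _)       0             = +≤+ z≤n , +≤+ z≤n , tt
  kernel-natural 1             1             = +≤+ z≤n , +≤+ z≤n , tt
  kernel-natural 1             (suc (suc _)) = +≤+ z≤n , +≤+ z≤n , +≤+ z≤n , tt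
  kernel-natural (suc (suc _)) 1             = +≤+ z≤n , +≤+ z≤n , +≤+ z≤n , tt
  kernel-natural (suc (suc _)) (suc (suc _)) = +≤+ z≤n , +≤+ z≤n , +≤+ z≤n , tt

injective-nonneg : ∀ {m n} C (w : Assignment m n) → 0ℤ ≤ injective C w
injective-nonneg C []      = +≤+ z≤n
injective-nonneg C (c ∷ w) = *-nonneg (𝟙-nonneg (not (C c))) (injective-nonneg (C ◂ c) w)

-- The coefficients of (1 - t) ^ r, the value of the Pochhammer symbol at q = 1.
oneMinus : ℕ → List ℤ
oneMinus zero    = 1ℤ ∷ []
oneMinus (suc r) = oneMinus r +ᶻ (0ℤ ∷ -1ℤ ·ᶻ oneMinus r)

signed : ∀ r s → -1ℤ ^ r * eval (oneMinus r) (1ℤ + s) ≡ s ^ r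
signed zero    s = base s
  where
  base : ∀ s → 1ℤ * (1ℤ + (1ℤ + s) * 0ℤ) ≡ 1ℤ
  base = solve-∀
signed (suc r) s = trans (cong (-1ℤ * -1ℤ ^ r *_) (trans (eval-+ᶻ (oneMinus r) (0ℤ ∷ -1ℤ ·ᶻ oneMinus r) (1ℤ + s))
    (cong (λ z → e + (0ℤ + (1ℤ + s) * z)) (eval-·ᶻ -1ℤ (oneMinus r) (1ℤ + s)))))
  (trans (step (-1ℤ ^ r) e s) (cong (s *_) (signed r s)))
  where
  e = eval (oneMinus r) (1ℤ + s)
  step : ∀ g e s → -1ℤ * g * (e + (0ℤ + (1ℤ + s) * (-1ℤ * e))) ≡ s * (g * e)
  step = solve-∀

-- The derivative at q = 1 of the q-factorial of k.
factorial′ : ℕ → ℤ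
factorial′ zero    = 0ℤ
factorial′ (suc k) = + suc k * factorial′ k + triangular (suc k) * + (k !)

2*triangular : ∀ k → + 2 * triangular (suc k) ≡ + suc k * + k
2*triangular zero    = refl
2*triangular (suc k) = trans (ℤₚ.*-distribˡ-+ (+ 2) (triangular (suc k)) (+ suc k))
    (trans (cong (_+ + 2 * + suc k) (2*triangular k)) (step (+ k)))
  where
  step : ∀ k → (1ℤ + k) * k + + 2 * (1ℤ + k) ≡ (1ℤ + (1ℤ + k)) * (1ℤ + k)
  step = solve-∀

-- The q-number [j] has logarithmic derivative (j - 1) / 2 at q = 1, and these add up to half of
-- `triangular k`. Doubling keeps the identity in the integers.
2*factorial′ : ∀ k → + 2 * factorial′ k ≡ + (k !) * triangular k
2*factorial′ zero    = refl
2*factorial′ (suc k) = begin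
  + 2 * (+ suc k * factorial′ k + triangular (suc k) * + (k !))
    ≡⟨ distribute (+ suc k) (factorial′ k) (triangular (suc k)) (+ (k !)) ⟩
  + suc k * (+ 2 * factorial′ k) + + 2 * triangular (suc k) * + (k !)
    ≡⟨ cong₂ (λ u v → + suc k * u + v * + (k !)) (2*factorial′ k) (2*triangular k) ⟩
  + suc k * (+ (k !) * triangular k) + + suc k * + k * + (k !)
    ≡⟨ collect (+ suc k) (+ (k !)) (triangular k) (+ k) ⟩
  + suc k * + (k !) * (triangular k + + k)
    ≡⟨ cong (_* triangular (suc k)) (ℤₚ.pos-* (suc k) (k !)) ⟨
  + (suc k !) * triangular (suc k) ∎
  where
  open ≡-Reasoning
  distribute : ∀ a d t f → + 2 * (a * d + t * f) ≡ a * (+ 2 * d) + + 2 * t * f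
  distribute = solve-∀
  collect : ∀ a f t k → a * (f * t) + a * k * f ≡ a * f * (t + k)
  collect = solve-∀

-- The value and the derivative at q = 1 of the coefficient polynomial of the r-th q-rook number.
constantFactor linearFactor : ℕ → ℕ → List ℤ
constantFactor n r = (-1ℤ ^ r * + ((n ∸ r) !)) ·ᶻ oneMinus r
linearFactor n r = (-1ℤ ^ r * ((triangular n - triangular r) * + ((n ∸ r) !) + factorial′ (n ∸ r))) ·ᶻ oneMinus r
                   +ᶻ (-1ℤ ^ r * (triangular r * + ((n ∸ r) !))) ·ᶻ oneMinus (ℕ.pred r)

eval-constantFactor : ∀ n r s → eval (constantFactor n r) (1ℤ + s) ≡ + ((n ∸ r) !) * s ^ r
eval-constantFactor n r s = trans (eval-·ᶻ (-1ℤ ^ r * + ((n ∸ r) !)) (oneMinus r) (1ℤ + s))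
  (trans (rearrange (-1ℤ ^ r) (+ ((n ∸ r) !)) (eval (oneMinus r) (1ℤ + s))) (cong (+ ((n ∸ r) !) *_) (signed r s)))
  where
  rearrange : ∀ g f e → g * f * e ≡ f * (g * e)
  rearrange = solve-∀

eval-factors : ∀ n r s extras → + 2 * s * (extras * eval (constantFactor n r) (1ℤ + s) + eval (linearFactor n r)
    (1ℤ + s)) ≡
               + ((n ∸ r) !) * bracket s n r (n ∸ r) extras
eval-factors n r s extras = begin
  + 2 * s * (extras * eval (constantFactor n r) t + eval (linearFactor n r) t)
    ≡⟨ cong₂ (λ u v → + 2 * s * (extras * u + v)) (eval-constantFactor n r s)
         (trans (eval-+ᶻ ((g * ((N - T) * f + f′)) ·ᶻ oneMinus r) ((g * (T * f)) ·ᶻ oneMinus (ℕ.pred r)) t)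
           (cong₂ _+_ (eval-·ᶻ (g * ((N - T) * f + f′)) (oneMinus r) t)
               (eval-·ᶻ (g * (T * f)) (oneMinus (ℕ.pred r)) t))) ⟩
  + 2 * s * (extras * (f * s ^ r) + (g * ((N - T) * f + f′) * eval (oneMinus r) t + g * (T * f) * eval
      (oneMinus (ℕ.pred r)) t))
    ≡⟨ separate s extras f (s ^ r) g N T f′ (eval (oneMinus r) t) (eval (oneMinus (ℕ.pred r)) t) ⟩
  + 2 * s * (extras * (f * s ^ r)) + s * ((+ 2 * (N - T) * f + + 2 * f′) * (g * eval (oneMinus r) t)) + + 2 * f *
      (s * (g * T * eval (oneMinus (ℕ.pred r)) t))
    ≡⟨ cong₂ (λ u v → + 2 * s * (extras * (f * s ^ r)) + s * u + + 2 * f * v)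
         (cong₂ (λ u v → (+ 2 * (N - T) * f + u) * v) (2*factorial′ (n ∸ r)) (signed r s)) (lowered r) ⟩
  + 2 * s * (extras * (f * s ^ r)) + s * ((+ 2 * (N - T) * f + f * triangular (n ∸ r)) * s ^ r) + + 2 * f *
      (- (T * s ^ r))
    ≡⟨ collect s extras f (s ^ r) N T (triangular (n ∸ r)) ⟩
  f * bracket s n r (n ∸ r) extras ∎
  where
  open ≡-Reasoning
  t = 1ℤ + s
  g = -1ℤ ^ r
  f = + ((n ∸ r) !)
  f′ = factorial′ (n ∸ r)
  N = triangular n
  T = triangular r
  separate : ∀ s x f p g N T f′ a b → + 2 * s * (x * (f * p) + (g * ((N - T) * f + f′) * a + g * (T * f) * b)) ≡
             + 2 * s * (x * (f * p)) + s * ((+ 2 * (N - T) * f + + 2 * f′) * (g * a)) + + 2 * f * (s * (g * T * b))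
  separate = solve-∀
  lowered : ∀ r → s * (-1ℤ ^ r * triangular r * eval (oneMinus (ℕ.pred r)) t) ≡ - (triangular r * s ^ r)
  -- For r = 0 the truncated predecessor does no harm, because `triangular 0` is zero.
  lowered zero    = ℤₚ.*-zeroʳ s
  lowered (suc r) = trans (rearrange s (-1ℤ ^ r) (triangular (suc r)) (eval (oneMinus r) t))
      (cong (λ z → - (triangular (suc r) * (s * z))) (signed r s))
    where
    rearrange : ∀ s g T e → s * (-1ℤ * g * T * e) ≡ - (T * (s * (g * e)))
    rearrange = solve-∀
  collect : ∀ s x f p N T E → + 2 * s * (x * (f * p)) + s * ((+ 2 * (N - T) * f + f * E) * p) + + 2 * f *
      (- (T * p)) ≡
            f * (p * (s * (+ 2 * x + + 2 * N - + 2 * T + E) - + 2 * T))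
  collect = solve-∀

∑-applyUpTo : ∀ n (g : ℕ → ℕ) (h : ℕ → ℤ) → ∑ (applyUpTo g n) h ≡ ∑ᶠ {n} (λ i → h (g (toℕ i)))
∑-applyUpTo zero    g h = refl
∑-applyUpTo (suc n) g h = trans (cong (_+_ (h (g 0))) (∑-applyUpTo n (g ∘ suc) h))
    (sym (∑ᶠ-suc {n} (λ i → h (g (toℕ i)))))

∑-rankIs : ∀ {n k} (g : ℕ → ℤ) → k ℕ.< n → ∑ (upTo n) (λ r → rankIs r k * g r) ≡ g k
∑-rankIs {n} {k} g k<n = trans (∑-applyUpTo n id (λ r → rankIs r k * g r))
  (trans (∑ᶠ-cong (λ i → cong (_* g (toℕ i)) (𝟙-cong (k ℕ.≟ toℕ i) (i Fin.≟ fromℕ< k<n)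
      (λ eq → Finₚ.toℕ-injective (trans (sym eq) (sym (Finₚ.toℕ-fromℕ< k<n))))
          (λ eq → trans (sym (Finₚ.toℕ-fromℕ< k<n)) (cong toℕ (sym eq))))))
    (trans (∑ᶠ-δ (fromℕ< k<n) (g ∘ toℕ)) (cong g (Finₚ.toℕ-fromℕ< k<n))))

module _ {n : ℕ} (B : Board n n) where

  private
    ps = placements n n
    ws = assignments n n
    rooks<1+n : ∀ (p : Placement n n) → rooks p ℕ.< suc n
    rooks<1+n p = s≤s (subst (rooks p ≤ℕ_) (rooks+empties p) (ℕₚ.m≤m+n (rooks p) (empties p)))
    n∸rooks : ∀ (p : Placement n n) → n ∸ rooks p ≡ empties p
    n∸rooks p = trans (cong (_∸ rooks p) (sym (rooks+empties p))) (ℕₚ.m+n∸m≡n (rooks p) (empties p))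

  rookCount extraCount : ℕ → ℤ
  rookCount r = rookSum B noColumns (rankIs r)
  extraCount r = extraSum B noColumns (rankIs r)

  ∑-ranks : ∀ (v : Placement n n → ℤ) (g : ℕ → ℤ) → ∑ (upTo (suc n))
      (λ r → ∑ ps (λ p → v p * rankIs r (rooks p)) * g r) ≡ ∑ ps (λ p → v p * g (rooks p))
  ∑-ranks v g = trans (∑-cong (upTo (suc n)) (λ r → sym (∑-*ʳ ps (g r) (λ p → v p * rankIs r (rooks p)))))
    (trans (∑-swap (upTo (suc n)) ps (λ r p → v p * rankIs r (rooks p) * g r))
      (∑-cong ps (λ p → trans (∑-cong (upTo (suc n)) (λ r → ℤₚ.*-assoc (v p) (rankIs r (rooks p)) (g r)))
        (trans (∑-*ˡ (upTo (suc n)) (v p) (λ r → rankIs r (rooks p) * g r))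
            (cong (v p *_) (∑-rankIs g (rooks<1+n p)))))))

  constantPoly linearPoly : List ℤ
  constantPoly = sumᶻ (upTo (suc n)) (λ r → rookCount r ·ᶻ constantFactor n r)
  linearPoly = sumᶻ (upTo (suc n)) (λ r → extraCount r ·ᶻ constantFactor n r +ᶻ rookCount r ·ᶻ linearFactor n r)

  hitPoly : List ℤ
  hitPoly = sumᶻ ws (λ w → injective noColumns w ·ᶻ shift (number (cell B w)) (1ℤ ∷ []))

  -- One polynomial must serve all values of t, so the module parameter s is fixed at 0 here;
  -- `eval-linearPoly` compares it with the instance s = t - 1, and the two agree by computation.
  kernelPoly : List ℤ
  kernelPoly = sumᶻ (allFin n) (λ i → sumᶻ (allFin n) (λ l → 𝟙 (i <ᵇ l) ·ᶻ sumᶻ ws (λ w → injective noColumns w ·ᶻ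
                 shift (hitsOutside B 0ℤ w i l) (kernelOf B 0ℤ w i l))))

  eval-constantPoly : ∀ s → eval constantPoly (1ℤ + s) ≡ eval hitPoly (1ℤ + s)
  eval-constantPoly s = begin
    eval constantPoly t
      ≡⟨ eval-sumᶻ (upTo (suc n)) (λ r → rookCount r ·ᶻ constantFactor n r) t ⟩
    ∑ (upTo (suc n)) (λ r → eval (rookCount r ·ᶻ constantFactor n r) t)
      ≡⟨ ∑-cong (upTo (suc n)) (λ r → trans (eval-·ᶻ (rookCount r) (constantFactor n r) t)
          (cong (rookCount r *_) (eval-constantFactor n r s))) ⟩
    ∑ (upTo (suc n)) (λ r → rookCount r * (+ ((n ∸ r) !) * s ^ r))
      ≡⟨ ∑-ranks (valid B noColumns) (λ r → + ((n ∸ r) !) * s ^ r) ⟩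
    ∑ ps (λ p → valid B noColumns p * (+ ((n ∸ rooks p) !) * s ^ rooks p))
      ≡⟨ ∑-cong ps (λ p → cong (λ e → valid B noColumns p * (+ (e !) * s ^ rooks p)) (n∸rooks p)) ⟩
    ∑ ps (λ p → valid B noColumns p * (+ (empties p !) * s ^ rooks p))
      ≡⟨ rook-hits B s ⟩
    ∑ ws (λ w → injective noColumns w * t ^ number (cell B w))
      ≡⟨ ∑-cong ws (λ w → trans (eval-·ᶻ (injective noColumns w) (shift (number (cell B w)) (1ℤ ∷ [])) t)
           (cong (injective noColumns w *_) (trans (eval-shift (number (cell B w)) (1ℤ ∷ []) t)
               (unit (t ^ number (cell B w)) t)))) ⟨
    ∑ ws (λ w → eval (injective noColumns w ·ᶻ shift (number (cell B w)) (1ℤ ∷ [])) t)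
      ≡⟨ eval-sumᶻ ws (λ w → injective noColumns w ·ᶻ shift (number (cell B w)) (1ℤ ∷ [])) t ⟨
    eval hitPoly t ∎
    where
    open ≡-Reasoning
    t = 1ℤ + s
    unit : ∀ p t → p * (1ℤ + t * 0ℤ) ≡ p
    unit = solve-∀

  -- The common factor s = t - 1 remains on both sides and is cancelled in `nonneg-linearPoly`,
  -- where t is at least 2.
  eval-linearPoly : ∀ s → + 2 * s * eval linearPoly (1ℤ + s) ≡ s * eval kernelPoly (1ℤ + s)
  eval-linearPoly s = begin
    + 2 * s * eval linearPoly t
      ≡⟨ cong (+ 2 * s *_) (trans (eval-sumᶻ (upTo (suc n))
          (λ r → extraCount r ·ᶻ constantFactor n r +ᶻ rookCount r ·ᶻ linearFactor n r) t)
           (trans (∑-cong (upTo (suc n)) summand) (∑-+ (upTo (suc n)) (λ r → extraCount r * c r)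
               (λ r → rookCount r * l r)))) ⟩
    + 2 * s * (∑ (upTo (suc n)) (λ r → extraCount r * c r) + ∑ (upTo (suc n)) (λ r → rookCount r * l r))
      ≡⟨ cong₂ (λ u v → + 2 * s * (u + v))
           (trans (∑-cong (upTo (suc n)) (λ r → cong (_* c r)
               (∑-cong ps (λ p → sym (ℤₚ.*-assoc (valid B noColumns p) (extra B noColumns p)
               (rankIs r (rooks p)))))))
                  (∑-ranks (λ p → valid B noColumns p * extra B noColumns p) c)) (∑-ranks (valid B noColumns) l) ⟩
    + 2 * s * (∑ ps (λ p → valid B noColumns p * extra B noColumns p * c (rooks p)) + ∑ ps
        (λ p → valid B noColumns p * l (rooks p)))
      ≡⟨ trans (cong (+ 2 * s *_) (sym (∑-+ ps (λ p → valid B noColumns p * extra B noColumns p * c (rooks p))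
          (λ p → valid B noColumns p * l (rooks p)))))
           (sym (∑-*ˡ ps (+ 2 * s) (λ p → valid B noColumns p * extra B noColumns p * c (rooks p)
               + valid B noColumns p * l (rooks p)))) ⟩
    ∑ ps (λ p → + 2 * s * (valid B noColumns p * extra B noColumns p * c (rooks p) + valid B noColumns p * l
        (rooks p)))
      ≡⟨ ∑-cong ps (λ p → trans (factor s (valid B noColumns p) (extra B noColumns p) (c (rooks p)) (l (rooks p)))
           (cong (valid B noColumns p *_) (trans (eval-factors n (rooks p) s (extra B noColumns p))
             (cong (λ e → + (e !) * bracket s n (rooks p) e (extra B noColumns p)) (n∸rooks p))))) ⟩
    ∑ ps (λ p → valid B noColumns p * (+ (empties p !) * bracket s n (rooks p) (empties p) (extra B noColumns p)))
      ≡⟨ bracket-kernel B s ⟩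
    s * pairs (λ i l → ∑ ws (λ w → injective noColumns w * (t ^ hitsOutside B s w i l * eval
        (kernelOf B s w i l) t)))
      ≡⟨ cong (s *_) eval-kernelPoly ⟨
    s * eval kernelPoly t ∎
    where
    open ≡-Reasoning
    t = 1ℤ + s
    c l : ℕ → ℤ
    c r = eval (constantFactor n r) t
    l r = eval (linearFactor n r) t
    summand : ∀ r → eval (extraCount r ·ᶻ constantFactor n r +ᶻ rookCount r ·ᶻ linearFactor n r) t
        ≡ extraCount r * c r + rookCount r * l r
    summand r = trans (eval-+ᶻ (extraCount r ·ᶻ constantFactor n r) (rookCount r ·ᶻ linearFactor n r) t)
      (cong₂ _+_ (eval-·ᶻ (extraCount r) (constantFactor n r) t) (eval-·ᶻ (rookCount r) (linearFactor n r) t))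
    factor : ∀ s v x c l → + 2 * s * (v * x * c + v * l) ≡ v * (+ 2 * s * (x * c + l))
    factor = solve-∀
    term : Fin n → Fin n → Assignment n n → List ℤ
    term i l w = injective noColumns w ·ᶻ shift (hitsOutside B s w i l) (kernelOf B s w i l)
    eval-kernelPoly : eval kernelPoly t ≡ pairs (λ i l → ∑ ws (λ w → injective noColumns w *
        (t ^ hitsOutside B s w i l * eval (kernelOf B s w i l) t)))
    eval-kernelPoly = trans (eval-sumᶻ (allFin n) (λ i → sumᶻ (allFin n)
        (λ l → 𝟙 (i <ᵇ l) ·ᶻ sumᶻ ws (term i l))) t)
      (∑ᶠ-cong (λ i → trans (eval-sumᶻ (allFin n) (λ l → 𝟙 (i <ᵇ l) ·ᶻ sumᶻ ws (term i l)) t)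
        (∑ᶠ-cong (λ l → trans (eval-·ᶻ (𝟙 (i <ᵇ l)) (sumᶻ ws (term i l)) t) (cong (𝟙 (i <ᵇ l) *_)
          (trans (eval-sumᶻ ws (term i l) t) (∑-cong ws (λ w → trans (eval-·ᶻ (injective noColumns w)
              (shift (hitsOutside B s w i l) (kernelOf B s w i l)) t)
            (cong (injective noColumns w *_) (eval-shift (hitsOutside B s w i l) (kernelOf B s w i l) t))))))))))

  coef-constantPoly : ∀ k → coef constantPoly k ≡ ∑ ws (λ w → injective noColumns w * 𝟙
      (does (number (cell B w) ℕ.≟ k)))
  coef-constantPoly k = trans (eval-determines constantPoly hitPoly (λ j → eval-constantPoly (+ suc j)) k)
    (trans (coef-sumᶻ ws (λ w → injective noColumns w ·ᶻ shift (number (cell B w)) (1ℤ ∷ [])) k)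
      (∑-cong ws (λ w → trans (coef-·ᶻ (injective noColumns w) (shift (number (cell B w)) (1ℤ ∷ [])) k)
          (cong (injective noColumns w *_) (coef-shift-1 (number (cell B w)) k)))))

  nonneg-kernelPoly : Nonneg kernelPoly
  nonneg-kernelPoly = nonneg-sumᶻ (allFin n) row (λ i → nonneg-sumᶻ (allFin n) (entries i) (λ l →
    nonneg-·ᶻ (𝟙 (i <ᵇ l)) (sumᶻ ws (term i l)) (𝟙-nonneg (i <ᵇ l)) (nonneg-sumᶻ ws (term i l) (λ w →
      nonneg-·ᶻ (injective noColumns w) (shift (hitsOutside B 0ℤ w i l) (kernelOf B 0ℤ w i l))
          (injective-nonneg noColumns w)
        (nonneg-shift (hitsOutside B 0ℤ w i l) (kernelOf B 0ℤ w i l)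
          (nonneg-kernel (hits (cell B w i) (cell B w l)) (hits (corner B w i l) (corner B w l i))))))))
    where
    term : Fin n → Fin n → Assignment n n → List ℤ
    term i l w = injective noColumns w ·ᶻ shift (hitsOutside B 0ℤ w i l) (kernelOf B 0ℤ w i l)
    entries : Fin n → Fin n → List ℤ
    entries i l = 𝟙 (i <ᵇ l) ·ᶻ sumᶻ ws (term i l)
    row : Fin n → List ℤ
    row i = sumᶻ (allFin n) (entries i)

  -- The polynomials `kernelPoly` and 2 `linearPoly` agree at all integers t ≥ 2, hence coefficient
  -- by coefficient.
  nonneg-linearPoly : Nonneg linearPoly
  nonneg-linearPoly k = ℤₚ.*-cancelˡ-≤-pos 0ℤ (coef linearPoly k) (+ 2)
      (subst (0ℤ ≤_) doubled (nonneg-kernelPoly k))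
    where
    doubled : coef kernelPoly k ≡ + 2 * coef linearPoly k
    doubled = trans (eval-determines kernelPoly (+ 2 ·ᶻ linearPoly) (λ j → ℤₚ.*-cancelˡ-≡ (+ suc j) _ _
        (trans (sym (eval-linearPoly (+ suc j))) (trans (rearrange (+ suc j) (eval linearPoly (+ suc (suc j))))
          (cong (+ suc j *_) (sym (eval-·ᶻ (+ 2) linearPoly (+ suc (suc j)))))))) k) (coef-·ᶻ (+ 2) linearPoly k)
      where
      rearrange : ∀ s e → + 2 * s * e ≡ s * (+ 2 * e)
      rearrange = solve-∀

-- Hit numbers

placementBoard : ∀ {m n} → Assignment m n → Board m n
placementBoard = Vec.map ⁅_⁆

∈-placementBoard : ∀ {m n} (w : Assignment m n) i j → (i , j) ∈ᴮ placementBoard w → j ≡ lookup w i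
∈-placementBoard w i j p = Subsetₚ.x∈⁅y⁆⇒x≡y (lookup w i) (subst (j ∈ˢ_) (Vecₚ.lookup-map i ⁅_⁆ w) p)

placementBoard-∈ : ∀ {m n} (w : Assignment m n) i → (i , lookup w i) ∈ᴮ placementBoard w
placementBoard-∈ w i = subst (lookup w i ∈ˢ_) (sym (Vecₚ.lookup-map i ⁅_⁆ w)) (Subsetₚ.x∈⁅x⁆ (lookup w i))

placementBoard-injective : ∀ {m n} (v w : Assignment m n) → placementBoard v ≡ placementBoard w → v ≡ w
placementBoard-injective v w eq = vec-ext (λ i → ∈-placementBoard w i (lookup v i)
    (subst ((i , lookup v i) ∈ᴮ_) eq (placementBoard-∈ v i)))

size-placementBoard : ∀ {m n} (w : Assignment m n) → size (placementBoard w) ≡ m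
size-placementBoard []      = refl
size-placementBoard (c ∷ w) = cong₂ ℕ._+_ (Subsetₚ.∣⁅x⁆∣≡1 c) (size-placementBoard w)

size-∩ : ∀ {m n} (w : Assignment m n) (B : Board m n) → size (placementBoard w ∩ᴮ B) ≡ number (cell B w)
size-∩ []      []      = refl
size-∩ (c ∷ w) (β ∷ B) = trans (cong₂ ℕ._+_ (row c β) (size-∩ w B)) (by-cases (lookup β c))
  where
  row : ∀ {n} (c : Fin n) (β : Subset n) → ∣ ⁅ c ⁆ ∩ β ∣ ≡ (if lookup β c then 1 else 0)
  row {suc n} zero (true ∷ β)  = cong suc (trans (cong ∣_∣ (Subsetₚ.∩-zeroˡ β)) (Subsetₚ.∣⊥∣≡0 n))
  row {suc n} zero (false ∷ β) = trans (cong ∣_∣ (Subsetₚ.∩-zeroˡ β)) (Subsetₚ.∣⊥∣≡0 n)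
  row (suc c) (b ∷ β) = row c β
  by-cases : ∀ b → (if b then 1 else 0) ℕ.+ number (cell B w) ≡
      (if b then suc (number (cell B w)) else number (cell B w))
  by-cases true  = refl
  by-cases false = refl

distinct⇒nonAttacking : ∀ {m n} (w : Assignment m n) → Distinct w → NonAttacking (placementBoard w)
distinct⇒nonAttacking w distinct i j i′ j′ p p′ same with ∈-placementBoard w i j p | ∈-placementBoard w i′ j′ p′ |
    same
... | refl | refl | inj₁ refl = refl , refl
... | refl | refl | inj₂ eq with refl ← distinct i i′ eq = refl , refl

nonAttacking⇒distinct : ∀ {m n} (w : Assignment m n) → NonAttacking (placementBoard w) → Distinct w
nonAttacking⇒distinct w na i j eq = proj₁ (na i (lookup w i) j (lookup w j) (placementBoard-∈ w i)
    (placementBoard-∈ w j) (inj₂ eq))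

∅-or-singleton : ∀ {n} (σ : Subset n) → (∀ i j → lookup σ i ≡ inside → lookup σ j ≡ inside → i ≡ j)
    → σ ≡ ∅ ⊎ ∃ λ c → σ ≡ ⁅ c ⁆
∅-or-singleton σ unique with ∅-or-∈ σ
... | inj₁ σ≡∅       = inj₁ σ≡∅
... | inj₂ (c , c∈σ) = inj₂ (c , vec-ext (λ j → trans (at j) (sym (lookup-⁅⁆ c j))))
  where
  at : ∀ j → lookup σ j ≡ (j == c)
  at j with j Fin.≟ c
  ... | yes refl = c∈σ
  ... | no j≢c   = Boolₚ.¬-not (λ j∈σ → j≢c (unique j c j∈σ c∈σ))

-- With at most one cell in each of m rows, a total of m cells leaves no row empty.
full-board : ∀ {m n} (P : Board m n) → (∀ i → lookup P i ≡ ∅ ⊎ ∃ λ c → lookup P i ≡ ⁅ c ⁆) →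
             size P ≤ℕ m × (size P ≡ m → ∃ λ w → P ≡ placementBoard w)
full-board []      rows = z≤n , λ _ → [] , refl
full-board {suc m} {n} (σ ∷ P) rows with rows zero | full-board P (rows ∘ suc)
... | inj₁ refl       | bound , full = subst (λ k → k ℕ.+ size P ≤ℕ suc m) (sym (Subsetₚ.∣⊥∣≡0 n))
    (ℕₚ.m≤n⇒m≤1+n bound) ,
  λ eq → contradiction (subst (_≤ℕ m) (trans (sym (cong (ℕ._+ size P) (Subsetₚ.∣⊥∣≡0 n))) eq) bound) ℕₚ.1+n≰n
... | inj₂ (c , refl) | bound , full = subst (λ k → k ℕ.+ size P ≤ℕ suc m) (sym (Subsetₚ.∣⁅x⁆∣≡1 c)) (s≤s bound) ,
  λ eq → extend (full (ℕₚ.suc-injective (trans (sym (cong (ℕ._+ size P) (Subsetₚ.∣⁅x⁆∣≡1 c))) eq)))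
  where
  extend : (∃ λ w → P ≡ placementBoard w) → ∃ λ w → ⁅ c ⁆ ∷ P ≡ placementBoard w
  extend (w , eq) = c ∷ w , cong (⁅ c ⁆ ∷_) eq

isHit⇒placementBoard : ∀ {m n} (B : Board m n) k P → IsHit B k P → ∃ λ w → P ≡ placementBoard w
isHit⇒placementBoard B k P (card , na , _) = proj₂ (full-board P (λ i → ∅-or-singleton (lookup P i)
  (λ j j′ j∈ j′∈ → proj₂ (na i j i j′ (Vecₚ.lookup⇒[]= j (lookup P i) j∈) (Vecₚ.lookup⇒[]= j′ (lookup P i) j′∈)
      (inj₁ refl))))) card

injective-distinct : ∀ {m n} (w : Assignment m n) → Distinct w → injective noColumns w ≡ 1ℤ
injective-distinct w distinct = fresh⇒1 noColumns w (distinct⇒fresh noColumns w (λ _ → refl) distinct)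

injective-¬distinct : ∀ {m n} (w : Assignment m n) → ¬ Distinct w → injective noColumns w ≡ 0ℤ
injective-¬distinct w ¬distinct with fresh-or-0 noColumns w
... | inj₁ (f , _) = contradiction (fresh⇒distinct noColumns w f) ¬distinct
... | inj₂ eq      = eq

hit-assignment : ∀ {m n} (B : Board m n) k w → 𝟙 (does (isHit? B k (placementBoard w))) ≡ injective noColumns w * 𝟙
    (does (number (cell B w) ℕ.≟ k))
hit-assignment B k w = by-cases (Finₚ.all? λ i → Finₚ.all? λ j → (lookup w i Fin.≟ lookup w j) Dec.→-dec
    (i Fin.≟ j))
  where
  by-cases : Dec (Distinct w) → 𝟙 (does (isHit? B k (placementBoard w))) ≡ injective noColumns w * 𝟙
      (does (number (cell B w) ℕ.≟ k))
  by-cases (yes d) = trans (𝟙-cong (isHit? B k (placementBoard w)) (number (cell B w) ℕ.≟ k)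
      (λ { (_ , _ , hits) → trans (sym (size-∩ w B)) hits })
          (λ hits → size-placementBoard w , distinct⇒nonAttacking w d , trans (size-∩ w B) hits))
    (sym (trans (cong (_* 𝟙 (does (number (cell B w) ℕ.≟ k))) (injective-distinct w d))
        (ℤₚ.*-identityˡ (𝟙 (does (number (cell B w) ℕ.≟ k))))))
  by-cases (no ¬d) = trans (𝟙-false (isHit? B k (placementBoard w))
      (λ { (_ , na , _) → ¬d (nonAttacking⇒distinct w na) }))
    (sym (cong (_* 𝟙 (does (number (cell B w) ℕ.≟ k))) (injective-¬distinct w ¬d)))

boards-enumerate : ∀ m n → Enumerates (vecs (subsets n) m)
boards-enumerate m n = vecs-enumerates (vecs-enumerates bool-enumerates n) m

_≟ᴮ_ : ∀ {m n} → DecidableEquality (Board m n)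
_≟ᴮ_ = Vecₚ.≡-dec (Vecₚ.≡-dec Boolₚ._≟_)

-- Hit numbers count sets of cells. A set that is a full non-attacking placement is
-- `placementBoard w` for exactly one w, so the count is transported by summing a delta function
-- over w.
hitNumber-assignments : ∀ {m n} (B : Board m n) k →
  + hitNumber B k ≡ ∑ (assignments m n) (λ w → injective noColumns w * 𝟙 (does (number (cell B w) ℕ.≟ k)))
hitNumber-assignments {m} {n} B k = begin
  + hitNumber B k
    ≡⟨ length-filter (isHit? B k) Ps ⟩
  ∑ Ps (λ P → 𝟙 (does (isHit? B k P)))
    ≡⟨ ∑-cong Ps represented ⟩
  ∑ Ps (λ P → ∑ ws (λ w → 𝟙 (does (P ≟ᴮ placementBoard w)) * hit w))
    ≡⟨ ∑-swap Ps ws (λ P w → 𝟙 (does (P ≟ᴮ placementBoard w)) * hit w) ⟩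
  ∑ ws (λ w → ∑ Ps (λ P → 𝟙 (does (P ≟ᴮ placementBoard w)) * hit w))
    ≡⟨ ∑-cong ws (λ w → ∑-δ (boards-enumerate m n) _≟ᴮ_ (placementBoard w) (λ _ → hit w)) ⟩
  ∑ ws hit ∎
  where
  open ≡-Reasoning
  Ps = vecs (subsets n) m
  ws = assignments m n
  hit : Assignment m n → ℤ
  hit w = injective noColumns w * 𝟙 (does (number (cell B w) ℕ.≟ k))
  represented : ∀ P → 𝟙 (does (isHit? B k P)) ≡ ∑ ws (λ w → 𝟙 (does (P ≟ᴮ placementBoard w)) * hit w)
  represented P with Any.any? (λ w → P ≟ᴮ placementBoard w) ws
  ... | yes found = at (Any.satisfied found)
    where
    at : (∃ λ w → P ≡ placementBoard w) → 𝟙 (does (isHit? B k P)) ≡ ∑ ws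
        (λ w → 𝟙 (does (P ≟ᴮ placementBoard w)) * hit w)
    at (v , refl) = trans (hit-assignment B k v) (sym (trans
      (sift (vecs-enumerates (allFin-enumerates n) m) (λ w → 𝟙 (does
          (placementBoard v ≟ᴮ placementBoard w)) * hit w) v
        (λ w w≢v → cong (_* hit w) (𝟙-false (placementBoard v ≟ᴮ placementBoard w)
            (λ eq → w≢v (sym (placementBoard-injective v w eq))))))
      (trans (cong (_* hit v) (𝟙-true (placementBoard v ≟ᴮ placementBoard v) refl)) (ℤₚ.*-identityˡ (hit v)))))
  ... | no ¬found = trans (𝟙-false (isHit? B k P) (λ h → none (isHit⇒placementBoard B k P h)))
      (sym (∑-zero ws (λ w → cong (_* hit w) (𝟙-false (P ≟ᴮ placementBoard w) (λ eq → none (w , eq))))))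
    where
    none : ¬ (∃ λ w → P ≡ placementBoard w)
    none (w , eq) = ¬found (lose (∈-vecs ∈ₚ.∈-allFin w) eq)

coef-constantPoly-hitNumber : ∀ {n} (B : Board n n) k → coef (constantPoly B) k ≡ + hitNumber B k
coef-constantPoly-hitNumber B k = trans (coef-constantPoly B k) (sym (hitNumber-assignments B k))

-- First-order expansion in q − 1

module ℚSolver = ℚ-Solver.+-*-Solver

ι : ℤ → ℚ
ι a = a / 1

-- Reduction to lowest terms blocks computation with fractions, so the comparison is made on
-- unnormalised representatives.
ι-*-/ : ∀ a b d .{{_ : NonZero d}} → ι a ℚ.* (b / d) ≡ (a * b) / d
ι-*-/ a b (suc d) = ℚₚ.toℚᵘ-injective (begin
  ℚ.toℚᵘ (ι a ℚ.* (b / suc d))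
    ≈⟨ ℚₚ.toℚᵘ-homo-* (ι a) (b / suc d) ⟩
  ℚ.toℚᵘ (ι a) ℚᵘ.* ℚ.toℚᵘ (b / suc d)
    ≈⟨ ℚᵘₚ.*-cong (ℚₚ.toℚᵘ-fromℚᵘ (ℚᵘ.mkℚᵘ a 0)) (ℚₚ.toℚᵘ-fromℚᵘ (ℚᵘ.mkℚᵘ b d)) ⟩
  ℚᵘ.mkℚᵘ a 0 ℚᵘ.* ℚᵘ.mkℚᵘ b d
    ≈⟨ ℚᵘ.*≡* (cong (λ k → a * b * + suc k) (sym (ℕₚ.+-identityʳ d))) ⟩
  ℚᵘ.mkℚᵘ (a * b) d
    ≈⟨ ℚₚ.toℚᵘ-fromℚᵘ (ℚᵘ.mkℚᵘ (a * b) d) ⟨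
  ℚ.toℚᵘ ((a * b) / suc d) ∎)
  where open ℚᵘₚ.≃-Reasoning

ι-* : ∀ a b → ι (a * b) ≡ ι a ℚ.* ι b
ι-* a b = sym (ι-*-/ a b 1)

ι-+ : ∀ a b → ι (a + b) ≡ ι a ℚ.+ ι b
ι-+ a b = ℚₚ.toℚᵘ-injective (begin
  ℚ.toℚᵘ (ι (a + b))
    ≈⟨ ℚₚ.toℚᵘ-fromℚᵘ (ℚᵘ.mkℚᵘ (a + b) 0) ⟩
  ℚᵘ.mkℚᵘ (a + b) 0
    ≈⟨ ℚᵘ.*≡* (lemma a b) ⟩
  ℚᵘ.mkℚᵘ a 0 ℚᵘ.+ ℚᵘ.mkℚᵘ b 0
    ≈⟨ ℚᵘₚ.+-cong (ℚₚ.toℚᵘ-fromℚᵘ (ℚᵘ.mkℚᵘ a 0)) (ℚₚ.toℚᵘ-fromℚᵘ (ℚᵘ.mkℚᵘ b 0)) ⟨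
  ℚ.toℚᵘ (ι a) ℚᵘ.+ ℚ.toℚᵘ (ι b)
    ≈⟨ ℚₚ.toℚᵘ-homo-+ (ι a) (ι b) ⟨
  ℚ.toℚᵘ (ι a ℚ.+ ι b) ∎)
  where
  open ℚᵘₚ.≃-Reasoning
  lemma : ∀ a b → (a + b) * 1ℤ ≡ (a * 1ℤ + b * 1ℤ) * 1ℤ
  lemma = solve-∀

/-cancel : ∀ {c k} d .{{_ : NonZero d}} → c ≡ + d * k → c / d ≡ ι k
/-cancel {c} {k} (suc d) eq = ℚₚ.fromℚᵘ-cong {ℚᵘ.mkℚᵘ c d} {ℚᵘ.mkℚᵘ k 0}
    (ℚᵘ.*≡* (trans (ℤₚ.*-identityʳ c) (trans eq (ℤₚ.*-comm (+ suc d) k))))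

ι-injective : ∀ {a b} → ι a ≡ ι b → a ≡ b
ι-injective {a} {b} eq with ℚₚ./-injective-≃ (ℚᵘ.mkℚᵘ a 0) (ℚᵘ.mkℚᵘ b 0) eq
... | ℚᵘ.*≡* eq′ = trans (sym (ℤₚ.*-identityʳ a)) (trans eq′ (ℤₚ.*-identityʳ b))

ι-neg : ∀ a → ι (- a) ≡ ℚ.- ι a
ι-neg a = RingProperties.+-cancelˡ ℚₚ.+-*-ring (ι a) (ι (- a)) (ℚ.- ι a)
    (trans (sym (ι-+ a (- a))) (trans (cong ι (ℤₚ.+-inverseʳ a)) (sym (ℚₚ.+-inverseʳ (ι a)))))

coefficient-+ₚ : ∀ p r k → coefficient (p +ₚ r) k ≡ coefficient p k ℚ.+ coefficient r k
coefficient-+ₚ []      r       k       = sym (ℚₚ.+-identityˡ (coefficient r k))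
coefficient-+ₚ (a ∷ p) []      k       = sym (ℚₚ.+-identityʳ (coefficient (a ∷ p) k))
coefficient-+ₚ (a ∷ p) (b ∷ r) zero    = refl
coefficient-+ₚ (a ∷ p) (b ∷ r) (suc k) = coefficient-+ₚ p r k

coefficient-·ₚ : ∀ a p k → coefficient (a ·ₚ p) k ≡ a ℚ.* coefficient p k
coefficient-·ₚ a []      k       = sym (ℚₚ.*-zeroʳ a)
coefficient-·ₚ a (b ∷ p) zero    = refl
coefficient-·ₚ a (b ∷ p) (suc k) = coefficient-·ₚ a p k

-- The factor c is carried along because the single coefficients become integers only after
-- multiplication by it.
coefficient-sumₚ : ∀ c (f : ℕ → Poly) (z : ℕ → ℤ) k xs → (∀ i → i ∈ xs → c ℚ.* coefficient (f i) k ≡ ι (z i)) →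
                   c ℚ.* coefficient (sumₚ (map f xs)) k ≡ ι (∑ xs z)
coefficient-sumₚ c f z k []       eq = ℚₚ.*-zeroʳ c
coefficient-sumₚ c f z k (i ∷ xs) eq = trans (cong (c ℚ.*_) (coefficient-+ₚ (f i) (sumₚ (map f xs)) k))
  (trans (ℚₚ.*-distribˡ-+ c (coefficient (f i) k) (coefficient (sumₚ (map f xs)) k))
    (trans (cong₂ ℚ._+_ (eq i (Any.here refl)) (coefficient-sumₚ c f z k xs (λ j j∈ → eq j (Any.there j∈))))
        (sym (ι-+ (z i) (∑ xs z)))))

-- The product of the factors q ^ j - t, which is the product of the 1 - t q ^ (-j) after its
-- denominators are cleared by q to the sum of the j.
linearFactors : ℕ → List ℕ → List ℤ
linearFactors q []       = 1ℤ ∷ []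
linearFactors q (j ∷ js) = (+ (q ℕ.^ j)) ·ᶻ linearFactors q js +ᶻ (0ℤ ∷ -1ℤ ·ᶻ linearFactors q js)

previous : (ℕ → ℤ) → ℕ → ℤ
previous f zero    = 0ℤ
previous f (suc k) = f k

coef-linear : ∀ c p k → coef (c ·ᶻ p +ᶻ (0ℤ ∷ -1ℤ ·ᶻ p)) k ≡ c * coef p k - previous (coef p) k
coef-linear c p k = trans (coef-+ᶻ (c ·ᶻ p) (0ℤ ∷ -1ℤ ·ᶻ p) k) (cong₂ _+_ (coef-·ᶻ c p k) (shifted k))
  where
  shifted : ∀ k → coef (0ℤ ∷ -1ℤ ·ᶻ p) k ≡ - previous (coef p) k
  shifted zero    = refl
  shifted (suc k) = trans (coef-·ᶻ -1ℤ p k) (ℤₚ.-1*i≡-i (coef p k))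

module _ (q : ℕ) .{{_ : NonZero q}} where

  open RawSemiringDefs ℚ.+-*-rawSemiring using () renaming (_^_ to _^ℚ_)

  private
    a = + 1 / q
    factor : ℕ → Poly
    factor j = 1ℚ ∷ (ℚ.- (a ^ℚ j)) ∷ []

  inverse-power : ∀ j → ι (+ (q ℕ.^ j)) ℚ.* a ^ℚ j ≡ 1ℚ
  inverse-power zero    = refl
  inverse-power (suc j) = begin
    ι (+ (q ℕ.* q ℕ.^ j)) ℚ.* (a ℚ.* a ^ℚ j)
      ≡⟨ cong (ℚ._* (a ℚ.* a ^ℚ j)) (trans (cong ι (ℤₚ.pos-* q (q ℕ.^ j))) (ι-* (+ q) (+ (q ℕ.^ j)))) ⟩
    ι (+ q) ℚ.* ι (+ (q ℕ.^ j)) ℚ.* (a ℚ.* a ^ℚ j)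
      ≡⟨ interchange (ι (+ q)) (ι (+ (q ℕ.^ j))) a (a ^ℚ j) ⟩
    ι (+ q) ℚ.* a ℚ.* (ι (+ (q ℕ.^ j)) ℚ.* a ^ℚ j)
      ≡⟨ cong₂ ℚ._*_ (trans (ι-*-/ (+ q) (+ 1) q) (/-cancel q refl)) (inverse-power j) ⟩
    1ℚ ℚ.* 1ℚ
      ≡⟨⟩
    1ℚ ∎
    where
    open ≡-Reasoning
    interchange : ∀ u v w z → u ℚ.* v ℚ.* (w ℚ.* z) ≡ u ℚ.* w ℚ.* (v ℚ.* z)
    interchange = ℚSolver.solve 4 (λ u v w z → u ℚSolver.:* v ℚSolver.:*
        (w ℚSolver.:* z) ℚSolver.:= u ℚSolver.:* w ℚSolver.:* (v ℚSolver.:* z)) refl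

  coefficient-factor : ∀ b r k → coefficient ((1ℚ ∷ b ∷ []) *ₚ r) (suc k) ≡ coefficient r
      (suc k) ℚ.+ b ℚ.* coefficient r k
  coefficient-factor b r k = trans (coefficient-+ₚ (1ℚ ·ₚ r) (0ℚ ∷ ((b ·ₚ r) +ₚ (0ℚ ∷ []))) (suc k))
    (cong₂ ℚ._+_ (trans (coefficient-·ₚ 1ℚ r (suc k)) (ℚₚ.*-identityˡ (coefficient r (suc k))))
      (trans (coefficient-+ₚ (b ·ₚ r) (0ℚ ∷ []) k) (trans (cong₂ ℚ._+_ (coefficient-·ₚ b r k) (zero-coefficient k))
          (ℚₚ.+-identityʳ (b ℚ.* coefficient r k)))))
    where
    zero-coefficient : ∀ k → coefficient (0ℚ ∷ []) k ≡ 0ℚ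
    zero-coefficient zero    = refl
    zero-coefficient (suc k) = refl

  coefficient-factor-0 : ∀ b r → coefficient ((1ℚ ∷ b ∷ []) *ₚ r) 0 ≡ coefficient r 0
  coefficient-factor-0 b r = trans (coefficient-+ₚ (1ℚ ·ₚ r) (0ℚ ∷ ((b ·ₚ r) +ₚ (0ℚ ∷ []))) 0)
    (trans (ℚₚ.+-identityʳ (coefficient (1ℚ ·ₚ r) 0)) (trans (coefficient-·ₚ 1ℚ r 0)
        (ℚₚ.*-identityˡ (coefficient r 0))))

  clear-denominators : ∀ js k → ι (+ (q ℕ.^ sumᴺ js)) ℚ.* coefficient (productₚ (map factor js)) k ≡ ι
      (coef (linearFactors q js) k)
  clear-denominators []       zero    = refl
  clear-denominators []       (suc k) = refl
  clear-denominators (j ∷ js) k = trans (cong (ℚ._* coefficient (factor j *ₚ R) k)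
      (trans (cong (λ e → ι (+ e)) (ℕₚ.^-distribˡ-+-* q j (sumᴺ js)))
          (trans (cong ι (ℤₚ.pos-* (q ℕ.^ j) (q ℕ.^ sumᴺ js))) (ι-* (+ (q ℕ.^ j)) (+ (q ℕ.^ sumᴺ js))))))
    (trans (step k) (cong ι (sym (coef-linear (+ (q ℕ.^ j)) (linearFactors q js) k))))
    where
    open ≡-Reasoning
    R = productₚ (map factor js)
    Q = ι (+ (q ℕ.^ j))
    X = ι (+ (q ℕ.^ sumᴺ js))
    G = coef (linearFactors q js)
    step : ∀ k → Q ℚ.* X ℚ.* coefficient (factor j *ₚ R) k ≡ ι (+ (q ℕ.^ j) * G k - previous G k)
    step zero = begin
      Q ℚ.* X ℚ.* coefficient (factor j *ₚ R) 0
        ≡⟨ trans (cong (Q ℚ.* X ℚ.*_) (coefficient-factor-0 (ℚ.- (a ^ℚ j)) R)) (ℚₚ.*-assoc Q X (coefficient R 0)) ⟩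
      Q ℚ.* (X ℚ.* coefficient R 0)
        ≡⟨ cong (Q ℚ.*_) (clear-denominators js 0) ⟩
      Q ℚ.* ι (G 0)
        ≡⟨ ι-* (+ (q ℕ.^ j)) (G 0) ⟨
      ι (+ (q ℕ.^ j) * G 0)
        ≡⟨ cong ι (ℤₚ.+-identityʳ (+ (q ℕ.^ j) * G 0)) ⟨
      ι (+ (q ℕ.^ j) * G 0 - 0ℤ) ∎
    step (suc k) = begin
      Q ℚ.* X ℚ.* coefficient (factor j *ₚ R) (suc k)
        ≡⟨ cong (Q ℚ.* X ℚ.*_) (coefficient-factor (ℚ.- (a ^ℚ j)) R k) ⟩
      Q ℚ.* X ℚ.* (coefficient R (suc k) ℚ.+ (ℚ.- (a ^ℚ j)) ℚ.* coefficient R k)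
        ≡⟨ expand Q X (coefficient R (suc k)) (a ^ℚ j) (coefficient R k) ⟩
      Q ℚ.* (X ℚ.* coefficient R (suc k)) ℚ.+ ℚ.- (Q ℚ.* a ^ℚ j ℚ.* (X ℚ.* coefficient R k))
        ≡⟨ cong₂ (λ u v → Q ℚ.* u ℚ.+ ℚ.- v) (clear-denominators js (suc k))
             (trans (cong₂ ℚ._*_ (inverse-power j) (clear-denominators js k)) (ℚₚ.*-identityˡ (ι (G k)))) ⟩
      Q ℚ.* ι (G (suc k)) ℚ.+ ℚ.- ι (G k)
        ≡⟨ trans (ι-+ (+ (q ℕ.^ j) * G (suc k)) (- G k)) (cong₂ ℚ._+_ (ι-* (+ (q ℕ.^ j)) (G (suc k)))
            (ι-neg (G k))) ⟨
      ι (+ (q ℕ.^ j) * G (suc k) - G k) ∎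
      where
      expand : ∀ Q X r b r′ → Q ℚ.* X ℚ.* (r ℚ.+ (ℚ.- b) ℚ.* r′) ≡ Q ℚ.* (X ℚ.* r) ℚ.+ ℚ.- (Q ℚ.* b ℚ.* (X ℚ.* r′))
      expand = ℚSolver.solve 5 (λ Q X r b r′ → Q ℚSolver.:* X ℚSolver.:*
          (r ℚSolver.:+ (ℚSolver.:- b) ℚSolver.:* r′) ℚSolver.:=
        Q ℚSolver.:* (X ℚSolver.:* r) ℚSolver.:+ ℚSolver.:- (Q ℚSolver.:* b ℚSolver.:* (X ℚSolver.:* r′))) refl

-- Arithmetic of dual numbers: a₀ and a₁ are the value and the derivative at q = 1. The sum and
-- product rules below carry them through the formula for the q-hit polynomial, factor by factor.
record FirstOrder (x a a₀ a₁ : ℤ) : Set where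
  constructor firstOrder
  field
    congruence : a ≡ a₀ + x * a₁ ⟦ x * x ⟧

open FirstOrder public

module _ {x : ℤ} where

  exact : ∀ {a a₀ a₁} → a ≡ a₀ + x * a₁ → FirstOrder x a a₀ a₁
  exact p = firstOrder (≡⇒≡⟦⟧ p)

  firstOrder-by : ∀ {a b a₀ a₁} → a ≡ b → FirstOrder x b a₀ a₁ → FirstOrder x a a₀ a₁
  firstOrder-by refl p = p

  constant : ∀ a → FirstOrder x a a 0ℤ
  constant a = exact (lemma a x)
    where
    lemma : ∀ a x → a ≡ a + x * 0ℤ
    lemma = solve-∀

  firstOrder-* : ∀ {a a₀ a₁ b b₀ b₁} → FirstOrder x a a₀ a₁ → FirstOrder x b b₀ b₁ → FirstOrder x (a * b) (a₀ * b₀)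
      (a₀ * b₁ + a₁ * b₀)
  firstOrder-* {a} {a₀} {a₁} {b} {b₀} {b₁} (firstOrder (modulo (divides y p))) (firstOrder (modulo (divides z r))) =
    firstOrder (modulo (divides (a * z + y * (b₀ + x * b₁) + a₁ * b₁) (begin
      a * b - (a₀ * b₀ + x * (a₀ * b₁ + a₁ * b₀))
        ≡⟨ split a b a₀ a₁ b₀ b₁ x ⟩
      a * (b - (b₀ + x * b₁)) + (a - (a₀ + x * a₁)) * (b₀ + x * b₁) + a₁ * b₁ * (x * x)
        ≡⟨ cong₂ (λ u v → a * v + u * (b₀ + x * b₁) + a₁ * b₁ * (x * x)) p r ⟩
      a * (z * (x * x)) + y * (x * x) * (b₀ + x * b₁) + a₁ * b₁ * (x * x)
        ≡⟨ collect a z y (b₀ + x * b₁) (a₁ * b₁) (x * x) ⟩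
      (a * z + y * (b₀ + x * b₁) + a₁ * b₁) * (x * x) ∎)))
    where
    open ≡-Reasoning
    split : ∀ a b a₀ a₁ b₀ b₁ x → a * b - (a₀ * b₀ + x * (a₀ * b₁ + a₁ * b₀)) ≡ a * (b - (b₀ + x * b₁)) +
        (a - (a₀ + x * a₁)) * (b₀ + x * b₁) + a₁ * b₁ * (x * x)
    split = solve-∀
    collect : ∀ a z y c d k → a * (z * k) + y * k * c + d * k ≡ (a * z + y * c + d) * k
    collect = solve-∀

  firstOrder-+ : ∀ {a a₀ a₁ b b₀ b₁} → FirstOrder x a a₀ a₁ → FirstOrder x b b₀ b₁ → FirstOrder x (a + b) (a₀ + b₀)
      (a₁ + b₁)
  firstOrder-+ {a₀ = a₀} {a₁} {b₀ = b₀} {b₁} (firstOrder p) (firstOrder r) =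
    firstOrder (≡⟦⟧-trans (≡⟦⟧-+ p r) (≡⇒≡⟦⟧ (lemma a₀ a₁ b₀ b₁ x)))
    where
    lemma : ∀ a₀ a₁ b₀ b₁ x → a₀ + x * a₁ + (b₀ + x * b₁) ≡ a₀ + b₀ + x * (a₁ + b₁)
    lemma = solve-∀

  firstOrder-∑ : ∀ {a} {A : Set a} (xs : List A) {f f₀ f₁ : A → ℤ} →
      (∀ y → y ∈ xs → FirstOrder x (f y) (f₀ y) (f₁ y)) →
                 FirstOrder x (∑ xs f) (∑ xs f₀) (∑ xs f₁)
  firstOrder-∑ []       p = constant 0ℤ
  firstOrder-∑ (y ∷ xs) p = firstOrder-+ (p y (Any.here refl)) (firstOrder-∑ xs (λ z z∈ → p z (Any.there z∈)))

  firstOrder-≡ : ∀ {a a₀ a₁ b₀ b₁} → a₀ ≡ b₀ → a₁ ≡ b₁ → FirstOrder x a a₀ a₁ → FirstOrder x a b₀ b₁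
  firstOrder-≡ refl refl p = p

triangular-C : ∀ k → + (k ℕᶜ.C 2) ≡ triangular k
triangular-C zero    = refl
triangular-C (suc k) = trans (cong +_ (sym (ℕᶜ.nCk+nC[k+1]≡[n+1]C[k+1] k 1)))
  (trans (cong (λ c → + (c ℕ.+ k ℕᶜ.C 2)) (ℕᶜ.nC1≡n k)) (trans (ℤₚ.pos-+ k (k ℕᶜ.C 2))
      (trans (ℤₚ.+-comm (+ k) (+ (k ℕᶜ.C 2))) (cong (_+ + k) (triangular-C k)))))

sum-upTo : ∀ k → sumᴺ (upTo k) ≡ k ℕᶜ.C 2
sum-upTo k = ℤₚ.+-injective (trans (go k) (sym (triangular-C k)))
  where
  go : ∀ k → + sumᴺ (upTo k) ≡ triangular k
  go zero    = refl
  go (suc k) = trans (cong (λ js → + sumᴺ js) (sym (Listₚ.upTo-∷ʳ k)))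
      (trans (cong +_ (trans (sum-++ (upTo k) (k ∷ [])) (cong (sumᴺ (upTo k) ℕ.+_) (ℕₚ.+-identityʳ k))))
    (trans (ℤₚ.pos-+ (sumᴺ (upTo k)) k) (cong (_+ + k) (go k))))

-- This makes the truncated difference of exponents in `summand` a genuine one.
C2-mono : ∀ {i n} → i ≤ℕ n → i ℕᶜ.C 2 ≤ℕ n ℕᶜ.C 2
C2-mono {i} i≤n = subst (λ k → i ℕᶜ.C 2 ≤ℕ k ℕᶜ.C 2) (ℕₚ.m∸n+n≡m i≤n) (go (_ ∸ i))
  where
  go : ∀ d → i ℕᶜ.C 2 ≤ℕ (d ℕ.+ i) ℕᶜ.C 2
  go zero    = ℕₚ.≤-refl
  go (suc d) = ℕₚ.≤-trans (go d) (subst ((d ℕ.+ i) ℕᶜ.C 2 ≤ℕ_) (ℕᶜ.nCk+nC[k+1]≡[n+1]C[k+1] (d ℕ.+ i) 1)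
      (ℕₚ.m≤n+m _ ((d ℕ.+ i) ℕᶜ.C 1)))

module _ (q : ℕ) (1≤q : 1 ≤ℕ q) where

  private
    x = + (q ∸ 1)
    q≡1+x : + q ≡ 1ℤ + x
    q≡1+x = cong +_ (sym (ℕₚ.m+[n∸m]≡n 1≤q))

  power-firstOrder : ∀ j → FirstOrder x (+ (q ℕ.^ j)) 1ℤ (+ j)
  power-firstOrder zero    = constant 1ℤ
  power-firstOrder (suc j) = firstOrder-by (ℤₚ.pos-* q (q ℕ.^ j))
    (firstOrder-≡ refl (lemma (+ j)) (firstOrder-* (exact {a₀ = 1ℤ} {a₁ = 1ℤ}
        (trans q≡1+x (cong (_+_ 1ℤ) (sym (ℤₚ.*-identityʳ x))))) (power-firstOrder j)))
    where
    lemma : ∀ j → 1ℤ * j + 1ℤ * 1ℤ ≡ 1ℤ + j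
    lemma = solve-∀

  qNumber-firstOrder : ∀ k → FirstOrder x (+ qNumber q k) (+ k) (triangular k)
  qNumber-firstOrder zero    = constant 0ℤ
  qNumber-firstOrder (suc k) = firstOrder-by (ℤₚ.pos-+ (qNumber q k) (q ℕ.^ k))
    (firstOrder-≡ (ℤₚ.+-comm (+ k) 1ℤ) refl (firstOrder-+ (qNumber-firstOrder k) (power-firstOrder k)))

  qFactorial-firstOrder : ∀ k → FirstOrder x (+ qFactorial q k) (+ (k !)) (factorial′ k)
  qFactorial-firstOrder zero    = constant 1ℤ
  qFactorial-firstOrder (suc k) = firstOrder-by (ℤₚ.pos-* (qNumber q (suc k)) (qFactorial q k))
    (firstOrder-≡ (sym (ℤₚ.pos-* (suc k) (k !))) refl (firstOrder-* (qNumber-firstOrder (suc k))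
        (qFactorial-firstOrder k)))

  -- By the product rule, each factor q ^ j - t contributes its derivative j times the product of
  -- the other factors, which at q = 1 is a power of 1 - t with exponent one less than the number of
  -- factors.
  linearFactors-firstOrder : ∀ js k → FirstOrder x (coef (linearFactors q js) k) (coef (oneMinus (length js)) k)
                                        (+ sumᴺ js * coef (oneMinus (ℕ.pred (length js))) k)
  linearFactors-firstOrder []       k = exact (lemma (coef (1ℤ ∷ []) k) x)
    where
    lemma : ∀ a x → a ≡ a + x * (0ℤ * a)
    lemma = solve-∀
  linearFactors-firstOrder (j ∷ js) k = firstOrder-by (coef-linear (+ (q ℕ.^ j)) (linearFactors q js) k)
    (firstOrder-≡ (trans (lemma₀ (A k) (previous A k)) (sym (A-suc (length js) k))) first
      (firstOrder-+ (firstOrder-* (power-firstOrder j) (linearFactors-firstOrder js k))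
        (firstOrder-by (sym (ℤₚ.-1*i≡-i (previous (coef (linearFactors q js)) k)))
            (firstOrder-* (constant -1ℤ) (previous-firstOrder k)))))
    where
    A A′ : ℕ → ℤ
    A = coef (oneMinus (length js))
    A′ = coef (oneMinus (ℕ.pred (length js)))
    σ = + sumᴺ js
    previous-firstOrder : ∀ k → FirstOrder x (previous (coef (linearFactors q js)) k) (previous A k)
        (σ * previous A′ k)
    previous-firstOrder zero    = exact (lemma σ x)
      where
      lemma : ∀ s x → 0ℤ ≡ 0ℤ + x * (s * 0ℤ)
      lemma = solve-∀
    previous-firstOrder (suc k) = linearFactors-firstOrder js k
    A-suc : ∀ r k → coef (oneMinus (suc r)) k ≡ coef (oneMinus r) k - previous (coef (oneMinus r)) k
    A-suc r k = trans (coef-+ᶻ (oneMinus r) (0ℤ ∷ -1ℤ ·ᶻ oneMinus r) k)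
        (cong (_+_ (coef (oneMinus r) k)) (shifted k))
      where
      shifted : ∀ k → coef (0ℤ ∷ -1ℤ ·ᶻ oneMinus r) k ≡ - previous (coef (oneMinus r)) k
      shifted zero    = refl
      shifted (suc k) = trans (coef-·ᶻ -1ℤ (oneMinus r) k) (ℤₚ.-1*i≡-i (coef (oneMinus r) k))
    lemma₀ : ∀ a b → 1ℤ * a + -1ℤ * b ≡ a - b
    lemma₀ = solve-∀
    first : 1ℤ * (σ * A′ k) + + j * A k + (-1ℤ * (σ * previous A′ k) + 0ℤ * previous A k) ≡ + (j ℕ.+ sumᴺ js) * A k
    first = trans (regroup σ (A′ k) (previous A′ k) (+ j) (A k) (previous A k))
      (trans (cong (_+ + j * A k) (by-length js)) (trans (sym (ℤₚ.*-distribʳ-+ (A k) σ (+ j)))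
        (cong (_* A k) (trans (ℤₚ.+-comm σ (+ j)) (sym (ℤₚ.pos-+ j (sumᴺ js)))))))
      where
      regroup : ∀ s a p j b c → 1ℤ * (s * a) + j * b + (-1ℤ * (s * p) + 0ℤ * c) ≡ s * (a - p) + j * b
      regroup = solve-∀
      -- For the empty list the predecessor of the length is off by one, but the sum of the list is
      -- zero.
      by-length : ∀ js → + sumᴺ js * (coef (oneMinus (ℕ.pred (length js))) k - previous
          (coef (oneMinus (ℕ.pred (length js)))) k) ≡ + sumᴺ js * coef (oneMinus (length js)) k
      by-length []       = refl
      by-length (i ∷ is) = cong (+ sumᴺ (i ∷ is) *_) (sym (A-suc (length is) k))

module HitCongruence {q : ℕ} (F : FiniteField q) {n : ℕ} (B : Board n n) where

  open GreedyRank F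
  open RawSemiringDefs ℚ.+-*-rawSemiring using () renaming (_^_ to _^ℚ_)

  private
    1≤q : 1 ≤ℕ q
    1≤q = ℕₚ.<⇒≤ 1<q

    pos-^ : ∀ i → + ((q ∸ 1) ℕ.^ i) ≡ x ^ i
    pos-^ zero    = refl
    pos-^ (suc i) = trans (ℤₚ.pos-* (q ∸ 1) ((q ∸ 1) ℕ.^ i)) (cong (x *_) (pos-^ i))

    sign-ι : ∀ i → (ℚ.- 1ℚ) ^ℚ i ≡ ι (-1ℤ ^ i)
    sign-ι zero    = refl
    sign-ι (suc i) = trans (cong ((ℚ.- 1ℚ) ℚ.*_) (sign-ι i)) (sym (ι-* -1ℤ (-1ℤ ^ i)))

  -- The q-rook number as an integer. Its definition depends on the bound for i, which
  -- `matrixCount-expansion` needs in order to produce the remainder.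
  qRook : ∀ i → i ≤ℕ n → ℤ
  qRook i i≤n = rookCount B i + x * extraCount B i + x * (x * proj₁ (matrixCount-expansion B i i≤n))

  qRookNumber-ι : ∀ i (i≤n : i ≤ℕ n) → qRookNumber F B i ≡ ι (qRook i i≤n)
  qRookNumber-ι i i≤n = /-cancel ((q ∸ 1) ℕ.^ i) {{ℕₚ.m^n≢0 (q ∸ 1) i}}
    (trans (proj₂ (matrixCount-expansion B i i≤n)) (cong (_* qRook i i≤n) (sym (pos-^ i))))

  qRook-firstOrder : ∀ i i≤n → FirstOrder x (qRook i i≤n) (rookCount B i) (extraCount B i)
  qRook-firstOrder i i≤n = firstOrder (modulo (divides z (lemma (rookCount B i) (extraCount B i) x z)))
    where
    z = proj₁ (matrixCount-expansion B i i≤n)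
    lemma : ∀ r e x z → r + x * e + x * (x * z) - (r + x * e) ≡ z * (x * x)
    lemma = solve-∀

  module _ (k : ℕ) where

    summand : ∀ i → i ≤ℕ n → ℤ
    summand i i≤n = + (q ℕ.^ (n ℕᶜ.C 2 ∸ i ℕᶜ.C 2)) * (qRook i i≤n *
        (+ qFactorial q (n ∸ i) * (-1ℤ ^ i * coef (linearFactors q (upTo i)) k)))

    -- A sum over a list of naturals cannot supply the proof of i ≤ n that `summand` asks for;
    -- outside this range 0 is a placeholder.
    term : ℕ → ℤ
    term i with i ℕ.≤? n
    ... | yes i≤n = summand i i≤n
    ... | no _    = 0ℤ

    term≡summand : ∀ i (i≤n : i ≤ℕ n) → term i ≡ summand i i≤n
    term≡summand i i≤n with i ℕ.≤? n
    ... | yes i≤n′ = cong (summand i) (ℕₚ.≤-irrelevant i≤n′ i≤n)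
    ... | no ¬i≤n  = contradiction i≤n ¬i≤n

    -- The leading power of q has exponent n choose 2. It is split so that the part with exponent i
    -- choose 2 clears the denominators of the i-th Pochhammer symbol, and the rest stays in front.
    summand-ι : ∀ i (i≤n : i ≤ℕ n) →
      ι (+ (q ℕ.^ (n ℕᶜ.C 2))) ℚ.* coefficient
        ((qRookNumber F B i ℚ.* _/_ (+ qFactorial q (n ∸ i)) (qFactorial q (n ∸ n)) {{qFactorial≢0 q (n ∸ n)}} ℚ.*
            ((ℚ.- 1ℚ) ^ℚ i)) ·ₚ pochhammer (+ 1 / q) i) k
      ≡ ι (summand i i≤n)
    summand-ι i i≤n = begin
      ι (+ (q ℕ.^ (n ℕᶜ.C 2))) ℚ.* coefficient ((M ℚ.* f ℚ.* s) ·ₚ pochhammer (+ 1 / q) i) k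
        ≡⟨ cong₂ ℚ._*_ split-power (coefficient-·ₚ (M ℚ.* f ℚ.* s) (pochhammer (+ 1 / q) i) k) ⟩
      ι (+ (q ℕ.^ e)) ℚ.* ι (+ (q ℕ.^ sumᴺ (upTo i))) ℚ.* (M ℚ.* f ℚ.* s ℚ.* P)
        ≡⟨ regroup (ι (+ (q ℕ.^ e))) (ι (+ (q ℕ.^ sumᴺ (upTo i)))) M f s P ⟩
      ι (+ (q ℕ.^ e)) ℚ.* (M ℚ.* (f ℚ.* (s ℚ.* (ι (+ (q ℕ.^ sumᴺ (upTo i))) ℚ.* P))))
        ≡⟨ cong (ι (+ (q ℕ.^ e)) ℚ.*_) (cong₂ ℚ._*_ (qRookNumber-ι i i≤n)
            (cong₂ ℚ._*_ factorial (cong₂ ℚ._*_ (sign-ι i) (clear-denominators q (upTo i) k)))) ⟩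
      ι (+ (q ℕ.^ e)) ℚ.* (ι (qRook i i≤n) ℚ.* (ι (+ qFactorial q (n ∸ i)) ℚ.* (ι (-1ℤ ^ i) ℚ.* ι C)))
        ≡⟨ cong (λ u → ι (+ (q ℕ.^ e)) ℚ.* (ι (qRook i i≤n) ℚ.* (ι (+ qFactorial q (n ∸ i)) ℚ.* u)))
            (ι-* (-1ℤ ^ i) C) ⟨
      ι (+ (q ℕ.^ e)) ℚ.* (ι (qRook i i≤n) ℚ.* (ι (+ qFactorial q (n ∸ i)) ℚ.* ι (-1ℤ ^ i * C)))
        ≡⟨ cong (λ u → ι (+ (q ℕ.^ e)) ℚ.* (ι (qRook i i≤n) ℚ.* u)) (ι-* (+ qFactorial q (n ∸ i)) (-1ℤ ^ i * C)) ⟨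
      ι (+ (q ℕ.^ e)) ℚ.* (ι (qRook i i≤n) ℚ.* ι (+ qFactorial q (n ∸ i) * (-1ℤ ^ i * C)))
        ≡⟨ cong (ι (+ (q ℕ.^ e)) ℚ.*_) (ι-* (qRook i i≤n) (+ qFactorial q (n ∸ i) * (-1ℤ ^ i * C))) ⟨
      ι (+ (q ℕ.^ e)) ℚ.* ι (qRook i i≤n * (+ qFactorial q (n ∸ i) * (-1ℤ ^ i * C)))
        ≡⟨ ι-* (+ (q ℕ.^ e)) (qRook i i≤n * (+ qFactorial q (n ∸ i) * (-1ℤ ^ i * C))) ⟨
      ι (summand i i≤n) ∎
      where
      open ≡-Reasoning
      e = n ℕᶜ.C 2 ∸ i ℕᶜ.C 2
      M = qRookNumber F B i
      f = _/_ (+ qFactorial q (n ∸ i)) (qFactorial q (n ∸ n)) {{qFactorial≢0 q (n ∸ n)}}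
      s = (ℚ.- 1ℚ) ^ℚ i
      P = coefficient (pochhammer (+ 1 / q) i) k
      C = coef (linearFactors q (upTo i)) k
      split-power : ι (+ (q ℕ.^ (n ℕᶜ.C 2))) ≡ ι (+ (q ℕ.^ e)) ℚ.* ι (+ (q ℕ.^ sumᴺ (upTo i)))
      split-power = trans (cong (λ j → ι (+ (q ℕ.^ j))) (trans (sym (ℕₚ.m∸n+n≡m (C2-mono i≤n)))
          (cong (e ℕ.+_) (sym (sum-upTo i)))))
        (trans (cong (λ j → ι (+ j)) (ℕₚ.^-distribˡ-+-* q e (sumᴺ (upTo i))))
          (trans (cong ι (ℤₚ.pos-* (q ℕ.^ e) (q ℕ.^ sumᴺ (upTo i)))) (ι-* (+ (q ℕ.^ e)) (+ (q ℕ.^ sumᴺ (upTo i))))))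
      -- The board is square, so the denominator is the q-factorial of 0, which is 1.
      factorial : f ≡ ι (+ qFactorial q (n ∸ i))
      factorial = /-cancel (qFactorial q (n ∸ n)) {{qFactorial≢0 q (n ∸ n)}}
        (sym (trans (cong (λ j → + qFactorial q j * + qFactorial q (n ∸ i)) (ℕₚ.n∸n≡0 n))
            (ℤₚ.*-identityˡ (+ qFactorial q (n ∸ i)))))
      regroup : ∀ a b m f s p → a ℚ.* b ℚ.* (m ℚ.* f ℚ.* s ℚ.* p) ≡ a ℚ.* (m ℚ.* (f ℚ.* (s ℚ.* (b ℚ.* p))))
      regroup = ℚSolver.solve 6 (λ a b m f s p → a ℚSolver.:* b ℚSolver.:*
          (m ℚSolver.:* f ℚSolver.:* s ℚSolver.:* p) ℚSolver.:=
        a ℚSolver.:* (m ℚSolver.:* (f ℚSolver.:* (s ℚSolver.:* (b ℚSolver.:* p))))) refl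

    summand-firstOrder : ∀ i (i≤n : i ≤ℕ n) → FirstOrder x (summand i i≤n)
        (coef (rookCount B i ·ᶻ constantFactor n i) k)
                           (coef (extraCount B i ·ᶻ constantFactor n i +ᶻ rookCount B i ·ᶻ linearFactor n i) k)
    summand-firstOrder i i≤n = firstOrder-≡ value slope
      (firstOrder-* (power-firstOrder q 1≤q e) (firstOrder-* (qRook-firstOrder i i≤n)
        (firstOrder-* (qFactorial-firstOrder q 1≤q (n ∸ i))
            (firstOrder-* (constant (-1ℤ ^ i)) (linearFactors-firstOrder q 1≤q (upTo i) k)))))
      where
      e = n ℕᶜ.C 2 ∸ i ℕᶜ.C 2
      g = -1ℤ ^ i
      R = rookCount B i
      E = extraCount B i
      f = + ((n ∸ i) !)
      f′ = factorial′ (n ∸ i)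
      N = triangular n
      T = triangular i
      len = length (upTo i)
      A = coef (oneMinus i) k
      A′ = coef (oneMinus (ℕ.pred i)) k
      exponent : + e ≡ N - T
      exponent = trans (sym (ℤₚ.⊖-≥ (C2-mono i≤n))) (trans (sym (ℤₚ.m-n≡m⊖n (n ℕᶜ.C 2) (i ℕᶜ.C 2)))
          (cong₂ _-_ (triangular-C n) (triangular-C i)))
      constantCoef : coef (constantFactor n i) k ≡ g * f * A
      constantCoef = coef-·ᶻ (g * f) (oneMinus i) k
      linearCoef : coef (linearFactor n i) k ≡ g * ((N - T) * f + f′) * A + g * (T * f) * A′
      linearCoef = trans (coef-+ᶻ ((g * ((N - T) * f + f′)) ·ᶻ oneMinus i) ((g * (T * f)) ·ᶻ oneMinus (ℕ.pred i)) k)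
        (cong₂ _+_ (coef-·ᶻ (g * ((N - T) * f + f′)) (oneMinus i) k)
            (coef-·ᶻ (g * (T * f)) (oneMinus (ℕ.pred i)) k))
      value : 1ℤ * (R * (f * (g * coef (oneMinus len) k))) ≡ coef (R ·ᶻ constantFactor n i) k
      value = trans (cong (λ j → 1ℤ * (R * (f * (g * coef (oneMinus j) k)))) (Listₚ.length-upTo i))
        (trans (lemma R f g A) (sym (trans (coef-·ᶻ R (constantFactor n i) k) (cong (R *_) constantCoef))))
        where
        lemma : ∀ r f g a → 1ℤ * (r * (f * (g * a))) ≡ r * (g * f * a)
        lemma = solve-∀
      slope : 1ℤ * (R * (f * (g * (+ sumᴺ (upTo i) * coef (oneMinus (ℕ.pred len)) k) + 0ℤ * coef (oneMinus len) k)
          + f′ * (g * coef (oneMinus len) k))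
                    + E * (f * (g * coef (oneMinus len) k))) + + e * (R * (f * (g * coef (oneMinus len) k))) ≡
              coef (E ·ᶻ constantFactor n i +ᶻ R ·ᶻ linearFactor n i) k
      slope = trans (substitute (Listₚ.length-upTo i) (trans (cong +_ (sum-upTo i)) (triangular-C i)) exponent)
        (trans (lemma R E f f′ g N T A A′) (sym (trans (coef-+ᶻ (E ·ᶻ constantFactor n i) (R ·ᶻ linearFactor n i) k)
          (cong₂ _+_ (trans (coef-·ᶻ E (constantFactor n i) k) (cong (E *_) constantCoef))
              (trans (coef-·ᶻ R (linearFactor n i) k) (cong (R *_) linearCoef))))))
        where
        substitute : ∀ {l l′ t t′ d d′} → l ≡ l′ → t ≡ t′ → d ≡ d′ →
          1ℤ * (R * (f * (g * (t * coef (oneMinus (ℕ.pred l)) k) + 0ℤ * coef (oneMinus l) k) + f′ *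
              (g * coef (oneMinus l) k))
                + E * (f * (g * coef (oneMinus l) k))) + d * (R * (f * (g * coef (oneMinus l) k))) ≡
          1ℤ * (R * (f * (g * (t′ * coef (oneMinus (ℕ.pred l′)) k) + 0ℤ * coef (oneMinus l′) k) + f′ *
              (g * coef (oneMinus l′) k))
                + E * (f * (g * coef (oneMinus l′) k))) + d′ * (R * (f * (g * coef (oneMinus l′) k)))
        substitute refl refl refl = refl
        lemma : ∀ R E f f′ g N T A A′ → 1ℤ * (R * (f * (g * (T * A′) + 0ℤ * A) + f′ * (g * A)) + E * (f * (g * A)))
            + (N - T) * (R * (f * (g * A))) ≡
                E * (g * f * A) + R * (g * ((N - T) * f + f′) * A + g * (T * f) * A′)
        lemma = solve-∀

    private
      ∈-upTo⇒≤ : ∀ {i} → i ∈ upTo (suc n) → i ≤ℕ n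
      ∈-upTo⇒≤ i∈ = ℕₚ.≤-pred (∈ₚ.∈-upTo⁻ i∈)

    qHit : ℤ
    qHit = ∑ (upTo (suc n)) term

    qHitNumber-ι : qHitNumber F B k ≡ ι qHit
    qHitNumber-ι = trans (coefficient-·ₚ (ι (+ (q ℕ.^ (n ℕᶜ.C 2)))) (sumₚ (map polynomial (upTo (suc n)))) k)
      (coefficient-sumₚ (ι (+ (q ℕ.^ (n ℕᶜ.C 2)))) polynomial term k (upTo (suc n))
        (λ i i∈ → trans (summand-ι i (∈-upTo⇒≤ i∈)) (cong ι (sym (term≡summand i (∈-upTo⇒≤ i∈))))))
      where
      polynomial : ℕ → Poly
      polynomial i = (qRookNumber F B i ℚ.* _/_ (+ qFactorial q (n ∸ i))
          (qFactorial q (n ∸ n)) {{qFactorial≢0 q (n ∸ n)}} ℚ.* ((ℚ.- 1ℚ) ^ℚ i))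
                     ·ₚ pochhammer (+ 1 / q) i

    qHit-firstOrder : FirstOrder x qHit (+ hitNumber B k) (coef (linearPoly B) k)
    qHit-firstOrder = firstOrder-≡
      (trans (sym (coef-sumᶻ (upTo (suc n)) (λ r → rookCount B r ·ᶻ constantFactor n r) k))
          (coef-constantPoly-hitNumber B k))
      (sym (coef-sumᶻ (upTo (suc n)) (λ r → extraCount B r ·ᶻ constantFactor n r
          +ᶻ rookCount B r ·ᶻ linearFactor n r) k))
      (firstOrder-∑ (upTo (suc n)) (λ i i∈ → firstOrder-by (term≡summand i (∈-upTo⇒≤ i∈))
          (summand-firstOrder i (∈-upTo⇒≤ i∈))))

-- Prime fields

-- Uniqueness of C requires actual fields with arbitrarily large q - 1; those of prime order are
-- enough.
module PrimeField (p : ℕ) (p-prime : Prime p) where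

  instance
    p≢0 : NonZero p
    p≢0 = prime⇒nonZero p-prime

  1<p : 1 ℕ.< p
  1<p = ℕ.nonTrivial⇒n>1 p {{prime⇒nonTrivial p-prime}}

  residue : ℕ → Fin p
  residue k = k ℕᵐ.mod p

  toℕ-residue : ∀ k → toℕ (residue k) ≡ k ℕᵐ.% p
  toℕ-residue k = Finₚ.toℕ-fromℕ< (ℕᵐ.m%n<n k p)

  residue-toℕ : ∀ a → residue (toℕ a) ≡ a
  residue-toℕ a = Finₚ.toℕ-injective (trans (toℕ-residue (toℕ a)) (ℕᵐ.m<n⇒m%n≡m (Finₚ.toℕ<n a)))

  residue-cong : ∀ {k l} → k ℕᵐ.% p ≡ l ℕᵐ.% p → residue k ≡ residue l
  residue-cong {k} {l} eq = Finₚ.toℕ-injective (trans (toℕ-residue k) (trans eq (sym (toℕ-residue l))))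

  0%p≡0 : 0 ℕᵐ.% p ≡ 0
  0%p≡0 = ℕᵐ.m<n⇒m%n≡m (ℕₚ.<-trans (s≤s z≤n) 1<p)

  infixl 6 _+ₘ_
  infixl 7 _*ₘ_
  infix  8 -ₘ_

  _+ₘ_ _*ₘ_ : Fin p → Fin p → Fin p
  a +ₘ b = residue (toℕ a ℕ.+ toℕ b)
  a *ₘ b = residue (toℕ a ℕ.* toℕ b)

  -ₘ_ : Fin p → Fin p
  -ₘ a = residue (p ∸ toℕ a)

  residue-+ : ∀ k l → residue k +ₘ residue l ≡ residue (k ℕ.+ l)
  residue-+ k l = residue-cong (trans (cong₂ (λ a b → (a ℕ.+ b) ℕᵐ.% p) (toℕ-residue k) (toℕ-residue l))
      (sym (ℕᵐ.%-distribˡ-+ k l p)))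

  residue-* : ∀ k l → residue k *ₘ residue l ≡ residue (k ℕ.* l)
  residue-* k l = residue-cong (trans (cong₂ (λ a b → (a ℕ.* b) ℕᵐ.% p) (toℕ-residue k) (toℕ-residue l))
      (sym (ℕᵐ.%-distribˡ-* k l p)))

  -- Laws transfer from ℕ because every element is a residue.
  on-residues : {P : Fin p → Set} → (∀ k → P (residue k)) → ∀ a → P a
  on-residues {P} law a = subst P (residue-toℕ a) (law (toℕ a))

  +ₘ-comm : ∀ a b → a +ₘ b ≡ b +ₘ a
  +ₘ-comm a b = cong residue (ℕₚ.+-comm (toℕ a) (toℕ b))

  *ₘ-comm : ∀ a b → a *ₘ b ≡ b *ₘ a
  *ₘ-comm a b = cong residue (ℕₚ.*-comm (toℕ a) (toℕ b))

  +ₘ-assoc : ∀ a b c → (a +ₘ b) +ₘ c ≡ a +ₘ (b +ₘ c)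
  +ₘ-assoc = on-residues λ k → on-residues λ l → on-residues λ m →
    trans (cong (_+ₘ residue m) (residue-+ k l)) (trans (residue-+ (k ℕ.+ l) m)
      (trans (cong residue (ℕₚ.+-assoc k l m)) (sym (trans (cong (residue k +ₘ_) (residue-+ l m))
          (residue-+ k (l ℕ.+ m))))))

  *ₘ-assoc : ∀ a b c → (a *ₘ b) *ₘ c ≡ a *ₘ (b *ₘ c)
  *ₘ-assoc = on-residues λ k → on-residues λ l → on-residues λ m →
    trans (cong (_*ₘ residue m) (residue-* k l)) (trans (residue-* (k ℕ.* l) m)
      (trans (cong residue (ℕₚ.*-assoc k l m)) (sym (trans (cong (residue k *ₘ_) (residue-* l m))
          (residue-* k (l ℕ.* m))))))

  *ₘ-distribˡ : ∀ a b c → a *ₘ (b +ₘ c) ≡ a *ₘ b +ₘ a *ₘ c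
  *ₘ-distribˡ = on-residues λ k → on-residues λ l → on-residues λ m →
    trans (cong (residue k *ₘ_) (residue-+ l m)) (trans (residue-* k (l ℕ.+ m))
      (trans (cong residue (ℕₚ.*-distribˡ-+ k l m)) (sym (trans (cong₂ _+ₘ_ (residue-* k l) (residue-* k m))
          (residue-+ (k ℕ.* l) (k ℕ.* m))))))

  *ₘ-distribʳ : ∀ a b c → (b +ₘ c) *ₘ a ≡ b *ₘ a +ₘ c *ₘ a
  *ₘ-distribʳ a b c = trans (*ₘ-comm (b +ₘ c) a) (trans (*ₘ-distribˡ a b c)
      (cong₂ _+ₘ_ (*ₘ-comm a b) (*ₘ-comm a c)))

  +ₘ-identityˡ : ∀ a → residue 0 +ₘ a ≡ a
  +ₘ-identityˡ = on-residues λ k → residue-+ 0 k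

  *ₘ-identityˡ : ∀ a → residue 1 *ₘ a ≡ a
  *ₘ-identityˡ = on-residues λ k → trans (residue-* 1 k) (cong residue (ℕₚ.*-identityˡ k))

  -ₘ-inverseˡ : ∀ a → (-ₘ a) +ₘ a ≡ residue 0
  -ₘ-inverseˡ a = trans (cong ((-ₘ a) +ₘ_) (sym (residue-toℕ a))) (trans (residue-+ (p ∸ toℕ a) (toℕ a))
    (residue-cong (trans (cong (ℕᵐ._% p) (ℕₚ.m∸n+n≡m (ℕₚ.<⇒≤ (Finₚ.toℕ<n a)))) (trans (ℕᵐ.n%n≡0 p) (sym 0%p≡0)))))

  isCommutativeRing : IsCommutativeRing _≡_ _+ₘ_ _*ₘ_ -ₘ_ (residue 0) (residue 1)
  isCommutativeRing = record
    { isRing = record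
      { +-isAbelianGroup = record
        { isGroup = record
          { isMonoid = record
            { isSemigroup = record
              { isMagma = record { isEquivalence = isEquivalence ; ∙-cong = cong₂ _+ₘ_ }
              ; assoc = +ₘ-assoc }
            ; identity = +ₘ-identityˡ , λ a → trans (+ₘ-comm a (residue 0)) (+ₘ-identityˡ a) }
          ; inverse = -ₘ-inverseˡ , λ a → trans (+ₘ-comm a (-ₘ a)) (-ₘ-inverseˡ a)
          ; ⁻¹-cong = cong -ₘ_ }
        ; comm = +ₘ-comm }
      ; *-cong = cong₂ _*ₘ_
      ; *-assoc = *ₘ-assoc
      ; *-identity = *ₘ-identityˡ , λ a → trans (*ₘ-comm a (residue 1)) (*ₘ-identityˡ a)
      ; distrib = *ₘ-distribˡ , *ₘ-distribʳ }
    ; *-comm = *ₘ-comm }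

  commutativeRing : CommutativeRing _ _
  commutativeRing = record { isCommutativeRing = isCommutativeRing }

  open RingProperties (CommutativeRing.ring commutativeRing) using (-‿distribʳ-*; +-cancelʳ)

  residue-multiple : ∀ u → residue (u ℕ.* p) ≡ residue 0
  residue-multiple u = residue-cong (trans (ℕᵐ.m*n%n≡0 u p) (sym 0%p≡0))

  inverse : ∀ a → a ≢ residue 0 → ∃ λ b → a *ₘ b ≡ residue 1
  inverse a a≢0 = from-Bézout (Coprimality.coprime-Bézout (Coprimality.prime⇒coprime p-prime {{nonZero}}
      (Finₚ.toℕ<n a)))
    where
    nonZero : NonZero (toℕ a)
    nonZero = ℕ.≢-nonZero (λ a≡0 → a≢0 (trans (sym (residue-toℕ a)) (cong residue a≡0)))
    times : ∀ v → a *ₘ residue v ≡ residue (v ℕ.* toℕ a)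
    times v = trans (cong (_*ₘ residue v) (sym (residue-toℕ a)))
        (trans (residue-* (toℕ a) v) (cong residue (ℕₚ.*-comm (toℕ a) v)))
    from-Bézout : GCD.Bézout.Identity 1 p (toℕ a) → ∃ λ b → a *ₘ b ≡ residue 1
    from-Bézout (GCD.Bézout.-+ u v eq) = residue v , trans (times v) (trans (cong residue (sym eq))
      (trans (sym (residue-+ 1 (u ℕ.* p))) (trans (cong (residue 1 +ₘ_) (residue-multiple u))
          (trans (+ₘ-comm (residue 1) (residue 0)) (+ₘ-identityˡ (residue 1))))))
    -- Here 1 + va is a multiple of p, so -v is the inverse of a.
    from-Bézout (GCD.Bézout.+- u v eq) = -ₘ residue v , trans (sym (-‿distribʳ-* a (residue v)))
      (+-cancelʳ (a *ₘ residue v) (-ₘ (a *ₘ residue v)) (residue 1)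
          (trans (-ₘ-inverseˡ (a *ₘ residue v)) (sym (trans (cong (residue 1 +ₘ_) (times v))
        (trans (residue-+ 1 (v ℕ.* toℕ a)) (trans (cong residue eq) (residue-multiple u)))))))

  field-p : FiniteField p
  field-p = record
    { Carrier = Fin p ; _+_ = _+ₘ_ ; _*_ = _*ₘ_ ; -_ = -ₘ_ ; 0# = residue 0 ; 1# = residue 1
    ; isCommutativeRing = isCommutativeRing
    ; 0≢1 = λ eq → contradiction (trans (sym 0%p≡0)
        (trans (sym (toℕ-residue 0)) (trans (cong toℕ eq) (trans (toℕ-residue 1) (ℕᵐ.m<n⇒m%n≡m 1<p))))) λ ()
    ; inverse = inverse
    ; enumeration = mk↔ₛ′ id id (λ _ → refl) (λ _ → refl) }

-- Euclid's argument: a prime divisor of N! + 1 exceeds N.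
large-prime : ∀ N → ∃ λ p → Prime p × N ℕ.< p
large-prime N with factorise (suc (N !))
... | record { factors = [] ; isFactorisation = eq } = contradiction (ℕₚ.suc-injective eq)
    (ℕ.≢-nonZero⁻¹ (N !) {{N ℕₚ.!≢0}})
... | record { factors = p ∷ ps ; isFactorisation = eq ; factorsPrime = p-prime All.∷ _ } = p , p-prime , ℕₚ.≰⇒> p≰N
  where
  p∣1+N! : p ℕᵈ.∣ suc (N !)
  p∣1+N! = subst (p ℕᵈ.∣_) (sym eq) (ℕᵈ.m∣m*n _)
  p∣p! : ∀ k → Prime k → k ℕᵈ.∣ k !
  p∣p! (suc k) _ = ℕᵈ.m∣m*n (k !)
  p∣p! zero    prime₀ = contradiction prime₀ Primality.¬prime[0]
  p≰N : ¬ p ≤ℕ N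
  p≰N p≤N = Primality.¬prime[1] (subst Prime (ℕᵈ.∣1⇒≡1 (ℕᵈ.∣m+n∣m⇒∣n {p} {N !} {1}
      (subst (p ℕᵈ.∣_) (ℕₚ.+-comm 1 (N !)) p∣1+N!)
    (ℕᵈ.∣-trans (p∣p! p p-prime) (ℕᵈ.m≤n⇒m!∣n! p≤N)))) p-prime)

-- The congruence for q-hit numbers and the uniqueness of its slope

ι-minus : ∀ a b → ι a ℚ.- ι b ≡ ι (a - b)
ι-minus a b = sym (trans (ι-+ a (- b)) (cong (ι a ℚ.+_) (ι-neg b)))

≡[mod]⇒≡⟦⟧ : ∀ {a b d} → ι a ≡ ι b [mod d ] → a ≡ b ⟦ d ⟧
≡[mod]⇒≡⟦⟧ {a} {b} (z , eq) = modulo (divides z (ι-injective (trans (sym (ι-minus a b)) eq)))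

≡⟦⟧⇒≡[mod] : ∀ {a b d} → a ≡ b ⟦ d ⟧ → ι a ≡ ι b [mod d ]
≡⟦⟧⇒≡[mod] {a} {b} (modulo (divides z eq)) = z , trans (ι-minus a b) (cong ι eq)

x*x≡x^2 : ∀ x → x * x ≡ x ^ 2
x*x≡x^2 x = cong (x *_) (sym (ℤₚ.*-identityʳ x))

qHit-congruence : ∀ {n} (B : Board n n) k {q} (F : FiniteField q) →
                  qHitNumber F B k ≡ ι (coef (linearPoly B) k * + (q ∸ 1) + + hitNumber B k) [mod (+ (q ∸ 1)) ^ 2 ]
qHit-congruence B k {q} F = subst (_≡ ι (C * x + h) [mod x ^ 2 ]) (sym (qHitNumber-ι k))
  (≡⟦⟧⇒≡[mod] (subst (qHit k ≡ C * x + h ⟦_⟧) (x*x≡x^2 x)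
    (≡⟦⟧-trans (congruence (qHit-firstOrder k)) (≡⇒≡⟦⟧ (rearrange h x C)))))
  where
  open HitCongruence F B
  x = + (q ∸ 1)
  C = coef (linearPoly B) k
  h = + hitNumber B k
  rearrange : ∀ h x C → h + x * C ≡ C * x + h
  rearrange = solve-∀

-- Subtracting the two congruences leaves (C - D) x divisible by x², and x is nonzero.
slopes-congruent : ∀ {n} (B : Board n n) k {q} (F : FiniteField q) C D →
  qHitNumber F B k ≡ ι (C * + (q ∸ 1) + + hitNumber B k) [mod (+ (q ∸ 1)) ^ 2 ] →
  qHitNumber F B k ≡ ι (D * + (q ∸ 1) + + hitNumber B k) [mod (+ (q ∸ 1)) ^ 2 ] → + (q ∸ 1) ∣ C - D
slopes-congruent B k {q} F C D c d =
  Div.*-cancelʳ-∣ x {{FiniteField.q-1≢0 F}} (subst (x * x ∣_) (cancel C D x h)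
      (difference (≡⟦⟧-trans (≡⟦⟧-sym (integral C c)) (integral D d))))
  where
  open HitCongruence F B
  x = + (q ∸ 1)
  h = + hitNumber B k
  integral : ∀ E → qHitNumber F B k ≡ ι (E * x + h) [mod x ^ 2 ] → qHit k ≡ E * x + h ⟦ x * x ⟧
  integral E e = subst (qHit k ≡ E * x + h ⟦_⟧) (sym (x*x≡x^2 x))
      (≡[mod]⇒≡⟦⟧ (subst (_≡ ι (E * x + h) [mod x ^ 2 ]) (qHitNumber-ι k) e))
  cancel : ∀ a b x h → a * x + h - (b * x + h) ≡ (a - b) * x
  cancel = solve-∀

small-multiple : ∀ x d → ℤ.∣ d ∣ ℕ.< x → + x ∣ d → d ≡ 0ℤ
small-multiple x d d<x x∣d with ℤ.∣ d ∣ in ∣d∣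
... | zero  = ℤₚ.∣i∣≡0⇒i≡0 ∣d∣
... | suc m = contradiction (ℕᵈ.∣⇒≤ (subst (x ℕᵈ.∣_) ∣d∣ (Div.∣⇒∣ᵤ x∣d))) (ℕₚ.<⇒≱ d<x)

linear-unique : ∀ {n} (B : Board n n) k C →
  (∀ q → IsPrimePower q → (F : FiniteField q) → qHitNumber F B k ≡ ι
      (C * + (q ∸ 1) + + hitNumber B k) [mod (+ (q ∸ 1)) ^ 2 ]) →
  coef (linearPoly B) k ≡ C
linear-unique B k C congruent = via (large-prime (suc ℤ.∣ C₀ - C ∣))
  where
  C₀ = coef (linearPoly B) k
  via : (∃ λ p → Prime p × suc ℤ.∣ C₀ - C ∣ ℕ.< p) → C₀ ≡ C
  -- The extra successor in `large` accounts for x being p - 1 and not p, so x still exceeds the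
  -- absolute value of the difference.
  via (p , p-prime , large) = ℤₚ.i-j≡0⇒i≡j C₀ C (small-multiple (p ∸ 1) (C₀ - C) (ℕₚ.∸-monoˡ-< large (s≤s z≤n))
    (slopes-congruent B k F C₀ C (qHit-congruence B k F) (congruent p
        (p , 0 , p-prime , sym (ℕₚ.*-identityʳ p)) F)))
    where
    F : FiniteField p
    F = PrimeField.field-p p p-prime

evaluate-linear : ∀ h C x → evaluate (h ∷ C ∷ []) x ≡ C * x + h
evaluate-linear = expand
  where
  expand : ∀ h C x → h * 1ℤ + (C * (x * 1ℤ) + 0ℤ) ≡ C * x + h
  expand = solve-∀

-- The two congruences in the theorem have their sides in opposite order, whence the multiplier - z.
evaluate-congruence : ∀ {f} h C x → f ≡ ι (C * x + h) [mod x ^ 2 ] → ι (evaluate (h ∷ C ∷ []) x) ≡ f [mod x ^ 2 ]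
evaluate-congruence {f} h C x (z , eq) = - z , (begin
  ι (evaluate (h ∷ C ∷ []) x) ℚ.- f   ≡⟨ cong (λ e → ι e ℚ.- f) (evaluate-linear h C x) ⟩
  ι (C * x + h) ℚ.- f                 ≡⟨ flip f (ι (C * x + h)) ⟩
  ℚ.- (f ℚ.- ι (C * x + h))           ≡⟨ cong ℚ.-_ eq ⟩
  ℚ.- ι (z * x ^ 2)                   ≡⟨ ι-neg (z * x ^ 2) ⟨
  ι (- (z * x ^ 2))                   ≡⟨ cong ι (ℤₚ.neg-distribˡ-* z (x ^ 2)) ⟩
  ι (- z * x ^ 2)                     ∎)
  where
  open ≡-Reasoning
  flip : ∀ a b → b ℚ.- a ≡ ℚ.- (a ℚ.- b)
  flip = ℚSolver.solve 2 (λ a b → b ℚSolver.:- a ℚSolver.:= ℚSolver.:- (a ℚSolver.:- b)) refl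

theorem4p11 : ∀ (n : ℕ) → 1 ≤ℕ n → (B : Board n n) → (i : ℕ) → i ≤ℕ n →
    (∃[ P ] (IsPolynomialModulo 2 (λ F → qHitNumber F B i) P × 0ℤ ≤ lookup P (suc zero)))
    × (Σ[ C ∈ ∃! _≡_ (λ (C : ℤ) →
    ∀ q → IsPrimePower q → (F : FiniteField q) →
    qHitNumber F B i
    ≡ ((C * + (q ∸ 1) + + hitNumber B i) / 1)
    [mod (+ (q ∸ 1)) ^ 2 ]) ]
    0ℤ ≤ proj₁ C)
theorem4p11 n _ B i _ =
  (+ hitNumber B i ∷ C ∷ [] , (λ q _ F → evaluate-congruence (+ hitNumber B i) C (+ (q ∸ 1))
      (qHit-congruence B i F)) , nonneg-linearPoly B i) ,
  ((C , (λ q _ F → qHit-congruence B i F) , λ {C′} congruent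
      → linear-unique B i C′ congruent) , nonneg-linearPoly B i)
  where
  C = coef (linearPoly B) i
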